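{- Let $w$ be an annular web of degree $n$, and let $I$ be a radial cut of $w$ with initial thickness $\alpha$. For $1\le j\le n$ put $$b_j(w,I;q):=\sum_{\mathcal L\in\mathrm{SLD}(w,I)}\ \sum_{\tau\in\mathrm{SYT}(j,1^{n-j})}q^{\mathrm{inv}_{\mathcal L}(\tau)},$$ and $b_0=b_{n+1}=0$. Then for $0\le k\le n$ the coefficient of $a^{2k-n}$ in the HOMFLY--PT polynomial $P_w(a,q)$ is $$[a^{2k-n}]P_w=\frac{(-1)^{n-k}\bigl(b_k(w,I;q)+b_{k+1}(w,I;q)\bigr)}{[\alpha]!\,(q-q^{ -1})^n},$$ and all other coefficients of $P_w$ in $a$ vanish.
   Context: **Annular webs.** Let $\mathbb A=[0,1]\times[0,1]/\big((x,0)\sim(x,1)\big)$ be the annulus; left/right refer to the first coordinate, upward to the second. An annular web $w$ is a finite trivalent graph embedded in $\mathbb A$ (vertex-free essential circles are allowed as edges), all of whose edges are oriented upward (the second coordinate increases along each edge), together with a thickness $t(e)\in\mathbb Z_{>0}$ for each edge $e$, such that at every vertex the total incoming thickness equals the total outgoing thickness. Every vertex is a merge (two incoming edges, one outgoing) or a split (one incoming, two outgoing). The degree $\deg(w)$ is $\sum t(e)$ over the edges crossed by any radial (horizontal) segment transverse to $w$ and avoiding vertices. **$X_w$ and $P_w$.** Let $\mathbb N=\{1,2,\dots\}$. A coloring $c$ of $w$ assigns to each edge $e$ a finite set $c(e)\subset\mathbb N$ with $|c(e)|=t(e)$ such that at every vertex the union of the color sets on incoming edges equals the union on outgoing edges;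 $\mathcal C(w)$ is the set of colorings. Put $\mathrm{inv}_w(c)=\sum_m\sum_{a\in c(e_R),\,b\in c(e_L)}\mathrm{sgn}(a-b)$ over all merges $m$, with $e_L,e_R$ the left and right incoming edges of $m$. $\Gamma_i(c)$ is the union of the edges $e$ with $i\in c(e)$ (a disjoint union of circles), $x^c=\prod_ix_i^{|\Gamma_i(c)|}$ with $|\cdot|$ the number of components, and $X_w[\mathbf x;q]=\sum_{c\in\mathcal C(w)}q^{\mathrm{inv}_w(c)}x^c$, which is a symmetric function. The HOMFLY--PT polynomial of $w$ is defined by plethystic substitution, $P_w(a,q):=X_w\!\left[\frac{a-a^{ -1}}{q-q^{ -1}};q\right]$, i.e. the image of $X_w$ under the $\mathbb Q(q)$-algebra homomorphism from symmetric functions to $\mathbb Q(a,q)$ with $p_m\mapsto\frac{a^m-a^{ -m}}{q^m-q^{ -m}}$ for all power sums $p_m$, $m\ge1$. **Radial cut, labeled loop decompositions.** A radial cut $I$ is a radial (horizontal) segment across $\mathbb A$ transverse to $w$ and disjoint from its vertices. Let $e_1,\dots,e_r$ be the edges meeting $I$, from left to right; the initial thickness is $t(I)=(t(e_1),\dots,t(e_r))$. For a composition $\alpha=(\alpha_1,\dots,\alpha_r)$, $[\alpha]!=[\alpha_1]!\cdots[\alpha_r]!$ with $[k]!=[1]\cdots[k]$ and $[k]=\frac{q^k-q^{ -k}}{q-q^{ -1}}$. Let $B_j=\{t(e_1)+\cdots+t(e_{j-1})+1,\dots,t(e_1)+\cdots+t(e_j)\}\subset[n]=\{1,\dots,n\}$.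 A standard labeled loop decomposition of $(w,I)$ is a map $\mathcal L$ from edges of $w$ to subsets of $[n]$ with (1) $\mathcal L(e_j)=B_j$ for all $j$; (2) $|\mathcal L(e)|=t(e)$ for all $e$; (3) at every merge or split, the label set of the single edge on one side is the disjoint union of the label sets of the two edges on the other side. $\mathrm{SLD}(w,I)$ is the set of these. For $u\in[n]$, $L_u$ is the loop formed by the edges whose label set contains $u$. **Inversions.** For $\mathcal L\in\mathrm{SLD}(w,I)$, the multiset $\mathsf A_I(\mathcal L)$ of ordered attacking pairs consists of: one pair $(u,v)$ for each block $B_j$ and each $u<v$ in $B_j$; and, for each merge, one pair $(u,v)$ whenever $L_u$ enters the merge from the left and $L_v$ from the right (all counted with multiplicity). For $\sigma:[n]\to\mathbb Z_{>0}$ put $\epsilon_\sigma(u,v)=+1$ if $\sigma(v)>\sigma(u)$, or $\sigma(v)=\sigma(u)$ and $v<u$; and $\epsilon_\sigma(u,v)=-1$ otherwise. Put $\mathrm{inv}_{\mathcal L}(\sigma)=\sum_{(u,v)\in\mathsf A_I(\mathcal L)}\epsilon_\sigma(u,v)$. $\mathrm{SYT}(j,1^{n-j})$ is the set of standard Young tableaux of hook shape $(j,1^{n-j})$ (entries $1,\dots,n$, increasing left to right along rows and top to bottom along columns, first row of length $j$). For such a tableau $\tau$, $\mathrm{inv}_{\mathcal L}(\tau):=\mathrm{inv}_{\mathcal L}(\sigma_\tau)$, where $\sigma_\tau(u)=i$ if $u$ lies in the $i$-th row of $\tau$. -}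

module Defs where

open import Data.Bool.Base using (Bool; true; false; if_then_else_; _∧_)
open import Data.Empty using (⊥-elim)
open import Data.Fin.Base using (Fin; toℕ)
import Data.Fin.Base as Fin
import Data.Fin.Properties as Fin
open import Data.Fin.Subset using (Subset; inside; outside; ∣_∣; _∩_; _∪_; ⋃; ⊥)
open import Data.Fin.Subset.Properties using (_∈?_)
open import Data.Integer.Base as ℤ using (ℤ; +_; -[1+_]; 0ℤ; 1ℤ; -1ℤ)
import Data.Integer.Properties as ℤ
open import Data.List.Base using (List; []; _∷_; _++_; [_]; map; concat; concatMap; foldr; filter; partition; replicate; zip; allFin; cartesianProduct; cartesianProductWith; length)
import Data.List.Properties as List
import Data.List.Membership.Propositional as List
open import Data.List.Relation.Binary.Permutation.Propositional using (_↭_)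
open import Data.List.Relation.Unary.All as All using (All)
open import Data.List.Relation.Unary.Any as Any using (Any)
open import Data.List.Relation.Unary.Linked as Linked using (Linked)
open import Data.List.Relation.Unary.Unique.Propositional using (Unique)
import Data.List.Relation.Unary.Unique.DecPropositional as DecUnique
open import Data.Nat.Base as ℕ using (ℕ; zero; suc; z≤n; s≤s)
open import Data.Nat.ListAction using (sum)
import Data.Nat.Properties as ℕ
open import Data.Product.Base using (_×_; _,_; proj₁; proj₂; uncurry; ∃; ∃₂)
open import Data.Sum.Base using (_⊎_; [_,_]′)
open import Data.Vec.Base as Vec using (Vec; lookup; tabulate; zipWith)
import Data.Vec.Properties as Vec
open import Algebra.Core using (Op₂)
import Data.Bool.Properties as Bool
open import Function.Base using (_∘_)
open import Relation.Binary.Definitions using (DecidableEquality)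
open import Relation.Binary.PropositionalEquality using (_≡_; _≢_; refl; sym; trans; cong; cong₂; subst)
open import Relation.Nullary.Decidable using (Dec; yes; no; does; ¬?; _×-dec_; _⊎-dec_)
open import Relation.Unary using (Decidable)

------------------------------------------------------------------------
-- Coefficients in increasing degree; trailing zeros are allowed.
ℤ[q] : Set
ℤ[q] = List ℤ

coefficient : ℤ[q] → ℕ → ℤ
coefficient []      _       = 0ℤ
coefficient (a ∷ f) zero    = a
coefficient (a ∷ f) (suc i) = coefficient f i

infixl 6 _+ₚ_
infixl 7 _*ₚ_
infix  4 _≈ₚ_

_≈ₚ_ : ℤ[q] → ℤ[q] → Set
f ≈ₚ g = ∀ i → coefficient f i ≡ coefficient g i

_+ₚ_ : ℤ[q] → ℤ[q] → ℤ[q]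
[]      +ₚ g       = g
(a ∷ f) +ₚ []      = a ∷ f
(a ∷ f) +ₚ (b ∷ g) = (a ℤ.+ b) ∷ (f +ₚ g)

scale : ℤ → ℤ[q] → ℤ[q]
scale a = map (a ℤ.*_)

_*ₚ_ : ℤ[q] → ℤ[q] → ℤ[q]
[]      *ₚ g = []
(a ∷ f) *ₚ g = scale a g +ₚ (0ℤ ∷ f *ₚ g)

NonZeroₚ : ℤ[q] → Set
NonZeroₚ = Any (_≢ 0ℤ)

nonZeroₚ? : Decidable NonZeroₚ
nonZeroₚ? = Any.any? (λ a → ¬? (a ℤ.≟ 0ℤ))

coefficient-+ : ∀ f g i → coefficient (f +ₚ g) i ≡ coefficient f i ℤ.+ coefficient g i
coefficient-+ []      g       i       = sym (ℤ.+-identityˡ _)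
coefficient-+ (a ∷ f) []      i       = sym (ℤ.+-identityʳ _)
coefficient-+ (a ∷ f) (b ∷ g) zero    = refl
coefficient-+ (a ∷ f) (b ∷ g) (suc i) = coefficient-+ f g i

coefficient-scale : ∀ a f i → coefficient (scale a f) i ≡ a ℤ.* coefficient f i
coefficient-scale a []      i       = sym (ℤ.*-zeroʳ a)
coefficient-scale a (b ∷ f) zero    = refl
coefficient-scale a (b ∷ f) (suc i) = coefficient-scale a f i

coefficient-* : ∀ a f g i →
  coefficient ((a ∷ f) *ₚ g) i ≡ a ℤ.* coefficient g i ℤ.+ coefficient (0ℤ ∷ f *ₚ g) i
coefficient-* a f g i = trans (coefficient-+ (scale a g) (0ℤ ∷ f *ₚ g) i)
  (cong (ℤ._+ coefficient (0ℤ ∷ f *ₚ g) i) (coefficient-scale a g i))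

VanishesBelow : ℕ → ℤ[q] → Set
VanishesBelow j f = ∀ k → k ℕ.< j → coefficient f k ≡ 0ℤ

vanishes-* : ∀ f {g j} → VanishesBelow j g → VanishesBelow j (f *ₚ g)
vanishes-* []      g≈0 k k<j = refl
vanishes-* (a ∷ f) {g} g≈0 k k<j = trans (coefficient-* a f g k)
  (cong₂ ℤ._+_ (trans (cong (a ℤ.*_) (g≈0 k k<j)) (ℤ.*-zeroʳ a)) (rest k k<j))
  where
  rest : ∀ k → k ℕ.< _ → coefficient (0ℤ ∷ f *ₚ g) k ≡ 0ℤ
  rest zero    _   = refl
  rest (suc k) k<j = vanishes-* f g≈0 k (ℕ.<-trans (ℕ.n<1+n k) k<j)

lowest-* : ∀ i f {g j} → VanishesBelow i f → VanishesBelow j g →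
  coefficient (f *ₚ g) (i ℕ.+ j) ≡ coefficient f i ℤ.* coefficient g j
lowest-* i [] _ _ = refl
lowest-* zero (a ∷ f) {g} {j} _ g≈0 = trans (coefficient-* a f g j)
  (trans (cong (ℤ._+_ (a ℤ.* coefficient g j)) (rest j g≈0)) (ℤ.+-identityʳ _))
  where
  rest : ∀ j → VanishesBelow j g → coefficient (0ℤ ∷ f *ₚ g) j ≡ 0ℤ
  rest zero    _   = refl
  rest (suc j) g≈0 = vanishes-* f g≈0 j (ℕ.n<1+n j)
lowest-* (suc i) (a ∷ f) {g} {j} f≈0 g≈0 = trans (coefficient-* a f g (suc i ℕ.+ j))
  (trans (cong (ℤ._+ coefficient (f *ₚ g) (i ℕ.+ j)) (trans (cong (ℤ._* c) (f≈0 0 (s≤s z≤n))) (ℤ.*-zeroˡ c)))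
  (trans (ℤ.+-identityˡ _) (lowest-* i f (λ k k<i → f≈0 (suc k) (s≤s k<i)) g≈0)))
  where c = coefficient g (suc i ℕ.+ j)

lowest : ∀ {f} → NonZeroₚ f → ∃ λ i → VanishesBelow i f × coefficient f i ≢ 0ℤ
lowest {a ∷ f} f≉0 with a ℤ.≟ 0ℤ
... | no a≢0 = 0 , (λ _ ()) , a≢0
lowest {a ∷ f} (Any.here a≢0)  | yes a≡0 = ⊥-elim (a≢0 a≡0)
lowest {a ∷ f} (Any.there f≉0) | yes a≡0 with lowest f≉0
... | i , f≈0 , fᵢ≢0 = suc i , (λ { zero _ → a≡0 ; (suc k) (s≤s k<i) → f≈0 k k<i }) , fᵢ≢0

coefficient⇒nonZero : ∀ f i → coefficient f i ≢ 0ℤ → NonZeroₚ f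
coefficient⇒nonZero []      i       fᵢ≢0 = ⊥-elim (fᵢ≢0 refl)
coefficient⇒nonZero (a ∷ f) zero    fᵢ≢0 = Any.here fᵢ≢0
coefficient⇒nonZero (a ∷ f) (suc i) fᵢ≢0 = Any.there (coefficient⇒nonZero f i fᵢ≢0)

*ₚ-nonZero : ∀ {f g} → NonZeroₚ f → NonZeroₚ g → NonZeroₚ (f *ₚ g)
*ₚ-nonZero {f} {g} f≉0 g≉0 with lowest f≉0 | lowest g≉0
... | i , f≈0 , fᵢ≢0 | j , g≈0 , gⱼ≢0 = coefficient⇒nonZero (f *ₚ g) (i ℕ.+ j)
  λ eq → [ fᵢ≢0 , gⱼ≢0 ]′ (ℤ.i*j≡0⇒i≡0∨j≡0 _ (trans (sym (lowest-* i f f≈0 g≈0)) eq))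

------------------------------------------------------------------------
record ℚ⟨q⟩ : Set where
  constructor frac
  field
    num   : ℤ[q]
    den   : ℤ[q]
    den≉0 : NonZeroₚ den

open ℚ⟨q⟩

infix  4 _≈ᴷ_
infixl 6 _+ᴷ_ _-ᴷ_
infixl 7 _*ᴷ_ _/ᴷ_
infix  8 -ᴷ_
infixr 9 _^_ q^_
infix 10 _⁻¹ᴷ

_≈ᴷ_ : ℚ⟨q⟩ → ℚ⟨q⟩ → Set
x ≈ᴷ y = num x *ₚ den y ≈ₚ num y *ₚ den x

polynomial : ℤ[q] → ℚ⟨q⟩
polynomial f = frac f (1ℤ ∷ []) (Any.here λ ())

0ᴷ 1ᴷ q : ℚ⟨q⟩
0ᴷ = polynomial []
1ᴷ = polynomial (1ℤ ∷ [])
q  = polynomial (0ℤ ∷ 1ℤ ∷ [])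

_+ᴷ_ _*ᴷ_ : ℚ⟨q⟩ → ℚ⟨q⟩ → ℚ⟨q⟩
frac a b b≉0 +ᴷ frac c d d≉0 = frac (a *ₚ d +ₚ c *ₚ b) (b *ₚ d) (*ₚ-nonZero b≉0 d≉0)
frac a b b≉0 *ᴷ frac c d d≉0 = frac (a *ₚ c) (b *ₚ d) (*ₚ-nonZero b≉0 d≉0)

-ᴷ_ : ℚ⟨q⟩ → ℚ⟨q⟩
-ᴷ frac a b b≉0 = frac (scale -1ℤ a) b b≉0

_-ᴷ_ : ℚ⟨q⟩ → ℚ⟨q⟩ → ℚ⟨q⟩
x -ᴷ y = x +ᴷ -ᴷ y

-- Total: 0⁻¹ = 0.
_⁻¹ᴷ : ℚ⟨q⟩ → ℚ⟨q⟩
frac a b b≉0 ⁻¹ᴷ with nonZeroₚ? a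
... | yes a≉0 = frac b a a≉0
... | no  _   = 0ᴷ

_/ᴷ_ : ℚ⟨q⟩ → ℚ⟨q⟩ → ℚ⟨q⟩
x /ᴷ y = x *ᴷ y ⁻¹ᴷ

_^_ : ℚ⟨q⟩ → ℕ → ℚ⟨q⟩
x ^ zero  = 1ᴷ
x ^ suc n = x *ᴷ x ^ n

q^_ : ℤ → ℚ⟨q⟩
q^ (+ n)    = q ^ n
q^ -[1+ n ] = (q ^ suc n) ⁻¹ᴷ

∑ᴷ : {A : Set} → List A → (A → ℚ⟨q⟩) → ℚ⟨q⟩
∑ᴷ xs f = foldr _+ᴷ_ 0ᴷ (map f xs)

∑ᶻ : {A : Set} → List A → (A → ℤ) → ℤ
∑ᶻ xs f = foldr ℤ._+_ 0ℤ (map f xs)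

z : ℚ⟨q⟩
z = q^ 1ℤ -ᴷ q^ -1ℤ

⟦_⟧ ⟦_⟧! : ℕ → ℚ⟨q⟩
⟦ k ⟧ = (q^ (+ k) -ᴷ q^ (ℤ.- + k)) /ᴷ z
⟦ zero  ⟧! = 1ᴷ
⟦ suc k ⟧! = ⟦ k ⟧! *ᴷ ⟦ suc k ⟧

⟦_⟧!! : List ℕ → ℚ⟨q⟩
⟦ α ⟧!! = foldr _*ᴷ_ 1ᴷ (map ⟦_⟧! α)

------------------------------------------------------------------------
-- Formal sums of terms with coefficients in ℚ(q), compared coefficient by coefficient.
module MonoidAlgebra {M : Set} (_∙_ : Op₂ M) (ε : M) (_≟_ : DecidableEquality M) where

  Carrier : Set
  Carrier = List (ℚ⟨q⟩ × M)

  coeff : M → Carrier → ℚ⟨q⟩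
  coeff m F = ∑ᴷ (filter (λ t → proj₂ t ≟ m) F) proj₁

  infix 4 _≈_
  _≈_ : Carrier → Carrier → Set
  F ≈ G = ∀ m → coeff m F ≈ᴷ coeff m G

  _·_ : ℚ⟨q⟩ → Carrier → Carrier
  c · F = map (λ (d , m) → c *ᴷ d , m) F

  _⊗_ : Carrier → Carrier → Carrier
  _⊗_ = cartesianProductWith λ (c , l) (d , m) → c *ᴷ d , l ∙ m

  1# : Carrier
  1# = [ 1ᴷ , ε ]

-- Polynomials over ℚ(q) in the variables x₀, …, x_{N-1}.
module MPoly (N : ℕ) = MonoidAlgebra {Vec ℕ N} (zipWith ℕ._+_) (Vec.replicate N 0) (Vec.≡-dec ℕ._≟_)

module LaurentA = MonoidAlgebra {ℤ} ℤ._+_ 0ℤ ℤ._≟_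

------------------------------------------------------------------------
-- Symmetric functions over ℚ(q), as ℚ(q)[p₁, p₂, …]:
-- a formal sum of terms c · p_{k₁+1} ⋯ p_{kᵣ+1}, one for each (c , k₁ ∷ … ∷ kᵣ ∷ []):
-- the index shift leaves no room for p₀.
Λ : Set
Λ = List (ℚ⟨q⟩ × List ℕ)

-- The ℚ(q)-algebra homomorphism sending p_m to p m.
module Substitution {M : Set} (_∙_ : Op₂ M) (ε : M) (_≟_ : DecidableEquality M) where
  open MonoidAlgebra _∙_ ε _≟_

  substitute : (p : ℕ → Carrier) → Λ → Carrier
  substitute p = concatMap λ (c , ks) → c · foldr _⊗_ 1# (map (p ∘ suc) ks)

powerSum : (N m : ℕ) → MPoly.Carrier N
powerSum N m = map (λ i → 1ᴷ , Vec.replicate N 0 Vec.[ i ]≔ m) (allFin N)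

-- f(x₀, …, x_{N-1}, 0, 0, …)
inVariables : (N : ℕ) → Λ → MPoly.Carrier N
inVariables N = Substitution.substitute (zipWith ℕ._+_) (Vec.replicate N 0) (Vec.≡-dec ℕ._≟_) (powerSum N)

-- f[(a - a⁻¹)/(q - q⁻¹)]
plethysm : Λ → LaurentA.Carrier
plethysm = Substitution.substitute ℤ._+_ 0ℤ ℤ._≟_ λ m →
  let d = (q^ (+ m) -ᴷ q^ (ℤ.- + m)) ⁻¹ᴷ
  in (d , + m) ∷ (-ᴷ d , ℤ.- + m) ∷ []

------------------------------------------------------------------------
-- Pairs of edges are listed from left to right.
data Vertex (E : Set) : Set where
  merge : (eL eR out : E) → Vertex E
  split : (inc eL eR : E) → Vertex E

module _ {E : Set} where

  incoming outgoing : Vertex E → List E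
  incoming (merge eL eR out) = eL ∷ eR ∷ []
  incoming (split inc eL eR) = inc ∷ []
  outgoing (merge eL eR out) = out ∷ []
  outgoing (split inc eL eR) = eL ∷ eR ∷ []

-- The underlying graph, with the left/right order at each vertex.  An edge
-- at no vertex is an essential circle.
record Web : Set where
  field
    edges        : ℕ
  Edge : Set
  Edge = Fin edges
  field
    thickness    : Edge → ℕ
    positive     : ∀ e → 1 ℕ.≤ thickness e
    vertices     : List (Vertex Edge)
    conservation : All (λ v → sum (map thickness (incoming v)) ≡ sum (map thickness (outgoing v))) vertices
    unique-tail  : Unique (concatMap outgoing vertices)
    unique-head  : Unique (concatMap incoming vertices)

-- Sweep r vs r′: a horizontal segment moving upward first meets the edges r,
-- from left to right, then passes the vertices vs one at a time, each one
-- replacing its adjacent incoming edges by its outgoing ones, and at the end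
-- meets the edges r′.
data Sweep {E : Set} : List E → List (Vertex E) → List E → Set where
  done : ∀ {r} → Unique r → Sweep r [] r
  pass : ∀ {r r′ v vs} (ls rs : List E) → Unique r →
         r ≡ ls ++ incoming v ++ rs →
         Sweep (ls ++ outgoing v ++ rs) vs r′ →
         Sweep r (v ∷ vs) r′

-- A planar-isotopy class of upward embeddings of w in the annulus, together
-- with a radial cut I: sweeping once around the annulus from I meets every
-- edge and every vertex and returns to I.  Vertices at equal height may be
-- passed in either order.  An edge has a constant total thickness to its left,
-- so it meets each horizontal segment at most once; this is why the edges met
-- by a segment are distinct.
record RadialCut (w : Web) : Set where
  open Web w
  field
    cut      : List Edge
    order    : List (Vertex Edge)
    order-↭  : order ↭ vertices
    sweep    : Sweep cut order cut
    covering : ∀ e → e List.∈ cut ⊎ e List.∈ concatMap outgoing vertices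

  initialThickness : List ℕ
  initialThickness = map thickness cut

  degree : ℕ
  degree = sum initialThickness

------------------------------------------------------------------------
tuples : {A : Set} → List A → (n : ℕ) → List (Vec A n)
tuples xs zero    = [ Vec.[] ]
tuples xs (suc n) = cartesianProductWith Vec._∷_ xs (tuples xs n)

subsets : ∀ n → List (Subset n)
subsets = tuples (inside ∷ outside ∷ [])

elements : ∀ {n} → Subset n → List (Fin n)
elements p = filter (_∈? p) (allFin _)

_≟ˢ_ : ∀ {n} → DecidableEquality (Subset n)
_≟ˢ_ = Vec.≡-dec Bool._≟_

-- The number of connected components of a graph with the given nodes, where
-- each member of links is a set of nodes to be joined to each other.
module Components {E : Set} (_≟_ : DecidableEquality E) where
  open import Data.List.Membership.DecPropositional _≟_ using () renaming (_∈?_ to _∈ᴸ?_)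

  join : List E → List (List E) → List (List E)
  join link classes with partition (Any.any? (_∈ᴸ? link)) classes
  ... | []      , rest = rest
  ... | touched , rest = concat touched ∷ rest

  components : List E → List (List E) → List (List E)
  components nodes links = foldr join (map [_] nodes) links

  #components : List E → List (List E) → ℕ
  #components nodes links = length (components nodes links)

------------------------------------------------------------------------
sgn : ℤ → ℤ
sgn (+ zero)  = 0ℤ
sgn (+ suc _) = 1ℤ
sgn -[1+ _ ]  = -1ℤ

module _ (w : Web) where
  open Web w

  -- The colours (or labels) are 0, …, N-1.
  EdgeSets : ℕ → Set
  EdgeSets N = Vec (Subset N) edges

  IsColoring : ∀ {N} → EdgeSets N → Set
  IsColoring c =
    (∀ e → ∣ lookup c e ∣ ≡ thickness e) ×
    All (λ v → ⋃ (map (lookup c) (incoming v)) ≡ ⋃ (map (lookup c) (outgoing v))) vertices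

  isColoring? : ∀ {N} → Decidable (IsColoring {N})
  isColoring? c =
    Fin.all? (λ e → ∣ lookup c e ∣ ℕ.≟ thickness e) ×-dec
    All.all? (λ v → ⋃ (map (lookup c) (incoming v)) ≟ˢ ⋃ (map (lookup c) (outgoing v))) vertices

  colorings : ∀ N → List (EdgeSets N)
  colorings N = filter isColoring? (tuples (subsets N) edges)

  module _ {N : ℕ} (c : EdgeSets N) where

    inv-at : Vertex Edge → ℤ
    inv-at (merge eL eR _) = ∑ᶻ (cartesianProduct (elements (lookup c eR)) (elements (lookup c eL)))
                               λ (a , b) → sgn (+ toℕ a ℤ.- + toℕ b)
    inv-at (split _ _ _)   = 0ℤ

    inv : ℤ
    inv = ∑ᶻ vertices inv-at

    Γ : Fin N → List Edge
    Γ i = filter (λ e → i ∈? lookup c e) (allFin edges)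

    ∣Γ_∣ : Fin N → ℕ
    ∣Γ i ∣ = Components.#components Fin._≟_ (Γ i) (map (λ v → incoming v ++ outgoing v) vertices)

  -- X_w(x₀, …, x_{N-1}, 0, 0, …).  Every colour used by c divides x^c, so the
  -- terms of X_w that survive are those of the colourings by 0, …, N-1.
  X : (N : ℕ) → MPoly.Carrier N
  X N = map (λ c → q^ inv c , tabulate ∣Γ c ∣) (colorings N)

  -- P is the image of X_w under plethystic substitution.  The element f of Λ
  -- exists because X_w is a symmetric function, and is unique because the
  -- power sums are algebraically independent.
  record IsHOMFLYPT (P : LaurentA.Carrier) : Set where
    field
      f   : Λ
      X≈f : ∀ N → let open MPoly N in X N ≈ inVariables N f
      P≈f : P LaurentA.≈ plethysm f

------------------------------------------------------------------------
-- The rows, from top to bottom, with entries 0, …, n-1.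
Tableau : ℕ → Set
Tableau n = List (List (Fin n))

-- zip stops at the end of the lower (shorter) row.
IsStandard : ∀ {n} → Tableau n → Set
IsStandard rows =
  Unique (concat rows) ×
  All (Linked Fin._<_) rows ×
  Linked (λ upper lower → All (uncurry Fin._<_) (zip upper lower)) rows

isStandard? : ∀ {n} → Decidable (IsStandard {n})
isStandard? rows =
  DecUnique.unique? Fin._≟_ (concat rows) ×-dec
  All.all? (Linked.linked? Fin._<?_) rows ×-dec
  Linked.linked? (λ upper lower → All.all? (λ (u , v) → u Fin.<? v) (zip upper lower)) rows

fillings : ∀ n → List ℕ → List (Tableau n)
fillings n []      = [ [] ]
fillings n (l ∷ λs) = cartesianProductWith (λ row rows → Vec.toList row ∷ rows)
                        (tuples (allFin n) l) (fillings n λs)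

-- For a partition of n, distinctness of the n entries makes each of
-- 0, …, n-1 occur exactly once.
SYT : ∀ n → List ℕ → List (Tableau n)
SYT n shape = filter isStandard? (fillings n shape)

hook : (n j : ℕ) → List ℕ
hook n j = j ∷ replicate (n ℕ.∸ j) 1

-- The top row has index 1; the value at an absent entry is never used.
rowOf : ∀ {n} → Tableau n → Fin n → ℕ
rowOf []           u = 1
rowOf (row ∷ rows) u = if does (Any.any? (u Fin.≟_) row) then 1 else suc (rowOf rows u)

------------------------------------------------------------------------
-- { u ∣ lo ≤ u < hi }
interval : ∀ n → (lo hi : ℕ) → Subset n
interval n lo hi = tabulate λ u → (lo ℕ.≤ᵇ toℕ u) ∧ (toℕ u ℕ.<ᵇ hi)

blocks : ∀ n → (offset : ℕ) → List ℕ → List (Subset n)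
blocks n o []      = []
blocks n o (t ∷ α) = interval n o (o ℕ.+ t) ∷ blocks n (o ℕ.+ t) α

_isDisjointUnionOf_,_ : ∀ {n} → Subset n → Subset n → Subset n → Set
p isDisjointUnionOf r , s = p ≡ r ∪ s × r ∩ s ≡ ⊥

disjointUnion? : ∀ {n} (p r s : Subset n) → Dec (p isDisjointUnionOf r , s)
disjointUnion? p r s = p ≟ˢ (r ∪ s) ×-dec (r ∩ s) ≟ˢ ⊥

module _ {w : Web} (I : RadialCut w) where
  open Web w
  open RadialCut I

  private n = degree

  B : List (Subset n)
  B = blocks n 0 initialThickness

  module _ (L : EdgeSets w n) where

    Splits : Vertex Edge → Set
    Splits (merge eL eR out) = lookup L out isDisjointUnionOf lookup L eL , lookup L eR
    Splits (split inc eL eR) = lookup L inc isDisjointUnionOf lookup L eL , lookup L eR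

    splits? : Decidable Splits
    splits? (merge eL eR out) = disjointUnion? (lookup L out) (lookup L eL) (lookup L eR)
    splits? (split inc eL eR) = disjointUnion? (lookup L inc) (lookup L eL) (lookup L eR)

    IsSLD : Set
    IsSLD = map (lookup L) cut ≡ B ×
            (∀ e → ∣ lookup L e ∣ ≡ thickness e) ×
            All Splits vertices

    isSLD? : Dec IsSLD
    isSLD? = List.≡-dec _≟ˢ_ (map (lookup L) cut) B ×-dec
             Fin.all? (λ e → ∣ lookup L e ∣ ℕ.≟ thickness e) ×-dec
             All.all? splits? vertices

    attacking : List (Fin n × Fin n)
    attacking =
      concatMap (λ b → filter (λ (u , v) → u Fin.<? v) (cartesianProduct (elements b) (elements b))) B ++
      concatMap atVertex vertices
      where
      atVertex : Vertex Edge → List (Fin n × Fin n)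
      atVertex (merge eL eR _) = cartesianProduct (elements (lookup L eL)) (elements (lookup L eR))
      atVertex (split _ _ _)   = []

    invᴸ : (Fin n → ℕ) → ℤ
    invᴸ σ = ∑ᶻ attacking λ (u , v) →
      if does (σ u ℕ.<? σ v ⊎-dec (σ v ℕ.≟ σ u ×-dec v Fin.<? u)) then 1ℤ else -1ℤ

  SLD : List (EdgeSets w n)
  SLD = filter isSLD? (tuples (subsets n) edges)

  b : ℕ → ℚ⟨q⟩
  b j = if (1 ℕ.≤ᵇ j) ∧ (j ℕ.≤ᵇ n)
        then (∑ᴷ SLD λ L → ∑ᴷ (SYT n (hook n j)) λ τ → q^ invᴸ L (rowOf τ))
        else 0ᴷ

{-# OPTIONS --safe #-}
module Submission where

open import Defs
open import Algebra.Bundles using (CommutativeRing)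
open import Algebra.Core using (Op₂)
import Algebra.Properties.Ring
import Algebra.Properties.Semiring.Mult.TCOptimised
import Algebra.Solver.Ring
open import Algebra.Solver.Ring.AlmostCommutativeRing using (fromCommutativeRing; _-Raw-AlmostCommutative⟶_)
open import Data.Bool.Base using (Bool; true; false; if_then_else_; _∧_; T; _∨_)
import Data.Bool.Properties as Bool
open import Data.Empty using (⊥-elim)
open import Data.Fin.Base as Fin using (Fin; zero; suc; toℕ)
import Data.Fin.Properties as Fin
open import Data.Fin.Subset as Sub using (Subset; ∣_∣; inside; outside; _∩_; _∪_; ⋃)
open import Data.Fin.Subset.Properties as Sub using (∣p∣≤n; ⊆-antisym; ∪-identityʳ)
open import Data.Integer.Base as ℤ using (ℤ; +_; -[1+_]; 0ℤ; 1ℤ; -1ℤ)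
import Data.Integer.Properties as ℤ
open import Data.Integer.Tactic.RingSolver using (solve-∀)
open import Data.List.Base using
  (List; []; _∷_; _++_; map; foldr; filter; cartesianProductWith; concatMap; allFin; length;
   upTo; [_]; concat; zip; replicate; take; cartesianProduct; partition; deduplicate)
open import Data.List.Membership.Propositional as ∈ using (_∈_; _∉_)
import Data.List.Membership.Propositional.Properties as ∈
open import Data.List.Membership.Propositional.Properties.WithK using (unique∧set⇒bag)
import Data.List.Base as List
import Data.List.Properties as List
open import Data.List.Relation.Binary.BagAndSetEquality using (∼bag⇒↭)
open import Data.List.Relation.Binary.Permutation.Propositional as ↭ using
  (_↭_; prep; swap; ↭-sym; ↭-trans; ↭-reflexive; ↭⇒↭ₛ; ↭-refl)
import Data.List.Relation.Binary.Permutation.Propositional.Properties as ↭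
import Data.List.Relation.Binary.Permutation.Setoid.Properties as ↭Setoid
open import Data.List.Relation.Unary.All as All using (All; []; _∷_)
import Data.List.Relation.Unary.All.Properties as All
open import Data.List.Relation.Unary.AllPairs as AllPairs using ([]; _∷_; AllPairs)
import Data.List.Relation.Unary.AllPairs.Properties as AllPairs
open import Data.List.Relation.Unary.Any as Any using (Any; here; there)
open import Data.List.Relation.Unary.Linked as Linked using (Linked; []; [-]; _∷_)
import Data.List.Relation.Unary.Linked.Properties as Linked
import Data.List.Relation.Unary.Unique.DecPropositional.Properties as DecUnique
open import Data.List.Relation.Unary.Unique.Propositional using (Unique)
import Data.List.Relation.Unary.Unique.Propositional.Properties as Unique
open import Data.Maybe.Base using (Maybe; just; nothing)
open import Data.Nat.Base as ℕ using (ℕ; zero; suc; z≤n; s≤s; _≤_; _<_; _∸_; _⊓_; _≤ᵇ_; _<ᵇ_)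
open import Data.Nat.ListAction using (sum)
open import Data.Nat.ListAction.Properties using (sum-++)
import Data.Nat.Properties as ℕ
open import Data.Product.Base using (_×_; _,_; proj₁; proj₂; ∃; uncurry)
open import Data.Sum.Base using (_⊎_; inj₁; inj₂)
open import Data.Unit.Base using (⊤; tt)
open import Data.Vec.Base as Vec using (Vec; lookup; _[_]≔_; []; _∷_; _∷ʳ_)
import Data.Vec.Properties as Vec
open import Function.Base using (_∘_; const; id)
open import Function.Bundles using (mk⇔)
open import Level using (0ℓ)
open import Relation.Binary.Bundles using (Setoid)
open import Relation.Binary.Definitions using (DecidableEquality)
open import Relation.Binary.PropositionalEquality as ≡ using (_≡_; _≢_; _≗_)
import Relation.Binary.Reasoning.Setoid
open import Relation.Nullary using (¬_)
open import Relation.Nullary.Decidable using (yes; no; Dec; does; _×-dec_; dec-true; dec-false; ¬?; _⊎-dec_)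
open import Relation.Unary using (Decidable)

-- A Laurent polynomial in a is determined by its values at a = q^m for m ≥ 1, and P_w(q^m, q) is the
-- value X(t) of X_w at q^(m-1), q^(m-3), …, q^(1-m), where t is the thickness.  A colouring by m colours
-- is a superposition of {0,1}-valued flows Γ_i; then inv = Σ_{i<j} J(Γ_i, Γ_j), where J counts signed
-- meetings at merges, and Γ_i has as many components as it has edges at the cut.
--
-- In the sum over hook tableaux the sign of an attacking pair depends only on the row of the larger label,
-- so at a = q^m the sum of (-1)^(n-k) (b_k + b_{k+1}) a^(2k-n) is the sum over loop decompositions of
-- Π_v (q^(m-N_v) - q^(N_v-m)), where N_v counts the signed attacks on v by smaller labels.  The labels are
-- removed one at a time, the largest first: if the rightmost strands of t at the cut are k strands at p, then
--   (q^k - q^-k) X(t) = Σ_γ (q^(m-N) - q^(N-m)) X(t - γ),   N = J(t, γ) + k - 1,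
-- over the loops γ through p.  This holds by induction on m.  Splitting off the first colour Γ leaves a
-- sum over pairs (γ, Γ), which is regrouped by D = γ + Γ: sweeping around the annulus, the possible γ
-- inside D are lattice paths, and their signed count vanishes unless D is again a flow with values in {0,1}.

-- Evaluation at a = q^N sends p_m to (q^(Nm) - q^(-Nm)) / (q^m - q^(-m)), which is the value of p_m
-- at q^(N-1), q^(N-3), ..., q^(1-N). Since a Laurent polynomial in a that vanishes at every q^N
-- with N ≥ 1 is zero (`vanishing`), it suffices to prove for every N that the sum over k of
-- (-1)^(n-k) (b_k + b_(k+1)) q^(N(2k-n)) equals X_w(q^(N-1), ..., q^(1-N)) times the product over j
-- of (q - q^-1)^(α_j) [α_j]!. This is `hook-identity`.
--
-- Both sides become statements about flows. A coloring is a tuple of 0/1-valued flows: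
-- `sized-union` turns unions into disjoint unions, `#strands` counts the circles of a flow by its
-- edges at the cut, because strands never change their left-to-right order, and inv becomes a sum
-- of pairings `J`. So X_w satisfies the colour-by-colour recursion `X̂` (`∑-colorings≈X̂`). A hook
-- tableau is a choice of labels for the first row, and the sign of an attacking pair depends only
-- on the place of its larger label (`ε-hook`). The hook sums therefore come from multiplying out a
-- product over labels v of q^(N-ν) - q^(ν-N), where ν is the signed number of attacks on v by
-- smaller labels (`inv-attackVector`, `bracketProduct-hooks`). The smallest label has ν = 0; its
-- two choices produce b_k and b_(k+1).
--
-- The bridge is `peel`, which removes the loop of the largest label; applied n times it produces
-- the quantum factorials (`Q≈X̂`). It is proved by induction on the number of colours. Splitting
-- off one colour Γ leaves the identity `regroup` between sums over pairs of a loop γ and a flow Γ.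
-- For a fixed superposition D = γ + Γ this is the one-colour case of `peel` itself (`LHS≈RHS`).
--
-- In that case γ is a lattice path inside D which must run through every edge where D is 2. The
-- generating function of q^J(D,γ) is computed along the sweep (`Z≈paths`), and `pair-symmetric` and
-- `double-symmetric` show that exchanging q and q^-1 changes it by a power of q only. Hence the two
-- exponentials in `ψ` cancel as soon as D has a double edge, and only superpositions that are
-- themselves 0/1-valued flows survive.

module IntegerCoefficients {c ℓ} (R : CommutativeRing c ℓ) where
  open CommutativeRing R
  open Algebra.Properties.Ring ring
  open Algebra.Properties.Semiring.Mult.TCOptimised semiring renaming (_×_ to _×ⁿ_)
  open Relation.Binary.Reasoning.Setoid setoid

  ⟪_⟫ : ℤ → Carrier
  ⟪ + n ⟫      = n ×ⁿ 1#
  ⟪ -[1+ n ] ⟫ = - (suc n ×ⁿ 1#)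

  ⟪⟫-neg : ∀ i → ⟪ ℤ.- i ⟫ ≈ - ⟪ i ⟫
  ⟪⟫-neg (+ zero)  = sym -0#≈0#
  ⟪⟫-neg (+ suc n) = refl
  ⟪⟫-neg -[1+ n ]  = sym (-‿involutive _)

  ⟪⟫-⊖ : ∀ m n → ⟪ m ℤ.⊖ n ⟫ ≈ m ×ⁿ 1# - n ×ⁿ 1#
  ⟪⟫-⊖ m       zero    = begin
    ⟪ m ℤ.⊖ 0 ⟫        ≡⟨ ≡.cong ⟪_⟫ (ℤ.⊖-≥ {m} z≤n) ⟩
    m ×ⁿ 1#             ≈⟨ +-identityʳ _ ⟨
    m ×ⁿ 1# + 0#        ≈⟨ +-congˡ -0#≈0# ⟨
    m ×ⁿ 1# - 0#        ∎
  ⟪⟫-⊖ zero    (suc n) = sym (+-identityˡ _)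
  ⟪⟫-⊖ (suc m) (suc n) = begin
    ⟪ suc m ℤ.⊖ suc n ⟫                   ≡⟨ ≡.cong ⟪_⟫ (ℤ.[1+m]⊖[1+n]≡m⊖n m n) ⟩
    ⟪ m ℤ.⊖ n ⟫                           ≈⟨ ⟪⟫-⊖ m n ⟩
    m ×ⁿ 1# - n ×ⁿ 1#                       ≈⟨ +-congʳ (+-identityˡ _) ⟨
    (0# + m ×ⁿ 1#) - n ×ⁿ 1#                ≈⟨ +-congʳ (+-congʳ (-‿inverseʳ 1#)) ⟨
    (1# - 1# + m ×ⁿ 1#) - n ×ⁿ 1#           ≈⟨ +-congʳ (trans (+-assoc _ _ _) (trans (+-congˡ (+-comm _ _)) (sym (+-assoc _ _ _)))) ⟩
    ((1# + m ×ⁿ 1#) - 1#) - n ×ⁿ 1#         ≈⟨ +-assoc _ _ _ ⟩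
    (1# + m ×ⁿ 1#) + (- 1# - n ×ⁿ 1#)       ≈⟨ +-cong (1+× m 1#) (trans (-‿cong (1+× n 1#)) (sym (-‿+-comm _ _))) ⟨
    suc m ×ⁿ 1# - suc n ×ⁿ 1#               ∎

  ⟪⟫-+ : ∀ i j → ⟪ i ℤ.+ j ⟫ ≈ ⟪ i ⟫ + ⟪ j ⟫
  ⟪⟫-+ (+ m)    (+ n)    = ×-homo-+ 1# m n
  ⟪⟫-+ (+ m)    -[1+ n ] = ⟪⟫-⊖ m (suc n)
  ⟪⟫-+ -[1+ m ] (+ n)    = trans (⟪⟫-⊖ n (suc m)) (+-comm _ _)
  ⟪⟫-+ -[1+ m ] -[1+ n ] = begin
    - (suc (suc (m ℕ.+ n)) ×ⁿ 1#)      ≡⟨ ≡.cong (λ k → - (suc k ×ⁿ 1#)) (ℕ+-suc m n) ⟨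
    - ((suc m ℕ.+ suc n) ×ⁿ 1#)        ≈⟨ -‿cong (×-homo-+ 1# (suc m) (suc n)) ⟩
    - (suc m ×ⁿ 1# + suc n ×ⁿ 1#)       ≈⟨ -‿+-comm _ _ ⟨
    - (suc m ×ⁿ 1#) - suc n ×ⁿ 1#       ∎
    where
    ℕ+-suc : ∀ m n → m ℕ.+ suc n ≡ suc (m ℕ.+ n)
    ℕ+-suc zero    n = ≡.refl
    ℕ+-suc (suc m) n = ≡.cong suc (ℕ+-suc m n)

  ⟪⟫-*-+ : ∀ i n → ⟪ i ℤ.* + n ⟫ ≈ ⟪ i ⟫ * (n ×ⁿ 1#)
  ⟪⟫-*-+ (+ m)    n = trans (reflexive (≡.cong ⟪_⟫ (≡.sym (ℤ.pos-* m n)))) (×1-homo-* m n)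
  ⟪⟫-*-+ -[1+ m ] n = begin
    ⟪ -[1+ m ] ℤ.* + n ⟫         ≡⟨ ≡.cong ⟪_⟫ (ℤ.neg-distribˡ-* (+ suc m) (+ n)) ⟨
    ⟪ ℤ.- (+ suc m ℤ.* + n) ⟫    ≈⟨ ⟪⟫-neg (+ suc m ℤ.* + n) ⟩
    - ⟪ + suc m ℤ.* + n ⟫        ≈⟨ -‿cong (⟪⟫-*-+ (+ suc m) n) ⟩
    - ((suc m ×ⁿ 1#) * (n ×ⁿ 1#))  ≈⟨ -‿distribˡ-* _ _ ⟩
    - (suc m ×ⁿ 1#) * (n ×ⁿ 1#)    ∎

  ⟪⟫-* : ∀ i j → ⟪ i ℤ.* j ⟫ ≈ ⟪ i ⟫ * ⟪ j ⟫
  ⟪⟫-* i (+ n)    = ⟪⟫-*-+ i n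
  ⟪⟫-* i -[1+ n ] = begin
    ⟪ i ℤ.* -[1+ n ] ⟫         ≡⟨ ≡.cong ⟪_⟫ (ℤ.neg-distribʳ-* i (+ suc n)) ⟨
    ⟪ ℤ.- (i ℤ.* + suc n) ⟫    ≈⟨ ⟪⟫-neg (i ℤ.* + suc n) ⟩
    - ⟪ i ℤ.* + suc n ⟫        ≈⟨ -‿cong (⟪⟫-*-+ i (suc n)) ⟩
    - (⟪ i ⟫ * (suc n ×ⁿ 1#))   ≈⟨ -‿distribʳ-* _ _ ⟩
    ⟪ i ⟫ * - (suc n ×ⁿ 1#)     ∎

  homomorphism : ℤ.+-*-rawRing -Raw-AlmostCommutative⟶ fromCommutativeRing R
  homomorphism = record
    { ⟦_⟧ = ⟪_⟫ ; +-homo = ⟪⟫-+ ; *-homo = ⟪⟫-* ; -‿homo = ⟪⟫-neg ; 0-homo = refl ; 1-homo = refl }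

  equal? : ∀ i j → Maybe (⟪ i ⟫ ≈ ⟪ j ⟫)
  equal? i j with i ℤ.≟ j
  ... | yes i≡j = just (reflexive (≡.cong ⟪_⟫ i≡j))
  ... | no  _   = nothing

  open Algebra.Solver.Ring ℤ.+-*-rawRing (fromCommutativeRing R) homomorphism equal? public
    using (solve; _:=_; _:+_; _:*_; :-_; _:-_; con)

-- The ring ℤ[q]

module ℤ[q]-ring where
  infix 4 _≋_
  -- Wraps `_≈ₚ_`, which unfolds to a function type, so that the two polynomials can be inferred
  -- from a proof of their equality.
  record _≋_ (f g : ℤ[q]) : Set where
    constructor pointwise
    field at : f ≈ₚ g
  open _≋_ public

  ≋-setoid : Setoid 0ℓ 0ℓ
  ≋-setoid = record
    { Carrier = ℤ[q] ; _≈_ = _≋_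
    ; isEquivalence = record
      { refl = pointwise λ _ → ≡.refl ; sym = λ p → pointwise λ i → ≡.sym (p .at i)
      ; trans = λ p r → pointwise λ i → ≡.trans (p .at i) (r .at i) } }

  open Setoid ≋-setoid using () renaming (refl to ≈-refl; sym to ≈-sym; trans to ≈-trans)

  infixr 5 _∷≈_
  _∷≈_ : ∀ {a b f g} → a ≡ b → f ≋ g → a ∷ f ≋ b ∷ g
  (p ∷≈ r) .at zero    = p
  (p ∷≈ r) .at (suc i) = r .at i

  0∷≈ : ∀ {a f} → a ≡ 0ℤ → f ≋ [] → a ∷ f ≋ []
  0∷≈ p r .at zero    = p
  0∷≈ p r .at (suc i) = r .at i

  +-cong : ∀ {f f′ g g′} → f ≋ f′ → g ≋ g′ → f +ₚ g ≋ f′ +ₚ g′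
  +-cong {f} {f′} {g} {g′} p r .at i = ≡.trans (coefficient-+ f g i)
    (≡.trans (≡.cong₂ ℤ._+_ (p .at i) (r .at i)) (≡.sym (coefficient-+ f′ g′ i)))

  +-comm : ∀ f g → f +ₚ g ≋ g +ₚ f
  +-comm f g .at i = ≡.trans (coefficient-+ f g i) (≡.trans (ℤ.+-comm (coefficient f i) (coefficient g i)) (≡.sym (coefficient-+ g f i)))

  +-assoc : ∀ f g h → (f +ₚ g) +ₚ h ≋ f +ₚ (g +ₚ h)
  +-assoc f g h .at i
    rewrite coefficient-+ (f +ₚ g) h i | coefficient-+ f g i | coefficient-+ f (g +ₚ h) i | coefficient-+ g h i
    = ℤ.+-assoc (coefficient f i) (coefficient g i) (coefficient h i)

  +-identityʳ : ∀ f → f +ₚ [] ≋ f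
  +-identityʳ [] .at i = ≡.refl
  +-identityʳ (a ∷ f) .at i = ≡.refl

  scale-cong : ∀ {a b f g} → a ≡ b → f ≋ g → scale a f ≋ scale b g
  scale-cong {a} {b} {f} {g} p r .at i = ≡.trans (coefficient-scale a f i) (≡.trans (≡.cong₂ ℤ._*_ p (r .at i)) (≡.sym (coefficient-scale b g i)))

  scale-+ : ∀ a f g → scale a (f +ₚ g) ≋ scale a f +ₚ scale a g
  scale-+ a f g .at i
    rewrite coefficient-scale a (f +ₚ g) i | coefficient-+ f g i | coefficient-+ (scale a f) (scale a g) i
          | coefficient-scale a f i | coefficient-scale a g i
    = ℤ.*-distribˡ-+ a (coefficient f i) (coefficient g i)

  +-scale : ∀ a b f → scale (a ℤ.+ b) f ≋ scale a f +ₚ scale b f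
  +-scale a b f .at i
    rewrite coefficient-scale (a ℤ.+ b) f i | coefficient-+ (scale a f) (scale b f) i
          | coefficient-scale a f i | coefficient-scale b f i
    = ℤ.*-distribʳ-+ (coefficient f i) a b

  scale-scale : ∀ a b f → scale a (scale b f) ≋ scale (a ℤ.* b) f
  scale-scale a b f .at i
    rewrite coefficient-scale a (scale b f) i | coefficient-scale b f i | coefficient-scale (a ℤ.* b) f i
    = ≡.sym (ℤ.*-assoc a b (coefficient f i))

  scale-zero : ∀ f → scale 0ℤ f ≋ []
  scale-zero f .at i = coefficient-scale 0ℤ f i

  scale-one : ∀ f → scale 1ℤ f ≋ f
  scale-one f .at i = ≡.trans (coefficient-scale 1ℤ f i) (ℤ.*-identityˡ _)

  *-zeroʳ : ∀ f → f *ₚ [] ≋ []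
  *-zeroʳ []      = ≈-refl
  *-zeroʳ (a ∷ f) = 0∷≈ ≡.refl (*-zeroʳ f)

  *-congʳ : ∀ f {g h} → g ≋ h → f *ₚ g ≋ f *ₚ h
  *-congʳ []      p = ≈-refl
  *-congʳ (a ∷ f) {g} {h} p =
    +-cong {scale a g} {scale a h} (scale-cong {a} {a} {g} {h} ≡.refl p) (≡.refl ∷≈ *-congʳ f p)

  module _ where
    open Relation.Binary.Reasoning.Setoid ≋-setoid

    swap-+ : ∀ f g h k → (f +ₚ g) +ₚ (h +ₚ k) ≋ (f +ₚ h) +ₚ (g +ₚ k)
    swap-+ f g h k .at i
      rewrite coefficient-+ (f +ₚ g) (h +ₚ k) i | coefficient-+ f g i | coefficient-+ h k i
            | coefficient-+ (f +ₚ h) (g +ₚ k) i | coefficient-+ f h i | coefficient-+ g k i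
      = lemma (coefficient f i) (coefficient g i) (coefficient h i) (coefficient k i)
      where
      open IntegerCoefficients ℤ.+-*-commutativeRing
      lemma : ∀ a b c d → (a ℤ.+ b) ℤ.+ (c ℤ.+ d) ≡ (a ℤ.+ c) ℤ.+ (b ℤ.+ d)
      lemma = solve 4 (λ a b c d → (a :+ b) :+ (c :+ d) := (a :+ c) :+ (b :+ d)) ≡.refl

    *-distribˡ : ∀ f g h → f *ₚ (g +ₚ h) ≋ f *ₚ g +ₚ f *ₚ h
    *-distribˡ []      g h = ≈-refl
    *-distribˡ (a ∷ f) g h = begin
      scale a (g +ₚ h) +ₚ (0ℤ ∷ f *ₚ (g +ₚ h))
        ≈⟨ +-cong {scale a (g +ₚ h)} (scale-+ a g h) (≡.refl ∷≈ *-distribˡ f g h) ⟩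
      (scale a g +ₚ scale a h) +ₚ ((0ℤ ∷ f *ₚ g) +ₚ (0ℤ ∷ f *ₚ h))
        ≈⟨ swap-+ (scale a g) (scale a h) (0ℤ ∷ f *ₚ g) (0ℤ ∷ f *ₚ h) ⟩
      (a ∷ f) *ₚ g +ₚ (a ∷ f) *ₚ h ∎

    -- Multiplication recurses on its left factor; this is the matching recursion on the right
    -- factor, from which commutativity follows.
    *-∷ : ∀ f b g → f *ₚ (b ∷ g) ≋ scale b f +ₚ (0ℤ ∷ f *ₚ g)
    *-∷ []      b g = ≈-sym (0∷≈ ≡.refl ≈-refl)
    *-∷ (a ∷ f) b g = ≡.cong (ℤ._+ 0ℤ) (ℤ.*-comm a b) ∷≈ (begin
      scale a g +ₚ f *ₚ (b ∷ g)                    ≈⟨ +-cong {scale a g} ≈-refl (*-∷ f b g) ⟩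
      scale a g +ₚ (scale b f +ₚ (0ℤ ∷ f *ₚ g))    ≈⟨ +-assoc (scale a g) (scale b f) _ ⟨
      (scale a g +ₚ scale b f) +ₚ (0ℤ ∷ f *ₚ g)    ≈⟨ +-cong (+-comm (scale a g) (scale b f)) ≈-refl ⟩
      (scale b f +ₚ scale a g) +ₚ (0ℤ ∷ f *ₚ g)    ≈⟨ +-assoc (scale b f) (scale a g) _ ⟩
      scale b f +ₚ (scale a g +ₚ (0ℤ ∷ f *ₚ g))    ∎)

    *-comm : ∀ f g → f *ₚ g ≋ g *ₚ f
    *-comm []      g = ≈-sym (*-zeroʳ g)
    *-comm (a ∷ f) g = begin
      scale a g +ₚ (0ℤ ∷ f *ₚ g) ≈⟨ +-cong {scale a g} ≈-refl (≡.refl ∷≈ *-comm f g) ⟩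
      scale a g +ₚ (0ℤ ∷ g *ₚ f) ≈⟨ *-∷ g a f ⟨
      g *ₚ (a ∷ f)               ∎

    *-congˡ : ∀ {f g} h → f ≋ g → f *ₚ h ≋ g *ₚ h
    *-congˡ {f} {g} h p = begin
      f *ₚ h ≈⟨ *-comm f h ⟩
      h *ₚ f ≈⟨ *-congʳ h p ⟩
      h *ₚ g ≈⟨ *-comm h g ⟩
      g *ₚ h ∎

    *-distribʳ : ∀ f g h → (g +ₚ h) *ₚ f ≋ g *ₚ f +ₚ h *ₚ f
    *-distribʳ f g h = begin
      (g +ₚ h) *ₚ f       ≈⟨ *-comm (g +ₚ h) f ⟩
      f *ₚ (g +ₚ h)       ≈⟨ *-distribˡ f g h ⟩
      f *ₚ g +ₚ f *ₚ h    ≈⟨ +-cong (*-comm f g) (*-comm f h) ⟩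
      g *ₚ f +ₚ h *ₚ f    ∎

    scale-*ˡ : ∀ a f g → scale a f *ₚ g ≋ scale a (f *ₚ g)
    scale-*ˡ a []      g = ≈-refl
    scale-*ˡ a (b ∷ f) g = begin
      scale (a ℤ.* b) g +ₚ (0ℤ ∷ scale a f *ₚ g)
        ≈⟨ +-cong (≈-sym (scale-scale a b g)) (≡.sym (ℤ.*-zeroʳ a) ∷≈ scale-*ˡ a f g) ⟩
      scale a (scale b g) +ₚ scale a (0ℤ ∷ f *ₚ g)
        ≈⟨ scale-+ a (scale b g) (0ℤ ∷ f *ₚ g) ⟨
      scale a ((b ∷ f) *ₚ g) ∎

    *-assoc : ∀ f g h → (f *ₚ g) *ₚ h ≋ f *ₚ (g *ₚ h)
    *-assoc []      g h = ≈-refl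
    *-assoc (a ∷ f) g h = begin
      (scale a g +ₚ (0ℤ ∷ f *ₚ g)) *ₚ h
        ≈⟨ *-distribʳ h (scale a g) (0ℤ ∷ f *ₚ g) ⟩
      scale a g *ₚ h +ₚ (scale 0ℤ h +ₚ (0ℤ ∷ (f *ₚ g) *ₚ h))
        ≈⟨ +-cong (scale-*ˡ a g h) (+-cong (scale-zero h) (≡.refl ∷≈ *-assoc f g h)) ⟩
      scale a (g *ₚ h) +ₚ (0ℤ ∷ f *ₚ (g *ₚ h)) ∎

    *-identityˡ : ∀ f → (1ℤ ∷ []) *ₚ f ≋ f
    *-identityˡ f = begin
      scale 1ℤ f +ₚ (0ℤ ∷ []) ≈⟨ +-cong (scale-one f) (0∷≈ ≡.refl ≈-refl) ⟩
      f +ₚ []                 ≈⟨ +-identityʳ f ⟩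
      f                       ∎

    -‿inverseˡ : ∀ f → scale -1ℤ f +ₚ f ≋ []
    -‿inverseˡ f = begin
      scale -1ℤ f +ₚ f           ≈⟨ +-cong {scale -1ℤ f} ≈-refl (≈-sym (scale-one f)) ⟩
      scale -1ℤ f +ₚ scale 1ℤ f  ≈⟨ +-scale -1ℤ 1ℤ f ⟨
      scale 0ℤ f                 ≈⟨ scale-zero f ⟩
      []                         ∎

  commutativeRing : CommutativeRing 0ℓ 0ℓ
  commutativeRing = record
    { Carrier = ℤ[q] ; _≈_ = _≋_ ; _+_ = _+ₚ_ ; _*_ = _*ₚ_ ; -_ = scale -1ℤ ; 0# = [] ; 1# = 1ℤ ∷ []
    ; isCommutativeRing = record
      { isRing = record
        { +-isAbelianGroup = record
          { isGroup = record
            { isMonoid = record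
              { isSemigroup = record
                { isMagma = record { isEquivalence = Setoid.isEquivalence ≋-setoid ; ∙-cong = λ {f} {g} → +-cong {f} {g} }
                ; assoc = +-assoc }
              ; identity = (λ _ → ≈-refl) , +-identityʳ }
            ; inverse = -‿inverseˡ , λ f → ≈-trans (+-comm f (scale -1ℤ f)) (-‿inverseˡ f)
            ; ⁻¹-cong = λ {f} {g} → scale-cong { -1ℤ } { -1ℤ } {f} {g} ≡.refl }
          ; comm = +-comm }
        ; *-cong = λ {f} {g} {h} {k} p r → ≈-trans (*-congˡ h p) (*-congʳ g r)
        ; *-assoc = *-assoc
        ; *-identity = *-identityˡ , λ f → ≈-trans (*-comm f (1ℤ ∷ [])) (*-identityˡ f)
        ; distrib = *-distribˡ , *-distribʳ }
      ; *-comm = *-comm } }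

  zero⇒≈[] : ∀ {f} → ¬ NonZeroₚ f → f ≋ []
  zero⇒≈[] {f} f≈0 .at i with coefficient f i ℤ.≟ 0ℤ
  ... | yes fᵢ≡0 = fᵢ≡0
  ... | no  fᵢ≢0 = ⊥-elim (f≈0 (coefficient⇒nonZero f i fᵢ≢0))

  ≈[]⇒zero : ∀ {f} → f ≋ [] → ¬ NonZeroₚ f
  ≈[]⇒zero f≈0 f≉0 with lowest f≉0
  ... | i , _ , fᵢ≢0 = fᵢ≢0 (f≈0 .at i)

  -- ℤ[q] is a domain because lowest nonzero coefficients multiply (`*ₚ-nonZero`).
  *-zero-divisor : ∀ f g → NonZeroₚ g → f *ₚ g ≋ [] → f ≋ []
  *-zero-divisor f g g≉0 fg≈0 with nonZeroₚ? f
  ... | yes f≉0 = ⊥-elim (≈[]⇒zero fg≈0 (*ₚ-nonZero f≉0 g≉0))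
  ... | no  f≈0 = zero⇒≈[] f≈0

-- The field ℚ(q)

module FractionIdentities {c ℓ} (R : CommutativeRing c ℓ) where
  open CommutativeRing R
  open IntegerCoefficients R
  open Relation.Binary.Reasoning.Setoid setoid

  +-comm-frac : ∀ a b c d → (a * d + c * b) * (d * b) ≈ (c * b + a * d) * (b * d)
  +-comm-frac = solve 4 (λ a b c d → (a :* d :+ c :* b) :* (d :* b) := (c :* b :+ a :* d) :* (b :* d)) refl

  +-assoc-frac : ∀ a b c d e f → ((a * d + c * b) * f + e * (b * d)) * (b * (d * f)) ≈ (a * (d * f) + (c * f + e * d) * b) * ((b * d) * f)
  +-assoc-frac = solve 6 (λ a b c d e f → ((a :* d :+ c :* b) :* f :+ e :* (b :* d)) :* (b :* (d :* f)) := (a :* (d :* f) :+ (c :* f :+ e :* d) :* b) :* ((b :* d) :* f)) refl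

  +-identityˡ-frac : ∀ a b → (0# * b + a * 1#) * b ≈ a * (1# * b)
  +-identityˡ-frac = solve 2 (λ a b → (con 0ℤ :* b :+ a :* con 1ℤ) :* b := a :* (con 1ℤ :* b)) refl

  -‿inverseˡ-frac : ∀ a b → ((- a) * b + a * b) * 1# ≈ 0# * (b * b)
  -‿inverseˡ-frac = solve 2 (λ a b → ((:- a) :* b :+ a :* b) :* con 1ℤ := con 0ℤ :* (b :* b)) refl

  *-assoc-frac : ∀ a b c d e f → ((a * c) * e) * (b * (d * f)) ≈ (a * (c * e)) * ((b * d) * f)
  *-assoc-frac = solve 6 (λ a b c d e f → ((a :* c) :* e) :* (b :* (d :* f)) := (a :* (c :* e)) :* ((b :* d) :* f)) refl

  *-comm-frac : ∀ a b c d → (a * c) * (d * b) ≈ (c * a) * (b * d)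
  *-comm-frac = solve 4 (λ a b c d → (a :* c) :* (d :* b) := (c :* a) :* (b :* d)) refl

  *-identityˡ-frac : ∀ a b → (1# * a) * b ≈ a * (1# * b)
  *-identityˡ-frac = solve 2 (λ a b → (con 1ℤ :* a) :* b := a :* (con 1ℤ :* b)) refl

  distribˡ-frac : ∀ a b c d e f → (a * (c * f + e * d)) * ((b * d) * (b * f)) ≈ ((a * c) * (b * f) + (a * e) * (b * d)) * (b * (d * f))
  distribˡ-frac = solve 6 (λ a b c d e f → (a :* (c :* f :+ e :* d)) :* ((b :* d) :* (b :* f)) := ((a :* c) :* (b :* f) :+ (a :* e) :* (b :* d)) :* (b :* (d :* f))) refl

  *-inverse-frac : ∀ a b → (a * b) * 1# ≈ 1# * (b * a)
  *-inverse-frac = solve 2 (λ a b → (a :* b) :* con 1ℤ := con 1ℤ :* (b :* a)) refl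

  private
    exchange : ∀ a d e f → (a * d) * (e * f) ≈ (a * e) * (d * f)
    exchange = solve 4 (λ a d e f → (a :* d) :* (e :* f) := (a :* e) :* (d :* f)) refl

    rotate : ∀ a b c → (a * b) * c ≈ (a * c) * b
    rotate = solve 3 (λ a b c → (a :* b) :* c := (a :* c) :* b) refl

  +-cong-frac : ∀ a b c d a′ b′ c′ d′ → a * b′ ≈ a′ * b → c * d′ ≈ c′ * d →
    (a * d + c * b) * (b′ * d′) ≈ (a′ * d′ + c′ * b′) * (b * d)
  +-cong-frac a b c d a′ b′ c′ d′ p r = begin
    (a * d + c * b) * (b′ * d′)                  ≈⟨ expand a b c d b′ d′ ⟩
    (a * b′) * (d * d′) + (c * d′) * (b * b′)    ≈⟨ +-cong (*-congʳ p) (*-congʳ r) ⟩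
    (a′ * b) * (d * d′) + (c′ * d) * (b * b′)    ≈⟨ collect a′ b c′ d b′ d′ ⟩
    (a′ * d′ + c′ * b′) * (b * d)                ∎
    where
    expand : ∀ a b c d e f → (a * d + c * b) * (e * f) ≈ (a * e) * (d * f) + (c * f) * (b * e)
    expand = solve 6 (λ a b c d e f → (a :* d :+ c :* b) :* (e :* f) := (a :* e) :* (d :* f) :+ (c :* f) :* (b :* e)) refl
    collect : ∀ a b c d e f → (a * b) * (d * f) + (c * d) * (b * e) ≈ (a * f + c * e) * (b * d)
    collect = solve 6 (λ a b c d e f → (a :* b) :* (d :* f) :+ (c :* d) :* (b :* e) := (a :* f :+ c :* e) :* (b :* d)) refl

  *-cong-frac : ∀ a b c d a′ b′ c′ d′ → a * b′ ≈ a′ * b → c * d′ ≈ c′ * d → (a * c) * (b′ * d′) ≈ (a′ * c′) * (b * d)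
  *-cong-frac a b c d a′ b′ c′ d′ p r = trans (exchange a c b′ d′) (trans (*-cong p r) (exchange a′ b c′ d))

  -‿cong-frac : ∀ a b a′ b′ → a * b′ ≈ a′ * b → (- a) * b′ ≈ (- a′) * b
  -‿cong-frac a b a′ b′ p = trans (neg a b′) (trans (-‿cong p) (sym (neg a′ b)))
    where
    neg : ∀ a b → (- a) * b ≈ - (a * b)
    neg = solve 2 (λ a b → (:- a) :* b := :- (a :* b)) refl

  -- Cross-multiplication is transitive only up to a factor, the middle denominator d; `≅-trans`
  -- cancels it in the domain ℤ[q].
  trans-frac : ∀ a b c d e f → a * d ≈ c * b → c * f ≈ e * d → (a * f) * d ≈ (e * b) * d
  trans-frac a b c d e f p r = begin
    (a * f) * d  ≈⟨ rotate a f d ⟩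
    (a * d) * f  ≈⟨ *-congʳ p ⟩
    (c * b) * f  ≈⟨ rotate c b f ⟩
    (c * f) * b  ≈⟨ *-congʳ r ⟩
    (e * d) * b  ≈⟨ rotate e d b ⟩
    (e * b) * d  ∎

  distrib-sub : ∀ u v d → u * d ≈ v * d → (u - v) * d ≈ 0#
  distrib-sub u v d p = trans (lemma u v d) (trans (+-congʳ p) (-‿inverseʳ _))
    where
    lemma : ∀ u v d → (u - v) * d ≈ u * d - v * d
    lemma = solve 3 (λ u v d → (u :- v) :* d := u :* d :- v :* d) refl

  sub≈0⇒≈ : ∀ {u v} → u - v ≈ 0# → u ≈ v
  sub≈0⇒≈ {u} {v} p = trans (lemma u v) (trans (+-congʳ p) (+-identityˡ v))
    where
    lemma : ∀ u v → u ≈ (u - v) + v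
    lemma = solve 2 (λ u v → u := (u :- v) :+ v) refl

record IsField {c ℓ} (R : CommutativeRing c ℓ) : Set (c Level.⊔ ℓ) where
  open CommutativeRing R
  field
    _⁻¹        : Carrier → Carrier
    *-inverseʳ : ∀ x → ¬ x ≈ 0# → x * x ⁻¹ ≈ 1#
    1≉0        : ¬ 1# ≈ 0#

module FieldProperties {c ℓ} {R : CommutativeRing c ℓ} (isField : IsField R) where
  open CommutativeRing R
  open IsField isField
  open Relation.Binary.Reasoning.Setoid setoid

  *-cancelˡ : ∀ x {y z} → ¬ x ≈ 0# → x * y ≈ x * z → y ≈ z
  *-cancelˡ x {y} {z} x≉0 p = begin
    y               ≈⟨ undo y ⟩
    x ⁻¹ * (x * y)  ≈⟨ *-congˡ p ⟩
    x ⁻¹ * (x * z)  ≈⟨ undo z ⟨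
    z               ∎
    where
    undo : ∀ y → y ≈ x ⁻¹ * (x * y)
    undo y = begin
      y               ≈⟨ *-identityˡ y ⟨
      1# * y          ≈⟨ *-congʳ (trans (*-comm (x ⁻¹) x) (*-inverseʳ x x≉0)) ⟨
      (x ⁻¹ * x) * y  ≈⟨ *-assoc (x ⁻¹) x y ⟩
      x ⁻¹ * (x * y)  ∎

  *-≉0 : ∀ {x y} → ¬ x ≈ 0# → ¬ y ≈ 0# → ¬ x * y ≈ 0#
  *-≉0 {x} x≉0 y≉0 p = y≉0 (*-cancelˡ x x≉0 (trans p (sym (zeroʳ x))))

  ≈-/ : ∀ {x y a} → ¬ a ≈ 0# → a * x ≈ y → x ≈ y * a ⁻¹
  ≈-/ {x} {y} {a} a≉0 p = *-cancelˡ a a≉0 (begin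
    a * x             ≈⟨ p ⟩
    y                 ≈⟨ *-identityʳ y ⟨
    y * 1#            ≈⟨ *-congˡ (*-inverseʳ a a≉0) ⟨
    y * (a * a ⁻¹)    ≈⟨ *-assoc y a _ ⟨
    (y * a) * a ⁻¹    ≈⟨ *-congʳ (*-comm y a) ⟩
    (a * y) * a ⁻¹    ≈⟨ *-assoc a y _ ⟩
    a * (y * a ⁻¹)    ∎)

  module Powers (E : ℤ → Carrier) (q : Carrier) (q≉0 : ¬ q ≈ 0#)
    (E-0 : E 0ℤ ≈ 1#) (E-suc : ∀ n → E (+ suc n) ≈ q * E (+ n))
    (E-neg : ∀ n → E -[1+ n ] ≈ (E (+ suc n)) ⁻¹)
    (qⁿ≉1 : ∀ n → ¬ E (+ suc n) ≈ 1#) where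

    E-pos≉0 : ∀ n → ¬ E (+ n) ≈ 0#
    E-pos≉0 zero    p = 1≉0 (trans (sym E-0) p)
    E-pos≉0 (suc n) p = *-≉0 q≉0 (E-pos≉0 n) (trans (sym (E-suc n)) p)

    E-inverse : ∀ n → E (+ suc n) * E -[1+ n ] ≈ 1#
    E-inverse n = trans (*-congˡ (E-neg n)) (*-inverseʳ _ (E-pos≉0 (suc n)))

    E-sucℤ : ∀ i → E (1ℤ ℤ.+ i) ≈ q * E i
    E-sucℤ (+ n)        = E-suc n
    E-sucℤ -[1+ zero ]  = begin
      E 0ℤ                        ≈⟨ E-0 ⟩
      1#                          ≈⟨ E-inverse 0 ⟨
      E 1ℤ * E -1ℤ                ≈⟨ *-congʳ (trans (E-suc 0) (trans (*-congˡ E-0) (*-identityʳ q))) ⟩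
      q * E -1ℤ                   ∎
    E-sucℤ -[1+ suc n ] = *-cancelˡ (E (+ suc n)) (E-pos≉0 (suc n)) (begin
      E (+ suc n) * E -[1+ n ]               ≈⟨ E-inverse n ⟩
      1#                                     ≈⟨ E-inverse (suc n) ⟨
      E (+ suc (suc n)) * E -[1+ suc n ]     ≈⟨ *-congʳ (trans (E-suc (suc n)) (*-comm _ _)) ⟩
      (E (+ suc n) * q) * E -[1+ suc n ]     ≈⟨ *-assoc _ _ _ ⟩
      E (+ suc n) * (q * E -[1+ suc n ])     ∎)

    E-pos-+ : ∀ m j → E (+ m ℤ.+ j) ≈ E (+ m) * E j
    E-pos-+ zero    j = begin
      E (0ℤ ℤ.+ j)   ≡⟨ ≡.cong E (ℤ.+-identityˡ j) ⟩
      E j            ≈⟨ *-identityˡ _ ⟨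
      1# * E j       ≈⟨ *-congʳ E-0 ⟨
      E 0ℤ * E j     ∎
    E-pos-+ (suc m) j = begin
      E (+ suc m ℤ.+ j)           ≡⟨ ≡.cong E (ℤ.+-assoc 1ℤ (+ m) j) ⟩
      E (1ℤ ℤ.+ (+ m ℤ.+ j))      ≈⟨ E-sucℤ (+ m ℤ.+ j) ⟩
      q * E (+ m ℤ.+ j)           ≈⟨ *-congˡ (E-pos-+ m j) ⟩
      q * (E (+ m) * E j)         ≈⟨ *-assoc q _ _ ⟨
      (q * E (+ m)) * E j         ≈⟨ *-congʳ (E-suc m) ⟨
      E (+ suc m) * E j           ∎

    E-+ : ∀ i j → E (i ℤ.+ j) ≈ E i * E j
    E-+ (+ m)    j = E-pos-+ m j
    E-+ -[1+ m ] j = *-cancelˡ (E (+ suc m)) (E-pos≉0 (suc m)) (begin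
      E (+ suc m) * E (-[1+ m ] ℤ.+ j)          ≈⟨ E-pos-+ (suc m) (-[1+ m ] ℤ.+ j) ⟨
      E (+ suc m ℤ.+ (-[1+ m ] ℤ.+ j))          ≡⟨ ≡.cong E (ℤ.+-assoc (+ suc m) -[1+ m ] j) ⟨
      E ((+ suc m ℤ.+ -[1+ m ]) ℤ.+ j)          ≡⟨ ≡.cong (λ i → E (i ℤ.+ j)) (ℤ.+-inverseʳ (+ suc m)) ⟩
      E (0ℤ ℤ.+ j)                              ≡⟨ ≡.cong E (ℤ.+-identityˡ j) ⟩
      E j                                       ≈⟨ *-identityˡ _ ⟨
      1# * E j                                  ≈⟨ *-congʳ (E-inverse m) ⟨
      (E (+ suc m) * E -[1+ m ]) * E j          ≈⟨ *-assoc _ _ _ ⟩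
      E (+ suc m) * (E -[1+ m ] * E j)          ∎)

    E≈1⇒0 : ∀ i → E i ≈ 1# → i ≡ 0ℤ
    E≈1⇒0 (+ zero)  p = ≡.refl
    E≈1⇒0 (+ suc n) p = ⊥-elim (qⁿ≉1 n p)
    E≈1⇒0 -[1+ n ]  p = ⊥-elim (qⁿ≉1 n (trans (sym (*-identityʳ _)) (trans (*-congˡ (sym p)) (E-inverse n))))

    E-injective : ∀ i j → E i ≈ E j → i ≡ j
    E-injective i j p = ℤ.i-j≡0⇒i≡j i j (E≈1⇒0 (i ℤ.- j) (begin
      E (i ℤ.- j)        ≈⟨ E-+ i (ℤ.- j) ⟩
      E i * E (ℤ.- j)    ≈⟨ *-congʳ p ⟩
      E j * E (ℤ.- j)    ≈⟨ E-+ j (ℤ.- j) ⟨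
      E (j ℤ.- j)        ≡⟨ ≡.cong E (ℤ.+-inverseʳ j) ⟩
      E 0ℤ               ≈⟨ E-0 ⟩
      1#                 ∎))

    -- No positive power of q is 1. This permits division by q^m - q^-m, and it separates the powers
    -- of a at the points a = q^N.
    E-E≉0 : ∀ {i j} → i ≢ j → ¬ E i - E j ≈ 0#
    E-E≉0 i≢j p = i≢j (E-injective _ _ (FractionIdentities.sub≈0⇒≈ R p))

module ℚ⟨q⟩-field where
  open ℚ⟨q⟩
  open ℤ[q]-ring using (at; pointwise; zero⇒≈[]; ≈[]⇒zero; *-zero-divisor)
  private
    module Z = CommutativeRing ℤ[q]-ring.commutativeRing
    module F = FractionIdentities ℤ[q]-ring.commutativeRing

  infix 4 _≅_
  -- The relation `_≈ᴷ_`, wrapped for the sake of inference in the same way as `_≋_`.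
  record _≅_ (x y : ℚ⟨q⟩) : Set where
    constructor cross
    field uncross : num x *ₚ den y Z.≈ num y *ₚ den x
  open _≅_ public

  toᴷ : ∀ {x y} → x ≅ y → x ≈ᴷ y
  toᴷ p = p .uncross .at

  fromᴷ : ∀ {x y} → x ≈ᴷ y → x ≅ y
  fromᴷ p = cross (pointwise p)

  ≅-trans : ∀ {x y z} → x ≅ y → y ≅ z → x ≅ z
  ≅-trans {frac a b _} {frac c d d≉0} {frac e f _} (cross p) (cross r) =
    cross (F.sub≈0⇒≈ (*-zero-divisor _ d d≉0 (F.distrib-sub (a *ₚ f) (e *ₚ b) d (F.trans-frac a b c d e f p r))))

  commutativeRing : CommutativeRing 0ℓ 0ℓ
  commutativeRing = record
    { Carrier = ℚ⟨q⟩ ; _≈_ = _≅_ ; _+_ = _+ᴷ_ ; _*_ = _*ᴷ_ ; -_ = -ᴷ_ ; 0# = 0ᴷ ; 1# = 1ᴷ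
    ; isCommutativeRing = record
      { isRing = record
        { +-isAbelianGroup = record
          { isGroup = record
            { isMonoid = record
              { isSemigroup = record
                { isMagma = record
                  { isEquivalence = record { refl = cross Z.refl ; sym = λ p → cross (Z.sym (p .uncross)) ; trans = ≅-trans }
                  ; ∙-cong = λ {x} {x′} {y} {y′} p r → cross (F.+-cong-frac (num x) (den x) (num y) (den y) (num x′) (den x′) (num y′) (den y′) (p .uncross) (r .uncross)) }
                ; assoc = λ x y z → cross (F.+-assoc-frac (num x) (den x) (num y) (den y) (num z) (den z)) }
              ; identity = +-identityˡ , λ x → ≅-trans (+-comm x 0ᴷ) (+-identityˡ x) }
            ; inverse = -‿inverseˡ , λ x → ≅-trans (+-comm x (-ᴷ x)) (-‿inverseˡ x)
            ; ⁻¹-cong = λ {x} {y} p → cross (F.-‿cong-frac (num x) (den x) (num y) (den y) (p .uncross)) }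
          ; comm = +-comm }
        ; *-cong = *-cong
        ; *-assoc = λ x y z → cross (F.*-assoc-frac (num x) (den x) (num y) (den y) (num z) (den z))
        ; *-identity = *-identityˡ , λ x → ≅-trans (*-comm x 1ᴷ) (*-identityˡ x)
        ; distrib = distribˡ , λ x y z → ≅-trans (*-comm (y +ᴷ z) x) (≅-trans (distribˡ x y z) (+-cong (*-comm x y) (*-comm x z))) }
      ; *-comm = *-comm } }
    where
    +-cong : ∀ {x x′ y y′} → x ≅ x′ → y ≅ y′ → x +ᴷ y ≅ x′ +ᴷ y′
    +-cong {x} {x′} {y} {y′} p r = cross (F.+-cong-frac (num x) (den x) (num y) (den y) (num x′) (den x′) (num y′) (den y′) (p .uncross) (r .uncross))
    *-cong : ∀ {x x′ y y′} → x ≅ x′ → y ≅ y′ → x *ᴷ y ≅ x′ *ᴷ y′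
    *-cong {x} {x′} {y} {y′} p r = cross (F.*-cong-frac (num x) (den x) (num y) (den y) (num x′) (den x′) (num y′) (den y′) (p .uncross) (r .uncross))
    +-comm : ∀ x y → x +ᴷ y ≅ y +ᴷ x
    +-comm x y = cross (F.+-comm-frac (num x) (den x) (num y) (den y))
    *-comm : ∀ x y → x *ᴷ y ≅ y *ᴷ x
    *-comm x y = cross (F.*-comm-frac (num x) (den x) (num y) (den y))
    +-identityˡ : ∀ x → 0ᴷ +ᴷ x ≅ x
    +-identityˡ x = cross (F.+-identityˡ-frac (num x) (den x))
    *-identityˡ : ∀ x → 1ᴷ *ᴷ x ≅ x
    *-identityˡ x = cross (F.*-identityˡ-frac (num x) (den x))
    -‿inverseˡ : ∀ x → -ᴷ x +ᴷ x ≅ 0ᴷ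
    -‿inverseˡ x = cross (F.-‿inverseˡ-frac (num x) (den x))
    distribˡ : ∀ x y z → x *ᴷ (y +ᴷ z) ≅ x *ᴷ y +ᴷ x *ᴷ z
    distribˡ x y z = cross (F.distribˡ-frac (num x) (den x) (num y) (den y) (num z) (den z))

  private module K = CommutativeRing commutativeRing

  *-inverseʳ : ∀ x → ¬ x ≅ 0ᴷ → x *ᴷ x ⁻¹ᴷ ≅ 1ᴷ
  *-inverseʳ (frac a b _) x≉0 with nonZeroₚ? a
  ... | yes a≉0 = cross (F.*-inverse-frac a b)
  ... | no  a≈0 = ⊥-elim (x≉0 (cross (Z.*-congʳ {1ℤ ∷ []} (zero⇒≈[] a≈0))))

  1≉0 : ¬ 1ᴷ ≅ 0ᴷ
  1≉0 p with p .uncross .at 0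
  ... | ()

  q≉0 : ¬ q ≅ 0ᴷ
  q≉0 p with p .uncross .at 1
  ... | ()

  private
    constant-* : ∀ f g → coefficient (f *ₚ g) 0 ≡ coefficient f 0 ℤ.* coefficient g 0
    constant-* f g = lowest-* 0 f {g} {0} (λ _ ()) (λ _ ())

    den₀ : ∀ n → coefficient (den (q ^ n)) 0 ≡ 1ℤ
    den₀ zero    = ≡.refl
    den₀ (suc n) = ≡.trans (constant-* (1ℤ ∷ []) (den (q ^ n))) (≡.trans (ℤ.*-identityˡ _) (den₀ n))

  -- Constant terms: that of the numerator is 0 and that of the denominator is 1.
  q^suc≉1 : ∀ n → ¬ q ^ suc n ≅ 1ᴷ
  q^suc≉1 n p = 0≢1 (begin
    0ℤ                                              ≡⟨ constant-* (0ℤ ∷ 1ℤ ∷ []) (num (q ^ n)) ⟨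
    coefficient (num (q ^ suc n)) 0                 ≡⟨ ℤ.*-identityʳ _ ⟨
    coefficient (num (q ^ suc n)) 0 ℤ.* 1ℤ          ≡⟨ constant-* (num (q ^ suc n)) (1ℤ ∷ []) ⟨
    coefficient (num (q ^ suc n) *ₚ (1ℤ ∷ [])) 0    ≡⟨ p .uncross .at 0 ⟩
    coefficient ((1ℤ ∷ []) *ₚ den (q ^ suc n)) 0    ≡⟨ constant-* (1ℤ ∷ []) (den (q ^ suc n)) ⟩
    1ℤ ℤ.* coefficient (den (q ^ suc n)) 0          ≡⟨ ≡.cong (1ℤ ℤ.*_) (den₀ (suc n)) ⟩
    1ℤ                                              ∎)
    where
    open ≡.≡-Reasoning
    0≢1 : 0ℤ ≢ 1ℤ
    0≢1 ()

  isField : IsField commutativeRing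
  isField = record { _⁻¹ = _⁻¹ᴷ ; *-inverseʳ = *-inverseʳ ; 1≉0 = 1≉0 }

  open FieldProperties isField public
  open Powers q^_ q q≉0 K.refl (λ _ → K.refl) (λ _ → K.refl) q^suc≉1 public

-- Finite sums

unique-↭ : {A : Set} {xs ys : List A} → Unique xs → Unique ys → (∀ {x} → x ∈ xs → x ∈ ys) → (∀ {x} → x ∈ ys → x ∈ xs) → xs ↭ ys
unique-↭ u u′ f g = ∼bag⇒↭ (unique∧set⇒bag u u′ (mk⇔ f g))

concatMap-↭ : {A A′ : Set} (f : A → List A′) {xs ys : List A} → xs ↭ ys → concatMap f xs ↭ concatMap f ys
concatMap-↭ f ↭.refl        = ↭.refl
concatMap-↭ f (prep x p)    = ↭.++⁺ˡ (f x) (concatMap-↭ f p)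
concatMap-↭ f (↭.trans p r) = ↭-trans (concatMap-↭ f p) (concatMap-↭ f r)
concatMap-↭ f {_} {y ∷ x ∷ ys} (swap {xs} x y p) = ↭-trans (↭-reflexive (≡.sym (List.++-assoc (f x) (f y) _)))
  (↭-trans (↭.++⁺ (↭.++-comm (f x) (f y)) (concatMap-↭ f p)) (↭-reflexive (List.++-assoc (f y) (f x) _)))

tuples-∈⁺ : {A : Set} {xs : List A} {n : ℕ} (v : Vec A n) → (∀ i → lookup v i ∈ xs) → v ∈ tuples xs n
tuples-∈⁺ Vec.[]      p = here ≡.refl
tuples-∈⁺ (x Vec.∷ v) p = ∈.∈-cartesianProductWith⁺ Vec._∷_ (p zero) (tuples-∈⁺ v (p ∘ suc))

tuples-∈⁻ : {A : Set} {xs : List A} {n : ℕ} (v : Vec A n) → v ∈ tuples xs n → ∀ i → lookup v i ∈ xs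
tuples-∈⁻ {xs = xs} {suc n} v v∈ i with ∈.∈-cartesianProductWith⁻ Vec._∷_ xs (tuples xs n) v∈
tuples-∈⁻ _ _ zero    | _ , _ , x∈ , _ , ≡.refl = x∈
tuples-∈⁻ _ _ (suc i) | _ , v , _ , v∈ , ≡.refl = tuples-∈⁻ v v∈ i

tuples-unique : {A : Set} {xs : List A} (n : ℕ) → Unique xs → Unique (tuples xs n)
tuples-unique zero    u = [] ∷ []
tuples-unique (suc n) u = Unique.cartesianProductWith⁺ Vec._∷_ Vec.∷-injective u (tuples-unique n u)

subsets-unique : ∀ n → Unique (subsets n)
subsets-unique n = tuples-unique n (((λ ()) ∷ []) ∷ [] ∷ [])

∈-subsets : ∀ {n} (γ : Vec Bool n) → γ ∈ subsets n
∈-subsets γ = tuples-∈⁺ γ (λ i → ∈-bools (lookup γ i))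
  where
  ∈-bools : ∀ b → b ∈ true ∷ false ∷ []
  ∈-bools true  = here ≡.refl
  ∈-bools false = there (here ≡.refl)

transpose : {A : Set} {m n : ℕ} → Vec (Vec A n) m → Vec (Vec A m) n
transpose Vec.[]      = Vec.replicate _ Vec.[]
transpose (v Vec.∷ M) = Vec.zipWith Vec._∷_ v (transpose M)

lookup-transpose : {A : Set} {m n : ℕ} (M : Vec (Vec A n) m) (i : Fin m) (j : Fin n) → lookup (lookup (transpose M) j) i ≡ lookup (lookup M i) j
lookup-transpose (v Vec.∷ M) zero    j = ≡.cong (λ r → lookup r zero) (Vec.lookup-zipWith Vec._∷_ j v (transpose M))
lookup-transpose (v Vec.∷ M) (suc i) j = ≡.trans (≡.cong (λ r → lookup r (suc i)) (Vec.lookup-zipWith Vec._∷_ j v (transpose M))) (lookup-transpose M i j)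

module Sums {c ℓ} (R : CommutativeRing c ℓ) where
  open CommutativeRing R
  open Algebra.Properties.Ring ring
  open Relation.Binary.Reasoning.Setoid setoid

  private variable
    A A′ : Set

  ∑ : List A → (A → Carrier) → Carrier
  ∑ xs f = foldr _+_ 0# (map f xs)

  when : {P : Set} → Dec P → Carrier → Carrier
  when P? x = if does P? then x else 0#

  when-yes : {P : Set} (P? : Dec P) {x : Carrier} → P → when P? x ≡ x
  when-yes (yes _) p = ≡.refl
  when-yes (no ¬p) p = ⊥-elim (¬p p)

  when-no : {P : Set} (P? : Dec P) {x : Carrier} → ¬ P → when P? x ≡ 0#
  when-no (yes p) ¬p = ⊥-elim (¬p p)
  when-no (no _)  ¬p = ≡.refl

  when-cong : {P Q : Set} (P? : Dec P) (Q? : Dec Q) {x y : Carrier} →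
    (P → Q) → (Q → P) → (P → x ≈ y) → when P? x ≈ when Q? y
  when-cong (yes p) (yes _) _ _ x≈y = x≈y p
  when-cong (yes p) (no ¬q) f _ _   = ⊥-elim (¬q (f p))
  when-cong (no ¬p) (yes q) _ g _   = ⊥-elim (¬p (g q))
  when-cong (no _)  (no _)  _ _ _   = refl

  when-*ˡ : {P : Set} (P? : Dec P) (a : Carrier) {x : Carrier} → a * when P? x ≈ when P? (a * x)
  when-*ˡ (yes _) a = refl
  when-*ˡ (no _)  a = zeroʳ a

  when-*ʳ : {P : Set} (P? : Dec P) (a : Carrier) {x : Carrier} → when P? x * a ≈ when P? (x * a)
  when-*ʳ (yes _) a = refl
  when-*ʳ (no _)  a = zeroˡ a

  ∑-cong : (xs : List A) {f g : A → Carrier} → (∀ x → f x ≈ g x) → ∑ xs f ≈ ∑ xs g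
  ∑-cong []       p = refl
  ∑-cong (x ∷ xs) p = +-cong (p x) (∑-cong xs p)

  ∑-cong-∈ : (xs : List A) {f g : A → Carrier} → (∀ {x} → x ∈ xs → f x ≈ g x) → ∑ xs f ≈ ∑ xs g
  ∑-cong-∈ []       p = refl
  ∑-cong-∈ (x ∷ xs) p = +-cong (p (here ≡.refl)) (∑-cong-∈ xs (p ∘ there))

  ∑-0 : (xs : List A) → ∑ xs (λ _ → 0#) ≈ 0#
  ∑-0 []       = refl
  ∑-0 (x ∷ xs) = trans (+-identityˡ _) (∑-0 xs)

  ∑-zero : (xs : List A) {f : A → Carrier} → (∀ x → f x ≈ 0#) → ∑ xs f ≈ 0#
  ∑-zero xs p = trans (∑-cong xs p) (∑-0 xs)

  ∑-zero-∈ : (xs : List A) {f : A → Carrier} → (∀ {x} → x ∈ xs → f x ≈ 0#) → ∑ xs f ≈ 0#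
  ∑-zero-∈ xs p = trans (∑-cong-∈ xs p) (∑-0 xs)

  ∑-++ : (xs {ys} : List A) {f : A → Carrier} → ∑ (xs ++ ys) f ≈ ∑ xs f + ∑ ys f
  ∑-++ []       = sym (+-identityˡ _)
  ∑-++ (x ∷ xs) = trans (+-congˡ (∑-++ xs)) (sym (+-assoc _ _ _))

  ∑-map : (g : A → A′) (xs : List A) {f : A′ → Carrier} → ∑ (map g xs) f ≡ ∑ xs (f ∘ g)
  ∑-map g []       = ≡.refl
  ∑-map g (x ∷ xs) = ≡.cong (λ s → _ + s) (∑-map g xs)

  ∑-concatMap : (g : A → List A′) (xs : List A) {f : A′ → Carrier} → ∑ (concatMap g xs) f ≈ ∑ xs (λ x → ∑ (g x) f)
  ∑-concatMap g []       = refl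
  ∑-concatMap g (x ∷ xs) = trans (∑-++ (g x)) (+-congˡ (∑-concatMap g xs))

  +-interchange : ∀ a b c d → (a + b) + (c + d) ≈ (a + c) + (b + d)
  +-interchange a b c d = begin
    (a + b) + (c + d)   ≈⟨ +-assoc a b _ ⟩
    a + (b + (c + d))   ≈⟨ +-congˡ (trans (sym (+-assoc b c d)) (trans (+-congʳ (+-comm b c)) (+-assoc c b d))) ⟩
    a + (c + (b + d))   ≈⟨ +-assoc a c _ ⟨
    (a + c) + (b + d)   ∎

  ∑-+ : (xs : List A) {f g : A → Carrier} → ∑ xs (λ x → f x + g x) ≈ ∑ xs f + ∑ xs g
  ∑-+ []       = sym (+-identityˡ _)
  ∑-+ (x ∷ xs) = trans (+-congˡ (∑-+ xs)) (+-interchange _ _ _ _)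

  ∑-*ˡ : (a : Carrier) (xs : List A) {f : A → Carrier} → a * ∑ xs f ≈ ∑ xs (λ x → a * f x)
  ∑-*ˡ a []       = zeroʳ a
  ∑-*ˡ a (x ∷ xs) = trans (distribˡ _ _ _) (+-congˡ (∑-*ˡ a xs))

  ∑-*ʳ : (a : Carrier) (xs : List A) {f : A → Carrier} → ∑ xs f * a ≈ ∑ xs (λ x → f x * a)
  ∑-*ʳ a xs = trans (*-comm _ _) (trans (∑-*ˡ a xs) (∑-cong xs (λ _ → *-comm _ _)))

  ∑-neg : (xs : List A) {f : A → Carrier} → - ∑ xs f ≈ ∑ xs (λ x → - f x)
  ∑-neg []       = -0#≈0#
  ∑-neg (x ∷ xs) = trans (sym (-‿+-comm _ _)) (+-congˡ (∑-neg xs))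

  ∑-swap : (xs : List A) (ys : List A′) {f : A → A′ → Carrier} →
    ∑ xs (λ x → ∑ ys (f x)) ≈ ∑ ys (λ y → ∑ xs (λ x → f x y))
  ∑-swap []       ys = sym (∑-0 ys)
  ∑-swap (x ∷ xs) ys = trans (+-congˡ (∑-swap xs ys)) (sym (∑-+ ys))

  ∑-product : {C : Set} (g : A → A′ → C) (xs : List A) (ys : List A′) {f : C → Carrier} →
    ∑ (cartesianProductWith g xs ys) f ≈ ∑ xs (λ x → ∑ ys (λ y → f (g x y)))
  ∑-product g []       ys = refl
  ∑-product g (x ∷ xs) ys = trans (∑-++ (map (g x) ys)) (+-cong (reflexive (∑-map (g x) ys)) (∑-product g xs ys))

  ∑-filter : {P : A → Set} (P? : Decidable P) (xs : List A) {f : A → Carrier} →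
    ∑ (filter P? xs) f ≈ ∑ xs (λ x → when (P? x) (f x))
  ∑-filter P? []       = refl
  ∑-filter P? (x ∷ xs) with P? x
  ... | yes _ = +-congˡ (∑-filter P? xs)
  ... | no  _ = trans (∑-filter P? xs) (sym (+-identityˡ _))

  when-∑ : {P : Set} (P? : Dec P) (xs : List A) {f : A → Carrier} → when P? (∑ xs f) ≈ ∑ xs (λ x → when P? (f x))
  when-∑ (yes _) xs = refl
  when-∑ (no _)  xs = sym (∑-0 xs)

  ∑-↭ : {xs ys : List A} {f : A → Carrier} → xs ↭ ys → ∑ xs f ≈ ∑ ys f
  ∑-↭ ↭.refl        = refl
  ∑-↭ (prep x p)    = +-congˡ (∑-↭ p)
  ∑-↭ (swap x y p)  = trans (+-congˡ (+-congˡ (∑-↭ p))) (trans (sym (+-assoc _ _ _)) (trans (+-congʳ (+-comm _ _)) (+-assoc _ _ _)))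
  ∑-↭ (↭.trans p r) = trans (∑-↭ p) (∑-↭ r)

  ∑-δ : (_≟_ : DecidableEquality A) {xs : List A} {f : A → Carrier} → Unique xs → ∀ {x} → x ∈ xs →
    ∑ xs (λ y → when (x ≟ y) (f y)) ≈ f x
  ∑-δ _≟_ {y ∷ xs} {f} (y∉ ∷ u) (here ≡.refl) = begin
    when (y ≟ y) (f y) + ∑ xs (λ z → when (y ≟ z) (f z))
      ≈⟨ +-cong (reflexive (when-yes (y ≟ y) ≡.refl)) (∑-zero-∈ xs (λ {z} z∈ → reflexive (when-no (y ≟ z) (All.lookup y∉ z∈)))) ⟩
    f y + 0#  ≈⟨ +-identityʳ _ ⟩
    f y       ∎
  ∑-δ _≟_ {y ∷ xs} {f} (y∉ ∷ u) {x} (there x∈) = begin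
    when (x ≟ y) (f y) + ∑ xs (λ z → when (x ≟ z) (f z))
      ≈⟨ +-cong (reflexive (when-no (x ≟ y) (λ { ≡.refl → All.lookup y∉ x∈ ≡.refl }))) (∑-δ _≟_ u x∈) ⟩
    0# + f x  ≈⟨ +-identityˡ _ ⟩
    f x       ∎

  ∑-tuples-suc : (xs : List A) (n : ℕ) {f : Vec A (suc n) → Carrier} →
    ∑ (tuples xs (suc n)) f ≈ ∑ xs (λ x → ∑ (tuples xs n) (λ v → f (x Vec.∷ v)))
  ∑-tuples-suc xs n = ∑-product Vec._∷_ xs (tuples xs n)

  -- Splits off the last entry, where `∑-tuples-suc` splits off the first: the recursion over labels
  -- removes the largest label.
  ∑-tuples-∷ʳ : (xs : List A) (n : ℕ) {f : Vec A (suc n) → Carrier} →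
    ∑ (tuples xs (suc n)) f ≈ ∑ xs (λ x → ∑ (tuples xs n) (λ v → f (v Vec.∷ʳ x)))
  ∑-tuples-∷ʳ xs zero    = ∑-tuples-suc xs 0
  ∑-tuples-∷ʳ xs (suc n) {f} = begin
    ∑ (tuples xs (suc (suc n))) f
      ≈⟨ ∑-tuples-suc xs (suc n) ⟩
    ∑ xs (λ x → ∑ (tuples xs (suc n)) (λ v → f (x Vec.∷ v)))
      ≈⟨ ∑-cong xs (λ x → ∑-tuples-∷ʳ xs n) ⟩
    ∑ xs (λ x → ∑ xs (λ y → ∑ (tuples xs n) (λ v → f (x Vec.∷ (v Vec.∷ʳ y)))))
      ≈⟨ ∑-swap xs xs ⟩
    ∑ xs (λ y → ∑ xs (λ x → ∑ (tuples xs n) (λ v → f ((x Vec.∷ v) Vec.∷ʳ y))))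
      ≈⟨ ∑-cong xs (λ y → ∑-tuples-suc xs n) ⟨
    ∑ xs (λ y → ∑ (tuples xs (suc n)) (λ v → f (v Vec.∷ʳ y))) ∎

  private
    ∑-tuples-columns : (xs : List A) (m n : ℕ) {f : Vec (Vec A (suc m)) n → Carrier} →
      ∑ (tuples (tuples xs (suc m)) n) f ≈
      ∑ (tuples xs n) (λ v → ∑ (tuples (tuples xs m) n) (λ M → f (Vec.zipWith Vec._∷_ v M)))
    ∑-tuples-columns xs m zero    = sym (+-identityʳ _)
    ∑-tuples-columns xs m (suc n) {f} = begin
      ∑ (tuples (tuples xs (suc m)) (suc n)) f
        ≈⟨ ∑-tuples-suc (tuples xs (suc m)) n ⟩
      ∑ (tuples xs (suc m)) (λ w → ∑ (tuples (tuples xs (suc m)) n) (λ M → f (w Vec.∷ M)))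
        ≈⟨ ∑-tuples-suc xs m ⟩
      ∑ xs (λ x → ∑ (tuples xs m) (λ w → ∑ (tuples (tuples xs (suc m)) n) (λ M → f ((x Vec.∷ w) Vec.∷ M))))
        ≈⟨ ∑-cong xs (λ x → ∑-cong (tuples xs m) (λ w → ∑-tuples-columns xs m n)) ⟩
      ∑ xs (λ x → ∑ (tuples xs m) (λ w → ∑ (tuples xs n) (λ v → ∑ (tuples (tuples xs m) n) (λ M →
        f ((x Vec.∷ w) Vec.∷ Vec.zipWith Vec._∷_ v M)))))
        ≈⟨ ∑-cong xs (λ x → ∑-swap (tuples xs m) (tuples xs n)) ⟩
      ∑ xs (λ x → ∑ (tuples xs n) (λ v → ∑ (tuples xs m) (λ w → ∑ (tuples (tuples xs m) n) (λ M →
        f ((x Vec.∷ w) Vec.∷ Vec.zipWith Vec._∷_ v M)))))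
        ≈⟨ ∑-cong xs (λ x → ∑-cong (tuples xs n) (λ v → ∑-tuples-suc (tuples xs m) n)) ⟨
      ∑ xs (λ x → ∑ (tuples xs n) (λ v → ∑ (tuples (tuples xs m) (suc n)) (λ M → f (Vec.zipWith Vec._∷_ (x Vec.∷ v) M))))
        ≈⟨ ∑-tuples-suc xs n ⟨
      ∑ (tuples xs (suc n)) (λ v → ∑ (tuples (tuples xs m) (suc n)) (λ M → f (Vec.zipWith Vec._∷_ v M))) ∎

    ∑-tuples-empty : (n : ℕ) {f : Vec (Vec A 0) n → Carrier} → ∑ (tuples (Vec.[] ∷ []) n) f ≈ f (Vec.replicate n Vec.[])
    ∑-tuples-empty zero    = +-identityʳ _
    ∑-tuples-empty (suc n) = trans (∑-tuples-suc (Vec.[] ∷ []) n) (trans (+-identityʳ _) (∑-tuples-empty n))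

  -- Colorings and loop decompositions assign to each edge a set of colours or labels; the argument
  -- works with the set of edges of each colour or label. This changes from one view to the other.
  ∑-transpose : (xs : List A) (m n : ℕ) {f : Vec (Vec A m) n → Carrier} →
    ∑ (tuples (tuples xs m) n) f ≈ ∑ (tuples (tuples xs n) m) (λ M → f (transpose M))
  ∑-transpose xs zero    n = trans (∑-tuples-empty n) (sym (+-identityʳ _))
  ∑-transpose xs (suc m) n {f} = begin
    ∑ (tuples (tuples xs (suc m)) n) f
      ≈⟨ ∑-tuples-columns xs m n ⟩
    ∑ (tuples xs n) (λ v → ∑ (tuples (tuples xs m) n) (λ M → f (Vec.zipWith Vec._∷_ v M)))
      ≈⟨ ∑-cong (tuples xs n) (λ v → ∑-transpose xs m n) ⟩
    ∑ (tuples xs n) (λ v → ∑ (tuples (tuples xs n) m) (λ M → f (transpose (v Vec.∷ M))))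
      ≈⟨ ∑-tuples-suc (tuples xs n) m ⟨
    ∑ (tuples (tuples xs n) (suc m)) (λ M → f (transpose M)) ∎

-- Flows

𝟚 : Bool → ℤ
𝟚 b = if b then 1ℤ else 0ℤ

module Flows {w : Web} (I : RadialCut w) where
  open Web w public
  open RadialCut I public
  open Sums ℤ.+-*-commutativeRing public using () renaming
    (∑-cong to ∑ᶻ-cong; ∑-+ to ∑ᶻ-+; ∑-neg to ∑ᶻ-neg; ∑-0 to ∑ᶻ-0; ∑-*ˡ to ∑ᶻ-*ˡ; ∑-↭ to ∑ᶻ-↭)

  outs-↭ : concatMap outgoing order ↭ concatMap outgoing vertices
  outs-↭ = concatMap-↭ outgoing order-↭

  outs : List Edge
  outs = concatMap outgoing order

  outs-unique : Unique outs
  outs-unique = ↭Setoid.Unique-resp-↭ (≡.setoid Edge) (↭⇒↭ₛ (↭-sym outs-↭)) unique-tail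

  covered : ∀ e → e ∈ cut ⊎ e ∈ outs
  covered e with covering e
  ... | inj₁ e∈ = inj₁ e∈
  ... | inj₂ e∈ = inj₂ (↭.∈-resp-↭ (↭-sym outs-↭) e∈)

  -- The values are signed, so that a flow can be subtracted without a side condition; `X̂` is zero
  -- on weights with a negative value.
  Weight : Set
  Weight = Edge → ℤ

  infixl 6 _⊕_ _⊖_
  _⊕_ _⊖_ : Weight → Weight → Weight
  (f ⊕ g) e = f e ℤ.+ g e
  (f ⊖ g) e = f e ℤ.- g e

  ⟦_⟧ˢ : Vec Bool edges → Weight
  ⟦ γ ⟧ˢ e = 𝟚 (lookup γ e)

  -- If f and g are the flows of two colours i < j, this is what the pair contributes to inv at the
  -- vertex: +1 for i on the left and j on the right, -1 for the opposite order. It is extended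
  -- bilinearly.
  J-at : Weight → Weight → Vertex Edge → ℤ
  J-at f g (merge eL eR _) = f eL ℤ.* g eR ℤ.- f eR ℤ.* g eL
  J-at f g (split _ _ _)   = 0ℤ

  J : Weight → Weight → ℤ
  J f g = ∑ᶻ order (J-at f g)

  h : Weight → ℤ
  h = ∑ᶻ cut

  Conserved : Weight → Vertex Edge → Set
  Conserved f v = ∑ᶻ (incoming v) f ≡ ∑ᶻ (outgoing v) f

  Flow : Weight → Set
  Flow f = All (Conserved f) order

  flow? : Decidable (Flow ∘ ⟦_⟧ˢ)
  flow? γ = All.all? (λ v → _ ℤ.≟ _) order

  flows : List (Vec Bool edges)
  flows = filter flow? (subsets edges)

  -- A flow with this property meets the cut once, at p, so it is a single loop through p.
  LoopAt : Edge → Vec Bool edges → Set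
  LoopAt p γ = All (λ e → lookup γ e ≡ does (p Fin.≟ e)) cut

  loopAt? : ∀ p → Decidable (LoopAt p)
  loopAt? p γ = All.all? (λ e → _ Bool.≟ _) cut

  loops : Edge → List (Vec Bool edges)
  loops p = filter (loopAt? p) flows

  J-cong : ∀ {f f′ g g′} → f ≗ f′ → g ≗ g′ → J f g ≡ J f′ g′
  J-cong {f} {f′} {g} {g′} p r = ∑ᶻ-cong order λ where
    (merge eL eR _) → ≡.cong₂ ℤ._-_ (≡.cong₂ ℤ._*_ (p eL) (r eR)) (≡.cong₂ ℤ._*_ (p eR) (r eL))
    (split _ _ _)   → ≡.refl

  h-cong : ∀ {f g} → f ≗ g → h f ≡ h g
  h-cong = ∑ᶻ-cong cut

  J-swap : ∀ f g → J f g ≡ ℤ.- J g f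
  J-swap f g = ≡.trans (∑ᶻ-cong order λ where
    (merge eL eR _) → lemma (f eL) (g eR) (f eR) (g eL)
    (split _ _ _)   → ≡.refl) (≡.sym (∑ᶻ-neg order))
    where
    lemma : ∀ a b c d → a ℤ.* b ℤ.- c ℤ.* d ≡ ℤ.- (d ℤ.* c ℤ.- b ℤ.* a)
    lemma = solve-∀

  J-self : ∀ f → J f f ≡ 0ℤ
  J-self f = ≡.trans (∑ᶻ-cong order λ where
    (merge eL eR _) → lemma (f eL) (f eR)
    (split _ _ _)   → ≡.refl) (∑ᶻ-0 order)
    where
    lemma : ∀ a b → a ℤ.* b ℤ.- b ℤ.* a ≡ 0ℤ
    lemma = solve-∀

  J-⊕ˡ : ∀ f g k → J (f ⊕ g) k ≡ J f k ℤ.+ J g k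
  J-⊕ˡ f g k = ≡.trans (∑ᶻ-cong order λ where
    (merge eL eR _) → lemma (f eL) (f eR) (g eL) (g eR) (k eL) (k eR)
    (split _ _ _)   → ≡.refl) (∑ᶻ-+ order)
    where
    lemma : ∀ a b c d x y → (a ℤ.+ c) ℤ.* y ℤ.- (b ℤ.+ d) ℤ.* x ≡ (a ℤ.* y ℤ.- b ℤ.* x) ℤ.+ (c ℤ.* y ℤ.- d ℤ.* x)
    lemma = solve-∀

  J-⊕ʳ : ∀ k f g → J k (f ⊕ g) ≡ J k f ℤ.+ J k g
  J-⊕ʳ k f g rewrite J-swap k (f ⊕ g) | J-⊕ˡ f g k | J-swap k f | J-swap k g = lemma (J f k) (J g k)
    where
    lemma : ∀ a b → ℤ.- (a ℤ.+ b) ≡ ℤ.- a ℤ.+ ℤ.- b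
    lemma = solve-∀

  ⊖-⊕ : ∀ f g → (f ⊖ g) ⊕ g ≗ f
  ⊖-⊕ f g e = lemma (f e) (g e)
    where
    lemma : ∀ a b → (a ℤ.- b) ℤ.+ b ≡ a
    lemma = solve-∀

  private
    unadd : ∀ {a b c} → a ≡ b ℤ.+ c → b ≡ a ℤ.- c
    unadd {_} {b} {c} ≡.refl = lemma b c
      where
      lemma : ∀ b c → b ≡ (b ℤ.+ c) ℤ.- c
      lemma = solve-∀

  J-⊖ˡ : ∀ f g k → J (f ⊖ g) k ≡ J f k ℤ.- J g k
  J-⊖ˡ f g k = unadd (≡.trans (J-cong (≡.sym ∘ ⊖-⊕ f g) (λ _ → ≡.refl)) (J-⊕ˡ (f ⊖ g) g k))

  J-⊖ʳ : ∀ k f g → J k (f ⊖ g) ≡ J k f ℤ.- J k g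
  J-⊖ʳ k f g = unadd (≡.trans (J-cong {k} {k} (λ _ → ≡.refl) (≡.sym ∘ ⊖-⊕ f g)) (J-⊕ʳ k (f ⊖ g) g))

  h-⊕ : ∀ f g → h (f ⊕ g) ≡ h f ℤ.+ h g
  h-⊕ f g = ∑ᶻ-+ cut

  h-⊖ : ∀ f g → h (f ⊖ g) ≡ h f ℤ.- h g
  h-⊖ f g = unadd (≡.trans (h-cong (≡.sym ∘ ⊖-⊕ f g)) (h-⊕ (f ⊖ g) g))

-- Exponentials and the principal specialization

-- `E i` stands for q^i. The homomorphism law alone carries the combinatorial argument, over any
-- commutative ring; division enters when the coefficients in a are extracted.
record Exponential {c ℓ} (R : CommutativeRing c ℓ) : Set (c Level.⊔ ℓ) where
  open CommutativeRing R hiding (zero)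
  field
    E   : ℤ → Carrier
    E-0 : E 0ℤ ≈ 1#
    E-+ : ∀ i j → E (i ℤ.+ j) ≈ E i * E j

  Separates : Set ℓ
  Separates = ∀ {i j} → i ≢ j → ¬ E i - E j ≈ 0#

  bracket : ℤ → Carrier
  bracket i = E i - E (ℤ.- i)

  -- This is (q - q^-1)^k [k]!, which avoids division.
  quantum-factorial : ℕ → Carrier
  quantum-factorial zero    = 1#
  quantum-factorial (suc k) = quantum-factorial k * bracket (+ suc k)

  factorials : List ℕ → Carrier
  factorials α = foldr _*_ 1# (map quantum-factorial α)

  power : Carrier → ℕ → Carrier
  power x zero    = 1#
  power x (suc k) = x * power x k

module PrincipalSpecialization {c ℓ} {R : CommutativeRing c ℓ} (exp : Exponential R) {w : Web} (I : RadialCut w) where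
  open CommutativeRing R
  open Exponential exp
  open Sums R
  open Flows I

  -- Among m + 1 colours the first has variable q^m, which gives m · h Γ. The other variables are
  -- q^-1 times those for m colours, which gives - h (t ⊖ Γ). The inversions of Γ with the later
  -- colours are J Γ (t ⊖ Γ), equal to J Γ t because J Γ Γ = 0.
  weight : ℕ → Weight → Weight → ℤ
  weight m Γ t = J Γ t ℤ.+ + m ℤ.* h Γ ℤ.- h (t ⊖ Γ)

  -- X_w(q^(m-1), q^(m-3), …, q^(1-m)) for the thickness function t, one colour at a time.
  X̂ : ℕ → Weight → Carrier
  X̂ zero    t = when (Fin.all? (λ e → t e ℤ.≟ 0ℤ)) 1#
  X̂ (suc m) t = ∑ flows (λ Γ → E (weight m ⟦ Γ ⟧ˢ t) * X̂ m (t ⊖ ⟦ Γ ⟧ˢ))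

  weight-cong : ∀ m {Γ Γ′ t t′} → Γ ≗ Γ′ → t ≗ t′ → weight m Γ t ≡ weight m Γ′ t′
  weight-cong m p r = ≡.cong₂ ℤ._-_ (≡.cong₂ ℤ._+_ (J-cong p r) (≡.cong (+ m ℤ.*_) (h-cong p)))
    (h-cong λ e → ≡.cong₂ ℤ._-_ (r e) (p e))

  X̂-cong : ∀ m {t t′} → t ≗ t′ → X̂ m t ≈ X̂ m t′
  X̂-cong zero    p = when-cong (Fin.all? _) (Fin.all? _) (λ r e → ≡.trans (≡.sym (p e)) (r e)) (λ r e → ≡.trans (p e) (r e)) (λ _ → refl)
  X̂-cong (suc m) p = ∑-cong flows λ Γ → *-cong
    (reflexive (≡.cong E (weight-cong m {⟦ Γ ⟧ˢ} (λ _ → ≡.refl) p)))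
    (X̂-cong m (λ e → ≡.cong (ℤ._- ⟦ Γ ⟧ˢ e) (p e)))

  𝟚≥0 : ∀ b → 0ℤ ℤ.≤ 𝟚 b
  𝟚≥0 true  = ℤ.+≤+ ℕ.z≤n
  𝟚≥0 false = ℤ.+≤+ ℕ.z≤n

  ⊖ˢ-< : ∀ {t : Weight} {e} γ → t e ℤ.< 0ℤ → (t ⊖ ⟦ γ ⟧ˢ) e ℤ.< 0ℤ
  ⊖ˢ-< {t} {e} γ t<0 = ℤ.≤-<-trans (≡.subst ((t ⊖ ⟦ γ ⟧ˢ) e ℤ.≤_) (ℤ.+-identityʳ (t e)) (ℤ.+-monoʳ-≤ (t e) (ℤ.neg-mono-≤ (𝟚≥0 (lookup γ e))))) t<0

  -- Subtracting flows only lowers the values, so a negative one never returns to the 0 demanded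
  -- when no colours are left.
  X̂-negative : ∀ m {t : Weight} {e} → t e ℤ.< 0ℤ → X̂ m t ≈ 0#
  X̂-negative zero    {t} {e} t<0 = reflexive (when-no (Fin.all? _) λ t≡0 → ℤ.<-irrefl (t≡0 e) t<0)
  X̂-negative (suc m) {t} t<0 = ∑-zero flows λ Γ → trans (*-congˡ (X̂-negative m (⊖ˢ-< {t} Γ t<0))) (zeroʳ _)

  X̂-overfull : ∀ m {t : Weight} {e} → t e ≡ 0ℤ → ∀ γ → lookup γ e ≡ true → X̂ m (t ⊖ ⟦ γ ⟧ˢ) ≈ 0#
  X̂-overfull m {t} {e} te≡0 γ γe = X̂-negative m {t ⊖ ⟦ γ ⟧ˢ} {e} (lemma te≡0 γe)
    where
    lemma : ∀ {a b} → a ≡ 0ℤ → b ≡ true → a ℤ.- 𝟚 b ℤ.< 0ℤ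
    lemma ≡.refl ≡.refl = ℤ.-<+

-- Superpositions of a loop and a flow

module Updates {c ℓ} (R : CommutativeRing c ℓ) where
  open CommutativeRing R hiding (zero)
  open Sums R
  open Relation.Binary.Reasoning.Setoid setoid

  -- The listed coordinates are overwritten one at a time, so a sum over sets of edges can be
  -- carried out in the order in which the sweep meets the edges.
  ∑≔ : ∀ {n} → List (Fin n) → Vec Bool n → (Vec Bool n → Carrier) → Carrier
  ∑≔ []       γ F = F γ
  ∑≔ (e ∷ es) γ F = ∑≔ es (γ [ e ]≔ true) F + ∑≔ es (γ [ e ]≔ false) F

  ∑≔-*ˡ : ∀ {n} a es (γ : Vec Bool n) {F} → a * ∑≔ es γ F ≈ ∑≔ es γ (λ γ′ → a * F γ′)
  ∑≔-*ˡ a []       γ = refl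
  ∑≔-*ˡ a (e ∷ es) γ = trans (distribˡ _ _ _) (+-cong (∑≔-*ˡ a es _) (∑≔-*ˡ a es _))

  ∑≔-++ : ∀ {n} es {es′} (γ : Vec Bool n) {F} → ∑≔ (es ++ es′) γ F ≡ ∑≔ es γ (λ γ′ → ∑≔ es′ γ′ F)
  ∑≔-++ []       γ = ≡.refl
  ∑≔-++ (e ∷ es) γ = ≡.cong₂ _+_ (∑≔-++ es _) (∑≔-++ es _)

  Agree : ∀ {n} → List (Fin n) → Vec Bool n → Vec Bool n → Set
  Agree es γ γ′ = ∀ e → e ∉ es → lookup γ′ e ≡ lookup γ e

  agree-update : ∀ {n es} e b (γ γ′ : Vec Bool n) → Agree es (γ [ e ]≔ b) γ′ → Agree (e ∷ es) γ γ′
  agree-update e b γ γ′ p x x∉ = ≡.trans (p x (x∉ ∘ there)) (Vec.lookup∘update′ (x∉ ∘ here) γ _)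

  ∑≔-cong : ∀ {n} es (γ : Vec Bool n) {F G} → (∀ γ′ → Agree es γ γ′ → F γ′ ≈ G γ′) → ∑≔ es γ F ≈ ∑≔ es γ G
  ∑≔-cong []       γ p = p γ (λ _ _ → ≡.refl)
  ∑≔-cong (e ∷ es) γ p = +-cong (∑≔-cong es _ λ γ′ a → p γ′ (agree-update e true γ γ′ a)) (∑≔-cong es _ λ γ′ a → p γ′ (agree-update e false γ γ′ a))

  ∑≔-0 : ∀ {n} es (γ : Vec Bool n) → ∑≔ es γ (λ _ → 0#) ≈ 0#
  ∑≔-0 []       γ = refl
  ∑≔-0 (e ∷ es) γ = trans (+-cong (∑≔-0 es _) (∑≔-0 es _)) (+-identityˡ 0#)

  ∑≔-zero : ∀ {n} es (γ : Vec Bool n) {F} → (∀ γ′ → Agree es γ γ′ → F γ′ ≈ 0#) → ∑≔ es γ F ≈ 0#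
  ∑≔-zero es γ p = trans (∑≔-cong es γ p) (∑≔-0 es γ)

  ∑≔-forced : ∀ {n} {es : List (Fin n)} (γ : Vec Bool n) {F} → Unique es →
    (∀ γ′ e → e ∈ es → lookup γ′ e ≢ lookup γ e → F γ′ ≈ 0#) → ∑≔ es γ F ≈ F γ
  ∑≔-forced {es = []}     γ u p = refl
  ∑≔-forced {es = e ∷ es} γ {F} (e∉ ∷ u) p = by-value (lookup γ e) ≡.refl
    where
    wrong : ∀ b → b ≢ lookup γ e → ∑≔ es (γ [ e ]≔ b) F ≈ 0#
    wrong b b≢ = ∑≔-zero es _ λ γ′ a → p γ′ e (here ≡.refl)
      (b≢ ∘ ≡.trans (≡.sym (≡.trans (a e (λ e∈ → All.lookup e∉ e∈ ≡.refl)) (Vec.lookup∘update e γ b))))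
    right : ∑≔ es (γ [ e ]≔ lookup γ e) F ≈ F γ
    right = trans (reflexive (≡.cong (λ γ → ∑≔ es γ F) (Vec.[]≔-lookup γ e)))
      (∑≔-forced γ u (λ γ′ e′ e′∈ → p γ′ e′ (there e′∈)))
    by-value : ∀ b → b ≡ lookup γ e → ∑≔ es (γ [ e ]≔ true) F + ∑≔ es (γ [ e ]≔ false) F ≈ F γ
    by-value true  eq = trans (+-cong (trans (reflexive (≡.cong (λ b → ∑≔ es (γ [ e ]≔ b) F) eq)) right)
      (wrong false λ r → true≢false (≡.trans eq (≡.sym r)))) (+-identityʳ _)
      where true≢false : true ≢ false
            true≢false ()
    by-value false eq = trans (+-cong (wrong true λ r → true≢false (≡.trans r (≡.sym eq)))
      (trans (reflexive (≡.cong (λ b → ∑≔ es (γ [ e ]≔ b) F) eq)) right)) (+-identityˡ _)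
      where true≢false : true ≢ false
            true≢false ()

  ∑≔-↭ : ∀ {n} {es es′ : List (Fin n)} (γ : Vec Bool n) {F} → es ↭ es′ → ∑≔ es γ F ≈ ∑≔ es′ γ F
  ∑≔-↭ γ ↭.refl        = refl
  ∑≔-↭ γ (prep e p)    = +-cong (∑≔-↭ _ p) (∑≔-↭ _ p)
  ∑≔-↭ γ (↭.trans p r) = trans (∑≔-↭ γ p) (∑≔-↭ γ r)
  ∑≔-↭ γ {F} (swap {xs = es} {ys = es′} x y p) with x Fin.≟ y
  ... | yes ≡.refl = +-cong (+-cong (∑≔-↭ _ p) (∑≔-↭ _ p)) (+-cong (∑≔-↭ _ p) (∑≔-↭ _ p))
  ... | no  x≢y    = trans (+-interchange _ _ _ _) (+-cong (+-cong (go true true) (go false true)) (+-cong (go true false) (go false false)))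
    where
    go : ∀ a b → ∑≔ es ((γ [ x ]≔ a) [ y ]≔ b) F ≈ ∑≔ es′ ((γ [ y ]≔ b) [ x ]≔ a) F
    go a b = trans (∑≔-↭ _ p) (reflexive (≡.cong (λ γ → ∑≔ es′ γ F) (Vec.[]≔-commutes γ x y x≢y)))

  -- Every coordinate gets overwritten, so any base point γ may be chosen; a base point adapted to
  -- the cut is used later.
  ∑-subsets : ∀ {n} (γ : Vec Bool n) {F} → ∑ (subsets n) F ≈ ∑≔ (allFin n) γ F
  ∑-subsets {zero}  Vec.[]      = +-identityʳ _
  ∑-subsets {suc n} (b Vec.∷ γ) {F} = begin
    ∑ (subsets (suc n)) F
      ≈⟨ ∑-tuples-suc (true ∷ false ∷ []) n ⟩
    ∑ (subsets n) (λ γ → F (true Vec.∷ γ)) + (∑ (subsets n) (λ γ → F (false Vec.∷ γ)) + 0#)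
      ≈⟨ +-cong (∑-subsets γ) (trans (+-identityʳ _) (∑-subsets γ)) ⟩
    ∑≔ (allFin n) γ (λ γ → F (true Vec.∷ γ)) + ∑≔ (allFin n) γ (λ γ → F (false Vec.∷ γ))
      ≡⟨ ≡.cong₂ _+_ (shift (allFin n) true γ) (shift (allFin n) false γ) ⟨
    ∑≔ (map suc (allFin n)) (true Vec.∷ γ) F + ∑≔ (map suc (allFin n)) (false Vec.∷ γ) F
      ≡⟨ ≡.cong (λ es → ∑≔ es (true Vec.∷ γ) F + ∑≔ es (false Vec.∷ γ) F) (List.map-tabulate (λ e → e) suc) ⟩
    ∑≔ (allFin (suc n)) (b Vec.∷ γ) F ∎
    where
    shift : ∀ es b γ → ∑≔ (map suc es) (b Vec.∷ γ) F ≡ ∑≔ es γ (λ γ → F (b Vec.∷ γ))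
    shift []       b γ = ≡.refl
    shift (e ∷ es) b γ = ≡.cong₂ _+_ (shift es b _) (shift es b _)

-- Decides whether a marked edge of a row lies to the left of the vertex being passed, or at it or
-- to its right.
split-++ : {A : Set} (xs : List A) {ys : List A} (ls : List A) {x : A} {rs : List A} → xs ++ ys ≡ ls ++ x ∷ rs →
  (∃ λ m → xs ≡ ls ++ x ∷ m × rs ≡ m ++ ys) ⊎ (∃ λ m → ls ≡ xs ++ m × ys ≡ m ++ x ∷ rs)
split-++ []       ls       eq = inj₂ (ls , ≡.refl , eq)
split-++ (x ∷ xs) []       eq = inj₁ (xs , ≡.cong (_∷ xs) (List.∷-injectiveˡ eq) , ≡.sym (List.∷-injectiveʳ eq))
split-++ (x ∷ xs) (y ∷ ls) eq with split-++ xs ls (List.∷-injectiveʳ eq)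
... | inj₁ (m , p , r) = inj₁ (m , ≡.cong₂ _∷_ (List.∷-injectiveˡ eq) p , r)
... | inj₂ (m , p , r) = inj₂ (m , ≡.cong₂ _∷_ (≡.sym (List.∷-injectiveˡ eq)) p , r)

-- Lattice paths inside a superposition and their symmetry

module LatticePaths {c ℓ} {R : CommutativeRing c ℓ} (exp : Exponential R) {Edge : Set} (D : Edge → ℕ) (D≤2 : ∀ e → D e ≤ 2) where
  open import Data.Nat.Base using (_+_)
  open CommutativeRing R hiding (zero) renaming (_+_ to _⊞_)
  open Exponential exp
  open Sums R
  open Relation.Binary.Reasoning.Setoid setoid
  open IntegerCoefficients R using (solve; _:=_; _:+_; _:*_; _:-_; con)

  total : List Edge → ℕ
  total es = sum (map D es)

  total-++ : ∀ xs ys → total (xs ++ ys) ≡ total xs + total ys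
  total-++ xs ys = ≡.trans (≡.cong sum (List.map-++ D xs ys)) (sum-++ (map D xs) (map D ys))

  Thin : List Edge → Set
  Thin = All (λ e → D e ≤ 1)

  Balanced : Vertex Edge → Set
  Balanced v = total (incoming v) ≡ total (outgoing v)

  abstract
    both? : (x y : Edge) → Dec (D x ≡ 1 × D y ≡ 1)
    both? x y = D x ℕ.≟ 1 ×-dec D y ℕ.≟ 1

  branch : {P : Set} → Dec P → Carrier → Carrier → Carrier
  branch P? x y = if does P? then x else y

  branch-yes : {P : Set} (P? : Dec P) {x y : Carrier} → P → branch P? x y ≡ x
  branch-yes (yes _) p = ≡.refl
  branch-yes (no ¬p) p = ⊥-elim (¬p p)

  branch-no : {P : Set} (P? : Dec P) {x y : Carrier} → ¬ P → branch P? x y ≡ y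
  branch-no (yes p) ¬p = ⊥-elim (¬p p)
  branch-no (no _)  ¬p = ≡.refl

  module _ (s : ℤ) where
    -- Two single edges merge into a double edge, with D-thickness ρ to its right, and the path must
    -- run through it. Arriving on the right edge it is at position ρ and contributes J = +1;
    -- arriving on the left edge it is at ρ + 1 and contributes J = -1.
    enter : ℕ → Carrier → ℕ → Carrier
    enter ρ Y k = when (k ℕ.≟ ρ) (E s * Y) ⊞ when (k ℕ.≟ suc ρ) (E (ℤ.- s) * Y)

    -- The sum of q^(s J(D , γ)) over the ways γ to continue, inside D and through all double edges of D,
    -- a path that has D-thickness k to its right, so as to end with nothing to its right.
    paths : ∀ {r vs r′} → Sweep r vs r′ → ℕ → Carrier
    paths (done _) k = when (k ℕ.≟ 0) 1#
    paths (pass {v = merge eL eR _} ls rs _ _ sw) k =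
      branch (both? eL eR) (enter (total rs) (paths sw (total rs)) k) (paths sw k)
    paths (pass {v = split _ eL eR} ls rs _ _ sw) k =
      branch (both? eL eR) (paths sw (total rs) ⊞ paths sw (suc (total rs))) (paths sw k)

    enter-right : ∀ ρ Y → enter ρ Y ρ ≈ E s * Y
    enter-right ρ Y = trans (+-cong (reflexive (when-yes (ρ ℕ.≟ ρ) ≡.refl)) (reflexive (when-no (ρ ℕ.≟ suc ρ) (λ eq → ℕ.1+n≢n (≡.sym eq))))) (+-identityʳ _)

    enter-left : ∀ ρ Y → enter ρ Y (suc ρ) ≈ E (ℤ.- s) * Y
    enter-left ρ Y = trans (+-cong (reflexive (when-no (suc ρ ℕ.≟ ρ) ℕ.1+n≢n)) (reflexive (when-yes (suc ρ ℕ.≟ suc ρ) ≡.refl))) (+-identityˡ _)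

    enter-miss : ∀ {ρ Y k} → k ≢ ρ → k ≢ suc ρ → enter ρ Y k ≈ 0#
    enter-miss {ρ} {Y} {k} p r = trans (+-cong (reflexive (when-no (k ℕ.≟ ρ) p)) (reflexive (when-no (k ℕ.≟ suc ρ) r))) (+-identityˡ _)

  private
    thin-sum : ∀ {a b} → a ≤ 1 → b ≤ 1 → ¬ (a ≡ 1 × b ≡ 1) → a + b ≤ 1
    thin-sum {zero}        {b}           _ b≤1 _ = b≤1
    thin-sum {suc zero}    {zero}        _ _   _ = s≤s z≤n
    thin-sum {suc zero}    {suc zero}    _ _  ¬p = ⊥-elim (¬p (≡.refl , ≡.refl))
    thin-sum {suc zero}    {suc (suc b)} _ (s≤s ()) _
    thin-sum {suc (suc a)} {b} (s≤s ()) _ _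

    two-left : ∀ {a b c} → a ≡ 2 → a + b ≡ c → c ≤ 2 → b ≡ 0 × c ≡ 2
    two-left {b = zero}  ≡.refl ≡.refl _ = ≡.refl , ≡.refl
    two-left {b = suc b} ≡.refl ≡.refl (s≤s (s≤s ()))

    1≢2 : 1 ≢ 2
    1≢2 ()

    two-split : ∀ {a b} → a + b ≡ 2 → ¬ (a ≡ 1 × b ≡ 1) → (a ≡ 2 × b ≡ 0) ⊎ (a ≡ 0 × b ≡ 2)
    two-split {zero}              eq _  = inj₂ (≡.refl , eq)
    two-split {suc zero}          eq ¬p = ⊥-elim (¬p (≡.refl , ℕ.suc-injective eq))
    two-split {suc (suc zero)}    eq _  = inj₁ (≡.refl , ℕ.suc-injective (ℕ.suc-injective eq))
    two-split {suc (suc (suc a))} ()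

  merge-balance : ∀ {eL eR o} → Balanced (merge eL eR o) → D eL + D eR ≡ D o
  merge-balance {eL} {eR} {o} bal = ≡.trans (≡.cong (λ k → D eL + k) (≡.sym (ℕ.+-identityʳ _))) (≡.trans bal (ℕ.+-identityʳ _))

  split-balance : ∀ {i oL oR} → Balanced (split i oL oR) → D oL + D oR ≡ D i
  split-balance {i} {oL} {oR} bal = ≡.trans (≡.cong (λ k → D oL + k) (≡.sym (ℕ.+-identityʳ _))) (≡.trans (≡.sym bal) (ℕ.+-identityʳ _))

  split-thin : ∀ {i oL oR} → Balanced (split i oL oR) → D i ≤ 1 → D oL ≤ 1 × D oR ≤ 1 × ¬ (D oL ≡ 1 × D oR ≡ 1)
  split-thin {i} {oL} {oR} bal i≤1 with split-balance {i} {oL} {oR} bal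
  ... | eq = ℕ.≤-trans (ℕ.m≤m+n (D oL) (D oR)) (≡.subst (_≤ 1) (≡.sym eq) i≤1)
           , ℕ.≤-trans (ℕ.m≤n+m (D oR) (D oL)) (≡.subst (_≤ 1) (≡.sym eq) i≤1)
           , λ (p , r) → ℕ.<-irrefl ≡.refl (≡.subst (_≤ 1) (≡.trans (≡.sym eq) (≡.cong₂ _+_ p r)) i≤1)

  merge-thin : ∀ {eL eR o} → Balanced (merge eL eR o) → D eL ≤ 1 → D eR ≤ 1 → ¬ (D eL ≡ 1 × D eR ≡ 1) → D o ≤ 1
  merge-thin {eL} {eR} {o} bal l≤1 r≤1 ¬both = ≡.subst (_≤ 1) (merge-balance {eL} {eR} {o} bal) (thin-sum l≤1 r≤1 ¬both)

  replace-thin : ∀ (ls : List Edge) {is os rs} → Thin os → Thin (ls ++ is ++ rs) → Thin (ls ++ os ++ rs)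
  replace-thin ls {is} thin t = All.++⁺ (All.++⁻ˡ ls t) (All.++⁺ thin (All.++⁻ʳ is (All.++⁻ʳ ls t)))

  total-swap : ∀ m {v rs} → Balanced v → total (m ++ incoming v ++ rs) ≡ total (m ++ outgoing v ++ rs)
  total-swap m {v} {rs} bal
    rewrite total-++ m (incoming v ++ rs) | total-++ (incoming v) rs | total-++ m (outgoing v ++ rs) | total-++ (outgoing v) rs | bal = ≡.refl

  -- Passing from s = 1 to s = -1 replaces q by q^-1 in the weights q^(s J). The condition is that
  -- q^(s k) f(s) is the same for both signs.
  record Symmetric (f : ℤ → Carrier) (k : ℕ) : Set ℓ where
    constructor symmetric
    field reflect : E (ℤ.- + k) * f -1ℤ ≈ E (+ k) * f 1ℤ
  open Symmetric

  private
    EE : ∀ {i j k} → i ℤ.+ j ≡ k → E i * E j ≈ E k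
    EE {i} {j} eq = trans (sym (E-+ i j)) (reflexive (≡.cong E eq))

    zero-symmetric : ∀ f k → f -1ℤ ≈ 0# → f 1ℤ ≈ 0# → Symmetric f k
    zero-symmetric f k p r = symmetric (trans (trans (*-congˡ p) (zeroʳ _)) (sym (trans (*-congˡ r) (zeroʳ _))))

    shift-symmetric : ∀ Y k i → Symmetric Y k → ∀ {a b a′ b′} → a ℤ.+ b ≡ ℤ.- + k ℤ.+ i → a′ ℤ.+ b′ ≡ + k ℤ.+ i →
      E a * (E b * Y -1ℤ) ≈ E a′ * (E b′ * Y 1ℤ)
    shift-symmetric Y k i sym-Y {a} {b} {a′} {b′} p r = begin
      E a * (E b * Y -1ℤ)                 ≈⟨ *-assoc _ _ _ ⟨
      (E a * E b) * Y -1ℤ                 ≈⟨ *-congʳ (trans (EE (≡.trans p (ℤ.+-comm (ℤ.- + k) i))) (E-+ i (ℤ.- + k))) ⟩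
      (E i * E (ℤ.- + k)) * Y -1ℤ         ≈⟨ *-assoc _ _ _ ⟩
      E i * (E (ℤ.- + k) * Y -1ℤ)         ≈⟨ *-congˡ (sym-Y .reflect) ⟩
      E i * (E (+ k) * Y 1ℤ)              ≈⟨ *-assoc _ _ _ ⟨
      (E i * E (+ k)) * Y 1ℤ              ≈⟨ *-congʳ (trans (EE (≡.trans r (ℤ.+-comm (+ k) i))) (E-+ i (+ k))) ⟨
      (E a′ * E b′) * Y 1ℤ                ≈⟨ *-assoc _ _ _ ⟩
      E a′ * (E b′ * Y 1ℤ)                ∎

    -1+suc : ∀ n → ℤ.- + suc n ℤ.+ 1ℤ ≡ ℤ.- + n ℤ.+ 0ℤ
    -1+suc n = lemma (+ n)
      where
      lemma : ∀ n → ℤ.- (1ℤ ℤ.+ n) ℤ.+ 1ℤ ≡ ℤ.- n ℤ.+ 0ℤ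
      lemma = solve-∀

    suc-1 : ∀ n → + suc n ℤ.+ -1ℤ ≡ + n ℤ.+ 0ℤ
    suc-1 n = lemma (+ n)
      where
      lemma : ∀ n → (1ℤ ℤ.+ n) ℤ.+ -1ℤ ≡ n ℤ.+ 0ℤ
      lemma = solve-∀

    -‿suc : ∀ n → ℤ.- + n ℤ.+ -1ℤ ≡ ℤ.- + suc n ℤ.+ 0ℤ
    -‿suc n = lemma (+ n)
      where
      lemma : ∀ n → ℤ.- n ℤ.+ -1ℤ ≡ ℤ.- (1ℤ ℤ.+ n) ℤ.+ 0ℤ
      lemma = solve-∀

    +-suc : ∀ n → + n ℤ.+ 1ℤ ≡ + suc n ℤ.+ 0ℤ
    +-suc n = lemma (+ n)
      where
      lemma : ∀ n → n ℤ.+ 1ℤ ≡ (1ℤ ℤ.+ n) ℤ.+ 0ℤ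
      lemma = solve-∀

    -- For k = ρ both entries occur and the change of sign exchanges them. For k = ρ + 1 only the
    -- left entry occurs and for k + 1 = ρ only the right one; its factor q^(-s) or q^s makes up for
    -- the difference between k and ρ. For any other k both terms vanish.
    enter-symmetric : ∀ (Y : ℤ → Carrier) ρ k → Symmetric Y ρ → Symmetric (λ s → enter s ρ (Y s) k ⊞ enter s ρ (Y s) (suc k)) k
    enter-symmetric Y ρ k sym-Y with k ℕ.≟ ρ
    ... | yes ≡.refl = symmetric (trans (expand -1ℤ (ℤ.- + ρ)) (trans (trans (+-cong (shift-symmetric Y ρ -1ℤ sym-Y ≡.refl ≡.refl) (shift-symmetric Y ρ 1ℤ sym-Y ≡.refl ≡.refl)) (+-comm _ _)) (sym (expand 1ℤ (+ ρ)))))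
      where
      expand : ∀ s i → E i * (enter s ρ (Y s) ρ ⊞ enter s ρ (Y s) (suc ρ)) ≈ E i * (E s * Y s) ⊞ E i * (E (ℤ.- s) * Y s)
      expand s i = trans (*-congˡ (+-cong (enter-right s ρ _) (enter-left s ρ _))) (distribˡ _ _ _)
    ... | no k≢ρ with k ℕ.≟ suc ρ
    ...   | yes ≡.refl = symmetric (trans (only -1ℤ (ℤ.- + suc ρ)) (trans (shift-symmetric Y ρ 0ℤ sym-Y (-1+suc ρ) (suc-1 ρ)) (sym (only 1ℤ (+ suc ρ)))))
      where
      only : ∀ s i → E i * (enter s ρ (Y s) (suc ρ) ⊞ enter s ρ (Y s) (suc (suc ρ))) ≈ E i * (E (ℤ.- s) * Y s)
      only s i = *-congˡ (trans (+-cong (enter-left s ρ _) (enter-miss s (λ eq → ℕ.<⇒≢ (ℕ.m<n⇒m<1+n (ℕ.n<1+n ρ)) (≡.sym eq)) ℕ.1+n≢n)) (+-identityʳ _))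
    ...   | no k≢1+ρ with suc k ℕ.≟ ρ
    ...     | yes ≡.refl = symmetric (trans (only -1ℤ (ℤ.- + k)) (trans (shift-symmetric Y (suc k) 0ℤ sym-Y (-‿suc k) (+-suc k)) (sym (only 1ℤ (+ k)))))
      where
      only : ∀ s i → E i * (enter s ρ (Y s) k ⊞ enter s ρ (Y s) (suc k)) ≈ E i * (E s * Y s)
      only s i = *-congˡ (trans (+-cong (enter-miss s k≢ρ k≢1+ρ) (enter-right s (suc k) _)) (+-identityˡ _))
    ...     | no 1+k≢ρ = zero-symmetric _ k (none -1ℤ) (none 1ℤ)
      where
      none : ∀ s → enter s ρ (Y s) k ⊞ enter s ρ (Y s) (suc k) ≈ 0#
      none s = trans (+-cong (enter-miss s k≢ρ k≢1+ρ) (enter-miss s 1+k≢ρ (λ eq → k≢ρ (ℕ.suc-injective eq)))) (+-identityˡ _)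

    miss-symmetric : ∀ (Y : ℤ → Carrier) {ρ k} → k ≢ ρ → k ≢ suc ρ → Symmetric (λ s → enter s ρ (Y s) k) k
    miss-symmetric Y {ρ} {k} p r = zero-symmetric (λ s → enter s ρ (Y s) k) k (enter-miss -1ℤ p r) (enter-miss 1ℤ p r)

    symmetric-cong : ∀ {f g : ℤ → Carrier} {k} → (∀ s → f s ≡ g s) → Symmetric g k → Symmetric f k
    symmetric-cong p r = symmetric (trans (*-congˡ (reflexive (p -1ℤ))) (trans (r .reflect) (sym (*-congˡ (reflexive (p 1ℤ))))))

  -- Proved together with `double-symmetric` by induction along the sweep. In a row without double
  -- edges, two neighbouring positions behave jointly like one double edge: a merge of two single
  -- edges turns the first kind of row into the second, and a split of the double edge turns it
  -- back.
  pair-symmetric : ∀ {r vs r′} (sw : Sweep r vs r′) → All Balanced vs → Thin r → ∀ k →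
    Symmetric (λ s → paths s sw k ⊞ paths s sw (suc k)) k
  -- One double edge is enough to consider: the path covers all double edges of a row but is on only
  -- one edge of it.
  double-symmetric : ∀ {r vs r′} (sw : Sweep r vs r′) → All Balanced vs → ∀ ls {x} rs → r ≡ ls ++ x ∷ rs →
    D x ≡ 2 → Thin ls → Thin rs → Symmetric (λ s → paths s sw (total rs)) (total rs)

  pair-symmetric (done _) _ _ zero    = symmetric refl
  pair-symmetric (done _) _ _ (suc k) = zero-symmetric (λ _ → 0# ⊞ 0#) (suc k) (+-identityˡ 0#) (+-identityˡ 0#)
  pair-symmetric (pass {v = merge eL eR o} ls rs _ ≡.refl sw) (bal ∷ bals) thin k with both? eL eR
  ... | no ¬both = pair-symmetric sw bals (replace-thin ls (merge-thin {eL} {eR} {o} bal eL≤1 eR≤1 ¬both ∷ []) thin) k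
    where
    eL≤1 = All.head (All.++⁻ʳ ls thin)
    eR≤1 = All.head (All.tail (All.++⁻ʳ ls thin))
  -- The merge creates a double edge, which reduces the pair of positions to a single one.
  ... | yes both = enter-symmetric (λ s → paths s sw (total rs)) (total rs) k
    (double-symmetric sw bals ls rs ≡.refl o≡2 (All.++⁻ˡ ls thin) (All.tail (All.tail (All.++⁻ʳ ls thin))))
    where
    o≡2 : D o ≡ 2
    o≡2 = ≡.trans (≡.sym (merge-balance {eL} {eR} {o} bal)) (≡.cong₂ _+_ (proj₁ both) (proj₂ both))
  pair-symmetric (pass {v = split i oL oR} ls rs _ ≡.refl sw) (bal ∷ bals) thin k
    with split-thin {i} {oL} {oR} bal (All.head (All.++⁻ʳ ls thin))
  ... | oL≤1 , oR≤1 , ¬both = symmetric-cong (λ s → ≡.cong₂ _⊞_ (branch-no (both? oL oR) ¬both) (branch-no (both? oL oR) ¬both))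
    (pair-symmetric sw bals (replace-thin ls (oL≤1 ∷ oR≤1 ∷ []) thin) k)

  double-symmetric (done _) _ ls rs _ _ _ _ with total rs
  ... | zero  = symmetric refl
  ... | suc k = zero-symmetric (λ _ → 0#) (suc k) refl refl
  double-symmetric (pass {v = merge eL eR o} lsᵥ rsᵥ _ ≡.refl sw) (bal ∷ bals) ls {x} rs eq x≡2 thinˡ thinʳ
    with split-++ lsᵥ ls eq
  ... | inj₁ (m , ≡.refl , ≡.refl) with both? eL eR
  -- The path is on the double edge x, to the left of this merge, and would leave the new double
  -- edge uncovered; both signs give 0.
  ...   | yes (eL≡1 , eR≡1) = miss-symmetric (λ s → paths s sw (total rsᵥ)) far far′
    where
    big : total (m ++ eL ∷ eR ∷ rsᵥ) ≡ total m + suc (suc (total rsᵥ))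
    big = ≡.trans (total-++ m (eL ∷ eR ∷ rsᵥ)) (≡.cong (λ k → total m + k) (≡.cong₂ (λ a b → a + (b + total rsᵥ)) eL≡1 eR≡1))
    far : total (m ++ eL ∷ eR ∷ rsᵥ) ≢ total rsᵥ
    far p = ℕ.<⇒≢ (ℕ.<-≤-trans (ℕ.m<n⇒m<1+n (ℕ.n<1+n _)) (ℕ.m≤n+m _ (total m))) (≡.sym (≡.trans (≡.sym big) p))
    far′ : total (m ++ eL ∷ eR ∷ rsᵥ) ≢ suc (total rsᵥ)
    far′ p = ℕ.<⇒≢ (ℕ.<-≤-trans (ℕ.n<1+n _) (ℕ.m≤n+m _ (total m))) (≡.sym (≡.trans (≡.sym big) p))
  ...   | no ¬both = ≡.subst (λ k → Symmetric (λ s → paths s sw k) k) (≡.sym (total-swap m {merge eL eR o} bal))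
    (double-symmetric sw bals ls (m ++ o ∷ rsᵥ) (List.++-assoc ls (x ∷ m) _) x≡2 thinˡ
      (replace-thin m (merge-thin {eL} {eR} {o} bal (All.head I-thin) (All.head (All.tail I-thin)) ¬both ∷ []) thinʳ))
    where I-thin = All.++⁻ʳ m thinʳ
  double-symmetric (pass {v = merge eL eR o} lsᵥ rsᵥ _ ≡.refl sw) (bal ∷ bals) ls {x} rs eq x≡2 thinˡ thinʳ
    | inj₂ (m , ≡.refl , eq′) with split-++ (eL ∷ eR ∷ []) m eq′
  ... | inj₂ (m′ , ≡.refl , ≡.refl) with both? eL eR
  ...   | yes (eL≡1 , eR≡1) = miss-symmetric (λ s → paths s sw (total (m′ ++ x ∷ rs))) (ℕ.<⇒≢ near) (ℕ.<⇒≢ (ℕ.m<n⇒m<1+n near))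
    where
    near : total rs < total (m′ ++ x ∷ rs)
    near = ≡.subst (total rs <_) (≡.sym (≡.trans (total-++ m′ (x ∷ rs)) (≡.cong (λ k → total m′ + (k + total rs)) x≡2)))
      (ℕ.<-≤-trans (ℕ.m<n⇒m<1+n (ℕ.n<1+n _)) (ℕ.m≤n+m _ (total m′)))
  ...   | no ¬both = double-symmetric sw bals (lsᵥ ++ o ∷ m′) rs (≡.sym (List.++-assoc lsᵥ (o ∷ m′) _)) x≡2
    (replace-thin lsᵥ (merge-thin {eL} {eR} {o} bal (All.head I-thin) (All.head (All.tail I-thin)) ¬both ∷ []) thinˡ) thinʳ
    where I-thin = All.++⁻ʳ lsᵥ thinˡ
  double-symmetric (pass {v = merge eL eR o} lsᵥ rsᵥ _ ≡.refl sw) (bal ∷ bals) _ rs _ x≡2 thinˡ thinʳ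
    | inj₂ ([] , ≡.refl , eq′) | inj₁ (_ , ≡.refl , ≡.refl) with both? eL eR
  ... | yes (eL≡1 , _) = ⊥-elim (1≢2 (≡.trans (≡.sym eL≡1) x≡2))
  -- A double edge entering a merge fills it, since D is at most 2: the other input is empty and the
  -- output is the double edge.
  ... | no  _ with two-left x≡2 (merge-balance {eL} {eR} {o} bal) (D≤2 o)
  ...   | eR≡0 , o≡2 rewrite eR≡0 = double-symmetric sw bals lsᵥ rsᵥ ≡.refl o≡2 (All.++⁻ˡ lsᵥ thinˡ) (All.tail thinʳ)
  double-symmetric (pass {v = merge eL eR o} lsᵥ rsᵥ _ ≡.refl sw) (bal ∷ bals) _ rs _ x≡2 thinˡ thinʳ
    | inj₂ (_ ∷ [] , ≡.refl , eq′) | inj₁ (_ , ≡.refl , ≡.refl) with both? eL eR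
  ... | yes (_ , eR≡1) = ⊥-elim (1≢2 (≡.trans (≡.sym eR≡1) x≡2))
  ... | no  _ with two-left x≡2 (≡.trans (ℕ.+-comm (D eR) (D eL)) (merge-balance {eL} {eR} {o} bal)) (D≤2 o)
  ...   | _ , o≡2 = double-symmetric sw bals lsᵥ rsᵥ ≡.refl o≡2 (All.++⁻ˡ lsᵥ thinˡ) thinʳ
  double-symmetric (pass {v = merge eL eR o} lsᵥ rsᵥ _ ≡.refl sw) (bal ∷ bals) _ rs _ x≡2 thinˡ thinʳ
    | inj₂ (_ ∷ _ ∷ [] , ≡.refl , eq′) | inj₁ (_ , () , ≡.refl)
  double-symmetric (pass {v = merge eL eR o} lsᵥ rsᵥ _ ≡.refl sw) (bal ∷ bals) _ rs _ x≡2 thinˡ thinʳ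
    | inj₂ (_ ∷ _ ∷ _ ∷ _ , ≡.refl , eq′) | inj₁ (_ , () , ≡.refl)
  double-symmetric (pass {v = split i oL oR} lsᵥ rsᵥ _ ≡.refl sw) (bal ∷ bals) ls {x} rs eq x≡2 thinˡ thinʳ
    with split-++ lsᵥ ls eq
  ... | inj₁ (m , ≡.refl , ≡.refl) with split-thin {i} {oL} {oR} bal (All.head (All.++⁻ʳ m thinʳ))
  ...   | oL≤1 , oR≤1 , ¬both = symmetric-cong (λ s → branch-no (both? oL oR) ¬both)
    (≡.subst (λ k → Symmetric (λ s → paths s sw k) k) (≡.sym (total-swap m {split i oL oR} bal))
      (double-symmetric sw bals ls (m ++ oL ∷ oR ∷ rsᵥ) (List.++-assoc ls (x ∷ m) _) x≡2 thinˡ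
        (replace-thin m (oL≤1 ∷ oR≤1 ∷ []) thinʳ)))
  double-symmetric (pass {v = split i oL oR} lsᵥ rsᵥ _ ≡.refl sw) (bal ∷ bals) ls {x} rs eq x≡2 thinˡ thinʳ
    | inj₂ (i′ ∷ m , ≡.refl , ≡.refl) with split-thin {i} {oL} {oR} bal (All.head (All.++⁻ʳ lsᵥ thinˡ))
  ...   | oL≤1 , oR≤1 , ¬both = symmetric-cong (λ s → branch-no (both? oL oR) ¬both)
    (double-symmetric sw bals (lsᵥ ++ oL ∷ oR ∷ m) rs (≡.sym (List.++-assoc lsᵥ (oL ∷ oR ∷ m) _)) x≡2
      (replace-thin lsᵥ (oL≤1 ∷ oR≤1 ∷ []) thinˡ) thinʳ)
  double-symmetric (pass {v = split i oL oR} lsᵥ rsᵥ _ ≡.refl sw) (bal ∷ bals) ls {x} rs eq x≡2 thinˡ thinʳ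
    | inj₂ ([] , ≡.refl , ≡.refl) with both? oL oR
  -- The path may leave the double edge by either branch, which yields the two neighbouring
  -- positions of `pair-symmetric`.
  ... | yes (oL≡1 , oR≡1) = pair-symmetric sw bals
    (All.++⁺ (All.++⁻ˡ lsᵥ thinˡ) (ℕ.≤-reflexive oL≡1 ∷ ℕ.≤-reflexive oR≡1 ∷ thinʳ)) (total rsᵥ)
  ... | no ¬both with two-split (≡.trans (split-balance {i} {oL} {oR} bal) x≡2) ¬both
  ...   | inj₁ (oL≡2 , oR≡0) = ≡.subst (λ k → Symmetric (λ s → paths s sw k) k) (≡.cong (_+ total rsᵥ) oR≡0)
    (double-symmetric sw bals lsᵥ (oR ∷ rsᵥ) ≡.refl oL≡2 (All.++⁻ˡ lsᵥ thinˡ) (≡.subst (_≤ 1) (≡.sym oR≡0) z≤n ∷ thinʳ))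
  ...   | inj₂ (oL≡0 , oR≡2) = double-symmetric sw bals (lsᵥ ++ oL ∷ []) rsᵥ (≡.sym (List.++-assoc lsᵥ (oL ∷ []) _)) oR≡2
    (All.++⁺ (All.++⁻ˡ lsᵥ thinˡ) (≡.subst (_≤ 1) (≡.sym oL≡0) z≤n ∷ [])) thinʳ

  -- Without double edges the path never has a choice, and every merge has an empty input, so that
  -- no power of q is collected.
  paths-thin : ∀ {r vs r′} s (sw : Sweep r vs r′) → All Balanced vs → Thin r → Thin (concatMap outgoing vs) → paths s sw 0 ≈ 1#
  paths-thin s (done _) _ _ _ = refl
  paths-thin s (pass {v = merge eL eR o} ls rs _ ≡.refl sw) (bal ∷ bals) thin (o≤1 ∷ outs) with both? eL eR
  ... | yes (p , r) = ⊥-elim (ℕ.<-irrefl ≡.refl (≡.subst (_≤ 1) (≡.trans (≡.sym (merge-balance {eL} {eR} {o} bal)) (≡.cong₂ _+_ p r)) o≤1))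
  ... | no  _ = paths-thin s sw bals (replace-thin ls (o≤1 ∷ []) thin) outs
  paths-thin s (pass {v = split i oL oR} ls rs _ ≡.refl sw) (bal ∷ bals) thin (oL≤1 ∷ oR≤1 ∷ outs)
    with split-thin {i} {oL} {oR} bal (All.head (All.++⁻ʳ ls thin))
  ... | _ , _ , ¬both = trans (reflexive (branch-no (both? oL oR) ¬both)) (paths-thin s sw bals (replace-thin ls (oL≤1 ∷ oR≤1 ∷ []) thin) outs)

  -- Consider the merge that creates the first double edge. A path with nothing to its right can
  -- only enter it from the right, and only if that merge also has nothing to its right; this costs
  -- q^s, and `double-symmetric` with k = 0 applies to the rest. Otherwise both sides vanish.
  paths-thick : ∀ {r vs r′} (sw : Sweep r vs r′) → All Balanced vs → Thin r → ∀ {e} → e ∈ concatMap outgoing vs → D e ≡ 2 →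
    E 1ℤ * paths -1ℤ sw 0 ≈ E -1ℤ * paths 1ℤ sw 0
  paths-thick (pass {v = merge eL eR o} ls rs _ ≡.refl sw) (bal ∷ bals) thin {e} e∈ e≡2 with both? eL eR
  ... | no ¬both = paths-thick sw bals (replace-thin ls (o≤1 ∷ []) thin) (later e∈) e≡2
    where
    o≤1 : D o ≤ 1
    o≤1 = merge-thin {eL} {eR} {o} bal (All.head (All.++⁻ʳ ls thin)) (All.head (All.tail (All.++⁻ʳ ls thin))) ¬both
    later : ∀ {es} → e ∈ o ∷ es → e ∈ es
    later (here ≡.refl) = ⊥-elim (ℕ.<-irrefl ≡.refl (≡.subst (_≤ 1) e≡2 o≤1))
    later (there e∈)    = e∈
  ... | yes (p , r) with double-symmetric sw bals ls rs ≡.refl (≡.trans (≡.sym (merge-balance {eL} {eR} {o} bal)) (≡.cong₂ _+_ p r))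
                           (All.++⁻ˡ ls thin) (All.tail (All.tail (All.++⁻ʳ ls thin)))
  ...   | Y-symmetric with total rs
  ...     | zero  = begin
    E 1ℤ * enter -1ℤ 0 (paths -1ℤ sw 0) 0   ≈⟨ *-congˡ (enter-right -1ℤ 0 _) ⟩
    E 1ℤ * (E -1ℤ * paths -1ℤ sw 0)         ≈⟨ shift-symmetric (λ s → paths s sw 0) 0 0ℤ Y-symmetric ≡.refl ≡.refl ⟩
    E -1ℤ * (E 1ℤ * paths 1ℤ sw 0)          ≈⟨ *-congˡ (enter-right 1ℤ 0 _) ⟨
    E -1ℤ * enter 1ℤ 0 (paths 1ℤ sw 0) 0    ∎
  ...     | suc k = trans (trans (*-congˡ (enter-miss -1ℤ {suc k} {paths -1ℤ sw (suc k)} {0} (λ ()) (λ ()))) (zeroʳ _))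
    (sym (trans (*-congˡ (enter-miss 1ℤ {suc k} {paths 1ℤ sw (suc k)} {0} (λ ()) (λ ()))) (zeroʳ _)))
  paths-thick (pass {v = split i oL oR} ls rs _ ≡.refl sw) (bal ∷ bals) thin {e} e∈ e≡2
    with split-thin {i} {oL} {oR} bal (All.head (All.++⁻ʳ ls thin))
  ... | oL≤1 , oR≤1 , ¬both = trans (*-congˡ (reflexive (branch-no (both? oL oR) ¬both)))
    (trans (paths-thick sw bals (replace-thin ls (oL≤1 ∷ oR≤1 ∷ []) thin) (later e∈) e≡2) (sym (*-congˡ (reflexive (branch-no (both? oL oR) ¬both)))))
    where
    later : ∀ {es} → e ∈ oL ∷ oR ∷ es → e ∈ es
    later (here ≡.refl)         = ⊥-elim (ℕ.<-irrefl ≡.refl (≡.subst (_≤ 1) e≡2 oL≤1))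
    later (there (here ≡.refl)) = ⊥-elim (ℕ.<-irrefl ≡.refl (≡.subst (_≤ 1) e≡2 oR≤1))
    later (there (there e∈))    = e∈

unique-++ʳ : {A : Set} (xs : List A) {ys : List A} → Unique (xs ++ ys) → Unique ys
unique-++ʳ []       u       = u
unique-++ʳ (x ∷ xs) (_ ∷ u) = unique-++ʳ xs u

unique-disjoint : {A : Set} (xs : List A) {ys : List A} → Unique (xs ++ ys) → ∀ {x} → x ∈ xs → x ∉ ys
unique-disjoint (x ∷ xs) (x∉ ∷ u) (here ≡.refl) x∈ys = All.lookup x∉ (∈.∈-++⁺ʳ xs x∈ys) ≡.refl
unique-disjoint (x ∷ xs) (_ ∷ u)  (there x∈)    x∈ys = unique-disjoint xs u x∈ x∈ys

sweep-unique : {E : Set} {r r′ : List E} {vs : List (Vertex E)} → Sweep r vs r′ → Unique r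
sweep-unique (done u)         = u
sweep-unique (pass _ _ u _ _) = u

bit : Bool → ℕ
bit b = if b then 1 else 0

-- Whether a path γ with γ e = b can be removed from D at e so as to leave 0 or 1.
Fits : ℕ → Bool → Set
Fits d true  = 1 ≤ d
Fits d false = d ≤ 1

fits? : ∀ d b → Dec (Fits d b)
fits? d true  = 1 ℕ.≤? d
fits? d false = d ℕ.≤? 1

-- Summing over loops along the sweep

module Transfer {c ℓ} {R : CommutativeRing c ℓ} (exp : Exponential R) {w : Web} (I : RadialCut w)
  (p : Fin (Web.edges w)) (D : Fin (Web.edges w) → ℕ) (D≤2 : ∀ e → D e ≤ 2) (s : ℤ) where
  open import Data.Nat.Base using (_+_)
  open CommutativeRing R hiding (zero) renaming (_+_ to _⊞_)
  open Exponential exp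
  open Sums R
  open Updates R
  open Flows I
  open LatticePaths exp {Edge} D D≤2
  open Relation.Binary.Reasoning.Setoid setoid

  φ-merge : (dL dR dO : ℕ) (a b c : Bool) → Carrier
  φ-merge dL dR dO a b c = when (bit a + bit b ℕ.≟ bit c ×-dec fits? dO c) (E (s ℤ.* (+ dL ℤ.* 𝟚 b ℤ.- + dR ℤ.* 𝟚 a)))

  φ-split : (dL dR : ℕ) (a b c : Bool) → Carrier
  φ-split dL dR a b c = when (bit a ℕ.≟ bit b + bit c ×-dec (fits? dL b ×-dec fits? dR c)) 1#

  -- The incoming edges are read from the state before the vertex and the outgoing ones from the
  -- state after it, since an edge across the cut can be consumed early and produced again at the
  -- end. `Fits` is tested when an edge is produced.
  φ : Vertex Edge → Vec Bool edges → Vec Bool edges → Carrier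
  φ (merge eL eR o) γ γ′ = φ-merge (D eL) (D eR) (D o) (lookup γ eL) (lookup γ eR) (lookup γ′ o)
  φ (split i oL oR) γ γ′ = φ-split (D oL) (D oR) (lookup γ i) (lookup γ′ oL) (lookup γ′ oR)

  F : List (Vertex Edge) → Vec Bool edges → Carrier
  F []       γ = when (loopAt? p γ) 1#
  F (v ∷ vs) γ = φ v γ γ * F vs γ

  -- The sum of `F` in transfer-matrix form: a local weight is multiplied in as soon as the outgoing
  -- edges of its vertex have received values.
  Z : List (Vertex Edge) → Vec Bool edges → Carrier
  Z []       γ = when (loopAt? p γ) 1#
  Z (v ∷ vs) γ = ∑≔ (outgoing v) γ (λ γ′ → φ v γ γ′ * Z vs γ′)

  φ-cong : ∀ v {γ₁ γ₁′ γ₂ γ₂′} → (∀ {e} → e ∈ incoming v → lookup γ₁ e ≡ lookup γ₂ e) →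
    (∀ {e} → e ∈ outgoing v → lookup γ₁′ e ≡ lookup γ₂′ e) → φ v γ₁ γ₁′ ≡ φ v γ₂ γ₂′
  φ-cong (merge eL eR o) pin pout
    rewrite pin (here ≡.refl) | pin (there (here ≡.refl)) | pout (here ≡.refl) = ≡.refl
  φ-cong (split i oL oR) pin pout
    rewrite pin (here ≡.refl) | pout (here ≡.refl) | pout (there (here ≡.refl)) = ≡.refl

  F-zero : ∀ vs {γ} → ¬ LoopAt p γ → F vs γ ≈ 0#
  F-zero []       {γ} ¬l = reflexive (when-no (loopAt? p γ) ¬l)
  F-zero (v ∷ vs) ¬l = trans (*-congˡ (F-zero vs ¬l)) (zeroʳ _)

  -- An edge in the row keeps its value, unless it is met again at the end, where LoopAt prescribes that value.
  Settled : List (Vertex Edge) → Vec Bool edges → Edge → Set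
  Settled vs γ e = e ∉ concatMap outgoing vs ⊎ (e ∈ cut × lookup γ e ≡ does (p Fin.≟ e))

  -- The incoming values of a vertex are already final when it is passed, so its local weight
  -- factors out of the sum over later edges. An edge of the cut that is produced again later is no
  -- exception: unless it regains its initial value, `LoopAt` makes the term vanish.
  ∑≔-F≈Z : ∀ {r vs} → Sweep r vs cut → Unique (concatMap outgoing vs) → ∀ γ → (∀ {e} → e ∈ r → Settled vs γ e) →
    ∑≔ (concatMap outgoing vs) γ (F vs) ≈ Z vs γ
  ∑≔-F≈Z (done _) _ γ _ = refl
  ∑≔-F≈Z (pass {v = v} {vs} ls rs u ≡.refl sw) uo γ settled = begin
    ∑≔ (outgoing v ++ concatMap outgoing vs) γ (F (v ∷ vs))
      ≡⟨ ∑≔-++ (outgoing v) γ ⟩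
    ∑≔ (outgoing v) γ (λ γ₁ → ∑≔ (concatMap outgoing vs) γ₁ (F (v ∷ vs)))
      ≈⟨ ∑≔-cong (outgoing v) γ (λ γ₁ agree₁ → trans (∑≔-cong (concatMap outgoing vs) γ₁ (λ γ₂ agree₂ → pull γ₁ agree₁ γ₂ agree₂ (loopAt? p γ₂)))
           (trans (sym (∑≔-*ˡ (φ v γ γ₁) (concatMap outgoing vs) γ₁)) (*-congˡ (∑≔-F≈Z sw (unique-++ʳ (outgoing v) uo) γ₁ (settled₁ γ₁ agree₁))))) ⟩
    ∑≔ (outgoing v) γ (λ γ₁ → φ v γ γ₁ * Z vs γ₁) ∎
    where
    pull : ∀ γ₁ → Agree (outgoing v) γ γ₁ → ∀ γ₂ → Agree (concatMap outgoing vs) γ₁ γ₂ → Dec (LoopAt p γ₂) →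
      F (v ∷ vs) γ₂ ≈ φ v γ γ₁ * F vs γ₂
    pull γ₁ agree₁ γ₂ agree₂ (no ¬l) = trans (*-congˡ (F-zero vs ¬l)) (trans (zeroʳ _) (sym (trans (*-congˡ (F-zero vs ¬l)) (zeroʳ _))))
    pull γ₁ agree₁ γ₂ agree₂ (yes l) = *-congʳ (reflexive (φ-cong v in-same (λ {e} e∈ → agree₂ e (unique-disjoint (outgoing v) uo e∈))))
      where
      in-same : ∀ {e} → e ∈ incoming v → lookup γ₂ e ≡ lookup γ e
      in-same {e} e∈ with settled (∈.∈-++⁺ʳ ls (∈.∈-++⁺ˡ e∈))
      ... | inj₁ e∉ = ≡.trans (agree₂ e (e∉ ∘ ∈.∈-++⁺ʳ (outgoing v))) (agree₁ e (e∉ ∘ ∈.∈-++⁺ˡ))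
      ... | inj₂ (e∈cut , eq) = ≡.trans (All.lookup l e∈cut) (≡.sym eq)
    settled₁ : ∀ γ₁ → Agree (outgoing v) γ γ₁ → ∀ {e} → e ∈ ls ++ outgoing v ++ rs → Settled vs γ₁ e
    settled₁ γ₁ agree₁ {e} e∈ with ∈.∈-++⁻ ls e∈
    ... | inj₁ e∈ls = keep (settled (∈.∈-++⁺ˡ e∈ls)) (λ e∈o → unique-disjoint ls (sweep-unique sw) e∈ls (∈.∈-++⁺ˡ e∈o))
      where
      keep : Settled (v ∷ vs) γ e → e ∉ outgoing v → Settled vs γ₁ e
      keep (inj₁ e∉)      _  = inj₁ (e∉ ∘ ∈.∈-++⁺ʳ (outgoing v))
      keep (inj₂ (e∈ , eq)) e∉ = inj₂ (e∈ , ≡.trans (agree₁ e e∉) eq)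
    ... | inj₂ e∈′ with ∈.∈-++⁻ (outgoing v) e∈′
    ...   | inj₁ e∈o  = inj₁ (unique-disjoint (outgoing v) uo e∈o)
    ...   | inj₂ e∈rs = keep (settled (∈.∈-++⁺ʳ ls (∈.∈-++⁺ʳ (incoming v) e∈rs))) (λ e∈o → unique-disjoint (outgoing v) (unique-++ʳ ls (sweep-unique sw)) e∈o e∈rs)
      where
      keep : Settled (v ∷ vs) γ e → e ∉ outgoing v → Settled vs γ₁ e
      keep (inj₁ e∉)      _  = inj₁ (e∉ ∘ ∈.∈-++⁺ʳ (outgoing v))
      keep (inj₂ (e∈ , eq)) e∉ = inj₂ (e∈ , ≡.trans (agree₁ e e∉) eq)

  private
    E-zero : ∀ {i} → i ≡ 0ℤ → E i ≈ 1#
    E-zero ≡.refl = E-0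

    cancelˡ : ∀ {x y} → y ≈ 0# → y ⊞ x ≈ x
    cancelˡ y≈0 = trans (+-congʳ y≈0) (+-identityˡ _)

    cancelʳ : ∀ {x y} → y ≈ 0# → x ⊞ y ≈ x
    cancelʳ y≈0 = trans (+-congˡ y≈0) (+-identityʳ _)

    when-1 : {P : Set} (P? : Dec P) {a x : Carrier} → a ≈ 1# → when P? a * x ≈ when P? x
    when-1 P? a≈1 = trans (when-*ʳ P? _) (when-cong P? P? (λ z → z) (λ z → z) (λ _ → trans (*-congʳ a≈1) (*-identityˡ _)))

  merge-idle : ∀ eL eR o {vs γ} → lookup γ eL ≡ false → lookup γ eR ≡ false →
    Z (merge eL eR o ∷ vs) γ ≈ when (D o ℕ.≤? 1) (Z vs (γ [ o ]≔ false))
  merge-idle eL eR o {vs} {γ} l r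
    rewrite l | r | Vec.lookup∘update o γ true | Vec.lookup∘update o γ false =
    trans (cancelˡ (zeroˡ _)) (when-1 (D o ℕ.≤? 1) (E-zero (lemma s (+ D eL) (+ D eR))))
    where
    lemma : ∀ s a b → s ℤ.* (a ℤ.* 0ℤ ℤ.- b ℤ.* 0ℤ) ≡ 0ℤ
    lemma = solve-∀

  merge-left : ∀ eL eR o {vs γ} → lookup γ eL ≡ true → lookup γ eR ≡ false →
    Z (merge eL eR o ∷ vs) γ ≈ when (1 ℕ.≤? D o) (E (s ℤ.* (ℤ.- + D eR)) * Z vs (γ [ o ]≔ true))
  merge-left eL eR o {vs} {γ} l r
    rewrite l | r | Vec.lookup∘update o γ true | Vec.lookup∘update o γ false =
    trans (cancelʳ (zeroˡ _)) (trans (when-*ʳ (1 ℕ.≤? D o) _)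
      (when-cong (1 ℕ.≤? D o) (1 ℕ.≤? D o) (λ z → z) (λ z → z) (λ _ → *-congʳ (reflexive (≡.cong E (lemma s (+ D eL) (+ D eR)))))))
    where
    lemma : ∀ s a b → s ℤ.* (a ℤ.* 0ℤ ℤ.- b ℤ.* 1ℤ) ≡ s ℤ.* (ℤ.- b)
    lemma = solve-∀

  merge-right : ∀ eL eR o {vs γ} → lookup γ eL ≡ false → lookup γ eR ≡ true →
    Z (merge eL eR o ∷ vs) γ ≈ when (1 ℕ.≤? D o) (E (s ℤ.* + D eL) * Z vs (γ [ o ]≔ true))
  merge-right eL eR o {vs} {γ} l r
    rewrite l | r | Vec.lookup∘update o γ true | Vec.lookup∘update o γ false =
    trans (cancelʳ (zeroˡ _)) (trans (when-*ʳ (1 ℕ.≤? D o) _)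
      (when-cong (1 ℕ.≤? D o) (1 ℕ.≤? D o) (λ z → z) (λ z → z) (λ _ → *-congʳ (reflexive (≡.cong E (lemma s (+ D eL) (+ D eR)))))))
    where
    lemma : ∀ s a b → s ℤ.* (a ℤ.* 1ℤ ℤ.- b ℤ.* 0ℤ) ≡ s ℤ.* a
    lemma = solve-∀

  set₂ : Vec Bool edges → Edge → Bool → Edge → Bool → Vec Bool edges
  set₂ γ x a y b = (γ [ x ]≔ a) [ y ]≔ b

  private
    set₂-left : ∀ γ {x y} a b → x ≢ y → lookup (set₂ γ x a y b) x ≡ a
    set₂-left γ {x} {y} a b x≢y = ≡.trans (Vec.lookup∘update′ x≢y (γ [ x ]≔ a) b) (Vec.lookup∘update x γ a)

    set₂-right : ∀ γ {x y} a b → lookup (set₂ γ x a y b) y ≡ b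
    set₂-right γ {x} {y} a b = Vec.lookup∘update y (γ [ x ]≔ a) b

  split-sum : ∀ i oL oR {vs γ c} → oL ≢ oR → lookup γ i ≡ c → let t a b = φ-split (D oL) (D oR) c a b * Z vs (set₂ γ oL a oR b) in
    Z (split i oL oR ∷ vs) γ ≈ (t true true ⊞ t true false) ⊞ (t false true ⊞ t false false)
  split-sum i oL oR {vs} {γ} oL≢oR ≡.refl = +-cong (+-cong (term true true) (term true false)) (+-cong (term false true) (term false false))
    where
    term : ∀ a b → φ (split i oL oR) γ (set₂ γ oL a oR b) * Z vs (set₂ γ oL a oR b) ≈ φ-split (D oL) (D oR) (lookup γ i) a b * Z vs (set₂ γ oL a oR b)
    term a b = *-congʳ (reflexive (≡.cong₂ (φ-split (D oL) (D oR) (lookup γ i)) (set₂-left γ a b oL≢oR) (set₂-right γ {oL} a b)))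

  split-idle : ∀ i oL oR {vs γ} → oL ≢ oR → lookup γ i ≡ false →
    Z (split i oL oR ∷ vs) γ ≈ when (D oL ℕ.≤? 1 ×-dec D oR ℕ.≤? 1) (Z vs (set₂ γ oL false oR false))
  split-idle i oL oR {vs} {γ} oL≢oR l = trans (split-sum i oL oR {vs} {γ} oL≢oR l)
    (trans (cancelˡ (trans (+-cong (zeroˡ _) (zeroˡ _)) (+-identityˡ _))) (trans (cancelˡ (zeroˡ _)) (when-1 (D oL ℕ.≤? 1 ×-dec D oR ℕ.≤? 1) refl)))

  split-active : ∀ i oL oR {vs γ} → oL ≢ oR → lookup γ i ≡ true →
    Z (split i oL oR ∷ vs) γ ≈ when (1 ℕ.≤? D oL ×-dec D oR ℕ.≤? 1) (Z vs (set₂ γ oL true oR false))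
                             ⊞ when (D oL ℕ.≤? 1 ×-dec 1 ℕ.≤? D oR) (Z vs (set₂ γ oL false oR true))
  split-active i oL oR {vs} {γ} oL≢oR l = trans (split-sum i oL oR {vs} {γ} oL≢oR l)
    (+-cong (trans (cancelˡ (zeroˡ _)) (when-1 (1 ℕ.≤? D oL ×-dec D oR ℕ.≤? 1) refl)) (trans (cancelʳ (zeroˡ _)) (when-1 (D oL ℕ.≤? 1 ×-dec 1 ℕ.≤? D oR) refl)))

  Off On : Vec Bool edges → Edge → Set
  Off γ e = lookup γ e ≡ false × D e ≤ 1
  On  γ e = lookup γ e ≡ true × 1 ≤ D e

  -- The path occupies exactly one edge x of the row, and by `Off` every double edge of the row is x
  -- itself. All that `paths` remembers of this is the thickness k to the right of x.
  record At (γ : Vec Bool edges) (r : List Edge) (k : ℕ) : Set where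
    constructor at
    field
      ls     : List Edge
      x      : Edge
      rs     : List Edge
      row    : r ≡ ls ++ x ∷ rs
      right  : k ≡ total rs
      on     : On γ x
      off-ls : All (Off γ) ls
      off-rs : All (Off γ) rs

  off-agree : ∀ {es} {γ γ′ : Vec Bool edges} {L} → Agree es γ γ′ → (∀ {e} → e ∈ L → e ∉ es) → All (Off γ) L → All (Off γ′) L
  off-agree agree L# []             = []
  off-agree {γ = γ} {γ′} agree L# ((p , d) ∷ ps) = (≡.trans (agree _ (L# (here ≡.refl))) p , d) ∷ off-agree {γ = γ} {γ′} agree (L# ∘ there) ps

  agree₁ : ∀ (γ : Vec Bool edges) o b → Agree (o ∷ []) γ (γ [ o ]≔ b)
  agree₁ γ o b e e∉ = Vec.lookup∘update′ (e∉ ∘ here) γ b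

  agree₂ : ∀ (γ : Vec Bool edges) x y a b → Agree (x ∷ y ∷ []) γ (set₂ γ x a y b)
  agree₂ γ x y a b e e∉ = ≡.trans (Vec.lookup∘update′ (e∉ ∘ there ∘ here) (γ [ x ]≔ a) b) (Vec.lookup∘update′ (e∉ ∘ here) γ a)

  fresh-ls : ∀ (ls : List Edge) {os rs} → Unique (ls ++ os ++ rs) → ∀ {e} → e ∈ ls → e ∉ os
  fresh-ls ls u e∈ e∈os = unique-disjoint ls u e∈ (∈.∈-++⁺ˡ e∈os)

  fresh-rs : ∀ (ls os : List Edge) {rs} → Unique (ls ++ os ++ rs) → ∀ {e} → e ∈ rs → e ∉ os
  fresh-rs ls os u e∈ e∈os = unique-disjoint os (unique-++ʳ ls u) e∈os e∈

  -- This and the next two lemmas update `At` across a vertex, for a path passing to the left of it,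
  -- to the right of it, or through it.
  carry-left : ∀ v ls x m {rs γ γ′ k} → Balanced v → Unique ((ls ++ x ∷ m) ++ outgoing v ++ rs) → Agree (outgoing v) γ γ′ →
    All (Off γ′) (outgoing v) → On γ x → All (Off γ) ls → All (Off γ) (m ++ incoming v ++ rs) → k ≡ total (m ++ incoming v ++ rs) →
    At γ′ ((ls ++ x ∷ m) ++ outgoing v ++ rs) k
  carry-left v ls x m {rs} {γ} {γ′} bal u agree off on off-ls off-rs right = at ls x (m ++ outgoing v ++ rs) (List.++-assoc ls (x ∷ m) _)
    (≡.trans right (total-swap m {v} bal))
    (≡.trans (agree x (fresh (∈.∈-++⁺ʳ ls (here ≡.refl)))) (proj₁ on) , proj₂ on)
    (off-agree {γ = γ} {γ′} agree (fresh ∘ ∈.∈-++⁺ˡ) off-ls)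
    (All.++⁺ (off-agree {γ = γ} {γ′} agree (fresh ∘ ∈.∈-++⁺ʳ ls ∘ there) (All.++⁻ˡ m off-rs))
      (All.++⁺ off (off-agree {γ = γ} {γ′} agree (fresh-rs (ls ++ x ∷ m) (outgoing v) u) (All.++⁻ʳ (incoming v) (All.++⁻ʳ m off-rs)))))
    where
    fresh : ∀ {e} → e ∈ ls ++ x ∷ m → e ∉ outgoing v
    fresh = fresh-ls (ls ++ x ∷ m) u

  carry-right : ∀ v ls m x rs {γ γ′} → Unique (ls ++ outgoing v ++ m ++ x ∷ rs) → Agree (outgoing v) γ γ′ →
    All (Off γ′) (outgoing v) → On γ x → All (Off γ) (ls ++ incoming v ++ m) → All (Off γ) rs →
    At γ′ (ls ++ outgoing v ++ m ++ x ∷ rs) (total rs)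
  carry-right v ls m x rs {γ} {γ′} u agree off on off-ls off-rs = at (ls ++ outgoing v ++ m) x rs
    (≡.sym (≡.trans (List.++-assoc ls (outgoing v ++ m) _) (≡.cong (ls ++_) (List.++-assoc (outgoing v) m _)))) ≡.refl
    (≡.trans (agree x (fresh (∈.∈-++⁺ʳ m (here ≡.refl)))) (proj₁ on) , proj₂ on)
    (All.++⁺ (off-agree {γ = γ} {γ′} agree (fresh-ls ls u) (All.++⁻ˡ ls off-ls))
      (All.++⁺ off (off-agree {γ = γ} {γ′} agree (fresh ∘ ∈.∈-++⁺ˡ) (All.++⁻ʳ (incoming v) (All.++⁻ʳ ls off-ls)))))
    (off-agree {γ = γ} {γ′} agree (fresh ∘ ∈.∈-++⁺ʳ m ∘ there) off-rs)
    where
    fresh : ∀ {e} → e ∈ m ++ x ∷ rs → e ∉ outgoing v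
    fresh = fresh-rs ls (outgoing v) u

  carry-in : ∀ v ls rs os₁ x os₂ {γ γ′} → outgoing v ≡ os₁ ++ x ∷ os₂ → Unique (ls ++ outgoing v ++ rs) → Agree (outgoing v) γ γ′ →
    All (Off γ′) os₁ → On γ′ x → All (Off γ′) os₂ → All (Off γ) ls → All (Off γ) rs → At γ′ (ls ++ outgoing v ++ rs) (total (os₂ ++ rs))
  carry-in v ls rs os₁ x os₂ {γ} {γ′} eq u agree off₁ on off₂ off-ls off-rs = at (ls ++ os₁) x (os₂ ++ rs)
    (≡.trans (≡.cong (λ os → ls ++ os ++ rs) eq) (≡.trans (≡.cong (ls ++_) (List.++-assoc os₁ (x ∷ os₂) rs)) (≡.sym (List.++-assoc ls os₁ _)))) ≡.refl on
    (All.++⁺ (off-agree {γ = γ} {γ′} agree (fresh-ls ls u) off-ls) off₁)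
    (All.++⁺ off₂ (off-agree {γ = γ} {γ′} agree (fresh-rs ls (outgoing v) u) off-rs))

  private
    thick-≢ : ∀ {a b} → a ≡ 1 × b ≡ 1 → ∀ {o} → a + b ≡ o → ¬ o ≤ 1
    thick-≢ (≡.refl , ≡.refl) ≡.refl (s≤s ())

    positive-zero : ∀ {a b o} → 1 ≤ a → b ≤ 1 → a + b ≡ o → o ≤ 2 → ¬ (a ≡ 1 × b ≡ 1) → b ≡ 0
    positive-zero {suc zero}       {zero}        _ _ _ _ _ = ≡.refl
    positive-zero {suc zero}       {suc zero}    _ _ _ _ ¬both = ⊥-elim (¬both (≡.refl , ≡.refl))
    positive-zero {suc zero}       {suc (suc b)} _ (s≤s ()) _ _ _
    positive-zero {suc (suc zero)} {zero}        _ _ _ _ _ = ≡.refl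
    positive-zero {suc (suc zero)} {suc b}       _ _ ≡.refl (s≤s (s≤s ())) _
    positive-zero {suc (suc (suc a))}            _ _ ≡.refl (s≤s (s≤s ())) _

  module _ (ls₀ rs₀ : List Edge) (cut≡ : cut ≡ ls₀ ++ p ∷ rs₀) (1≤Dp : 1 ≤ D p) (zero-rs₀ : All (λ e → D e ≡ 0) rs₀) where

    private
      total-rs₀ : total rs₀ ≡ 0
      total-rs₀ = go zero-rs₀
        where
        go : ∀ {es} → All (λ e → D e ≡ 0) es → total es ≡ 0
        go []       = ≡.refl
        go (d ∷ ds) = ≡.cong₂ _+_ d (go ds)

      -- Back at the cut, the path closes up exactly when it is at p. Right of p it cannot be, since
      -- D vanishes there; left of p it would have D p ≥ 1 to its right. So closing up amounts to k
      -- = 0.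
      final : ∀ {γ k} → At γ cut k → Z [] γ ≈ when (k ℕ.≟ 0) 1#
      final {γ} {k} (at ls x rs row right (on , 1≤Dx) off-ls off-rs) with split-++ ls ls₀ (≡.trans (≡.sym row) cut≡)
      ... | inj₁ (m , _ , ≡.refl) = ⊥-elim (ℕ.<-irrefl (≡.sym (All.lookup zero-rs₀ (∈.∈-++⁺ʳ m (here ≡.refl)))) 1≤Dx)
      ... | inj₂ ([] , _ , ≡.refl) = trans (reflexive (when-yes (loopAt? p γ) loop)) (sym (reflexive (when-yes (k ℕ.≟ 0) (≡.trans right total-rs₀))))
        where
        unique : Unique (ls ++ p ∷ rs)
        unique = ≡.subst Unique row (sweep-unique sweep)
        off-loop : ∀ {es} → (∀ {e} → e ∈ es → e ≢ p) → All (Off γ) es → All (λ e → lookup γ e ≡ does (p Fin.≟ e)) es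
        off-loop ≢p []               = []
        off-loop ≢p ((off , _) ∷ os) = ≡.trans off (≡.sym (dec-false (p Fin.≟ _) (≢p (here ≡.refl) ∘ ≡.sym))) ∷ off-loop (≢p ∘ there) os
        p∉rs : ∀ {e} → e ∈ rs → e ≢ p
        p∉rs e∈ ≡.refl with unique-++ʳ ls unique
        ... | p∉ ∷ _ = All.lookup p∉ e∈ ≡.refl
        loop : LoopAt p γ
        loop = ≡.subst (All _) (≡.sym row) (All.++⁺ (off-loop (λ { e∈ ≡.refl → unique-disjoint ls unique e∈ (here ≡.refl) }) off-ls)
          (≡.trans on (≡.sym (dec-true (p Fin.≟ p) ≡.refl)) ∷ off-loop p∉rs off-rs))
      ... | inj₂ (.x ∷ m , _ , ≡.refl) = trans (reflexive (when-no (loopAt? p γ) not-loop)) (sym (reflexive (when-no (k ℕ.≟ 0) k≢0)))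
        where
        not-loop : ¬ LoopAt p γ
        not-loop l = refute (p Fin.≟ x)
          where
          refute : ¬ Dec (p ≡ x)
          refute (no p≢x) with ≡.trans (≡.sym on) (≡.trans (All.lookup l (≡.subst (x ∈_) (≡.sym row) (∈.∈-++⁺ʳ ls (here ≡.refl)))) (dec-false (p Fin.≟ x) p≢x))
          ... | ()
          refute (yes ≡.refl) with unique-++ʳ ls (≡.subst Unique row (sweep-unique sweep))
          ... | p∉ ∷ _ = All.lookup p∉ (∈.∈-++⁺ʳ m (here ≡.refl)) ≡.refl
        k≢0 : k ≢ 0
        k≢0 k≡0 = ℕ.<-irrefl (≡.trans (≡.sym k≡0) right) (ℕ.≤-trans 1≤Dp (≡.subst (D p ≤_) (≡.sym (total-++ m (p ∷ rs₀)))
          (ℕ.≤-trans (ℕ.m≤m+n (D p) (total rs₀)) (ℕ.m≤n+m _ (total m)))))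

    -- Induction along the sweep: a vertex away from the path changes neither the position nor the
    -- weight, and a vertex on the path acts as in `paths`.
    Z≈paths : ∀ {r vs γ k} (sw : Sweep r vs cut) → All Balanced vs → At γ r k → Z vs γ ≈ paths s sw k
    Z≈paths (done _) _ st = final st
    Z≈paths {γ = γ} {k} (pass {v = v@(merge eL eR o)} {vs} lsᵥ rsᵥ _ ≡.refl sw) (bal ∷ bals) (at ls x rs row right on off-ls off-rs) =
      by-position (split-++ lsᵥ ls row)
      where
      balance = merge-balance {eL} {eR} {o} bal
      Goal : Set _
      Goal = Z (v ∷ vs) γ ≈ branch (both? eL eR) (enter s (total rsᵥ) (paths s sw (total rsᵥ)) k) (paths s sw k)

      -- The path avoids the merge. If both inputs are single, the output is an uncovered double
      -- edge, so `Fits` kills the left side and the position is missed by `enter` on the right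
      -- side.
      idle : Off γ eL → Off γ eR → ((D eL ≡ 1 × D eR ≡ 1) → k ≢ total rsᵥ × k ≢ suc (total rsᵥ)) →
        (D o ≤ 1 → At (γ [ o ]≔ false) (lsᵥ ++ o ∷ rsᵥ) k) → Goal
      idle offL offR far next = trans (merge-idle eL eR o {vs} {γ} (proj₁ offL) (proj₁ offR)) (go (both? eL eR))
        where
        go : Dec (D eL ≡ 1 × D eR ≡ 1) → when (D o ℕ.≤? 1) (Z vs (γ [ o ]≔ false)) ≈ branch (both? eL eR) (enter s (total rsᵥ) (paths s sw (total rsᵥ)) k) (paths s sw k)
        go (yes both) = trans (reflexive (when-no (D o ℕ.≤? 1) (thick-≢ both balance)))
          (sym (trans (reflexive (branch-yes (both? eL eR) both)) (enter-miss s (proj₁ (far both)) (proj₂ (far both)))))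
        go (no ¬both) = trans (reflexive (when-yes (D o ℕ.≤? 1) o≤1)) (trans (Z≈paths sw bals (next o≤1)) (reflexive (≡.sym (branch-no (both? eL eR) ¬both))))
          where o≤1 = merge-thin {eL} {eR} {o} bal (proj₂ offL) (proj₂ offR) ¬both

      moved : 1 ≤ D o → All (Off γ) lsᵥ → All (Off γ) rsᵥ → At (γ [ o ]≔ true) (lsᵥ ++ o ∷ rsᵥ) (total rsᵥ)
      moved 1≤o offl offr = carry-in v lsᵥ rsᵥ [] o [] {γ = γ} ≡.refl (sweep-unique sw) (agree₁ γ o true) [] (Vec.lookup∘update o γ true , 1≤o) [] offl offr

      -- If the right input is single, this is the left entry of `enter`. Otherwise the right input
      -- is empty, so neither weight nor position changes.
      from-left : On γ eL → Off γ eR → k ≡ total (eR ∷ rsᵥ) → All (Off γ) lsᵥ → All (Off γ) rsᵥ → Goal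
      from-left onL offR k≡ offl offr = trans (merge-left eL eR o {vs} {γ} (proj₁ onL) (proj₁ offR))
        (trans (reflexive (when-yes (1 ℕ.≤? D o) 1≤o)) (trans (*-congˡ (Z≈paths sw bals (moved 1≤o offl offr))) (go (both? eL eR))))
        where
        1≤o = ℕ.≤-trans (proj₂ onL) (≡.subst (D eL ≤_) balance (ℕ.m≤m+n (D eL) (D eR)))
        go : Dec (D eL ≡ 1 × D eR ≡ 1) → E (s ℤ.* (ℤ.- + D eR)) * paths s sw (total rsᵥ) ≈ branch (both? eL eR) (enter s (total rsᵥ) (paths s sw (total rsᵥ)) k) (paths s sw k)
        go (yes both) = sym (trans (reflexive (≡.trans (branch-yes (both? eL eR) both) (≡.cong (enter s (total rsᵥ) _) (≡.trans k≡ (≡.cong (_+ total rsᵥ) (proj₂ both))))))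
          (trans (enter-left s (total rsᵥ) _) (*-congʳ (reflexive (≡.cong E (≡.trans (lemma s) (≡.cong (λ d → s ℤ.* (ℤ.- + d)) (≡.sym (proj₂ both)))))))))
          where
          lemma : ∀ s → ℤ.- s ≡ s ℤ.* -1ℤ
          lemma = solve-∀
        go (no ¬both) = trans (*-congʳ (E-zero (≡.trans (≡.cong (λ d → s ℤ.* (ℤ.- + d)) eR≡0) (ℤ.*-zeroʳ s)))) (trans (*-identityˡ _)
          (trans (reflexive (≡.cong (paths s sw) (≡.sym (≡.trans k≡ (≡.cong (_+ total rsᵥ) eR≡0))))) (reflexive (≡.sym (branch-no (both? eL eR) ¬both)))))
          where eR≡0 = positive-zero (proj₂ onL) (proj₂ offR) balance (D≤2 o) ¬both

      from-right : Off γ eL → On γ eR → k ≡ total rsᵥ → All (Off γ) lsᵥ → All (Off γ) rsᵥ → Goal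
      from-right offL onR k≡ offl offr = trans (merge-right eL eR o {vs} {γ} (proj₁ offL) (proj₁ onR))
        (trans (reflexive (when-yes (1 ℕ.≤? D o) 1≤o)) (trans (*-congˡ (Z≈paths sw bals (moved 1≤o offl offr))) (go (both? eL eR))))
        where
        1≤o = ℕ.≤-trans (proj₂ onR) (≡.subst (D eR ≤_) balance (ℕ.m≤n+m (D eR) (D eL)))
        go : Dec (D eL ≡ 1 × D eR ≡ 1) → E (s ℤ.* + D eL) * paths s sw (total rsᵥ) ≈ branch (both? eL eR) (enter s (total rsᵥ) (paths s sw (total rsᵥ)) k) (paths s sw k)
        go (yes both) = sym (trans (reflexive (≡.trans (branch-yes (both? eL eR) both) (≡.cong (enter s (total rsᵥ) _) k≡)))
          (trans (enter-right s (total rsᵥ) _) (*-congʳ (reflexive (≡.cong E (≡.trans (≡.sym (ℤ.*-identityʳ s)) (≡.cong (λ d → s ℤ.* + d) (≡.sym (proj₁ both)))))))))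
        go (no ¬both) = trans (*-congʳ (E-zero (≡.trans (≡.cong (λ d → s ℤ.* + d) eL≡0) (ℤ.*-zeroʳ s)))) (trans (*-identityˡ _)
          (trans (reflexive (≡.cong (paths s sw) (≡.sym k≡))) (reflexive (≡.sym (branch-no (both? eL eR) ¬both)))))
          where eL≡0 = positive-zero (proj₂ onR) (proj₂ offL) (≡.trans (ℕ.+-comm (D eR) (D eL)) balance) (D≤2 o) (λ (p , r) → ¬both (r , p))

      by-position : (∃ λ m → lsᵥ ≡ ls ++ x ∷ m × rs ≡ m ++ incoming v ++ rsᵥ) ⊎ (∃ λ m → ls ≡ lsᵥ ++ m × incoming v ++ rsᵥ ≡ m ++ x ∷ rs) → Goal
      by-position (inj₁ (m , ≡.refl , ≡.refl)) = idle (All.head (All.++⁻ʳ m off-rs)) (All.head (All.tail (All.++⁻ʳ m off-rs))) far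
        (λ o≤1 → carry-left v ls x m {γ = γ} bal (sweep-unique sw) (agree₁ γ o false) ((Vec.lookup∘update o γ false , o≤1) ∷ []) on off-ls off-rs right)
        where
        far : D eL ≡ 1 × D eR ≡ 1 → k ≢ total rsᵥ × k ≢ suc (total rsᵥ)
        far (eL≡1 , eR≡1) = (λ p → ℕ.<⇒≢ (ℕ.<-≤-trans (ℕ.m<n⇒m<1+n (ℕ.n<1+n _)) (ℕ.m≤n+m _ (total m))) (≡.sym (≡.trans (≡.sym big) p)))
                          , (λ p → ℕ.<⇒≢ (ℕ.<-≤-trans (ℕ.n<1+n _) (ℕ.m≤n+m _ (total m))) (≡.sym (≡.trans (≡.sym big) p)))
          where
          big : k ≡ total m + suc (suc (total rsᵥ))
          big = ≡.trans right (≡.trans (total-++ m (eL ∷ eR ∷ rsᵥ)) (≡.cong (λ k → total m + k) (≡.cong₂ (λ a b → a + (b + total rsᵥ)) eL≡1 eR≡1)))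
      by-position (inj₂ ([] , ≡.refl , ≡.refl)) = from-left on (All.head off-rs) right (≡.subst (All _) (List.++-identityʳ lsᵥ) off-ls) (All.tail off-rs)
      by-position (inj₂ (_ ∷ [] , ≡.refl , ≡.refl)) = from-right (All.head (All.++⁻ʳ lsᵥ off-ls)) on right (All.++⁻ˡ lsᵥ off-ls) off-rs
      by-position (inj₂ (_ ∷ _ ∷ m , ≡.refl , ≡.refl)) = idle (All.head (All.++⁻ʳ lsᵥ off-ls)) (All.head (All.tail (All.++⁻ʳ lsᵥ off-ls))) near
        (λ o≤1 → ≡.subst (At _ _) (≡.sym right) (carry-right v lsᵥ m x rs {γ = γ} (sweep-unique sw) (agree₁ γ o false) ((Vec.lookup∘update o γ false , o≤1) ∷ []) on off-ls off-rs))
        where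
        near : D eL ≡ 1 × D eR ≡ 1 → k ≢ total (m ++ x ∷ rs) × k ≢ suc (total (m ++ x ∷ rs))
        near _ = ℕ.<⇒≢ k< , ℕ.<⇒≢ (ℕ.m<n⇒m<1+n k<)
          where
          k< : k < total (m ++ x ∷ rs)
          k< = ≡.subst₂ _<_ (≡.sym right) (≡.sym (total-++ m (x ∷ rs))) (ℕ.<-≤-trans (ℕ.+-monoˡ-≤ (total rs) (proj₂ on)) (ℕ.m≤n+m _ (total m)))
    Z≈paths {γ = γ} {k} (pass {v = v@(split i oL oR)} {vs} lsᵥ rsᵥ _ ≡.refl sw) (bal ∷ bals) (at ls x rs row right on off-ls off-rs) =
      by-position (split-++ lsᵥ ls row)
      where
      balance = split-balance {i} {oL} {oR} bal
      Goal : Set _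
      Goal = Z (v ∷ vs) γ ≈ branch (both? oL oR) (paths s sw (total rsᵥ) ⊞ paths s sw (suc (total rsᵥ))) (paths s sw k)

      oL≢oR : oL ≢ oR
      oL≢oR with unique-++ʳ lsᵥ (sweep-unique sw)
      ... | (oL≢ ∷ _) ∷ _ = oL≢

      set-on-left : lookup (set₂ γ oL true oR false) oL ≡ true
      set-on-left = set₂-left γ true false oL≢oR

      idle : Off γ i → (D oL ≤ 1 → D oR ≤ 1 → At (set₂ γ oL false oR false) (lsᵥ ++ oL ∷ oR ∷ rsᵥ) k) → Goal
      idle off next with split-thin {i} {oL} {oR} bal (proj₂ off)
      ... | oL≤1 , oR≤1 , ¬both = trans (split-idle i oL oR {vs} {γ} oL≢oR (proj₁ off))
        (trans (reflexive (when-yes (D oL ℕ.≤? 1 ×-dec D oR ℕ.≤? 1) (oL≤1 , oR≤1)))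
          (trans (Z≈paths sw bals (next oL≤1 oR≤1)) (reflexive (≡.sym (branch-no (both? oL oR) ¬both)))))

      offs : ∀ {a b} → D oL ≤ 1 → D oR ≤ 1 → a ≡ false → b ≡ false → All (Off (set₂ γ oL a oR b)) (oL ∷ oR ∷ [])
      offs oL≤1 oR≤1 ≡.refl ≡.refl = (set₂-left γ false false oL≢oR , oL≤1) ∷ (set₂-right γ {oL} false false , oR≤1) ∷ []

      -- Two single outputs leave both continuations open. Otherwise one output is empty and the
      -- other carries all of D, so exactly one continuation fits.
      active : On γ i → k ≡ total rsᵥ → All (Off γ) lsᵥ → All (Off γ) rsᵥ → Goal
      active onI k≡ offl offr = trans (split-active i oL oR {vs} {γ} oL≢oR (proj₁ onI)) (go (both? oL oR))
        where
        u = sweep-unique sw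
        go-left : 1 ≤ D oL → D oR ≤ 1 → Z vs (set₂ γ oL true oR false) ≈ paths s sw (D oR + total rsᵥ)
        go-left 1≤oL oR≤1 = Z≈paths sw bals (carry-in v lsᵥ rsᵥ [] oL (oR ∷ []) {γ = γ} ≡.refl u (agree₂ γ oL oR true false) [] (set-on-left , 1≤oL)
          ((set₂-right γ {oL} true false , oR≤1) ∷ []) offl offr)
        go-right : D oL ≤ 1 → 1 ≤ D oR → Z vs (set₂ γ oL false oR true) ≈ paths s sw (total rsᵥ)
        go-right oL≤1 1≤oR = Z≈paths sw bals (carry-in v lsᵥ rsᵥ (oL ∷ []) oR [] {γ = γ} ≡.refl u (agree₂ γ oL oR false true)
          ((set₂-left γ false true oL≢oR , oL≤1) ∷ []) (set₂-right γ {oL} false true , 1≤oR) [] offl offr)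
        left? = 1 ℕ.≤? D oL ×-dec D oR ℕ.≤? 1
        right? = D oL ℕ.≤? 1 ×-dec 1 ℕ.≤? D oR

        go : Dec (D oL ≡ 1 × D oR ≡ 1) → when left? (Z vs (set₂ γ oL true oR false)) ⊞ when right? (Z vs (set₂ γ oL false oR true)) ≈
          branch (both? oL oR) (paths s sw (total rsᵥ) ⊞ paths s sw (suc (total rsᵥ))) (paths s sw k)
        go (yes both@(oL≡1 , oR≡1)) = trans (+-cong
            (trans (reflexive (when-yes left? (1≤oL , oR≤1))) (trans (go-left 1≤oL oR≤1) (reflexive (≡.cong (λ d → paths s sw (d + total rsᵥ)) oR≡1))))
            (trans (reflexive (when-yes right? (oL≤1 , 1≤oR))) (go-right oL≤1 1≤oR)))
          (trans (+-comm _ _) (reflexive (≡.sym (branch-yes (both? oL oR) both))))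
          where
          oL≤1 = ℕ.≤-reflexive oL≡1
          oR≤1 = ℕ.≤-reflexive oR≡1
          1≤oL = ℕ.≤-reflexive (≡.sym oL≡1)
          1≤oR = ℕ.≤-reflexive (≡.sym oR≡1)
        go (no ¬both) with ℕ.m≤n⇒m<n∨m≡n (z≤n {D oL})
        ... | inj₁ 1≤oL = trans (cancelʳ (reflexive (when-no right? λ (oL≤1 , 1≤oR) → ¬both (ℕ.≤-antisym oL≤1 1≤oL , one-of 1≤oR))))
          (trans (trans (reflexive (when-yes left? (1≤oL , ℕ.≤-trans (ℕ.≤-reflexive oR≡0) z≤n))) (go-left 1≤oL (ℕ.≤-trans (ℕ.≤-reflexive oR≡0) z≤n)))
            (trans (reflexive (≡.cong (paths s sw) (≡.trans (≡.cong (_+ total rsᵥ) oR≡0) (≡.sym k≡)))) (reflexive (≡.sym (branch-no (both? oL oR) ¬both)))))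
          where
          oR≡0 : D oR ≡ 0
          oR≡0 = half 1≤oL (≡.subst (_≤ 2) (≡.sym balance) (D≤2 i)) ¬both
            where
            half : ∀ {a b} → 1 ≤ a → a + b ≤ 2 → ¬ (a ≡ 1 × b ≡ 1) → b ≡ 0
            half {_} {zero} _ _ _ = ≡.refl
            half {suc zero} {suc zero} _ _ ¬both = ⊥-elim (¬both (≡.refl , ≡.refl))
            half {suc zero} {suc (suc b)} _ (s≤s (s≤s ())) _
            half {suc (suc a)} {suc b} _ (s≤s (s≤s a+b≤0)) _ with ≡.trans (≡.sym (ℕ.+-suc a b)) (ℕ.n≤0⇒n≡0 a+b≤0)
            ... | ()
          one-of : 1 ≤ D oR → D oR ≡ 1
          one-of 1≤oR = ⊥-elim (ℕ.<-irrefl (≡.sym oR≡0) 1≤oR)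
        ... | inj₂ 0≡oL = trans (cancelˡ (reflexive (when-no left? λ (1≤oL , _) → ℕ.<-irrefl 0≡oL 1≤oL)))
          (trans (trans (reflexive (when-yes right? (oL≤1 , 1≤oR))) (go-right oL≤1 1≤oR))
            (trans (reflexive (≡.cong (paths s sw) (≡.sym k≡))) (reflexive (≡.sym (branch-no (both? oL oR) ¬both)))))
          where
          oL≤1 : D oL ≤ 1
          oL≤1 = ≡.subst (_≤ 1) 0≡oL z≤n
          1≤oR : 1 ≤ D oR
          1≤oR = ≡.subst (1 ≤_) (≡.trans (≡.sym balance) (≡.cong (_+ D oR) (≡.sym 0≡oL))) (proj₂ onI)

      by-position : (∃ λ m → lsᵥ ≡ ls ++ x ∷ m × rs ≡ m ++ incoming v ++ rsᵥ) ⊎ (∃ λ m → ls ≡ lsᵥ ++ m × incoming v ++ rsᵥ ≡ m ++ x ∷ rs) → Goal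
      by-position (inj₁ (m , ≡.refl , ≡.refl)) = idle (All.head (All.++⁻ʳ m off-rs))
        (λ oL≤1 oR≤1 → carry-left v ls x m {γ = γ} bal (sweep-unique sw) (agree₂ γ oL oR false false) (offs oL≤1 oR≤1 ≡.refl ≡.refl) on off-ls off-rs right)
      by-position (inj₂ ([] , ≡.refl , ≡.refl)) = active on right (≡.subst (All _) (List.++-identityʳ lsᵥ) off-ls) off-rs
      by-position (inj₂ (_ ∷ m , ≡.refl , ≡.refl)) = idle (All.head (All.++⁻ʳ lsᵥ off-ls))
        (λ oL≤1 oR≤1 → ≡.subst (At _ _) (≡.sym right) (carry-right v lsᵥ m x rs {γ = γ} (sweep-unique sw) (agree₂ γ oL oR false false) (offs oL≤1 oR≤1 ≡.refl ≡.refl) on off-ls off-rs))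

open import Algebra.Properties.Group (CommutativeRing.+-group ℤ.+-*-commutativeRing) using () renaming (∙-cancelˡ to +-cancelˡᶻ)

-- The one-colour identity and the regrouping of superpositions

module Superposition {c ℓ} {R : CommutativeRing c ℓ} (exp : Exponential R) {w : Web} (I : RadialCut w)
  (p : Fin (Web.edges w)) (ls₀ rs₀ : List (Fin (Web.edges w))) (cut≡ : RadialCut.cut I ≡ ls₀ ++ p ∷ rs₀) where
  open import Data.Nat.Base using (_+_)
  open CommutativeRing R hiding (zero) renaming (_+_ to _⊞_)
  open Exponential exp
  open Sums R
  open Updates R
  open Flows I
  open Relation.Binary.Reasoning.Setoid setoid
  open IntegerCoefficients R using (solve; _:=_; _:+_; _:*_; _:-_; :-_; con)

  _⊕ᵛ_ : Vec Bool edges → Vec Bool edges → Vec ℕ edges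
  γ ⊕ᵛ Γ = Vec.zipWith (λ a b → bit a + bit b) γ Γ

  ∅ : Vec Bool edges
  ∅ = Vec.replicate edges false

  _≟ᵛ_ : (u v : Vec ℕ edges) → Dec (u ≡ v)
  _≟ᵛ_ = Vec.≡-dec ℕ._≟_

  ⟦_⟧ᵛ : Vec ℕ edges → Weight
  ⟦ D ⟧ᵛ e = + lookup D e

  bit-𝟚 : ∀ b → + bit b ≡ 𝟚 b
  bit-𝟚 true  = ≡.refl
  bit-𝟚 false = ≡.refl

  ⊕ᵛ-⊕ : ∀ γ Γ → ⟦ γ ⊕ᵛ Γ ⟧ᵛ ≗ ⟦ γ ⟧ˢ ⊕ ⟦ Γ ⟧ˢ
  ⊕ᵛ-⊕ γ Γ e = ≡.trans (≡.cong +_ (Vec.lookup-zipWith _ e γ Γ)) (≡.cong₂ ℤ._+_ (bit-𝟚 (lookup γ e)) (bit-𝟚 (lookup Γ e)))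

  ∅-lookup : ∀ e → lookup ∅ e ≡ false
  ∅-lookup e = Vec.lookup-replicate e false

  -- This is the coefficient q^(m-N) - q^(N-m) of the peeling recursion, for m = 1 colour and
  -- thickness D; M is the number N.
  ψ : Weight → Vec Bool edges → Carrier
  ψ D γ = let M = J D ⟦ γ ⟧ˢ ℤ.+ D p ℤ.- 1ℤ in E (1ℤ ℤ.- M) - E (M ℤ.- 1ℤ)

  ψ-cong : ∀ {D D′} γ → D ≗ D′ → ψ D γ ≈ ψ D′ γ
  ψ-cong {D} {D′} γ eq = reflexive (≡.cong (λ N → let M = N ℤ.- 1ℤ in E (1ℤ ℤ.- M) - E (M ℤ.- 1ℤ)) (≡.cong₂ ℤ._+_ (J-cong {g = ⟦ γ ⟧ˢ} eq (λ _ → ≡.refl)) (eq p)))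

  p∈cut : p ∈ cut
  p∈cut = ≡.subst (p ∈_) (≡.sym cut≡) (∈.∈-++⁺ʳ ls₀ (here ≡.refl))

  open import Data.List.Membership.DecPropositional (Fin._≟_ {edges}) using (_∈?_)

  -- Edges leaving no vertex. By `covered` they lie in the cut, so `LoopAt` fixes their values.
  others : List Edge
  others = filter (λ e → ¬? (e ∈? outs)) (allFin edges)

  allFin-↭ : allFin edges ↭ others ++ outs
  allFin-↭ = unique-↭ (Unique.allFin⁺ edges)
    (Unique.++⁺ (Unique.filter⁺ (λ e → ¬? (e ∈? outs)) (Unique.allFin⁺ edges)) outs-unique
      (λ (e∈ , e∈outs) → proj₂ (∈.∈-filter⁻ (λ e → ¬? (e ∈? outs)) {xs = allFin edges} e∈) e∈outs))
    (λ {e} _ → place e (e ∈? outs)) (λ {e} _ → ∈.∈-allFin e)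
    where
    place : ∀ e → Dec (e ∈ outs) → e ∈ others ++ outs
    place e (yes e∈) = ∈.∈-++⁺ʳ others e∈
    place e (no e∉)  = ∈.∈-++⁺ˡ (∈.∈-filter⁺ (λ e → ¬? (e ∈? outs)) (∈.∈-allFin e) e∉)

  module _ (Dᵛ : Vec ℕ edges) (D≤2 : ∀ e → lookup Dᵛ e ≤ 2) (zero-rs₀ : All (λ e → lookup Dᵛ e ≡ 0) rs₀) where
    D : Edge → ℕ
    D = lookup Dᵛ

    open LatticePaths exp {Edge} D D≤2
    private module T = Transfer exp I p D D≤2
    open T 0ℤ using (Off)

    FitsAll : Vec Bool edges → Set
    FitsAll γ = ∀ e → Fits (D e) (lookup γ e)

    abstract
      fitsAll? : ∀ γ → Dec (FitsAll γ)
      fitsAll? γ = Fin.all? (λ e → fits? (D e) (lookup γ e))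

    CutFits : Set
    CutFits = All (λ e → Fits (D e) (does (p Fin.≟ e))) cut

    Good : Vec Bool edges → Vertex Edge → Set
    Good γ (merge eL eR o) = bit (lookup γ eL) + bit (lookup γ eR) ≡ bit (lookup γ o) × Fits (D o) (lookup γ o)
    Good γ (split i oL oR) = bit (lookup γ i) ≡ bit (lookup γ oL) + bit (lookup γ oR) × Fits (D oL) (lookup γ oL) × Fits (D oR) (lookup γ oR)

    good? : ∀ γ v → Dec (Good γ v)
    good? γ (merge eL eR o) = bit (lookup γ eL) + bit (lookup γ eR) ℕ.≟ bit (lookup γ o) ×-dec fits? (D o) (lookup γ o)
    good? γ (split i oL oR) = bit (lookup γ i) ℕ.≟ bit (lookup γ oL) + bit (lookup γ oR) ×-dec (fits? (D oL) (lookup γ oL) ×-dec fits? (D oR) (lookup γ oR))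

    private
      F-product : ∀ s vs γ → T.F s vs γ ≈ when (All.all? (good? γ) vs) (when (loopAt? p γ) (E (s ℤ.* ∑ᶻ vs (J-at ⟦ Dᵛ ⟧ᵛ ⟦ γ ⟧ˢ))))
      F-product s []       γ = when-cong (loopAt? p γ) (loopAt? p γ) (λ z → z) (λ z → z) (λ _ → trans (sym E-0) (reflexive (≡.cong E (≡.sym (ℤ.*-zeroʳ s)))))
      F-product s (v ∷ vs) γ = begin
        T.φ s v γ γ * T.F s vs γ
          ≈⟨ *-cong (φ-good v) (F-product s vs γ) ⟩
        when (good? γ v) (E (s ℤ.* j)) * when (All.all? (good? γ) vs) (when (loopAt? p γ) (E (s ℤ.* js)))
          ≈⟨ go (good? γ v) (All.all? (good? γ) vs) (loopAt? p γ) ⟩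
        when (good? γ v ×-dec All.all? (good? γ) vs) (when (loopAt? p γ) (E (s ℤ.* (j ℤ.+ js))))
          ≈⟨ when-cong (good? γ v ×-dec All.all? (good? γ) vs) (All.all? (good? γ) (v ∷ vs)) (λ (a , b) → a ∷ b) (λ { (a ∷ b) → a , b }) (λ _ → refl) ⟩
        when (All.all? (good? γ) (v ∷ vs)) (when (loopAt? p γ) (E (s ℤ.* (j ℤ.+ js)))) ∎
        where
        j = J-at ⟦ Dᵛ ⟧ᵛ ⟦ γ ⟧ˢ v
        js = ∑ᶻ vs (J-at ⟦ Dᵛ ⟧ᵛ ⟦ γ ⟧ˢ)
        φ-good : ∀ v → T.φ s v γ γ ≈ when (good? γ v) (E (s ℤ.* J-at ⟦ Dᵛ ⟧ᵛ ⟦ γ ⟧ˢ v))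
        φ-good (merge eL eR o)   = refl
        φ-good v@(split i oL oR) = when-cong (good? γ v) (good? γ v) (λ z → z) (λ z → z) (λ _ → trans (sym E-0) (reflexive (≡.cong E (≡.sym (ℤ.*-zeroʳ s)))))
        go : {A B C : Set} (A? : Dec A) (B? : Dec B) (C? : Dec C) →
          when A? (E (s ℤ.* j)) * when B? (when C? (E (s ℤ.* js))) ≈ when (A? ×-dec B?) (when C? (E (s ℤ.* (j ℤ.+ js))))
        go (no _)  _       _       = zeroˡ _
        go (yes _) (no _)  _       = zeroʳ _
        go (yes _) (yes _) (no _)  = zeroʳ _
        go (yes _) (yes _) (yes _) = trans (sym (E-+ _ _)) (reflexive (≡.cong E (≡.sym (ℤ.*-distribˡ-+ s j js))))

      good⇒conserved : ∀ γ v → Good γ v → Conserved ⟦ γ ⟧ˢ v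
      good⇒conserved γ (merge eL eR o) (eq , _) = lemma (lookup γ eL) (lookup γ eR) (lookup γ o) eq
        where
        lemma : ∀ a b c → bit a + bit b ≡ bit c → 𝟚 a ℤ.+ (𝟚 b ℤ.+ 0ℤ) ≡ 𝟚 c ℤ.+ 0ℤ
        lemma true  true  true  ()
        lemma true  true  false ()
        lemma true  false true  _ = ≡.refl
        lemma true  false false ()
        lemma false true  true  _ = ≡.refl
        lemma false true  false ()
        lemma false false true  ()
        lemma false false false _ = ≡.refl
      good⇒conserved γ (split i oL oR) (eq , _) = lemma (lookup γ i) (lookup γ oL) (lookup γ oR) eq
        where
        lemma : ∀ c a b → bit c ≡ bit a + bit b → 𝟚 c ℤ.+ 0ℤ ≡ 𝟚 a ℤ.+ (𝟚 b ℤ.+ 0ℤ)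
        lemma true  true  true  ()
        lemma false true  true  ()
        lemma true  true  false _ = ≡.refl
        lemma false true  false ()
        lemma true  false true  _ = ≡.refl
        lemma false false true  ()
        lemma true  false false ()
        lemma false false false _ = ≡.refl

      conserved⇒good : ∀ γ → FitsAll γ → ∀ v → Conserved ⟦ γ ⟧ˢ v → Good γ v
      conserved⇒good γ fits (merge eL eR o) eq = lemma (lookup γ eL) (lookup γ eR) (lookup γ o) eq , fits o
        where
        lemma : ∀ a b c → 𝟚 a ℤ.+ (𝟚 b ℤ.+ 0ℤ) ≡ 𝟚 c ℤ.+ 0ℤ → bit a + bit b ≡ bit c
        lemma true  true  true  ()
        lemma true  true  false ()
        lemma true  false true  _ = ≡.refl
        lemma true  false false ()
        lemma false true  true  _ = ≡.refl
        lemma false true  false ()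
        lemma false false true  ()
        lemma false false false _ = ≡.refl
      conserved⇒good γ fits (split i oL oR) eq = lemma (lookup γ i) (lookup γ oL) (lookup γ oR) eq , fits oL , fits oR
        where
        lemma : ∀ c a b → 𝟚 c ℤ.+ 0ℤ ≡ 𝟚 a ℤ.+ (𝟚 b ℤ.+ 0ℤ) → bit c ≡ bit a + bit b
        lemma true  true  true  ()
        lemma false true  true  ()
        lemma true  true  false _ = ≡.refl
        lemma false true  false ()
        lemma true  false true  _ = ≡.refl
        lemma false false true  ()
        lemma true  false false ()
        lemma false false false _ = ≡.refl

      good⇒fits : ∀ {γ vs e} → All (Good γ) vs → e ∈ concatMap outgoing vs → Fits (D e) (lookup γ e)
      good⇒fits {vs = merge _ _ _ ∷ vs} ((_ , f) ∷ gs)     (here ≡.refl)         = f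
      good⇒fits {vs = merge _ _ _ ∷ vs} (_ ∷ gs)           (there e∈)            = good⇒fits gs e∈
      good⇒fits {vs = split _ _ _ ∷ vs} ((_ , f , _) ∷ gs) (here ≡.refl)         = f
      good⇒fits {vs = split _ _ _ ∷ vs} ((_ , _ , f) ∷ gs) (there (here ≡.refl)) = f
      good⇒fits {vs = split _ _ _ ∷ vs} (_ ∷ gs)           (there (there e∈))    = good⇒fits gs e∈

    ∑-loops : (f : Vec Bool edges → Carrier) → ∑ (loops p) f ≈ ∑ (subsets edges) (λ γ → when (flow? γ) (when (loopAt? p γ) (f γ)))
    ∑-loops f = trans (∑-filter (loopAt? p) flows) (∑-filter flow? (subsets edges))

    module _ (bal : All Balanced order) (cutFits : CutFits) where
      private
        γ₀ : Vec Bool edges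
        γ₀ = Vec.tabulate (λ e → does (p Fin.≟ e))

        γ₀-lookup : ∀ e → lookup γ₀ e ≡ does (p Fin.≟ e)
        γ₀-lookup e = Vec.lookup∘tabulate _ e

        1≤Dp : 1 ≤ D p
        1≤Dp = ≡.subst (Fits (D p)) (dec-true (p Fin.≟ p) ≡.refl) (All.lookup cutFits p∈cut)

        off₀ : ∀ {e} → e ∈ cut → p ≢ e → Off γ₀ e
        off₀ {e} e∈ p≢e = ≡.trans (γ₀-lookup e) (dec-false (p Fin.≟ e) p≢e) , ≡.subst (Fits (D e)) (dec-false (p Fin.≟ e) p≢e) (All.lookup cutFits e∈)

        cut-unique : Unique (ls₀ ++ p ∷ rs₀)
        cut-unique = ≡.subst Unique cut≡ (sweep-unique sweep)

        p∉ls₀ : ∀ {e} → e ∈ ls₀ → p ≢ e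
        p∉ls₀ e∈ ≡.refl = unique-disjoint ls₀ cut-unique e∈ (here ≡.refl)

        p∉rs₀ : ∀ {e} → e ∈ rs₀ → p ≢ e
        p∉rs₀ e∈ with unique-++ʳ ls₀ cut-unique
        ... | p∉ ∷ _ = All.lookup p∉ e∈

        in-cut : ∀ {e} → e ∈ ls₀ ++ p ∷ rs₀ → e ∈ cut
        in-cut = ≡.subst (_ ∈_) (≡.sym cut≡)

      total-rs₀ : total rs₀ ≡ 0
      total-rs₀ = go zero-rs₀
        where
        go : ∀ {es} → All (λ e → D e ≡ 0) es → total es ≡ 0
        go []       = ≡.refl
        go (d ∷ ds) = ≡.cong₂ _+_ d (go ds)

      thin-ls₀ : Thin ls₀
      thin-ls₀ = All.tabulate λ e∈ → proj₂ (off₀ (in-cut (∈.∈-++⁺ˡ e∈)) (p∉ls₀ e∈))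

      thin-rs₀ : Thin rs₀
      thin-rs₀ = All.tabulate λ e∈ → proj₂ (off₀ (in-cut (∈.∈-++⁺ʳ ls₀ (there e∈))) (p∉rs₀ e∈))

      -- q^(s J) is a product over the vertices, and so are conservation and fitting away from the
      -- cut. The sum over all sets of edges therefore becomes the transfer sum, once the edges in
      -- `others` have been given their forced values.
      loops-paths : ∀ s → ∑ (loops p) (λ γ → when (fitsAll? γ) (E (s ℤ.* J ⟦ Dᵛ ⟧ᵛ ⟦ γ ⟧ˢ))) ≈ paths s sweep 0
      loops-paths s = begin
        ∑ (loops p) (λ γ → when (fitsAll? γ) (E (s ℤ.* J ⟦ Dᵛ ⟧ᵛ ⟦ γ ⟧ˢ)))
          ≈⟨ ∑-loops _ ⟩
        ∑ (subsets edges) (λ γ → when (flow? γ) (when (loopAt? p γ) (when (fitsAll? γ) (E (s ℤ.* J ⟦ Dᵛ ⟧ᵛ ⟦ γ ⟧ˢ)))))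
          ≈⟨ ∑-cong (subsets edges) same ⟨
        ∑ (subsets edges) (T.F s order)
          ≈⟨ ∑-subsets γ₀ ⟩
        ∑≔ (allFin edges) γ₀ (T.F s order)
          ≈⟨ ∑≔-↭ γ₀ allFin-↭ ⟩
        ∑≔ (others ++ outs) γ₀ (T.F s order)
          ≡⟨ ∑≔-++ others γ₀ ⟩
        ∑≔ others γ₀ (λ γ → ∑≔ outs γ (T.F s order))
          ≈⟨ ∑≔-forced γ₀ (Unique.filter⁺ (λ e → ¬? (e ∈? outs)) (Unique.allFin⁺ edges)) forced ⟩
        ∑≔ outs γ₀ (T.F s order)
          ≈⟨ T.∑≔-F≈Z s sweep outs-unique γ₀ (λ {e} e∈ → inj₂ (e∈ , γ₀-lookup e)) ⟩
        T.Z s order γ₀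
          ≈⟨ T.Z≈paths s ls₀ rs₀ cut≡ 1≤Dp zero-rs₀ sweep bal
               (T.at ls₀ p rs₀ cut≡ (≡.sym total-rs₀) (≡.trans (γ₀-lookup p) (dec-true (p Fin.≟ p) ≡.refl) , 1≤Dp)
                 (All.tabulate λ e∈ → off₀ (in-cut (∈.∈-++⁺ˡ e∈)) (p∉ls₀ e∈))
                 (All.tabulate λ e∈ → off₀ (in-cut (∈.∈-++⁺ʳ ls₀ (there e∈))) (p∉rs₀ e∈))) ⟩
        paths s sweep 0 ∎
        where
        forced : ∀ γ′ e → e ∈ others → lookup γ′ e ≢ lookup γ₀ e → ∑≔ outs γ′ (T.F s order) ≈ 0#
        forced γ′ e e∈ ≢γ₀ = ∑≔-zero outs γ′ λ γ″ agree → T.F-zero s order λ l →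
          ≢γ₀ (≡.trans (≡.sym (agree e e∉)) (≡.trans (All.lookup l e∈cut) (≡.sym (γ₀-lookup e))))
          where
          e∉ : e ∉ outs
          e∉ = proj₂ (∈.∈-filter⁻ (λ e → ¬? (e ∈? outs)) {xs = allFin edges} e∈)
          e∈cut : e ∈ cut
          e∈cut with covered e
          ... | inj₁ e∈ = e∈
          ... | inj₂ e∈ = ⊥-elim (e∉ e∈)
        same : ∀ γ → T.F s order γ ≈ when (flow? γ) (when (loopAt? p γ) (when (fitsAll? γ) (E (s ℤ.* J ⟦ Dᵛ ⟧ᵛ ⟦ γ ⟧ˢ))))
        same γ = trans (F-product s order γ) (go (All.all? (good? γ) order) (flow? γ) (loopAt? p γ) (fitsAll? γ))
          where
          go : ∀ {a} (G? : Dec (All (Good γ) order)) (f? : Dec (Flow ⟦ γ ⟧ˢ)) (l? : Dec (LoopAt p γ)) (fits? : Dec (FitsAll γ)) →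
            when G? (when l? a) ≈ when f? (when l? (when fits? a))
          go (yes _) (yes _) (no _)  _       = refl
          go (yes _) (no _)  (no _)  _       = refl
          go (no _)  (yes _) (no _)  _       = refl
          go (no _)  (no _)  (no _)  _       = refl
          go (yes _) (yes _) (yes _) (yes _) = refl
          go (yes g) (no ¬f) (yes _) _       = ⊥-elim (¬f (All.map (λ {v} → good⇒conserved γ v) g))
          go (yes g) (yes _) (yes l) (no ¬fits) = ⊥-elim (¬fits λ e → fit e (covered e))
            where
            fit : ∀ e → e ∈ cut ⊎ e ∈ outs → Fits (D e) (lookup γ e)
            fit e (inj₁ e∈) = ≡.subst (Fits (D e)) (≡.sym (All.lookup l e∈)) (All.lookup cutFits e∈)
            fit e (inj₂ e∈) = good⇒fits g e∈
          go (no ¬g) (yes f) (yes _) (yes fits) = ⊥-elim (¬g (All.map (λ {v} → conserved⇒good γ fits v) f))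
          go (no _)  (yes _) (yes _) (no _)  = refl
          go (no _)  (no _)  (yes _) _       = refl

    private
      total-∑ᶻ : ∀ es → + total es ≡ ∑ᶻ es ⟦ Dᵛ ⟧ᵛ
      total-∑ᶻ []       = ≡.refl
      total-∑ᶻ (e ∷ es) = ≡.cong (λ z → + D e ℤ.+ z) (total-∑ᶻ es)

      ∑ᶻ-superposed : ∀ {γ Γ} → γ ⊕ᵛ Γ ≡ Dᵛ → ∀ es → + total es ≡ ∑ᶻ es ⟦ γ ⟧ˢ ℤ.+ ∑ᶻ es ⟦ Γ ⟧ˢ
      ∑ᶻ-superposed {γ} {Γ} eq es = ≡.trans (total-∑ᶻ es) (≡.trans (∑ᶻ-cong es λ e → ≡.trans (≡.cong (λ D → ⟦ D ⟧ᵛ e) (≡.sym eq)) (⊕ᵛ-⊕ γ Γ e)) (∑ᶻ-+ es))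

      flow⇒balanced : ∀ {γ Γ} → γ ⊕ᵛ Γ ≡ Dᵛ → Flow ⟦ γ ⟧ˢ → Flow ⟦ Γ ⟧ˢ → All Balanced order
      flow⇒balanced {γ} {Γ} eq f g = All.zipWith (λ {v} (a , b) → ℤ.+-injective
        (≡.trans (∑ᶻ-superposed {γ} {Γ} eq (incoming v)) (≡.trans (≡.cong₂ ℤ._+_ a b) (≡.sym (∑ᶻ-superposed {γ} {Γ} eq (outgoing v)))))) (f , g)

      balanced⇒flow : ∀ {γ Γ} → γ ⊕ᵛ Γ ≡ Dᵛ → Flow ⟦ γ ⟧ˢ → All Balanced order → Flow ⟦ Γ ⟧ˢ
      balanced⇒flow {γ} {Γ} eq f bal = All.zipWith (λ {v} (a , b) → +-cancelˡᶻ (∑ᶻ (incoming v) ⟦ γ ⟧ˢ) _ _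
        (≡.trans (≡.sym (∑ᶻ-superposed {γ} {Γ} eq (incoming v))) (≡.trans (≡.cong +_ b)
          (≡.trans (∑ᶻ-superposed {γ} {Γ} eq (outgoing v)) (≡.cong (ℤ._+ ∑ᶻ (outgoing v) ⟦ Γ ⟧ˢ) (≡.sym a)))))) (f , bal)

      superposed-lookup : ∀ {γ Γ} → γ ⊕ᵛ Γ ≡ Dᵛ → ∀ e → D e ≡ bit (lookup γ e) + bit (lookup Γ e)
      superposed-lookup {γ} {Γ} eq e = ≡.trans (≡.cong (λ v → lookup v e) (≡.sym eq)) (Vec.lookup-zipWith _ e γ Γ)

      superposed⇒fits : ∀ {γ Γ} → γ ⊕ᵛ Γ ≡ Dᵛ → FitsAll γ
      superposed⇒fits {γ} {Γ} eq e = lemma (lookup γ e) (lookup Γ e) (superposed-lookup {γ} {Γ} eq e)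
        where
        lemma : ∀ {d} a b → d ≡ bit a + bit b → Fits d a
        lemma true  _     ≡.refl = s≤s z≤n
        lemma false true  ≡.refl = s≤s z≤n
        lemma false false ≡.refl = z≤n

    flows-unique : Unique flows
    flows-unique = Unique.filter⁺ flow? (subsets-unique edges)

    -- The only candidate for Γ is D - γ. It is 0/1-valued exactly when γ fits, and it is a flow
    -- because γ and D are balanced.
    ∑-complement : ∀ γ {x} → Flow ⟦ γ ⟧ˢ → All Balanced order → ∑ flows (λ Γ → when ((γ ⊕ᵛ Γ) ≟ᵛ Dᵛ) x) ≈ when (fitsAll? γ) x
    ∑-complement γ {x} f bal = go (fitsAll? γ)
      where
      go : (d : Dec (FitsAll γ)) → ∑ flows (λ Γ → when ((γ ⊕ᵛ Γ) ≟ᵛ Dᵛ) x) ≈ when d x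
      go (no ¬fits) = ∑-zero flows λ Γ → reflexive (when-no ((γ ⊕ᵛ Γ) ≟ᵛ Dᵛ) (λ eq → ¬fits (superposed⇒fits {γ} {Γ} eq)))
      go (yes fits) = trans (∑-cong flows λ Γ → when-cong ((γ ⊕ᵛ Γ) ≟ᵛ Dᵛ) (Vec.≡-dec Bool._≟_ Γ* Γ) (unique Γ) (λ { ≡.refl → Γ*-eq }) (λ _ → refl))
        (∑-δ (Vec.≡-dec Bool._≟_) {flows} {λ _ → x} flows-unique (∈.∈-filter⁺ flow? (∈-subsets Γ*) (balanced⇒flow {γ} {Γ*} Γ*-eq f bal)))
        where
        Γ* : Vec Bool edges
        -- D - γ, written as the truth value of γ e + 1 = D e.
        Γ* = Vec.tabulate (λ e → does (suc (bit (lookup γ e)) ℕ.≟ D e))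
        residue : ∀ b d → d ≤ 2 → Fits d b → bit b + bit (does (suc (bit b) ℕ.≟ d)) ≡ d
        residue true  1       _ _ = ≡.refl
        residue true  2       _ _ = ≡.refl
        residue false 0       _ _ = ≡.refl
        residue false 1       _ _ = ≡.refl
        residue true  (suc (suc (suc d))) (s≤s (s≤s ())) _
        residue false (suc (suc d)) _ (s≤s ())
        Γ*-eq : γ ⊕ᵛ Γ* ≡ Dᵛ
        Γ*-eq = ≡.trans (≡.sym (Vec.tabulate∘lookup _)) (≡.trans (Vec.tabulate-cong λ e → ≡.trans (Vec.lookup-zipWith _ e γ Γ*)
          (≡.trans (≡.cong (λ b → bit (lookup γ e) + bit b) (Vec.lookup∘tabulate _ e)) (residue (lookup γ e) (D e) (D≤2 e) (fits e)))) (Vec.tabulate∘lookup Dᵛ))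
        bit-injective : ∀ a b → bit a ≡ bit b → a ≡ b
        bit-injective true  true  _ = ≡.refl
        bit-injective false false _ = ≡.refl
        unique : ∀ Γ → γ ⊕ᵛ Γ ≡ Dᵛ → Γ* ≡ Γ
        unique Γ eq = ≡.trans (≡.sym (Vec.tabulate∘lookup Γ*)) (≡.trans (Vec.tabulate-cong λ e → bit-injective (lookup Γ* e) (lookup Γ e)
          (ℕ.+-cancelˡ-≡ (bit (lookup γ e)) _ _ (≡.trans (≡.sym (superposed-lookup {γ} {Γ*} Γ*-eq e)) (superposed-lookup {γ} {Γ} eq e)))) (Vec.tabulate∘lookup Γ))

    private
      ∅-bit : ∀ Γ → ∅ ⊕ᵛ Γ ≡ Dᵛ → ∀ e → D e ≡ bit (lookup Γ e)
      ∅-bit Γ eq e = ≡.trans (superposed-lookup {∅} {Γ} eq e) (≡.cong (λ b → bit b + bit (lookup Γ e)) (∅-lookup e))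

      ∅-flow : Flow ⟦ ∅ ⟧ˢ
      ∅-flow = All.tabulate λ {v} _ → conserved v
        where
        conserved : ∀ v → Conserved ⟦ ∅ ⟧ˢ v
        conserved (merge x y o) rewrite ∅-lookup x | ∅-lookup y | ∅-lookup o = ≡.refl
        conserved (split i x y) rewrite ∅-lookup x | ∅-lookup y | ∅-lookup i = ≡.refl

    -- The two sides of the peeling recursion for one colour and thickness D, summed over the
    -- possible colour classes: `RHS` is q - q^-1 if D is a 0/1-valued flow through p, and 0
    -- otherwise.
    LHS RHS : Carrier
    LHS = ∑ (loops p) (λ γ → ∑ flows (λ Γ → when ((γ ⊕ᵛ Γ) ≟ᵛ Dᵛ) (ψ ⟦ Dᵛ ⟧ᵛ γ)))
    RHS = ∑ flows (λ Γ → when (lookup Γ p Bool.≟ true) (when ((∅ ⊕ᵛ Γ) ≟ᵛ Dᵛ) (E 1ℤ - E -1ℤ)))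

    private
      RHS-zero : (∀ Γ → Flow ⟦ Γ ⟧ˢ → lookup Γ p ≡ true → ¬ ∅ ⊕ᵛ Γ ≡ Dᵛ) → RHS ≈ 0#
      RHS-zero impossible = ∑-zero-∈ flows λ {Γ} Γ∈ → go Γ (proj₂ (∈.∈-filter⁻ flow? {xs = subsets edges} Γ∈)) (lookup Γ p Bool.≟ true)
        where
        go : ∀ Γ → Flow ⟦ Γ ⟧ˢ → (d : Dec (lookup Γ p ≡ true)) → when d (when ((∅ ⊕ᵛ Γ) ≟ᵛ Dᵛ) (E 1ℤ - E -1ℤ)) ≈ 0#
        go Γ f (no _)   = refl
        go Γ f (yes Γp) = reflexive (when-no ((∅ ⊕ᵛ Γ) ≟ᵛ Dᵛ) (impossible Γ f Γp))

      LHS-zero : (∀ γ Γ → LoopAt p γ → Flow ⟦ γ ⟧ˢ → Flow ⟦ Γ ⟧ˢ → ¬ γ ⊕ᵛ Γ ≡ Dᵛ) → LHS ≈ 0#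
      LHS-zero impossible = ∑-zero-∈ (loops p) λ {γ} γ∈ → ∑-zero-∈ flows λ {Γ} Γ∈ → reflexive (when-no ((γ ⊕ᵛ Γ) ≟ᵛ Dᵛ)
        (impossible γ Γ (proj₂ (∈.∈-filter⁻ (loopAt? p) {xs = flows} γ∈))
          (proj₂ (∈.∈-filter⁻ flow? {xs = subsets edges} (proj₁ (∈.∈-filter⁻ (loopAt? p) {xs = flows} γ∈))))
          (proj₂ (∈.∈-filter⁻ flow? {xs = subsets edges} Γ∈))))

      module _ (bal : All Balanced order) (cutFits : CutFits) where
        -- The two exponentials of `ψ` have exponents -(D p - 2) - J and (D p - 2) + J, which are
        -- the two signs s = -1 and s = 1 of `paths`.
        LHS-paths : LHS ≈ E (ℤ.- (+ D p ℤ.- + 2)) * paths -1ℤ sweep 0 - E (+ D p ℤ.- + 2) * paths 1ℤ sweep 0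
        LHS-paths = begin
          LHS
            ≈⟨ ∑-cong-∈ (loops p) (λ {γ} γ∈ → ∑-complement γ (proj₂ (∈.∈-filter⁻ flow? {xs = subsets edges} (proj₁ (∈.∈-filter⁻ (loopAt? p) {xs = flows} γ∈)))) bal) ⟩
          ∑ (loops p) (λ γ → when (fitsAll? γ) (ψ ⟦ Dᵛ ⟧ᵛ γ))
            ≈⟨ ∑-cong (loops p) (λ γ → separate (J ⟦ Dᵛ ⟧ᵛ ⟦ γ ⟧ˢ) (+ D p) (fitsAll? γ)) ⟩
          ∑ (loops p) (λ γ → a * f -1ℤ γ ⊞ (- a′) * f 1ℤ γ)
            ≈⟨ ∑-+ (loops p) ⟩
          ∑ (loops p) (λ γ → a * f -1ℤ γ) ⊞ ∑ (loops p) (λ γ → (- a′) * f 1ℤ γ)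
            ≈⟨ +-cong (∑-*ˡ a (loops p)) (∑-*ˡ (- a′) (loops p)) ⟨
          a * ∑ (loops p) (f -1ℤ) ⊞ (- a′) * ∑ (loops p) (f 1ℤ)
            ≈⟨ +-cong (*-congˡ (loops-paths bal cutFits -1ℤ)) (*-congˡ (loops-paths bal cutFits 1ℤ)) ⟩
          a * paths -1ℤ sweep 0 ⊞ (- a′) * paths 1ℤ sweep 0
            ≈⟨ negate a a′ _ _ ⟩
          a * paths -1ℤ sweep 0 - a′ * paths 1ℤ sweep 0 ∎
          where
          a = E (ℤ.- (+ D p ℤ.- + 2))
          a′ = E (+ D p ℤ.- + 2)
          f : ℤ → Vec Bool edges → Carrier
          f s γ = when (fitsAll? γ) (E (s ℤ.* J ⟦ Dᵛ ⟧ᵛ ⟦ γ ⟧ˢ))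
          negate : ∀ a a′ x y → a * x ⊞ (- a′) * y ≈ a * x - a′ * y
          negate = solve 4 (λ a b x y → a :* x :+ (:- b) :* y := a :* x :- b :* y) refl
          separate : ∀ j d {P : Set} (P? : Dec P) → when P? (let M = j ℤ.+ d ℤ.- 1ℤ in E (1ℤ ℤ.- M) - E (M ℤ.- 1ℤ)) ≈
            E (ℤ.- (d ℤ.- + 2)) * when P? (E (-1ℤ ℤ.* j)) ⊞ (- E (d ℤ.- + 2)) * when P? (E (1ℤ ℤ.* j))
          separate j d (no _)  = sym (trans (+-cong (zeroʳ _) (zeroʳ _)) (+-identityˡ 0#))
          separate j d (yes _) = trans (+-cong (trans (reflexive (≡.cong E (e₁ j d))) (E-+ _ _)) (-‿cong (trans (reflexive (≡.cong E (e₂ j d))) (E-+ _ _))))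
            (sym (negate _ _ _ _))
            where
            e₁ : ∀ j d → 1ℤ ℤ.- (j ℤ.+ d ℤ.- 1ℤ) ≡ ℤ.- (d ℤ.- + 2) ℤ.+ -1ℤ ℤ.* j
            e₁ = solve-∀
            e₂ : ∀ j d → j ℤ.+ d ℤ.- 1ℤ ℤ.- 1ℤ ≡ (d ℤ.- + 2) ℤ.+ 1ℤ ℤ.* j
            e₂ = solve-∀

        -- Both prefactors are q^0 and nothing lies to the right of p, so `double-symmetric` with k
        -- = 0 makes the two terms equal.
        thick-start : D p ≡ 2 → LHS ≈ RHS
        thick-start Dp≡2 = trans LHS-paths (trans (trans (+-congˡ (-‿cong swap′)) (-‿inverseʳ _)) (sym (RHS-zero λ Γ _ _ eq → two≢bit _ (≡.trans (≡.sym Dp≡2) (∅-bit Γ eq p)))))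
          where
          two≢bit : ∀ b → 2 ≢ bit b
          two≢bit true  ()
          two≢bit false ()
          Y : Symmetric (λ s → paths s sweep 0) 0
          Y = ≡.subst (λ k → Symmetric (λ s → paths s sweep k) k) (total-rs₀ bal cutFits)
            (double-symmetric sweep bal ls₀ rs₀ cut≡ Dp≡2 (thin-ls₀ bal cutFits) (thin-rs₀ bal cutFits))
          swap′ : E (+ D p ℤ.- + 2) * paths 1ℤ sweep 0 ≈ E (ℤ.- (+ D p ℤ.- + 2)) * paths -1ℤ sweep 0
          swap′ rewrite Dp≡2 = sym (Symmetric.reflect Y)

        -- The cut is thin. With a double edge elsewhere the two terms cancel by `paths-thick`; with
        -- none, `paths-thin` leaves q - q^-1.
        thin-start : D p ≡ 1 → LHS ≈ RHS
        thin-start Dp≡1 = trans LHS-paths (trans (reflexive (≡.cong (λ d → E (ℤ.- (+ d ℤ.- + 2)) * paths -1ℤ sweep 0 - E (+ d ℤ.- + 2) * paths 1ℤ sweep 0) Dp≡1)) (go (All.all? (λ e → D e ℕ.≤? 1) outs)))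
          where
          thin-cut : Thin cut
          thin-cut = ≡.subst Thin (≡.sym cut≡) (All.++⁺ (thin-ls₀ bal cutFits) (ℕ.≤-reflexive Dp≡1 ∷ thin-rs₀ bal cutFits))
          go : Dec (Thin outs) → E 1ℤ * paths -1ℤ sweep 0 - E -1ℤ * paths 1ℤ sweep 0 ≈ RHS
          go (yes thin) = trans (+-cong (trans (*-congˡ (paths-thin -1ℤ sweep bal thin-cut thin)) (*-identityʳ _)) (-‿cong (trans (*-congˡ (paths-thin 1ℤ sweep bal thin-cut thin)) (*-identityʳ _))))
            (sym (trans (∑-cong flows (λ Γ → drop-p Γ)) (trans (∑-complement ∅ ∅-flow bal) (reflexive (when-yes (fitsAll? ∅) fits)))))
            where
            fits : FitsAll ∅
            fits e = ≡.subst (Fits (D e)) (≡.sym (∅-lookup e)) (thin-at (covered e))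
              where
              thin-at : e ∈ cut ⊎ e ∈ outs → D e ≤ 1
              thin-at (inj₁ e∈) = All.lookup thin-cut e∈
              thin-at (inj₂ e∈) = All.lookup thin e∈
            one-bit : ∀ b → 1 ≡ bit b → b ≡ true
            one-bit true _ = ≡.refl
            drop-p : ∀ Γ {x} → when (lookup Γ p Bool.≟ true) (when ((∅ ⊕ᵛ Γ) ≟ᵛ Dᵛ) x) ≈ when ((∅ ⊕ᵛ Γ) ≟ᵛ Dᵛ) x
            drop-p Γ with (∅ ⊕ᵛ Γ) ≟ᵛ Dᵛ
            ... | yes eq = reflexive (when-yes (lookup Γ p Bool.≟ true) (one-bit _ (≡.trans (≡.sym Dp≡1) (∅-bit Γ eq p))))
            ... | no  _  with lookup Γ p Bool.≟ true
            ...   | yes _ = refl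
            ...   | no  _ = refl
          go (no ¬thin) = trans (trans (+-congʳ (paths-thick sweep bal thin-cut e∈ e≡2)) (-‿inverseʳ _)) (sym (RHS-zero λ Γ _ _ eq → ¬thin (All.tabulate λ {e} _ → ≡.subst (_≤ 1) (≡.sym (∅-bit Γ eq e)) (bit≤1 _))))
            where
            bit≤1 : ∀ b → bit b ≤ 1
            bit≤1 true  = s≤s z≤n
            bit≤1 false = z≤n
            find : ∀ es → ¬ Thin es → ∃ λ e → e ∈ es × ¬ D e ≤ 1
            find []       ¬thin = ⊥-elim (¬thin [])
            find (e ∷ es) ¬thin with D e ℕ.≤? 1
            ... | no  ¬≤1 = e , here ≡.refl , ¬≤1
            ... | yes ≤1 with find es (λ thin → ¬thin (≤1 ∷ thin))
            ...   | e′ , e′∈ , ¬≤1 = e′ , there e′∈ , ¬≤1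
            found = find outs ¬thin
            e∈ = proj₁ (proj₂ found)
            e≡2 : D (proj₁ found) ≡ 2
            e≡2 = ℕ.≤-antisym (D≤2 _) (ℕ.≰⇒> (proj₂ (proj₂ found)))

    -- If D is not balanced, or does not fit a loop through p at the cut, then both sums are empty.
    -- Otherwise D p is 1 or 2.
    LHS≈RHS : LHS ≈ RHS
    LHS≈RHS = balanced (All.all? (λ v → _ ℕ.≟ _) order) (All.all? (λ e → fits? (D e) (does (p Fin.≟ e))) cut)
      where
      balanced : Dec (All Balanced order) → Dec CutFits → LHS ≈ RHS
      balanced (no ¬bal) _ = trans (LHS-zero λ γ Γ _ f g eq → ¬bal (flow⇒balanced {γ} {Γ} eq f g))
        (sym (RHS-zero λ Γ g _ eq → ¬bal (flow⇒balanced {∅} {Γ} eq ∅-flow g)))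
      balanced (yes bal) (no ¬fits) = trans (LHS-zero λ γ Γ l f g eq → ¬fits (All.tabulate λ {e} e∈ → ≡.subst (Fits (D e)) (All.lookup l e∈) (superposed⇒fits {γ} {Γ} eq e)))
        (sym (RHS-zero λ Γ g Γp eq → ¬fits (All.tabulate λ {e} _ → fit Γ Γp eq e (p Fin.≟ e))))
        where
        fit : ∀ Γ → lookup Γ p ≡ true → ∅ ⊕ᵛ Γ ≡ Dᵛ → ∀ e → (d : Dec (p ≡ e)) → Fits (D e) (does d)
        fit Γ Γp eq e (yes ≡.refl) = ℕ.≤-reflexive (≡.sym (≡.trans (∅-bit Γ eq p) (≡.cong bit Γp)))
        fit Γ Γp eq e (no _)       = ≡.subst (Fits (D e)) (∅-lookup e) (superposed⇒fits {∅} {Γ} eq e)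
      balanced (yes bal) (yes fits) with one-or-two (≡.subst (Fits (D p)) (dec-true (p Fin.≟ p) ≡.refl) (All.lookup fits p∈cut)) (D≤2 p)
        where
        one-or-two : ∀ {d} → 1 ≤ d → d ≤ 2 → d ≡ 1 ⊎ d ≡ 2
        one-or-two {1} _ _ = inj₁ ≡.refl
        one-or-two {2} _ _ = inj₂ ≡.refl
        one-or-two {suc (suc (suc _))} _ (s≤s (s≤s ()))
      ... | inj₁ Dp≡1 = thin-start bal fits Dp≡1
      ... | inj₂ Dp≡2 = thick-start bal fits Dp≡2

  private
    Ds : List (Vec ℕ edges)
    Ds = tuples (0 ∷ 1 ∷ 2 ∷ []) edges

    Ds-unique : Unique Ds
    Ds-unique = tuples-unique edges (((λ ()) ∷ (λ ()) ∷ []) ∷ ((λ ()) ∷ []) ∷ [] ∷ [])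

    ⊕ᵛ∈Ds : ∀ γ Γ → γ ⊕ᵛ Γ ∈ Ds
    ⊕ᵛ∈Ds γ Γ = tuples-∈⁺ (γ ⊕ᵛ Γ) (λ e → ≡.subst (_∈ 0 ∷ 1 ∷ 2 ∷ []) (≡.sym (Vec.lookup-zipWith _ e γ Γ)) (lemma (lookup γ e) (lookup Γ e)))
      where
      lemma : ∀ a b → bit a + bit b ∈ 0 ∷ 1 ∷ 2 ∷ []
      lemma true  true  = there (there (here ≡.refl))
      lemma true  false = there (here ≡.refl)
      lemma false true  = there (here ≡.refl)
      lemma false false = here ≡.refl

    Ds≤2 : ∀ {D} → D ∈ Ds → ∀ e → lookup D e ≤ 2
    Ds≤2 {D} D∈ e = lemma (tuples-∈⁻ D D∈ e)
      where
      lemma : ∀ {d} → d ∈ 0 ∷ 1 ∷ 2 ∷ [] → d ≤ 2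
      lemma (here ≡.refl)                 = z≤n
      lemma (there (here ≡.refl))         = s≤s z≤n
      lemma (there (there (here ≡.refl))) = s≤s (s≤s z≤n)

  -- Trades a colour through p for a superposition of a loop through p and a colour. Both sums are
  -- sorted by the total weight D, and `LHS≈RHS` is applied to each D; those with D nonzero to the
  -- right of p are removed by the vanishing of G.
  regroup : (G : Weight → Carrier) → (∀ {f g} → f ≗ g → G f ≈ G g) → (∀ {D e} → e ∈ rs₀ → 0ℤ ℤ.< D e → G D ≈ 0#) →
    ∑ (loops p) (λ γ → ∑ flows (λ Γ → G (⟦ γ ⟧ˢ ⊕ ⟦ Γ ⟧ˢ) * ψ (⟦ γ ⟧ˢ ⊕ ⟦ Γ ⟧ˢ) γ))
    ≈ ∑ flows (λ Γ → when (lookup Γ p Bool.≟ true) (G ⟦ Γ ⟧ˢ * (E 1ℤ - E -1ℤ)))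
  regroup G G-cong G-zero = begin
    ∑ (loops p) (λ γ → ∑ flows (λ Γ → G (⟦ γ ⟧ˢ ⊕ ⟦ Γ ⟧ˢ) * ψ (⟦ γ ⟧ˢ ⊕ ⟦ Γ ⟧ˢ) γ))
      ≈⟨ ∑-cong (loops p) (λ γ → ∑-cong flows (λ Γ → spread γ Γ (λ D → ψ D γ) (ψ-cong γ))) ⟩
    ∑ (loops p) (λ γ → ∑ flows (λ Γ → ∑ Ds (λ D → G ⟦ D ⟧ᵛ * when ((γ ⊕ᵛ Γ) ≟ᵛ D) (ψ ⟦ D ⟧ᵛ γ))))
      ≈⟨ ∑-cong (loops p) (λ γ → ∑-swap flows Ds) ⟩
    ∑ (loops p) (λ γ → ∑ Ds (λ D → ∑ flows (λ Γ → G ⟦ D ⟧ᵛ * when ((γ ⊕ᵛ Γ) ≟ᵛ D) (ψ ⟦ D ⟧ᵛ γ))))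
      ≈⟨ ∑-swap (loops p) Ds ⟩
    ∑ Ds (λ D → ∑ (loops p) (λ γ → ∑ flows (λ Γ → G ⟦ D ⟧ᵛ * when ((γ ⊕ᵛ Γ) ≟ᵛ D) (ψ ⟦ D ⟧ᵛ γ))))
      ≈⟨ ∑-cong Ds (λ D → ∑-cong (loops p) (λ γ → ∑-*ˡ _ flows)) ⟨
    ∑ Ds (λ D → ∑ (loops p) (λ γ → G ⟦ D ⟧ᵛ * ∑ flows (λ Γ → when ((γ ⊕ᵛ Γ) ≟ᵛ D) (ψ ⟦ D ⟧ᵛ γ))))
      ≈⟨ ∑-cong Ds (λ D → ∑-*ˡ _ (loops p)) ⟨
    ∑ Ds (λ D → G ⟦ D ⟧ᵛ * ∑ (loops p) (λ γ → ∑ flows (λ Γ → when ((γ ⊕ᵛ Γ) ≟ᵛ D) (ψ ⟦ D ⟧ᵛ γ))))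
      ≈⟨ ∑-cong-∈ Ds (λ {D} D∈ → per-D D D∈ (All.all? (λ e → lookup D e ℕ.≟ 0) rs₀)) ⟩
    ∑ Ds (λ D → G ⟦ D ⟧ᵛ * ∑ flows (λ Γ → when (lookup Γ p Bool.≟ true) (when ((∅ ⊕ᵛ Γ) ≟ᵛ D) z′)))
      ≈⟨ ∑-cong Ds (λ D → ∑-*ˡ _ flows) ⟩
    ∑ Ds (λ D → ∑ flows (λ Γ → G ⟦ D ⟧ᵛ * when (lookup Γ p Bool.≟ true) (when ((∅ ⊕ᵛ Γ) ≟ᵛ D) z′)))
      ≈⟨ ∑-swap Ds flows ⟩
    ∑ flows (λ Γ → ∑ Ds (λ D → G ⟦ D ⟧ᵛ * when (lookup Γ p Bool.≟ true) (when ((∅ ⊕ᵛ Γ) ≟ᵛ D) z′)))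
      ≈⟨ ∑-cong flows (λ Γ → trans (∑-cong Ds (λ D → when-*ˡ (lookup Γ p Bool.≟ true) _)) (sym (when-∑ (lookup Γ p Bool.≟ true) Ds))) ⟩
    ∑ flows (λ Γ → when (lookup Γ p Bool.≟ true) (∑ Ds (λ D → G ⟦ D ⟧ᵛ * when ((∅ ⊕ᵛ Γ) ≟ᵛ D) z′)))
      ≈⟨ ∑-cong flows (λ Γ → when-cong (lookup Γ p Bool.≟ true) (lookup Γ p Bool.≟ true) (λ z → z) (λ z → z) (λ _ →
           trans (sym (spread ∅ Γ (λ _ → z′) (λ _ → refl))) (*-congʳ (G-cong λ e → ≡.trans (≡.cong (λ b → 𝟚 b ℤ.+ ⟦ Γ ⟧ˢ e) (∅-lookup e)) (ℤ.+-identityˡ _))))) ⟩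
    ∑ flows (λ Γ → when (lookup Γ p Bool.≟ true) (G ⟦ Γ ⟧ˢ * z′)) ∎
    where
    z′ = E 1ℤ - E -1ℤ

    spread : ∀ γ Γ (f : Weight → Carrier) → (∀ {D D′} → D ≗ D′ → f D ≈ f D′) →
      G (⟦ γ ⟧ˢ ⊕ ⟦ Γ ⟧ˢ) * f (⟦ γ ⟧ˢ ⊕ ⟦ Γ ⟧ˢ) ≈ ∑ Ds (λ D → G ⟦ D ⟧ᵛ * when ((γ ⊕ᵛ Γ) ≟ᵛ D) (f ⟦ D ⟧ᵛ))
    spread γ Γ f f-cong = begin
      G (⟦ γ ⟧ˢ ⊕ ⟦ Γ ⟧ˢ) * f (⟦ γ ⟧ˢ ⊕ ⟦ Γ ⟧ˢ)
        ≈⟨ *-cong (G-cong (⊕ᵛ-⊕ γ Γ)) (f-cong (⊕ᵛ-⊕ γ Γ)) ⟨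
      G ⟦ γ ⊕ᵛ Γ ⟧ᵛ * f ⟦ γ ⊕ᵛ Γ ⟧ᵛ
        ≈⟨ ∑-δ _≟ᵛ_ {Ds} {λ D → G ⟦ D ⟧ᵛ * f ⟦ D ⟧ᵛ} Ds-unique (⊕ᵛ∈Ds γ Γ) ⟨
      ∑ Ds (λ D → when ((γ ⊕ᵛ Γ) ≟ᵛ D) (G ⟦ D ⟧ᵛ * f ⟦ D ⟧ᵛ))
        ≈⟨ ∑-cong Ds (λ D → when-*ˡ ((γ ⊕ᵛ Γ) ≟ᵛ D) _) ⟨
      ∑ Ds (λ D → G ⟦ D ⟧ᵛ * when ((γ ⊕ᵛ Γ) ≟ᵛ D) (f ⟦ D ⟧ᵛ)) ∎

    per-D : ∀ D → D ∈ Ds → Dec (All (λ e → lookup D e ≡ 0) rs₀) →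
      G ⟦ D ⟧ᵛ * ∑ (loops p) (λ γ → ∑ flows (λ Γ → when ((γ ⊕ᵛ Γ) ≟ᵛ D) (ψ ⟦ D ⟧ᵛ γ))) ≈
      G ⟦ D ⟧ᵛ * ∑ flows (λ Γ → when (lookup Γ p Bool.≟ true) (when ((∅ ⊕ᵛ Γ) ≟ᵛ D) z′))
    per-D D D∈ (yes zero-rs) = *-congˡ (LHS≈RHS D (Ds≤2 D∈) zero-rs)
    per-D D D∈ (no ¬zero-rs) = trans (trans (*-congʳ G≈0) (zeroˡ _)) (sym (trans (*-congʳ G≈0) (zeroˡ _)))
      where
      find : ∀ es → ¬ All (λ e → lookup D e ≡ 0) es → ∃ λ e → e ∈ es × lookup D e ≢ 0
      find []       ¬all = ⊥-elim (¬all [])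
      find (e ∷ es) ¬all with lookup D e ℕ.≟ 0
      ... | no  ≢0 = e , here ≡.refl , ≢0
      ... | yes ≡0 with find es (λ all → ¬all (≡0 ∷ all))
      ...   | e′ , e′∈ , ≢0 = e′ , there e′∈ , ≢0
      found = find rs₀ ¬zero-rs
      G≈0 : G ⟦ D ⟧ᵛ ≈ 0#
      G≈0 = G-zero {⟦ D ⟧ᵛ} (proj₁ (proj₂ found)) (ℤ.+<+ (ℕ.n≢0⇒n>0 (proj₂ (proj₂ found))))

-- Peeling off a loop

module Peeling {c ℓ} {R : CommutativeRing c ℓ} (exp : Exponential R) {w : Web} (I : RadialCut w) where
  open CommutativeRing R hiding (zero)
  open Exponential exp
  open Flows I
  open Sums R
  open PrincipalSpecialization exp I
  open Relation.Binary.Reasoning.Setoid setoid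
  open IntegerCoefficients R using (solve; _:=_; _:+_; _:*_; _:-_)

  E-cong : ∀ {i j} → i ≡ j → E i ≈ E j
  E-cong p = reflexive (≡.cong E p)

  E-diff : ∀ a b c → E a * (E b - E c) ≈ E (a ℤ.+ b) - E (a ℤ.+ c)
  E-diff a b c = begin
    E a * (E b - E c)            ≈⟨ expand (E a) (E b) (E c) ⟩
    E a * E b - E a * E c        ≈⟨ +-cong (E-+ a b) (-‿cong (E-+ a c)) ⟨
    E (a ℤ.+ b) - E (a ℤ.+ c)    ∎
    where
    expand : ∀ x y z → x * (y - z) ≈ x * y - x * z
    expand = solve 3 (λ x y z → x :* (y :- z) := x :* y :- x :* z) refl

  -- The number N of the recursion: t p strands start together with γ, and J t γ counts signed meetings.
  meet : Weight → Edge → Vec Bool edges → ℤ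
  meet t p γ = J t ⟦ γ ⟧ˢ ℤ.+ t p ℤ.- 1ℤ

  bracket-cong : ∀ {i j} → i ≡ j → bracket i ≈ bracket j
  bracket-cong p = reflexive (≡.cong bracket p)

  loops⇒ : ∀ {p γ} → γ ∈ loops p → LoopAt p γ × Flow ⟦ γ ⟧ˢ
  loops⇒ {p} γ∈ with ∈.∈-filter⁻ (loopAt? p) {xs = flows} γ∈
  ... | γ∈flows , loop = loop , proj₂ (∈.∈-filter⁻ flow? {xs = subsets edges} γ∈flows)

  private
    loop-height : ∀ p (es : List Edge) γ → Unique es → p ∈ es → All (λ e → lookup γ e ≡ does (p Fin.≟ e)) es → ∑ᶻ es ⟦ γ ⟧ˢ ≡ 1ℤ
    loop-height p es γ u p∈ l = ≡.trans (Sums.∑-cong-∈ ℤ.+-*-commutativeRing es (λ e∈ → helper (All.lookup l e∈)))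
      (Sums.∑-δ ℤ.+-*-commutativeRing Fin._≟_ u p∈)
      where
      helper : ∀ {b e} → b ≡ does (p Fin.≟ e) → 𝟚 b ≡ (if does (p Fin.≟ e) then 1ℤ else 0ℤ)
      helper ≡.refl = ≡.refl

  loop-at : ∀ {p γ} → p ∈ cut → LoopAt p γ → ⟦ γ ⟧ˢ p ≡ 1ℤ
  loop-at {p} {γ} p∈ l = ≡.cong 𝟚 (≡.trans (All.lookup l p∈) (dec-true (p Fin.≟ p) ≡.refl))

  loop-h : ∀ {p γ} → p ∈ cut → LoopAt p γ → h ⟦ γ ⟧ˢ ≡ 1ℤ
  loop-h {p} {γ} p∈ l = loop-height p cut γ (sweep-unique sweep) p∈ l

  module _ (p : Edge) (rs : List Edge) (found : ∃ λ ls → cut ≡ ls ++ p ∷ rs) where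
    p∈cut : p ∈ cut
    p∈cut = ≡.subst (p ∈_) (≡.sym (proj₂ found)) (∈.∈-++⁺ʳ (proj₁ found) (here ≡.refl))

    -- Induction on the number of colours. The first colour Γ is split off, the induction hypothesis
    -- removes a loop from t ⊖ Γ, and the correction for Γ through p is rewritten by `regroup`, so
    -- that loops and colours can be exchanged.
    peel : ∀ m t → (∀ {e} → e ∈ rs → t e ≡ 0ℤ) →
      bracket (t p) * X̂ m t ≈ ∑ (loops p) (λ γ → bracket (+ m ℤ.- meet t p γ) * X̂ m (t ⊖ ⟦ γ ⟧ˢ))
    peel zero t _ = by-cases (Fin.all? (λ e → t e ℤ.≟ 0ℤ))
      where
      bracket-0 : ∀ {i} x → i ≡ 0ℤ → bracket i * x ≈ 0#
      bracket-0 x i≡0 = trans (*-congʳ (trans (bracket-cong i≡0) (-‿inverseʳ (E 0ℤ)))) (zeroˡ x)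

      by-cases : Dec (∀ e → t e ≡ 0ℤ) →
        bracket (t p) * X̂ 0 t ≈ ∑ (loops p) (λ γ → bracket (+ 0 ℤ.- meet t p γ) * X̂ 0 (t ⊖ ⟦ γ ⟧ˢ))
      by-cases (yes t≡0) = trans (bracket-0 _ (t≡0 p)) (sym (∑-zero-∈ (loops p) λ {γ} γ∈ →
        trans (*-congˡ (X̂-negative 0 {t ⊖ ⟦ γ ⟧ˢ} {p}
          (≡.subst₂ (λ a b → a ℤ.- b ℤ.< 0ℤ) (≡.sym (t≡0 p)) (≡.sym (loop-at {p} {γ} p∈cut (proj₁ (loops⇒ {p} γ∈)))) ℤ.-<+))) (zeroʳ _)))
      by-cases (no t≢0) = trans (trans (*-congˡ (reflexive (when-no (Fin.all? _) t≢0))) (zeroʳ _))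
        (sym (∑-zero-∈ (loops p) λ {γ} γ∈ → vanish γ (proj₁ (loops⇒ {p} γ∈)) (Fin.all? (λ e → (t ⊖ ⟦ γ ⟧ˢ) e ℤ.≟ 0ℤ))))
        where
        vanish : ∀ γ → LoopAt p γ → Dec (∀ e → (t ⊖ ⟦ γ ⟧ˢ) e ≡ 0ℤ) → bracket (+ 0 ℤ.- meet t p γ) * X̂ 0 (t ⊖ ⟦ γ ⟧ˢ) ≈ 0#
        vanish γ l (no t≢γ) = trans (*-congˡ (reflexive (when-no (Fin.all? _) t≢γ))) (zeroʳ _)
        -- Here t is the loop γ itself: J γ γ = 0 and t p = 1, so the bracket is q^0 - q^0.
        vanish γ l (yes t≡γ) = bracket-0 _ N≡0
          where
          t≗γ : t ≗ ⟦ γ ⟧ˢ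
          t≗γ e = ℤ.i-j≡0⇒i≡j (t e) (⟦ γ ⟧ˢ e) (t≡γ e)
          N≡0 : + 0 ℤ.- meet t p γ ≡ 0ℤ
          N≡0 = ≡.cong₂ (λ x y → + 0 ℤ.- (x ℤ.+ y ℤ.- 1ℤ))
            (≡.trans (J-cong {g = ⟦ γ ⟧ˢ} t≗γ (λ _ → ≡.refl)) (J-self ⟦ γ ⟧ˢ))
            (≡.trans (t≗γ p) (loop-at {p} {γ} p∈cut l))
    peel (suc m) t t≡0 = begin
      bracket (t p) * ∑ flows (λ Γ → E (weight m ⟦ Γ ⟧ˢ t) * X̂ m (t ⊖ ⟦ Γ ⟧ˢ))
        ≈⟨ ∑-*ˡ _ flows ⟩
      ∑ flows (λ Γ → bracket (t p) * (E (weight m ⟦ Γ ⟧ˢ t) * X̂ m (t ⊖ ⟦ Γ ⟧ˢ)))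
        ≈⟨ ∑-cong flows left ⟩
      ∑ flows (λ Γ → E (a Γ) * (bracket ((t ⊖ ⟦ Γ ⟧ˢ) p) * X̂ m (t ⊖ ⟦ Γ ⟧ˢ)) + when (lookup Γ p Bool.≟ true) (G ⟦ Γ ⟧ˢ * (E 1ℤ - E -1ℤ)))
        ≈⟨ ∑-+ flows ⟩
      ∑ flows (λ Γ → E (a Γ) * (bracket ((t ⊖ ⟦ Γ ⟧ˢ) p) * X̂ m (t ⊖ ⟦ Γ ⟧ˢ))) + ∑ flows (λ Γ → when (lookup Γ p Bool.≟ true) (G ⟦ Γ ⟧ˢ * (E 1ℤ - E -1ℤ)))
        ≈⟨ +-cong (∑-cong flows peel-rest) (sym (Superposition.regroup exp I p (proj₁ found) rs (proj₂ found) G G-cong (λ {D} → G-zero {D}))) ⟩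
      ∑ flows (λ Γ → ∑ (loops p) (λ γ → E (a Γ) * (bracket (+ m ℤ.- meet (t ⊖ ⟦ Γ ⟧ˢ) p γ) * X̂ m (t ⊖ ⟦ Γ ⟧ˢ ⊖ ⟦ γ ⟧ˢ))))
        + ∑ (loops p) (λ γ → ∑ flows (λ Γ → superposed γ Γ))
        ≈⟨ +-congʳ (∑-swap flows (loops p)) ⟩
      ∑ (loops p) (λ γ → ∑ flows (λ Γ → E (a Γ) * (bracket (+ m ℤ.- meet (t ⊖ ⟦ Γ ⟧ˢ) p γ) * X̂ m (t ⊖ ⟦ Γ ⟧ˢ ⊖ ⟦ γ ⟧ˢ))))
        + ∑ (loops p) (λ γ → ∑ flows (λ Γ → superposed γ Γ))
        ≈⟨ ∑-+ (loops p) ⟨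
      ∑ (loops p) (λ γ → ∑ flows (λ Γ → E (a Γ) * (bracket (+ m ℤ.- meet (t ⊖ ⟦ Γ ⟧ˢ) p γ) * X̂ m (t ⊖ ⟦ Γ ⟧ˢ ⊖ ⟦ γ ⟧ˢ))) + ∑ flows (λ Γ → superposed γ Γ))
        ≈⟨ ∑-cong-∈ (loops p) (λ {γ} γ∈ → trans (sym (∑-+ flows)) (trans (∑-cong flows (right γ (proj₁ (loops⇒ {p} γ∈)))) (sym (∑-*ˡ _ flows)))) ⟩
      ∑ (loops p) (λ γ → bracket (+ suc m ℤ.- meet t p γ) * X̂ (suc m) (t ⊖ ⟦ γ ⟧ˢ)) ∎
      where
      a : Vec Bool edges → ℤ
      a Γ = ⟦ Γ ⟧ˢ p ℤ.+ weight m ⟦ Γ ⟧ˢ t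

      -- For D = Γ with Γ p = 1 this is the exponent of the correction term in `left`. It is defined
      -- for every D, so that `regroup` can evaluate it at γ ⊕ Γ.
      shift : Weight → ℤ
      shift D = weight m D t ℤ.- t p ℤ.+ D p

      G : Weight → Carrier
      G D = E (shift D) * X̂ m (t ⊖ D)

      superposed : Vec Bool edges → Vec Bool edges → Carrier
      superposed γ Γ = let D = ⟦ γ ⟧ˢ ⊕ ⟦ Γ ⟧ˢ; M = J D ⟦ γ ⟧ˢ ℤ.+ D p ℤ.- 1ℤ in G D * (E (1ℤ ℤ.- M) - E (M ℤ.- 1ℤ))

      G-cong : ∀ {f g} → f ≗ g → G f ≈ G g
      G-cong {f} {g} r = *-cong
        (E-cong (≡.cong₂ ℤ._+_ (≡.cong (ℤ._- t p) (weight-cong m {f} {g} {t} r (λ _ → ≡.refl))) (r p)))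
        (X̂-cong m (λ e → ≡.cong (λ z → t e ℤ.- z) (r e)))

      G-zero : ∀ {D e} → e ∈ rs → 0ℤ ℤ.< D e → G D ≈ 0#
      G-zero {D} {e} e∈ 0<D = trans (*-congˡ (X̂-negative m {t ⊖ D} {e} (≡.subst (ℤ._< 0ℤ) (≡.sym (≡.trans (≡.cong (ℤ._- D e) (t≡0 e∈)) (ℤ.+-identityˡ _))) (ℤ.neg-mono-< 0<D)))) (zeroʳ _)

      -- If Γ runs through p, then t ⊖ Γ has thickness k - 1 there, and q^k - q^-k = q (q^(k-1) -
      -- q^(1-k)) + q^(1-k) (q - q^-1). If it does not, there is nothing to correct.
      left : ∀ Γ → bracket (t p) * (E (weight m ⟦ Γ ⟧ˢ t) * X̂ m (t ⊖ ⟦ Γ ⟧ˢ)) ≈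
        E (a Γ) * (bracket ((t ⊖ ⟦ Γ ⟧ˢ) p) * X̂ m (t ⊖ ⟦ Γ ⟧ˢ)) + when (lookup Γ p Bool.≟ true) (G ⟦ Γ ⟧ˢ * (E 1ℤ - E -1ℤ))
      left Γ with lookup Γ p
      ... | false = begin
        bracket k * (E u * rest)                               ≈⟨ rearrange _ _ rest ⟩
        E u * (bracket k * rest)                               ≈⟨ *-cong (E-cong (plus-0 u)) (*-congʳ (bracket-cong (minus-0 k))) ⟩
        E (0ℤ ℤ.+ u) * (bracket (k ℤ.- 0ℤ) * rest)             ≈⟨ +-identityʳ _ ⟨
        E (0ℤ ℤ.+ u) * (bracket (k ℤ.- 0ℤ) * rest) + 0#        ∎
        where
        k = t p
        u = weight m ⟦ Γ ⟧ˢ t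
        rest = X̂ m (t ⊖ ⟦ Γ ⟧ˢ)
        rearrange : ∀ x y z → x * (y * z) ≈ y * (x * z)
        rearrange = solve 3 (λ x y z → x :* (y :* z) := y :* (x :* z)) refl
        plus-0 : ∀ u → u ≡ 0ℤ ℤ.+ u
        plus-0 = solve-∀
        minus-0 : ∀ k → k ≡ k ℤ.- 0ℤ
        minus-0 = solve-∀
      ... | true  = begin
        bracket k * (E u * rest)
          ≈⟨ rearrange _ _ rest ⟩
        (E u * bracket k) * rest
          ≈⟨ *-congʳ (E-diff u k (ℤ.- k)) ⟩
        (E (u ℤ.+ k) - E (u ℤ.+ ℤ.- k)) * rest
          ≈⟨ *-congʳ (cancel _ _ _) ⟨
        ((E (u ℤ.+ k) - E (u ℤ.- k ℤ.+ 1ℤ ℤ.+ 1ℤ)) + (E (u ℤ.- k ℤ.+ 1ℤ ℤ.+ 1ℤ) - E (u ℤ.+ ℤ.- k))) * rest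
          ≈⟨ *-congʳ (+-cong (+-cong (E-cong (e₁ u k)) (-‿cong (E-cong (e₂ u k)))) (+-congˡ (-‿cong (E-cong (e₃ u k))))) ⟩
        ((E ((1ℤ ℤ.+ u) ℤ.+ (k ℤ.- 1ℤ)) - E ((1ℤ ℤ.+ u) ℤ.+ ℤ.- (k ℤ.- 1ℤ))) + (E (u ℤ.- k ℤ.+ 1ℤ ℤ.+ 1ℤ) - E (u ℤ.- k ℤ.+ 1ℤ ℤ.+ -1ℤ))) * rest
          ≈⟨ *-congʳ (+-cong (E-diff (1ℤ ℤ.+ u) (k ℤ.- 1ℤ) _) (E-diff (u ℤ.- k ℤ.+ 1ℤ) 1ℤ -1ℤ)) ⟨
        (E (1ℤ ℤ.+ u) * bracket (k ℤ.- 1ℤ) + E (u ℤ.- k ℤ.+ 1ℤ) * (E 1ℤ - E -1ℤ)) * rest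
          ≈⟨ distribute _ _ _ _ rest ⟩
        E (1ℤ ℤ.+ u) * (bracket (k ℤ.- 1ℤ) * rest) + E (u ℤ.- k ℤ.+ 1ℤ) * rest * (E 1ℤ - E -1ℤ) ∎
        where
        k = t p
        u = weight m ⟦ Γ ⟧ˢ t
        rest = X̂ m (t ⊖ ⟦ Γ ⟧ˢ)
        rearrange : ∀ x y z → x * (y * z) ≈ (y * x) * z
        rearrange = solve 3 (λ x y z → x :* (y :* z) := (y :* x) :* z) refl
        cancel : ∀ x y z → (x - y) + (y - z) ≈ x - z
        cancel = solve 3 (λ x y z → (x :- y) :+ (y :- z) := x :- z) refl
        distribute : ∀ x y z v rest → (x * y + z * v) * rest ≈ x * (y * rest) + z * rest * v
        distribute = solve 5 (λ x y z v rest → (x :* y :+ z :* v) :* rest := x :* (y :* rest) :+ z :* rest :* v) refl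
        e₁ : ∀ u k → u ℤ.+ k ≡ (1ℤ ℤ.+ u) ℤ.+ (k ℤ.- 1ℤ)
        e₁ = solve-∀
        e₂ : ∀ u k → u ℤ.- k ℤ.+ 1ℤ ℤ.+ 1ℤ ≡ (1ℤ ℤ.+ u) ℤ.+ ℤ.- (k ℤ.- 1ℤ)
        e₂ = solve-∀
        e₃ : ∀ u k → u ℤ.+ ℤ.- k ≡ u ℤ.- k ℤ.+ 1ℤ ℤ.+ -1ℤ
        e₃ = solve-∀

      -- The induction hypothesis needs t ⊖ Γ to vanish to the right of p. A colour Γ violating this
      -- makes t ⊖ Γ negative there, and both sides are 0.
      peel-rest : ∀ Γ → E (a Γ) * (bracket ((t ⊖ ⟦ Γ ⟧ˢ) p) * X̂ m (t ⊖ ⟦ Γ ⟧ˢ)) ≈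
        ∑ (loops p) (λ γ → E (a Γ) * (bracket (+ m ℤ.- meet (t ⊖ ⟦ Γ ⟧ˢ) p γ) * X̂ m (t ⊖ ⟦ Γ ⟧ˢ ⊖ ⟦ γ ⟧ˢ)))
      peel-rest Γ with All.all? (λ e → lookup Γ e Bool.≟ false) rs
      ... | yes Γ≡0 = trans (*-congˡ (peel m (t ⊖ ⟦ Γ ⟧ˢ) (λ {e} e∈ → ≡.cong₂ ℤ._-_ (t≡0 e∈) (≡.cong 𝟚 (All.lookup Γ≡0 e∈))))) (∑-*ˡ _ (loops p))
      ... | no  Γ≢0 with ¬All⇒Any rs Γ≢0
        where
        ¬All⇒Any : ∀ rs → ¬ All (λ e → lookup Γ e ≡ false) rs → ∃ λ e → e ∈ rs × lookup Γ e ≡ true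
        ¬All⇒Any []       ¬all = ⊥-elim (¬all All.[])
        ¬All⇒Any (e ∷ rs) ¬all with lookup Γ e in eq
        ... | true  = e , here ≡.refl , eq
        ... | false with ¬All⇒Any rs (λ all → ¬all (eq All.∷ all))
        ...   | e′ , e′∈ , eq′ = e′ , there e′∈ , eq′
      ... | e , e∈ , Γe = begin
        E (a Γ) * (bracket _ * X̂ m (t ⊖ ⟦ Γ ⟧ˢ))   ≈⟨ *-congˡ (trans (*-congˡ (X̂-overfull m {t} (t≡0 e∈) Γ Γe)) (zeroʳ _)) ⟩
        E (a Γ) * 0#                               ≈⟨ zeroʳ _ ⟩
        0#                                         ≈⟨ ∑-zero (loops p) (λ γ → trans (*-congˡ (trans (*-congˡ (X̂-negative m {t ⊖ ⟦ Γ ⟧ˢ ⊖ ⟦ γ ⟧ˢ} {e} (⊖ˢ-< {t ⊖ ⟦ Γ ⟧ˢ} γ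
                                                        (≡.subst₂ (λ x y → x ℤ.- 𝟚 y ℤ.< 0ℤ) (≡.sym (t≡0 e∈)) (≡.sym Γe) ℤ.-<+)))) (zeroʳ _))) (zeroʳ _)) ⟨
        ∑ (loops p) _                              ∎

      -- Each product is a difference of two powers of q. The first power of one product equals the
      -- second power of the other (`first≡last`), and the two remaining ones form the desired
      -- bracket. The exponents follow from bilinearity and antisymmetry of J, h γ = 1 and γ p = 1.
      right : ∀ γ → LoopAt p γ → ∀ Γ →
        E (a Γ) * (bracket (+ m ℤ.- meet (t ⊖ ⟦ Γ ⟧ˢ) p γ) * X̂ m (t ⊖ ⟦ Γ ⟧ˢ ⊖ ⟦ γ ⟧ˢ)) + superposed γ Γ ≈
        bracket (+ suc m ℤ.- meet t p γ) * (E (weight m ⟦ Γ ⟧ˢ (t ⊖ ⟦ γ ⟧ˢ)) * X̂ m (t ⊖ ⟦ γ ⟧ˢ ⊖ ⟦ Γ ⟧ˢ))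
      right γ l Γ = begin
        E (a Γ) * (bracket i * X̂ m (t ⊖ ⟦ Γ ⟧ˢ ⊖ ⟦ γ ⟧ˢ)) + (E (shift D) * X̂ m (t ⊖ D)) * (E (1ℤ ℤ.- M) - E (M ℤ.- 1ℤ))
          ≈⟨ +-cong (*-congˡ (*-congˡ (X̂-cong m (λ e → swap-minus (t e) (⟦ Γ ⟧ˢ e) (⟦ γ ⟧ˢ e))))) (*-congʳ (*-congˡ (X̂-cong m (λ e → assoc-minus (t e) (⟦ γ ⟧ˢ e) (⟦ Γ ⟧ˢ e))))) ⟩
        E (a Γ) * (bracket i * rest) + (E (shift D) * rest) * (E (1ℤ ℤ.- M) - E (M ℤ.- 1ℤ))
          ≈⟨ collect _ _ _ _ rest ⟩
        (E (a Γ) * bracket i + E (shift D) * (E (1ℤ ℤ.- M) - E (M ℤ.- 1ℤ))) * rest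
          ≈⟨ *-congʳ (+-cong (E-diff (a Γ) i _) (E-diff (shift D) _ _)) ⟩
        ((E (a Γ ℤ.+ i) - E (a Γ ℤ.+ ℤ.- i)) + (E (shift D ℤ.+ (1ℤ ℤ.- M)) - E (shift D ℤ.+ (M ℤ.- 1ℤ)))) * rest
          ≈⟨ *-congʳ (+-cong (+-cong (E-cong first≡last) (-‿cong (E-cong second))) (+-congʳ (E-cong third))) ⟩
        ((E (shift D ℤ.+ (M ℤ.- 1ℤ)) - E (e ℤ.+ ℤ.- s)) + (E (e ℤ.+ s) - E (shift D ℤ.+ (M ℤ.- 1ℤ)))) * rest
          ≈⟨ *-congʳ (cancel _ _ _) ⟩
        (E (e ℤ.+ s) - E (e ℤ.+ ℤ.- s)) * rest
          ≈⟨ *-congʳ (E-diff e s (ℤ.- s)) ⟨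
        (E e * bracket s) * rest
          ≈⟨ rearrange _ _ rest ⟩
        bracket (+ suc m ℤ.- meet t p γ) * (E (weight m ⟦ Γ ⟧ˢ (t ⊖ ⟦ γ ⟧ˢ)) * rest) ∎
        where
        D = ⟦ γ ⟧ˢ ⊕ ⟦ Γ ⟧ˢ
        M = J D ⟦ γ ⟧ˢ ℤ.+ D p ℤ.- 1ℤ
        i = + m ℤ.- meet (t ⊖ ⟦ Γ ⟧ˢ) p γ
        rest = X̂ m (t ⊖ ⟦ γ ⟧ˢ ⊖ ⟦ Γ ⟧ˢ)
        s = + suc m ℤ.- meet t p γ
        e = weight m ⟦ Γ ⟧ˢ (t ⊖ ⟦ γ ⟧ˢ)
        g = ⟦ Γ ⟧ˢ p
        k = t p
        jt = J t ⟦ γ ⟧ˢ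
        jΓt = J ⟦ Γ ⟧ˢ t
        jΓγ = J ⟦ Γ ⟧ˢ ⟦ γ ⟧ˢ
        hΓ = h ⟦ Γ ⟧ˢ
        γp≡1 : ⟦ γ ⟧ˢ p ≡ 1ℤ
        γp≡1 = loop-at {p} {γ} p∈cut l
        hγ≡1 : h ⟦ γ ⟧ˢ ≡ 1ℤ
        hγ≡1 = loop-h {p} {γ} p∈cut l
        swap-minus : ∀ x y z → x ℤ.- y ℤ.- z ≡ x ℤ.- z ℤ.- y
        swap-minus = solve-∀
        assoc-minus : ∀ x y z → x ℤ.- (y ℤ.+ z) ≡ x ℤ.- y ℤ.- z
        assoc-minus = solve-∀
        collect : ∀ x y z v rest → x * (y * rest) + (z * rest) * v ≈ (x * y + z * v) * rest
        collect = solve 5 (λ x y z v rest → x :* (y :* rest) :+ (z :* rest) :* v := (x :* y :+ z :* v) :* rest) refl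
        cancel : ∀ x y z → (x - y) + (z - x) ≈ z - y
        cancel = solve 3 (λ x y z → (x :- y) :+ (z :- x) := z :- y) refl
        rearrange : ∀ x y z → (x * y) * z ≈ y * (x * z)
        rearrange = solve 3 (λ x y z → (x :* y) :* z := y :* (x :* z)) refl
        a≡ : a Γ ≡ g ℤ.+ (jΓt ℤ.+ + m ℤ.* hΓ ℤ.- (h t ℤ.- hΓ))
        a≡ = ≡.cong (λ x → g ℤ.+ (jΓt ℤ.+ + m ℤ.* hΓ ℤ.- x)) (h-⊖ t ⟦ Γ ⟧ˢ)
        i≡ : i ≡ + m ℤ.- ((jt ℤ.- jΓγ) ℤ.+ (k ℤ.- g) ℤ.- 1ℤ)
        i≡ = ≡.cong (λ x → + m ℤ.- (x ℤ.+ (k ℤ.- g) ℤ.- 1ℤ)) (J-⊖ˡ t ⟦ Γ ⟧ˢ ⟦ γ ⟧ˢ)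
        jD≡ : J D t ≡ ℤ.- jt ℤ.+ jΓt
        jD≡ = ≡.trans (J-⊕ˡ ⟦ γ ⟧ˢ ⟦ Γ ⟧ˢ t) (≡.cong (ℤ._+ jΓt) (J-swap ⟦ γ ⟧ˢ t))
        hD≡ : h D ≡ 1ℤ ℤ.+ hΓ
        hD≡ = ≡.trans (h-⊕ ⟦ γ ⟧ˢ ⟦ Γ ⟧ˢ) (≡.cong (ℤ._+ hΓ) hγ≡1)
        Dp≡ : D p ≡ 1ℤ ℤ.+ g
        Dp≡ = ≡.cong (ℤ._+ g) γp≡1
        b≡ : shift D ≡ ((ℤ.- jt ℤ.+ jΓt) ℤ.+ + m ℤ.* (1ℤ ℤ.+ hΓ) ℤ.- (h t ℤ.- (1ℤ ℤ.+ hΓ))) ℤ.- k ℤ.+ (1ℤ ℤ.+ g)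
        b≡ = ≡.cong₂ (λ x y → x ℤ.- k ℤ.+ y)
          (≡.cong₂ ℤ._-_ (≡.cong₂ (λ x y → x ℤ.+ + m ℤ.* y) jD≡ hD≡) (≡.trans (h-⊖ t D) (≡.cong (λ z → h t ℤ.- z) hD≡))) Dp≡
        M≡ : M ≡ (0ℤ ℤ.+ jΓγ) ℤ.+ (1ℤ ℤ.+ g) ℤ.- 1ℤ
        M≡ = ≡.cong₂ (λ x y → x ℤ.+ y ℤ.- 1ℤ) (≡.trans (J-⊕ˡ ⟦ γ ⟧ˢ ⟦ Γ ⟧ˢ ⟦ γ ⟧ˢ) (≡.cong (ℤ._+ jΓγ) (J-self ⟦ γ ⟧ˢ))) Dp≡
        e≡ : e ≡ (jΓt ℤ.- jΓγ) ℤ.+ + m ℤ.* hΓ ℤ.- ((h t ℤ.- 1ℤ) ℤ.- hΓ)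
        e≡ = ≡.cong₂ (λ x y → x ℤ.+ + m ℤ.* hΓ ℤ.- y) (J-⊖ʳ ⟦ Γ ⟧ˢ t ⟦ γ ⟧ˢ)
          (≡.trans (h-⊖ (t ⊖ ⟦ γ ⟧ˢ) ⟦ Γ ⟧ˢ) (≡.cong (ℤ._- hΓ) (≡.trans (h-⊖ t ⟦ γ ⟧ˢ) (≡.cong (λ z → h t ℤ.- z) hγ≡1))))
        first≡last : a Γ ℤ.+ i ≡ shift D ℤ.+ (M ℤ.- 1ℤ)
        first≡last = ≡.trans (≡.cong₂ ℤ._+_ a≡ i≡) (≡.trans (lemma jt jΓt jΓγ (+ m) hΓ (h t) k g)
          (≡.sym (≡.cong₂ (λ x y → x ℤ.+ (y ℤ.- 1ℤ)) b≡ M≡)))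
          where
          lemma : ∀ jt jΓt jΓγ m hΓ ht k g →
            (g ℤ.+ (jΓt ℤ.+ m ℤ.* hΓ ℤ.- (ht ℤ.- hΓ))) ℤ.+ (m ℤ.- ((jt ℤ.- jΓγ) ℤ.+ (k ℤ.- g) ℤ.- 1ℤ)) ≡
            (((ℤ.- jt ℤ.+ jΓt) ℤ.+ m ℤ.* (1ℤ ℤ.+ hΓ) ℤ.- (ht ℤ.- (1ℤ ℤ.+ hΓ))) ℤ.- k ℤ.+ (1ℤ ℤ.+ g)) ℤ.+ ((0ℤ ℤ.+ jΓγ) ℤ.+ (1ℤ ℤ.+ g) ℤ.- 1ℤ ℤ.- 1ℤ)
          lemma = solve-∀
        second : a Γ ℤ.+ ℤ.- i ≡ e ℤ.+ ℤ.- s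
        second = ≡.trans (≡.cong₂ (λ x y → x ℤ.+ ℤ.- y) a≡ i≡) (≡.trans (lemma jt jΓt jΓγ (+ m) hΓ (h t) k g)
          (≡.sym (≡.cong (ℤ._+ ℤ.- s) e≡)))
          where
          lemma : ∀ jt jΓt jΓγ m hΓ ht k g →
            (g ℤ.+ (jΓt ℤ.+ m ℤ.* hΓ ℤ.- (ht ℤ.- hΓ))) ℤ.+ ℤ.- (m ℤ.- ((jt ℤ.- jΓγ) ℤ.+ (k ℤ.- g) ℤ.- 1ℤ)) ≡
            ((jΓt ℤ.- jΓγ) ℤ.+ m ℤ.* hΓ ℤ.- ((ht ℤ.- 1ℤ) ℤ.- hΓ)) ℤ.+ ℤ.- ((1ℤ ℤ.+ m) ℤ.- (jt ℤ.+ k ℤ.- 1ℤ))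
          lemma = solve-∀
        third : shift D ℤ.+ (1ℤ ℤ.- M) ≡ e ℤ.+ s
        third = ≡.trans (≡.cong₂ (λ x y → x ℤ.+ (1ℤ ℤ.- y)) b≡ M≡) (≡.trans (lemma jt jΓt jΓγ (+ m) hΓ (h t) k g)
          (≡.sym (≡.cong (ℤ._+ s) e≡)))
          where
          lemma : ∀ jt jΓt jΓγ m hΓ ht k g →
            (((ℤ.- jt ℤ.+ jΓt) ℤ.+ m ℤ.* (1ℤ ℤ.+ hΓ) ℤ.- (ht ℤ.- (1ℤ ℤ.+ hΓ))) ℤ.- k ℤ.+ (1ℤ ℤ.+ g)) ℤ.+ (1ℤ ℤ.- ((0ℤ ℤ.+ jΓγ) ℤ.+ (1ℤ ℤ.+ g) ℤ.- 1ℤ)) ≡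
            ((jΓt ℤ.- jΓγ) ℤ.+ m ℤ.* hΓ ℤ.- ((ht ℤ.- 1ℤ) ℤ.- hΓ)) ℤ.+ ((1ℤ ℤ.+ m) ℤ.- (jt ℤ.+ k ℤ.- 1ℤ))
          lemma = solve-∀

-- Labelled loops

inBlock : (o t k : ℕ) → Bool
inBlock o t k = (o ≤ᵇ k) ∧ (k <ᵇ o ℕ.+ t)

-- The values at the cut of the loop with label k, where α is the list of the block sizes and o the first label.
rowOfLabel : (o : ℕ) → List ℕ → ℕ → List Bool
rowOfLabel o []      k = []
rowOfLabel o (t ∷ α) k = inBlock o t k ∷ rowOfLabel (o ℕ.+ t) α k

-- The number of labels below n in each block: the thicknesses left at the cut when only the n
-- smallest labels remain.
levels : ℕ → ℕ → List ℕ → List ℕ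
levels n o []      = []
levels n o (t ∷ α) = (n ∸ o) ⊓ t ∷ levels n (o ℕ.+ t) α

rowOfLabel-++ : ∀ o α β k → rowOfLabel o (α ++ β) k ≡ rowOfLabel o α k ++ rowOfLabel (o ℕ.+ sum α) β k
rowOfLabel-++ o []      β k = ≡.cong (λ o → rowOfLabel o β k) (≡.sym (ℕ.+-identityʳ o))
rowOfLabel-++ o (t ∷ α) β k = ≡.cong (inBlock o t k ∷_) (≡.trans (rowOfLabel-++ (o ℕ.+ t) α β k)
  (≡.cong (λ o′ → rowOfLabel (o ℕ.+ t) α k ++ rowOfLabel o′ β k) (ℕ.+-assoc o t (sum α))))

levels-++ : ∀ n o α β → levels n o (α ++ β) ≡ levels n o α ++ levels n (o ℕ.+ sum α) β
levels-++ n o []      β = ≡.cong (λ o → levels n o β) (≡.sym (ℕ.+-identityʳ o))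
levels-++ n o (t ∷ α) β = ≡.cong ((n ∸ o) ⊓ t ∷_) (≡.trans (levels-++ n (o ℕ.+ t) α β)
  (≡.cong (λ o′ → levels n (o ℕ.+ t) α ++ levels n o′ β) (ℕ.+-assoc o t (sum α))))

levels-full : ∀ n o α → o ℕ.+ sum α ≤ n → levels n o α ≡ α
levels-full n o []      _   = ≡.refl
levels-full n o (t ∷ α) o+α≤n = ≡.cong₂ _∷_ (ℕ.m≥n⇒m⊓n≡n (≡.subst (_≤ n ∸ o) (ℕ.m+n∸m≡n o t) (ℕ.∸-monoˡ-≤ o (ℕ.≤-trans (ℕ.+-monoʳ-≤ o (ℕ.m≤m+n t (sum α))) o+α≤n))))
  (levels-full n (o ℕ.+ t) α (≡.subst (_≤ n) (≡.sym (ℕ.+-assoc o t (sum α))) o+α≤n))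

levels-empty : ∀ n o α → n ≤ o → levels n o α ≡ map (const 0) α
levels-empty n o []      _   = ≡.refl
levels-empty n o (t ∷ α) n≤o = ≡.cong₂ _∷_ (≡.cong (_⊓ t) (ℕ.m≤n⇒m∸n≡0 n≤o)) (levels-empty n (o ℕ.+ t) α (ℕ.≤-trans n≤o (ℕ.m≤m+n o t)))

private
  ∧-falseˡ : ∀ {a b} → ¬ T a → a ∧ b ≡ false
  ∧-falseˡ {true}  ¬a = ⊥-elim (¬a tt)
  ∧-falseˡ {false} _  = ≡.refl

  ∧-falseʳ : ∀ {a b} → ¬ T b → a ∧ b ≡ false
  ∧-falseʳ {true}  {true}  ¬b = ⊥-elim (¬b tt)
  ∧-falseʳ {true}  {false} _  = ≡.refl
  ∧-falseʳ {false}         _  = ≡.refl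

  T⇒true : ∀ {a} → T a → a ≡ true
  T⇒true {true} _ = ≡.refl

inBlock-below : ∀ {o k} t → k < o → inBlock o t k ≡ false
inBlock-below t k<o = ∧-falseˡ (λ o≤k → ℕ.<⇒≱ k<o (ℕ.≤ᵇ⇒≤ _ _ o≤k))

inBlock-above : ∀ {o t k} → o ℕ.+ t ≤ k → inBlock o t k ≡ false
inBlock-above {o} {t} {k} o+t≤k = ∧-falseʳ {o ≤ᵇ k} (λ k<o+t → ℕ.<⇒≱ (ℕ.<ᵇ⇒< _ _ k<o+t) o+t≤k)

inBlock-in : ∀ {o t k} → o ≤ k → k < o ℕ.+ t → inBlock o t k ≡ true
inBlock-in o≤k k<o+t = ≡.cong₂ _∧_ (T⇒true (ℕ.≤⇒≤ᵇ o≤k)) (T⇒true (ℕ.<⇒<ᵇ k<o+t))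

rowOfLabel-below : ∀ o α k → k < o → rowOfLabel o α k ≡ map (const false) α
rowOfLabel-below o []      k _   = ≡.refl
rowOfLabel-below o (t ∷ α) k k<o = ≡.cong₂ _∷_ (inBlock-below t k<o) (rowOfLabel-below (o ℕ.+ t) α k (ℕ.<-≤-trans k<o (ℕ.m≤m+n o t)))

rowOfLabel-above : ∀ o α k → o ℕ.+ sum α ≤ k → rowOfLabel o α k ≡ map (const false) α
rowOfLabel-above o []      k _     = ≡.refl
rowOfLabel-above o (t ∷ α) k o+α≤k = ≡.cong₂ _∷_ (inBlock-above {o} {t} (ℕ.≤-trans (ℕ.+-monoʳ-≤ o (ℕ.m≤m+n t (sum α))) o+α≤k))
  (rowOfLabel-above (o ℕ.+ t) α k (≡.subst (_≤ k) (≡.sym (ℕ.+-assoc o t (sum α))) o+α≤k))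

findBlock : {A : Set} (th : A → ℕ) (es : List A) (o n : ℕ) → o ≤ n → n < o ℕ.+ sum (map th es) →
  ∃ λ ls → ∃ λ p → ∃ λ rs → es ≡ ls ++ p ∷ rs × o ℕ.+ sum (map th ls) ≤ n × n < (o ℕ.+ sum (map th ls)) ℕ.+ th p
findBlock th []       o n o≤n n<o = ⊥-elim (ℕ.<⇒≱ n<o (≡.subst (_≤ n) (≡.sym (ℕ.+-identityʳ o)) o≤n))
findBlock th (e ∷ es) o n o≤n n<  with n ℕ.<? o ℕ.+ th e
... | yes n<o+t = [] , e , es , ≡.refl , ≡.subst (_≤ n) (≡.sym (ℕ.+-identityʳ o)) o≤n , ≡.subst (λ o → n < o ℕ.+ th e) (≡.sym (ℕ.+-identityʳ o)) n<o+t
... | no  n≮o+t with findBlock th es (o ℕ.+ th e) n (ℕ.≮⇒≥ n≮o+t) (≡.subst (n <_) (≡.sym (ℕ.+-assoc o (th e) _)) n<)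
...   | ls , p , rs , eq , ≤n , n<′ = e ∷ ls , p , rs , ≡.cong (e ∷_) eq , ≡.subst (_≤ n) (ℕ.+-assoc o (th e) _) ≤n , ≡.subst (λ o → n < o ℕ.+ th p) (ℕ.+-assoc o (th e) _) n<′

module LabelledFlows {w : Web} (I : RadialCut w) where
  open import Data.Nat.Base using (_+_)
  open Flows I

  C : Weight → Weight → ℤ
  C f g = ∑ᶻ cut (λ e → f e ℤ.* g e)

  C-cong : ∀ {f f′ g} → f ≗ f′ → C f g ≡ C f′ g
  C-cong p = ∑ᶻ-cong cut (λ e → ≡.cong (ℤ._* _) (p e))

  -- The signed number of attacking pairs (u , v) with u < v, for the loop γ of label v and the sum f of the loops of the labels u < v.
  attacks : Weight → Vec Bool edges → ℤ
  attacks f γ = J f ⟦ γ ⟧ˢ ℤ.+ C f ⟦ γ ⟧ˢ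

  attacks-cong : ∀ {f f′} γ → f ≗ f′ → attacks f γ ≡ attacks f′ γ
  attacks-cong γ p = ≡.cong₂ ℤ._+_ (J-cong {g = ⟦ γ ⟧ˢ} p (λ _ → ≡.refl)) (C-cong {g = ⟦ γ ⟧ˢ} p)

  AtRow : ℕ → Vec Bool edges → Set
  AtRow k γ = map (lookup γ) cut ≡ rowOfLabel 0 initialThickness k

  atRow? : ∀ k γ → Dec (AtRow k γ)
  atRow? k γ = List.≡-dec Bool._≟_ _ _

  sumLoops : ∀ {n} → Vec (Vec Bool edges) n → Weight
  sumLoops []      e = 0ℤ
  sumLoops (γ ∷ g) e = ⟦ γ ⟧ˢ e ℤ.+ sumLoops g e

  attackVector : ∀ {n} → Weight → Vec (Vec Bool edges) n → Vec ℤ n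
  attackVector f []      = []
  attackVector f (γ ∷ g) = attacks f γ ∷ attackVector (f ⊕ ⟦ γ ⟧ˢ) g

  Rows : ∀ {n} → ℕ → Vec (Vec Bool edges) n → Set
  Rows k []      = ⊤
  Rows k (γ ∷ g) = (Flow ⟦ γ ⟧ˢ × AtRow k γ) × Rows (suc k) g

  rows? : ∀ {n} k (g : Vec (Vec Bool edges) n) → Dec (Rows k g)
  rows? k []      = yes tt
  rows? k (γ ∷ g) = (flow? γ ×-dec atRow? k γ) ×-dec rows? (suc k) g

  -- The transposed form of a standard labeled loop decomposition of t: one flow for each label,
  -- starting in its block, with sum t.
  Valid : ∀ {n} → Weight → Vec (Vec Bool edges) n → Set
  Valid t g = Rows 0 g × (∀ e → sumLoops g e ≡ t e)

  abstract
    valid? : ∀ {n} t (g : Vec (Vec Bool edges) n) → Dec (Valid t g)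
    valid? t g = rows? 0 g ×-dec Fin.all? (λ e → sumLoops g e ℤ.≟ t e)

  0ʷ : Weight
  0ʷ _ = 0ℤ

-- The recursion over labels

module LabelledLoops {c ℓ} {R : CommutativeRing c ℓ} (exp : Exponential R) {w : Web} (I : RadialCut w) (m : ℕ) where
  open import Data.Nat.Base using (_+_)
  open CommutativeRing R hiding (zero) renaming (_+_ to _⊞_)
  open Exponential exp
  open Sums R
  open Flows I
  open LabelledFlows I
  open PrincipalSpecialization exp I
  open Peeling exp I using (bracket-cong; meet; loop-at; peel)
  open Relation.Binary.Reasoning.Setoid setoid

  -- The sum over all labelled loop decompositions of the product of the brackets, with the largest
  -- label removed first.
  Q : ℕ → Weight → Carrier
  Q zero    t = when (Fin.all? (λ e → t e ℤ.≟ 0ℤ)) 1#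
  Q (suc n) t = ∑ flows (λ γ → when (atRow? n γ) (bracket (+ m ℤ.- attacks (t ⊖ ⟦ γ ⟧ˢ) γ) * Q n (t ⊖ ⟦ γ ⟧ˢ)))

  private
    -- Rows stay empty along the sweep: a vertex with empty inputs has empty outputs.
    flow-zero : ∀ {γ} → Flow ⟦ γ ⟧ˢ → (∀ {e} → e ∈ cut → lookup γ e ≡ false) → ∀ e → lookup γ e ≡ false
    flow-zero {γ} f cut≡0 e with covered e
    ... | inj₁ e∈ = cut≡0 e∈
    ... | inj₂ e∈ = go sweep f cut≡0 e∈
      where
      vertex : ∀ v → Conserved ⟦ γ ⟧ˢ v → (∀ {e} → e ∈ incoming v → lookup γ e ≡ false) → ∀ {e} → e ∈ outgoing v → lookup γ e ≡ false
      vertex (merge x y o) eq z (here ≡.refl) with lookup γ x | lookup γ y | lookup γ o | z (here ≡.refl) | z (there (here ≡.refl))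
      ... | _ | _ | false | _ | _ = ≡.refl
      vertex (merge x y o) () z (here ≡.refl) | _ | _ | true | ≡.refl | ≡.refl
      vertex (split i x y) eq z e∈ with lookup γ i | lookup γ x in eqx | lookup γ y in eqy | z (here ≡.refl)
      vertex (split i x y) eq z (here ≡.refl)         | _ | false | false | ≡.refl = eqx
      vertex (split i x y) eq z (there (here ≡.refl)) | _ | false | false | ≡.refl = eqy
      vertex (split i x y) () z e∈ | _ | true  | true  | ≡.refl
      vertex (split i x y) () z e∈ | _ | true  | false | ≡.refl
      vertex (split i x y) () z e∈ | _ | false | true  | ≡.refl
      go : ∀ {r vs r′} → Sweep r vs r′ → All (Conserved ⟦ γ ⟧ˢ) vs → (∀ {e} → e ∈ r → lookup γ e ≡ false) →
        ∀ {e} → e ∈ concatMap outgoing vs → lookup γ e ≡ false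
      go (pass {v = v} {vs} ls rs _ ≡.refl sw) (eq ∷ f) z e∈ = at (∈.∈-++⁻ (outgoing v) e∈)
        where
        out : ∀ {e} → e ∈ outgoing v → lookup γ e ≡ false
        out = vertex v eq (λ e∈ → z (∈.∈-++⁺ʳ ls (∈.∈-++⁺ˡ e∈)))
        next : ∀ {e} → e ∈ ls ++ outgoing v ++ rs → lookup γ e ≡ false
        next e∈ with ∈.∈-++⁻ ls e∈
        ... | inj₁ e∈ls = z (∈.∈-++⁺ˡ e∈ls)
        ... | inj₂ e∈′ with ∈.∈-++⁻ (outgoing v) e∈′
        ...   | inj₁ e∈o  = out e∈o
        ...   | inj₂ e∈rs = z (∈.∈-++⁺ʳ ls (∈.∈-++⁺ʳ (incoming v) e∈rs))
        at : ∀ {e} → e ∈ outgoing v ⊎ e ∈ concatMap outgoing vs → lookup γ e ≡ false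
        at (inj₁ e∈) = out e∈
        at (inj₂ e∈) = go sw f next e∈

  -- Without strands at the cut there is only the empty colouring.
  X̂-empty : ∀ m t → (∀ {e} → e ∈ cut → t e ≡ 0ℤ) → X̂ m t ≈ X̂ 0 t
  X̂-empty zero    t t≡0 = refl
  X̂-empty (suc m) t t≡0 = begin
    ∑ flows (λ Γ → E (weight m ⟦ Γ ⟧ˢ t) * X̂ m (t ⊖ ⟦ Γ ⟧ˢ))
      ≈⟨ ∑-cong-∈ flows (λ {Γ} Γ∈ → only-∅ Γ (proj₂ (∈.∈-filter⁻ flow? {xs = subsets edges} Γ∈)) (Vec.≡-dec Bool._≟_ ∅ Γ)) ⟩
    ∑ flows (λ Γ → when (Vec.≡-dec Bool._≟_ ∅ Γ) (X̂ m t))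
      ≈⟨ ∑-δ (Vec.≡-dec Bool._≟_) {flows} {λ _ → X̂ m t} (Unique.filter⁺ flow? (subsets-unique edges)) (∈.∈-filter⁺ flow? (∈-subsets ∅) ∅-flow) ⟩
    X̂ m t
      ≈⟨ X̂-empty m t t≡0 ⟩
    X̂ 0 t ∎
    where
    ∅ : Vec Bool edges
    ∅ = Vec.replicate edges false
    ∅-lookup : ∀ e → lookup ∅ e ≡ false
    ∅-lookup e = Vec.lookup-replicate e false
    ∅-zero : ⟦ ∅ ⟧ˢ ≗ (λ _ → 0ℤ)
    ∅-zero e = ≡.cong 𝟚 (∅-lookup e)
    ∅-flow : Flow ⟦ ∅ ⟧ˢ
    ∅-flow = All.tabulate λ {v} _ → ≡.trans (∑ᶻ-cong (incoming v) ∅-zero) (≡.trans (∑ᶻ-0 (incoming v))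
      (≡.sym (≡.trans (∑ᶻ-cong (outgoing v) ∅-zero) (∑ᶻ-0 (outgoing v)))))
    t-∅ : t ⊖ ⟦ ∅ ⟧ˢ ≗ t
    t-∅ e = ≡.trans (≡.cong (λ z → t e ℤ.- z) (∅-zero e)) (ℤ.+-identityʳ (t e))
    weight-∅ : weight m ⟦ ∅ ⟧ˢ t ≡ 0ℤ
    weight-∅ = ≡.trans (weight-cong m {⟦ ∅ ⟧ˢ} {λ _ → 0ℤ} {t} ∅-zero (λ _ → ≡.refl)) (≡.cong₂ ℤ._-_ (≡.cong₂ ℤ._+_ J≡0 (≡.trans (≡.cong (+ m ℤ.*_) (∑ᶻ-0 cut)) (ℤ.*-zeroʳ (+ m)))) h≡0)
      where
      J≡0 : J (λ _ → 0ℤ) t ≡ 0ℤ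
      J≡0 = ≡.trans (∑ᶻ-cong order {g = λ _ → 0ℤ} λ { (merge _ _ _) → ≡.refl ; (split _ _ _) → ≡.refl }) (∑ᶻ-0 order)
      h≡0 : h (t ⊖ (λ _ → 0ℤ)) ≡ 0ℤ
      h≡0 = ≡.trans (Sums.∑-cong-∈ ℤ.+-*-commutativeRing cut (λ e∈ → ≡.trans (ℤ.+-identityʳ _) (t≡0 e∈))) (∑ᶻ-0 cut)
    only-∅ : ∀ Γ → Flow ⟦ Γ ⟧ˢ → (d : Dec (∅ ≡ Γ)) → E (weight m ⟦ Γ ⟧ˢ t) * X̂ m (t ⊖ ⟦ Γ ⟧ˢ) ≈ when d (X̂ m t)
    only-∅ Γ f (yes ≡.refl) = trans (*-cong (trans (reflexive (≡.cong E weight-∅)) E-0) (X̂-cong m t-∅)) (*-identityˡ _)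
    only-∅ Γ f (no ∅≢Γ) = go (All.all? (λ e → lookup Γ e Bool.≟ false) cut)
      where
      go : Dec (All (λ e → lookup Γ e ≡ false) cut) → E (weight m ⟦ Γ ⟧ˢ t) * X̂ m (t ⊖ ⟦ Γ ⟧ˢ) ≈ 0#
      go (yes Γ≡0) = ⊥-elim (∅≢Γ (≡.trans (≡.sym (Vec.tabulate∘lookup ∅)) (≡.trans (Vec.tabulate-cong λ e →
        ≡.trans (∅-lookup e) (≡.sym (flow-zero {Γ} f (All.lookup Γ≡0) e))) (Vec.tabulate∘lookup Γ))))
      go (no Γ≢0) with find cut Γ≢0
        where
        find : ∀ es → ¬ All (λ e → lookup Γ e ≡ false) es → ∃ λ e → e ∈ es × lookup Γ e ≡ true
        find []       ¬all = ⊥-elim (¬all [])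
        find (e ∷ es) ¬all with lookup Γ e in eq
        ... | true  = e , here ≡.refl , eq
        ... | false with find es (λ all → ¬all (eq ∷ all))
        ...   | e′ , e′∈ , eq′ = e′ , there e′∈ , eq′
      ... | e , e∈ , Γe = trans (*-congˡ (X̂-overfull m {t} (t≡0 e∈) Γ Γe)) (zeroʳ _)

  private
    map-≡⇒All : ∀ {A B : Set} {f g : A → B} xs → map f xs ≡ map g xs → All (λ x → f x ≡ g x) xs
    map-≡⇒All []       _  = []
    map-≡⇒All (x ∷ xs) eq = List.∷-injectiveˡ eq ∷ map-≡⇒All xs (List.∷-injectiveʳ eq)

    All⇒map-≡ : ∀ {A B : Set} {f g : A → B} {xs} → All (λ x → f x ≡ g x) xs → map f xs ≡ map g xs
    All⇒map-≡ []       = ≡.refl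
    All⇒map-≡ (p ∷ ps) = ≡.cong₂ _∷_ p (All⇒map-≡ ps)

    map-const : ∀ {A B C : Set} {c : C} (f : A → B) xs → map (const c) (map f xs) ≡ map (const c) xs
    map-const f xs = ≡.sym (List.map-∘ xs)

    ++-prefix : ∀ {A B C : Set} {f : A → C} {g : B → C} xs ys {us vs} → length xs ≡ length ys →
      map f xs ++ us ≡ map g ys ++ vs → us ≡ vs
    ++-prefix []       []       _   eq = eq
    ++-prefix (x ∷ xs) (y ∷ ys) len eq = ++-prefix xs ys (ℕ.suc-injective len) (List.∷-injectiveʳ eq)

  factorials-++ : ∀ α β → factorials (α ++ β) ≈ factorials α * factorials β
  factorials-++ []      β = sym (*-identityˡ _)
  factorials-++ (a ∷ α) β = trans (*-congˡ (factorials-++ α β)) (sym (*-assoc _ _ _))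

  factorials-0 : ∀ (α : List ℕ) → factorials (map (const 0) α) ≈ 1#
  factorials-0 []      = refl
  factorials-0 (a ∷ α) = trans (*-identityˡ _) (factorials-0 α)

  -- Label n lies in the block of p, preceded there by k = n ∸ lo smaller labels. With the labels up
  -- to n present, the strands to the right of p are absent, which is the situation of `peel`.
  module NextLabel (n : ℕ) (ls : List Edge) (p : Edge) (rs : List Edge) (cut≡ : cut ≡ ls ++ p ∷ rs)
    (lo≤n : sum (map thickness ls) ≤ n) (n<hi : n < sum (map thickness ls) + thickness p) where
    private
      Aₗ Aᵣ zeros : List ℕ
      Aₗ = map thickness ls
      Aᵣ = map thickness rs
      zeros = map (const 0) rs
      lo = sum Aₗ
      k = n ∸ lo

      α≡ : initialThickness ≡ Aₗ ++ thickness p ∷ Aᵣ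
      α≡ = ≡.trans (≡.cong (map thickness) cut≡) (List.map-++ thickness ls (p ∷ rs))

      p∈cut : p ∈ cut
      p∈cut = ≡.subst (p ∈_) (≡.sym cut≡) (∈.∈-++⁺ʳ ls (here ≡.refl))

      unique : Unique (ls ++ p ∷ rs)
      unique = ≡.subst Unique cut≡ (sweep-unique sweep)

      1+n∸lo : suc n ∸ lo ≡ suc k
      1+n∸lo = ℕ.+-∸-assoc 1 lo≤n

      levels-at : ∀ j → lo ≤ j → j ≤ lo + thickness p → levels j 0 initialThickness ≡ Aₗ ++ (j ∸ lo) ∷ zeros
      levels-at j lo≤j j≤hi = ≡.trans (≡.cong (levels j 0) α≡) (≡.trans (levels-++ j 0 Aₗ (thickness p ∷ Aᵣ))
        (≡.cong₂ _++_ (levels-full j 0 Aₗ lo≤j) (≡.cong₂ _∷_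
          (ℕ.m≤n⇒m⊓n≡m (≡.subst (j ∸ lo ≤_) (ℕ.m+n∸m≡n lo (thickness p)) (ℕ.∸-monoˡ-≤ lo j≤hi)))
          (≡.trans (levels-empty j (lo + thickness p) Aᵣ j≤hi) (map-const thickness rs)))))

    levels-before : levels n 0 initialThickness ≡ Aₗ ++ k ∷ zeros
    levels-before = levels-at n lo≤n (ℕ.<⇒≤ n<hi)

    levels-after : levels (suc n) 0 initialThickness ≡ Aₗ ++ suc k ∷ zeros
    levels-after = ≡.trans (levels-at (suc n) (ℕ.m≤n⇒m≤1+n lo≤n) n<hi) (≡.cong (λ j → Aₗ ++ j ∷ zeros) 1+n∸lo)

    row≡ : rowOfLabel 0 initialThickness n ≡ map (λ e → does (p Fin.≟ e)) cut
    row≡ = ≡.trans (≡.cong (λ α → rowOfLabel 0 α n) α≡) (≡.trans (rowOfLabel-++ 0 Aₗ (thickness p ∷ Aᵣ) n) (≡.trans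
      (≡.cong₂ _++_ (≡.trans (rowOfLabel-above 0 Aₗ n lo≤n) (map-const thickness ls))
        (≡.cong₂ _∷_ (inBlock-in lo≤n n<hi) (≡.trans (rowOfLabel-below (lo + thickness p) Aᵣ n n<hi) (map-const thickness rs))))
      (≡.sym (≡.trans (≡.cong (map _) cut≡) (≡.trans (List.map-++ _ ls (p ∷ rs)) (≡.cong₂ _++_
        (All⇒map-≡ (All.tabulate λ {e} e∈ → dec-false (p Fin.≟ e) λ { ≡.refl → unique-disjoint ls unique e∈ (here ≡.refl) }))
        (≡.cong₂ _∷_ (dec-true (p Fin.≟ p) ≡.refl) (All⇒map-≡ (All.tabulate λ {e} e∈ → dec-false (p Fin.≟ e) (p∉rs e∈))))))))))
      where
      p∉rs : ∀ {e} → e ∈ rs → p ≢ e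
      p∉rs e∈ with unique-++ʳ ls unique
      ... | p∉ ∷ _ = All.lookup p∉ e∈

    atRow⇒loop : ∀ {γ} → AtRow n γ → LoopAt p γ
    atRow⇒loop eq = map-≡⇒All cut (≡.trans eq row≡)

    loop⇒atRow : ∀ {γ} → LoopAt p γ → AtRow n γ
    loop⇒atRow l = ≡.trans (All⇒map-≡ l) (≡.sym row≡)

    -- Label n raises the level of its block from k to k + 1 and leaves the other levels alone.
    factorials-step : factorials (levels (suc n) 0 initialThickness) ≈ factorials (levels n 0 initialThickness) * bracket (+ suc k)
    factorials-step = begin
      factorials (levels (suc n) 0 initialThickness)                          ≡⟨ ≡.cong factorials levels-after ⟩
      factorials (Aₗ ++ suc k ∷ zeros)                                         ≈⟨ factorials-++ Aₗ (suc k ∷ zeros) ⟩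
      factorials Aₗ * ((quantum-factorial k * bracket (+ suc k)) * factorials zeros)  ≈⟨ *-congˡ (trans (*-assoc _ _ _) (trans (*-congˡ (*-comm _ _)) (sym (*-assoc _ _ _)))) ⟩
      factorials Aₗ * ((quantum-factorial k * factorials zeros) * bracket (+ suc k))  ≈⟨ *-assoc _ _ _ ⟨
      (factorials Aₗ * factorials (k ∷ zeros)) * bracket (+ suc k)             ≈⟨ *-congʳ (factorials-++ Aₗ (k ∷ zeros)) ⟨
      factorials (Aₗ ++ k ∷ zeros) * bracket (+ suc k)                         ≡⟨ ≡.cong (λ α → factorials α * bracket (+ suc k)) levels-before ⟨
      factorials (levels n 0 initialThickness) * bracket (+ suc k)            ∎

    module _ (t : Weight) (t-cut : map t cut ≡ map (+_) (levels (suc n) 0 initialThickness)) where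
      private
        t-cut++ : map t ls ++ map t (p ∷ rs) ≡ map (+_) Aₗ ++ map (+_) (suc k ∷ zeros)
        t-cut++ = ≡.trans (≡.sym (List.map-++ t ls (p ∷ rs))) (≡.trans (≡.cong (map t) (≡.sym cut≡)) (≡.trans t-cut
          (≡.trans (≡.cong (map (+_)) levels-after) (List.map-++ (+_) Aₗ (suc k ∷ zeros)))))

        tail≡ : map t (p ∷ rs) ≡ map (+_) (suc k ∷ zeros)
        tail≡ = ++-prefix ls Aₗ (≡.sym (List.length-map thickness ls)) t-cut++

      tp≡ : t p ≡ + suc k
      tp≡ = List.∷-injectiveˡ tail≡

      t-rs : ∀ {e} → e ∈ rs → t e ≡ 0ℤ
      t-rs = All.lookup (map-≡⇒All rs (≡.trans (List.∷-injectiveʳ tail≡) (≡.sym (List.map-∘ rs))))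

      rest-cut : ∀ {γ} → LoopAt p γ → map (t ⊖ ⟦ γ ⟧ˢ) cut ≡ map (+_) (levels n 0 initialThickness)
      rest-cut {γ} l = ≡.trans (≡.cong (map _) cut≡) (≡.trans (List.map-++ _ ls (p ∷ rs)) (≡.trans
        (≡.cong₂ _++_ (All⇒map-≡ (All.tabulate λ {e} e∈ → off e∈ λ { ≡.refl → unique-disjoint ls unique e∈ (here ≡.refl) }))
          (≡.cong₂ _∷_ (≡.trans (≡.cong₂ ℤ._-_ tp≡ (loop-at {p} {γ} p∈cut l)) ≡.refl)
            (All⇒map-≡ (All.tabulate λ {e} e∈ → off′ e∈ (p∉rs e∈)))))
        (≡.trans (≡.cong₂ (λ a b → a ++ + k ∷ b) left≡ (≡.trans (All⇒map-≡ (All.tabulate λ e∈ → t-rs e∈)) (List.map-∘ rs)))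
          (≡.sym (≡.trans (≡.cong (map (+_)) levels-before) (List.map-++ (+_) Aₗ (k ∷ zeros)))))))
        where
        p∉rs : ∀ {e} → e ∈ rs → p ≢ e
        p∉rs e∈ with unique-++ʳ ls unique
        ... | p∉ ∷ _ = All.lookup p∉ e∈
        γ≡0 : ∀ {e} → e ∈ cut → p ≢ e → ⟦ γ ⟧ˢ e ≡ 0ℤ
        γ≡0 {e} e∈ p≢e = ≡.cong 𝟚 (≡.trans (All.lookup l e∈) (dec-false (p Fin.≟ e) p≢e))
        off : ∀ {e} → e ∈ ls → p ≢ e → (t ⊖ ⟦ γ ⟧ˢ) e ≡ t e
        off {e} e∈ p≢e = ≡.trans (≡.cong (λ z → t e ℤ.- z) (γ≡0 (≡.subst (e ∈_) (≡.sym cut≡) (∈.∈-++⁺ˡ e∈)) p≢e)) (ℤ.+-identityʳ (t e))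
        off′ : ∀ {e} → e ∈ rs → p ≢ e → (t ⊖ ⟦ γ ⟧ˢ) e ≡ t e
        off′ {e} e∈ p≢e = ≡.trans (≡.cong (λ z → t e ℤ.- z) (γ≡0 (≡.subst (e ∈_) (≡.sym cut≡) (∈.∈-++⁺ʳ ls (there e∈))) p≢e)) (ℤ.+-identityʳ (t e))
        left≡ : map t ls ≡ map (+_) Aₗ
        left≡ = List.++-cancelʳ (map t (p ∷ rs)) _ _ (≡.trans t-cut++ (≡.cong (λ xs → map (+_) Aₗ ++ xs) (≡.sym tail≡)))

      -- J γ γ = 0 takes care of the merges. At the cut γ is only at p, together with the t p - 1
      -- other strands of its block.
      attacks≡meet : ∀ {γ} → LoopAt p γ → attacks (t ⊖ ⟦ γ ⟧ˢ) γ ≡ meet t p γ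
      attacks≡meet {γ} l = ≡.trans (≡.cong₂ ℤ._+_ (≡.trans (J-⊖ˡ t ⟦ γ ⟧ˢ ⟦ γ ⟧ˢ) (≡.cong (λ z → J t ⟦ γ ⟧ˢ ℤ.- z) (J-self ⟦ γ ⟧ˢ))) C≡) (lemma (J t ⟦ γ ⟧ˢ) (t p))
        where
        lemma : ∀ j x → (j ℤ.- 0ℤ) ℤ.+ (x ℤ.- 1ℤ) ≡ j ℤ.+ x ℤ.- 1ℤ
        lemma = solve-∀
        pick : ∀ x {b} → (d : Dec b) → x ℤ.* 𝟚 (does d) ≡ (if does d then x else 0ℤ)
        pick x (yes _) = ℤ.*-identityʳ x
        pick x (no _)  = ℤ.*-zeroʳ x
        C≡ : C (t ⊖ ⟦ γ ⟧ˢ) ⟦ γ ⟧ˢ ≡ t p ℤ.- 1ℤ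
        C≡ = ≡.trans (Sums.∑-cong-∈ ℤ.+-*-commutativeRing cut (λ {e} e∈ →
               ≡.trans (≡.cong (λ b → (t ⊖ ⟦ γ ⟧ˢ) e ℤ.* 𝟚 b) (All.lookup l e∈)) (pick ((t ⊖ ⟦ γ ⟧ˢ) e) (p Fin.≟ e))))
             (≡.trans (Sums.∑-δ ℤ.+-*-commutativeRing Fin._≟_ {cut} {t ⊖ ⟦ γ ⟧ˢ} (sweep-unique sweep) p∈cut)
               (≡.cong (λ z → t p ℤ.- z) (loop-at {p} {γ} p∈cut l)))

      Q-step : (∀ t′ → map t′ cut ≡ map (+_) (levels n 0 initialThickness) → Q n t′ ≈ factorials (levels n 0 initialThickness) * X̂ m t′) →
        Q (suc n) t ≈ factorials (levels (suc n) 0 initialThickness) * X̂ m t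
      Q-step hyp = begin
        ∑ flows (λ γ → when (atRow? n γ) (bracket (+ m ℤ.- attacks (t ⊖ ⟦ γ ⟧ˢ) γ) * Q n (t ⊖ ⟦ γ ⟧ˢ)))
          ≈⟨ ∑-cong flows (λ γ → when-cong (atRow? n γ) (loopAt? p γ) (atRow⇒loop {γ}) (loop⇒atRow {γ}) (λ row → step γ (atRow⇒loop {γ} row))) ⟩
        ∑ flows (λ γ → when (loopAt? p γ) (f * (bracket (+ m ℤ.- meet t p γ) * X̂ m (t ⊖ ⟦ γ ⟧ˢ))))
          ≈⟨ ∑-filter (loopAt? p) flows ⟨
        ∑ (loops p) (λ γ → f * (bracket (+ m ℤ.- meet t p γ) * X̂ m (t ⊖ ⟦ γ ⟧ˢ)))
          ≈⟨ ∑-*ˡ f (loops p) ⟨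
        f * ∑ (loops p) (λ γ → bracket (+ m ℤ.- meet t p γ) * X̂ m (t ⊖ ⟦ γ ⟧ˢ))
          ≈⟨ *-congˡ (peel p rs (ls , cut≡) m t t-rs) ⟨
        f * (bracket (t p) * X̂ m t)
          ≈⟨ *-assoc _ _ _ ⟨
        (f * bracket (t p)) * X̂ m t
          ≈⟨ *-congʳ (trans (*-congˡ (bracket-cong tp≡)) (sym factorials-step)) ⟩
        factorials (levels (suc n) 0 initialThickness) * X̂ m t ∎
        where
        f = factorials (levels n 0 initialThickness)
        step : ∀ γ → LoopAt p γ → bracket (+ m ℤ.- attacks (t ⊖ ⟦ γ ⟧ˢ) γ) * Q n (t ⊖ ⟦ γ ⟧ˢ) ≈ f * (bracket (+ m ℤ.- meet t p γ) * X̂ m (t ⊖ ⟦ γ ⟧ˢ))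
        step γ l = begin
          bracket (+ m ℤ.- attacks (t ⊖ ⟦ γ ⟧ˢ) γ) * Q n (t ⊖ ⟦ γ ⟧ˢ)
            ≈⟨ *-cong (bracket-cong (≡.cong (λ z → + m ℤ.- z) (attacks≡meet {γ} l))) (hyp (t ⊖ ⟦ γ ⟧ˢ) (rest-cut {γ} l)) ⟩
          bracket (+ m ℤ.- meet t p γ) * (f * X̂ m (t ⊖ ⟦ γ ⟧ˢ))
            ≈⟨ trans (sym (*-assoc _ _ _)) (trans (*-congʳ (*-comm _ _)) (*-assoc _ _ _)) ⟩
          f * (bracket (+ m ℤ.- meet t p γ) * X̂ m (t ⊖ ⟦ γ ⟧ˢ)) ∎

  -- Each removal of a label is one application of `peel`, whose factor q^(k+1) - q^-(k+1) on the
  -- left builds up the quantum factorials of the blocks.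
  Q≈X̂ : ∀ n → n ≤ degree → ∀ t → map t cut ≡ map (+_) (levels n 0 initialThickness) → Q n t ≈ factorials (levels n 0 initialThickness) * X̂ m t
  Q≈X̂ zero _ t t-cut = begin
    X̂ 0 t                                       ≈⟨ X̂-empty m t (All.lookup (map-≡⇒All cut (≡.trans t-cut (≡.trans (≡.cong (map (+_)) (levels-empty 0 0 initialThickness z≤n))
                                                     (≡.trans (≡.sym (List.map-∘ initialThickness)) (map-const thickness cut)))))) ⟨
    X̂ m t                                       ≈⟨ *-identityˡ _ ⟨
    1# * X̂ m t                                  ≈⟨ *-congʳ (trans (reflexive (≡.cong factorials (levels-empty 0 0 initialThickness z≤n))) (factorials-0 initialThickness)) ⟨
    factorials (levels 0 0 initialThickness) * X̂ m t ∎
  Q≈X̂ (suc n) n<d t t-cut with findBlock thickness cut 0 n z≤n n<d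
  ... | ls , p , rs , cut≡ , lo≤n , n<hi = NextLabel.Q-step n ls p rs cut≡ lo≤n n<hi t t-cut (Q≈X̂ n (ℕ.<⇒≤ n<d))

-- A chosen label will lie in the first row of the hook, where the pairs with smaller labels count
-- -1.
sign : Bool → ℤ
sign b = if b then -1ℤ else 1ℤ

dot : ∀ {n} → (Fin n → ℤ) → Vec ℤ n → ℤ
dot s []       = 0ℤ
dot s (ν ∷ νs) = s zero ℤ.* ν ℤ.+ dot (s ∘ suc) νs

signs : ∀ {n} → Subset n → Fin n → ℤ
signs S u = sign (Vec.lookup S u)

-- Expansion of the product of brackets

module LoopTuples {c ℓ} {R : CommutativeRing c ℓ} (exp : Exponential R) {w : Web} (I : RadialCut w) (m : ℕ) where
  open CommutativeRing R hiding (zero) renaming (_+_ to _⊞_)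
  open Exponential exp
  open Sums R
  open Flows I
  open Peeling exp I using (bracket-cong)
  open LabelledFlows I
  open LabelledLoops exp I m
  open Relation.Binary.Reasoning.Setoid setoid
  open IntegerCoefficients R using (solve; _:=_; _:+_; _:*_; _:-_; :-_; con)

  bracketProduct : ∀ {n} → Vec ℤ n → Carrier
  bracketProduct []       = 1#
  bracketProduct (ν ∷ νs) = bracket (+ m ℤ.- ν) * bracketProduct νs

  private
    rows-∷ʳ⁻ : ∀ {n} k (g : Vec (Vec Bool edges) n) γ → Rows k (g ∷ʳ γ) → Rows k g × Flow ⟦ γ ⟧ˢ × AtRow (k ℕ.+ n) γ
    rows-∷ʳ⁻ k []      γ ((f , r) , _) = tt , f , ≡.subst (λ k → AtRow k γ) (≡.sym (ℕ.+-identityʳ k)) r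
    rows-∷ʳ⁻ {suc n} k (δ ∷ g) γ (d , rs) with rows-∷ʳ⁻ (suc k) g γ rs
    ... | rs′ , f , r = (d , rs′) , f , ≡.subst (λ k → AtRow k γ) (≡.sym (ℕ.+-suc k n)) r

    rows-∷ʳ⁺ : ∀ {n} k (g : Vec (Vec Bool edges) n) γ → Rows k g → Flow ⟦ γ ⟧ˢ → AtRow (k ℕ.+ n) γ → Rows k (g ∷ʳ γ)
    rows-∷ʳ⁺ k []      γ _ f r = (f , ≡.subst (λ k → AtRow k γ) (ℕ.+-identityʳ k) r) , tt
    rows-∷ʳ⁺ {suc n} k (δ ∷ g) γ (d , rs) f r = d , rows-∷ʳ⁺ (suc k) g γ rs f (≡.subst (λ k → AtRow k γ) (ℕ.+-suc k n) r)

    sumLoops-∷ʳ : ∀ {n} (g : Vec (Vec Bool edges) n) γ e → sumLoops (g ∷ʳ γ) e ≡ sumLoops g e ℤ.+ ⟦ γ ⟧ˢ e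
    sumLoops-∷ʳ []      γ e = ℤ.+-comm (⟦ γ ⟧ˢ e) 0ℤ
    sumLoops-∷ʳ (δ ∷ g) γ e = ≡.trans (≡.cong (λ z → ⟦ δ ⟧ˢ e ℤ.+ z) (sumLoops-∷ʳ g γ e)) (≡.sym (ℤ.+-assoc (⟦ δ ⟧ˢ e) _ _))

    product-∷ʳ : ∀ {n} f (g : Vec (Vec Bool edges) n) γ → bracketProduct (attackVector f (g ∷ʳ γ)) ≈
      bracket (+ m ℤ.- attacks (f ⊕ sumLoops g) γ) * bracketProduct (attackVector f g)
    product-∷ʳ f []      γ = *-congʳ (bracket-cong (≡.cong (λ z → + m ℤ.- z) (attacks-cong γ (λ e → ≡.sym (ℤ.+-identityʳ (f e))))))
    product-∷ʳ f (δ ∷ g) γ = begin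
      bracket (+ m ℤ.- attacks f δ) * bracketProduct (attackVector (f ⊕ ⟦ δ ⟧ˢ) (g ∷ʳ γ))
        ≈⟨ *-congˡ (product-∷ʳ (f ⊕ ⟦ δ ⟧ˢ) g γ) ⟩
      bracket (+ m ℤ.- attacks f δ) * (bracket (+ m ℤ.- attacks (f ⊕ ⟦ δ ⟧ˢ ⊕ sumLoops g) γ) * bracketProduct (attackVector (f ⊕ ⟦ δ ⟧ˢ) g))
        ≈⟨ trans (sym (*-assoc _ _ _)) (trans (*-congʳ (*-comm _ _)) (*-assoc _ _ _)) ⟩
      bracket (+ m ℤ.- attacks (f ⊕ ⟦ δ ⟧ˢ ⊕ sumLoops g) γ) * (bracket (+ m ℤ.- attacks f δ) * bracketProduct (attackVector (f ⊕ ⟦ δ ⟧ˢ) g))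
        ≈⟨ *-congʳ (bracket-cong (≡.cong (λ z → + m ℤ.- z) (attacks-cong γ (λ e → ℤ.+-assoc (f e) _ _)))) ⟩
      bracket (+ m ℤ.- attacks (f ⊕ (⟦ δ ⟧ˢ ⊕ sumLoops g)) γ) * bracketProduct (attackVector f (δ ∷ g)) ∎

  -- The last loop of the tuple belongs to the largest label, and all others are smaller, so its
  -- attack number is taken against their sum t ⊖ γ.
  ∑-tuples≈Q : ∀ n t → ∑ (tuples (subsets edges) n) (λ g → when (valid? t g) (bracketProduct (attackVector 0ʷ g))) ≈ Q n t
  ∑-tuples≈Q zero t = trans (+-identityʳ _) (when-cong (valid? t []) (Fin.all? (λ e → t e ℤ.≟ 0ℤ))
    (λ (_ , p) e → ≡.sym (p e)) (λ p → tt , λ e → ≡.sym (p e)) (λ _ → refl))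
  ∑-tuples≈Q (suc n) t = begin
    ∑ (tuples (subsets edges) (suc n)) (λ g → when (valid? t g) (bracketProduct (attackVector 0ʷ g)))
      ≈⟨ ∑-tuples-∷ʳ (subsets edges) n ⟩
    ∑ (subsets edges) (λ γ → ∑ (tuples (subsets edges) n) (λ g → when (valid? t (g ∷ʳ γ)) (bracketProduct (attackVector 0ʷ (g ∷ʳ γ)))))
      ≈⟨ ∑-cong (subsets edges) (λ γ → ∑-cong (tuples (subsets edges) n) (λ g → last γ g (flow? γ) (atRow? n γ) (valid? (t ⊖ ⟦ γ ⟧ˢ) g))) ⟩
    ∑ (subsets edges) (λ γ → ∑ (tuples (subsets edges) n) (λ g → when (flow? γ) (when (atRow? n γ) (k γ * when (valid? (t ⊖ ⟦ γ ⟧ˢ) g) (bracketProduct (attackVector 0ʷ g))))))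
      ≈⟨ ∑-cong (subsets edges) (λ γ → when-∑ (flow? γ) (tuples (subsets edges) n)) ⟨
    ∑ (subsets edges) (λ γ → when (flow? γ) (∑ (tuples (subsets edges) n) (λ g → when (atRow? n γ) (k γ * when (valid? (t ⊖ ⟦ γ ⟧ˢ) g) (bracketProduct (attackVector 0ʷ g))))))
      ≈⟨ ∑-filter flow? (subsets edges) ⟨
    ∑ flows (λ γ → ∑ (tuples (subsets edges) n) (λ g → when (atRow? n γ) (k γ * when (valid? (t ⊖ ⟦ γ ⟧ˢ) g) (bracketProduct (attackVector 0ʷ g)))))
      ≈⟨ ∑-cong flows (λ γ → trans (sym (when-∑ (atRow? n γ) (tuples (subsets edges) n))) (when-cong (atRow? n γ) (atRow? n γ) (λ z → z) (λ z → z) (λ _ →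
           trans (sym (∑-*ˡ (k γ) (tuples (subsets edges) n))) (*-congˡ (∑-tuples≈Q n (t ⊖ ⟦ γ ⟧ˢ)))))) ⟩
    ∑ flows (λ γ → when (atRow? n γ) (k γ * Q n (t ⊖ ⟦ γ ⟧ˢ))) ∎
    where
    k : Vec Bool edges → Carrier
    k γ = bracket (+ m ℤ.- attacks (t ⊖ ⟦ γ ⟧ˢ) γ)

    unsum : ∀ {a b c} → a ℤ.+ b ≡ c → a ≡ c ℤ.- b
    unsum {a} {b} ≡.refl = lemma a b
      where
      lemma : ∀ a b → a ≡ a ℤ.+ b ℤ.- b
      lemma = solve-∀

    resum : ∀ {a b c} → a ≡ c ℤ.- b → a ℤ.+ b ≡ c
    resum {_} {b} {c} ≡.refl = lemma c b
      where
      lemma : ∀ c b → c ℤ.- b ℤ.+ b ≡ c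
      lemma = solve-∀

    last : ∀ γ g (f? : Dec (Flow ⟦ γ ⟧ˢ)) (r? : Dec (AtRow n γ)) (v? : Dec (Valid (t ⊖ ⟦ γ ⟧ˢ) g)) →
      when (valid? t (g ∷ʳ γ)) (bracketProduct (attackVector 0ʷ (g ∷ʳ γ))) ≈ when f? (when r? (k γ * when v? (bracketProduct (attackVector 0ʷ g))))
    last γ g (no ¬f) _ _ = reflexive (when-no (valid? t (g ∷ʳ γ)) λ (rs , _) → ¬f (proj₁ (proj₂ (rows-∷ʳ⁻ 0 g γ rs))))
    last γ g (yes f) (no ¬r) _ = reflexive (when-no (valid? t (g ∷ʳ γ)) λ (rs , _) → ¬r (proj₂ (proj₂ (rows-∷ʳ⁻ 0 g γ rs))))
    last γ g (yes f) (yes r) (no ¬v) = trans (reflexive (when-no (valid? t (g ∷ʳ γ)) λ (rs , s) →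
      ¬v (proj₁ (rows-∷ʳ⁻ 0 g γ rs) , λ e → unsum (≡.trans (≡.sym (sumLoops-∷ʳ g γ e)) (s e))))) (sym (zeroʳ _))
    last γ g (yes f) (yes r) (yes (rs , s)) = trans (reflexive (when-yes (valid? t (g ∷ʳ γ))
      (rows-∷ʳ⁺ 0 g γ rs f r , λ e → ≡.trans (sumLoops-∷ʳ g γ e) (resum {sumLoops g e} {⟦ γ ⟧ˢ e} (s e)))))
      (trans (product-∷ʳ 0ʷ g γ) (*-congʳ (bracket-cong (≡.cong (λ z → + m ℤ.- z) (attacks-cong γ (λ e → ≡.trans (ℤ.+-identityˡ _) (s e)))))))

  -- The part of an expanded term that does not depend on the attack numbers: q^m for a chosen
  -- label, -q^-m for any other.
  signWeight : ∀ {n} → Subset n → Carrier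
  signWeight []          = 1#
  signWeight (true ∷ S)  = E (+ m) * signWeight S
  signWeight (false ∷ S) = (- E (ℤ.- + m)) * signWeight S

  -- Multiplying out q^(m-ν) - q^(ν-m): the set S records the factors from which the first power is
  -- taken.
  bracketProduct-expand : ∀ {n} (νs : Vec ℤ n) → bracketProduct νs ≈ ∑ (subsets n) (λ S → signWeight S * E (dot (signs S) νs))
  bracketProduct-expand []       = sym (trans (+-identityʳ _) (trans (*-identityˡ _) E-0))
  bracketProduct-expand {suc n} (ν ∷ νs) = begin
    bracket (+ m ℤ.- ν) * bracketProduct νs
      ≈⟨ *-cong (+-cong (E-+ (+ m) (ℤ.- ν)) (-‿cong (trans (reflexive (≡.cong E (lemma (+ m) ν))) (E-+ (ℤ.- + m) ν)))) (bracketProduct-expand νs) ⟩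
    (E (+ m) * E (ℤ.- ν) - E (ℤ.- + m) * E ν) * ∑ (subsets n) f
      ≈⟨ distribute _ _ _ _ _ ⟩
    (E (+ m) * E (ℤ.- ν)) * ∑ (subsets n) f ⊞ ((- E (ℤ.- + m)) * E ν) * ∑ (subsets n) f
      ≈⟨ +-cong (∑-*ˡ _ (subsets n)) (∑-*ˡ _ (subsets n)) ⟩
    ∑ (subsets n) (λ S → (E (+ m) * E (ℤ.- ν)) * f S) ⊞ ∑ (subsets n) (λ S → ((- E (ℤ.- + m)) * E ν) * f S)
      ≈⟨ +-cong (∑-cong (subsets n) (λ S → collect (E (+ m)) (≡.sym (ℤ.-1*i≡-i ν)) S)) (trans (∑-cong (subsets n) (λ S → collect (- E (ℤ.- + m)) (≡.sym (ℤ.*-identityˡ ν)) S)) (sym (+-identityʳ _))) ⟩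
    ∑ (subsets n) (λ S → signWeight (true ∷ S) * E (dot (signs (true ∷ S)) (ν ∷ νs))) ⊞ (∑ (subsets n) (λ S → signWeight (false ∷ S) * E (dot (signs (false ∷ S)) (ν ∷ νs))) ⊞ 0#)
      ≈⟨ ∑-tuples-suc (true ∷ false ∷ []) n ⟨
    ∑ (subsets (suc n)) (λ S → signWeight S * E (dot (signs S) (ν ∷ νs))) ∎
    where
    f : Subset n → Carrier
    f S = signWeight S * E (dot (signs S) νs)
    lemma : ∀ m ν → ℤ.- (m ℤ.- ν) ≡ ℤ.- m ℤ.+ ν
    lemma = solve-∀
    distribute : ∀ a b c d x → (a * b - c * d) * x ≈ (a * b) * x ⊞ ((- c) * d) * x
    distribute = solve 5 (λ a b c d x → (a :* b :- c :* d) :* x := (a :* b) :* x :+ ((:- c) :* d) :* x) refl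
    collect : ∀ a {i j} → i ≡ j → ∀ S → (a * E i) * f S ≈ (a * signWeight S) * E (j ℤ.+ dot (signs S) νs)
    collect a {i} ≡.refl S = trans (rearrange a (E i) (signWeight S) (E (dot (signs S) νs))) (*-congˡ (sym (E-+ i _)))
      where
      rearrange : ∀ a b c d → (a * b) * (c * d) ≈ (a * c) * (b * d)
      rearrange = solve 4 (λ a b c d → (a :* b) :* (c :* d) := (a :* c) :* (b :* d)) refl

  -- (-1)^(n-k) a^(2k-n) at a = q^m.
  term : ℕ → ℕ → Carrier
  term n k = power (- 1#) (n ∸ k) * E (+ m ℤ.* (+ (2 ℕ.* k) ℤ.- + n))

  signWeight≈term : ∀ {n} (S : Subset n) → signWeight S ≈ term n ∣ S ∣
  signWeight≈term []          = sym (trans (*-identityˡ _) (trans (reflexive (≡.cong E (ℤ.*-zeroʳ (+ m)))) E-0))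
  signWeight≈term {suc n} (true ∷ S)  = begin
    E (+ m) * signWeight S                                                                  ≈⟨ *-congˡ (signWeight≈term S) ⟩
    E (+ m) * (power (- 1#) (n ∸ ∣ S ∣) * E (+ m ℤ.* (+ (2 ℕ.* ∣ S ∣) ℤ.- + n)))            ≈⟨ rearrange _ _ _ ⟩
    power (- 1#) (n ∸ ∣ S ∣) * (E (+ m) * E (+ m ℤ.* (+ (2 ℕ.* ∣ S ∣) ℤ.- + n)))            ≈⟨ *-congˡ (E-+ (+ m) _) ⟨
    power (- 1#) (n ∸ ∣ S ∣) * E (+ m ℤ.+ + m ℤ.* (+ (2 ℕ.* ∣ S ∣) ℤ.- + n))                ≡⟨ ≡.cong (λ i → power (- 1#) (n ∸ ∣ S ∣) * E i) (≡.trans (≡.cong (λ i → + m ℤ.+ + m ℤ.* (i ℤ.- + n)) (ℤ.pos-* 2 ∣ S ∣)) (≡.trans (lemma (+ m) (+ ∣ S ∣) (+ n)) (≡.cong (λ i → + m ℤ.* (i ℤ.- + suc n)) (≡.sym (ℤ.pos-* 2 (suc ∣ S ∣)))))) ⟩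
    power (- 1#) (n ∸ ∣ S ∣) * E (+ m ℤ.* (+ (2 ℕ.* suc ∣ S ∣) ℤ.- + suc n))                ∎
    where
    rearrange : ∀ a b c → a * (b * c) ≈ b * (a * c)
    rearrange = solve 3 (λ a b c → a :* (b :* c) := b :* (a :* c)) refl
    lemma : ∀ m s n → m ℤ.+ m ℤ.* (+ 2 ℤ.* s ℤ.- n) ≡ m ℤ.* (+ 2 ℤ.* (1ℤ ℤ.+ s) ℤ.- (1ℤ ℤ.+ n))
    lemma = solve-∀
  signWeight≈term {suc n} (false ∷ S) = begin
    (- E (ℤ.- + m)) * signWeight S                                                          ≈⟨ *-congˡ (signWeight≈term S) ⟩
    (- E (ℤ.- + m)) * (power (- 1#) (n ∸ ∣ S ∣) * E (+ m ℤ.* (+ (2 ℕ.* ∣ S ∣) ℤ.- + n)))    ≈⟨ rearrange _ _ _ ⟩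
    (- 1# * power (- 1#) (n ∸ ∣ S ∣)) * (E (ℤ.- + m) * E (+ m ℤ.* (+ (2 ℕ.* ∣ S ∣) ℤ.- + n)))  ≈⟨ *-cong (reflexive (≡.cong (power (- 1#)) (≡.sym (ℕ.+-∸-assoc 1 (∣p∣≤n S))))) (sym (E-+ (ℤ.- + m) _)) ⟩
    power (- 1#) (suc n ∸ ∣ S ∣) * E (ℤ.- + m ℤ.+ + m ℤ.* (+ (2 ℕ.* ∣ S ∣) ℤ.- + n))         ≡⟨ ≡.cong (λ i → power (- 1#) (suc n ∸ ∣ S ∣) * E i) (lemma (+ m) (+ (2 ℕ.* ∣ S ∣)) (+ n)) ⟩
    power (- 1#) (suc n ∸ ∣ S ∣) * E (+ m ℤ.* (+ (2 ℕ.* ∣ S ∣) ℤ.- + suc n))                 ∎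
    where
    rearrange : ∀ a b c → (- a) * (b * c) ≈ (- 1# * b) * (a * c)
    rearrange = solve 3 (λ a b c → (:- a) :* (b :* c) := ((:- con 1ℤ) :* b) :* (a :* c)) refl
    lemma : ∀ m s n → ℤ.- m ℤ.+ m ℤ.* (s ℤ.- n) ≡ m ℤ.* (s ℤ.- (1ℤ ℤ.+ n))
    lemma = solve-∀

  -- Label 0 may be in the first row of the hook or not, without changing the inversions.
  bracketProduct-hooks : ∀ {n} (νs : Vec ℤ n) → bracketProduct (0ℤ ∷ νs) ≈
    ∑ (upTo (suc (suc n))) (λ k → term (suc n) k * (∑ (subsets n) (λ S → when (suc ∣ S ∣ ℕ.≟ k) (E (dot (signs S) νs)))
                                                    ⊞ ∑ (subsets n) (λ S → when (suc ∣ S ∣ ℕ.≟ suc k) (E (dot (signs S) νs)))))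
  bracketProduct-hooks {n} νs = begin
    bracketProduct (0ℤ ∷ νs)
      ≈⟨ bracketProduct-expand (0ℤ ∷ νs) ⟩
    ∑ (subsets (suc n)) (λ S → signWeight S * E (dot (signs S) (0ℤ ∷ νs)))
      ≈⟨ ∑-tuples-suc (true ∷ false ∷ []) n ⟩
    ∑ (subsets n) (λ S → signWeight (true ∷ S) * E (0ℤ ℤ.+ dot (signs S) νs)) ⊞ (∑ (subsets n) (λ S → signWeight (false ∷ S) * E (0ℤ ℤ.+ dot (signs S) νs)) ⊞ 0#)
      ≈⟨ +-cong (∑-cong (subsets n) (λ S → *-cong (signWeight≈term (true ∷ S)) (E0+ S))) (trans (+-identityʳ _) (∑-cong (subsets n) (λ S → *-cong (signWeight≈term (false ∷ S)) (E0+ S)))) ⟩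
    ∑ (subsets n) (λ S → term (suc n) (suc ∣ S ∣) * e S) ⊞ ∑ (subsets n) (λ S → term (suc n) ∣ S ∣ * e S)
      ≈⟨ +-cong (∑-cong (subsets n) (λ S → select (suc ∣ S ∣) (s≤s (s≤s (∣p∣≤n S))) S (λ k → suc ∣ S ∣ ℕ.≟ k) (λ p → p) (λ p → p)))
                (∑-cong (subsets n) (λ S → select ∣ S ∣ (ℕ.m≤n⇒m≤1+n (s≤s (∣p∣≤n S))) S (λ k → suc ∣ S ∣ ℕ.≟ suc k) (≡.cong suc) ℕ.suc-injective)) ⟩
    ∑ (subsets n) (λ S → ∑ ks (λ k → term (suc n) k * when (suc ∣ S ∣ ℕ.≟ k) (e S))) ⊞ ∑ (subsets n) (λ S → ∑ ks (λ k → term (suc n) k * when (suc ∣ S ∣ ℕ.≟ suc k) (e S)))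
      ≈⟨ +-cong (∑-swap (subsets n) ks) (∑-swap (subsets n) ks) ⟩
    ∑ ks (λ k → ∑ (subsets n) (λ S → term (suc n) k * when (suc ∣ S ∣ ℕ.≟ k) (e S))) ⊞ ∑ ks (λ k → ∑ (subsets n) (λ S → term (suc n) k * when (suc ∣ S ∣ ℕ.≟ suc k) (e S)))
      ≈⟨ ∑-+ ks ⟨
    ∑ ks (λ k → ∑ (subsets n) (λ S → term (suc n) k * when (suc ∣ S ∣ ℕ.≟ k) (e S)) ⊞ ∑ (subsets n) (λ S → term (suc n) k * when (suc ∣ S ∣ ℕ.≟ suc k) (e S)))
      ≈⟨ ∑-cong ks (λ k → trans (+-cong (sym (∑-*ˡ _ (subsets n))) (sym (∑-*ˡ _ (subsets n)))) (sym (distribˡ _ _ _))) ⟩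
    ∑ ks (λ k → term (suc n) k * (∑ (subsets n) (λ S → when (suc ∣ S ∣ ℕ.≟ k) (e S)) ⊞ ∑ (subsets n) (λ S → when (suc ∣ S ∣ ℕ.≟ suc k) (e S)))) ∎
    where
    ks = upTo (suc (suc n))
    e : Subset n → Carrier
    e S = E (dot (signs S) νs)
    E0+ : ∀ S → E (0ℤ ℤ.+ dot (signs S) νs) ≈ e S
    E0+ S = reflexive (≡.cong E (ℤ.+-identityˡ _))
    select : ∀ j → j ℕ.< suc (suc n) → ∀ S {P : ℕ → Set} (P? : ∀ k → Dec (P k)) → (∀ {k} → j ≡ k → P k) → (∀ {k} → P k → j ≡ k) →
      term (suc n) j * e S ≈ ∑ ks (λ k → term (suc n) k * when (P? k) (e S))
    select j j< S P? to from = begin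
      term (suc n) j * e S
        ≈⟨ ∑-δ ℕ._≟_ {ks} {λ k → term (suc n) k * e S} (Unique.upTo⁺ (suc (suc n))) (∈.∈-upTo⁺ j<) ⟨
      ∑ ks (λ k → when (j ℕ.≟ k) (term (suc n) k * e S))
        ≈⟨ ∑-cong ks (λ k → trans (when-cong (j ℕ.≟ k) (P? k) to from (λ _ → refl)) (sym (when-*ˡ (P? k) _))) ⟩
      ∑ ks (λ k → term (suc n) k * when (P? k) (e S)) ∎

-- Hook tableaux

Sorted : ∀ {n} → List (Fin n) → Set
Sorted = AllPairs Fin._<_

allFin-sorted : ∀ n → Sorted (allFin n)
allFin-sorted n = AllPairs.tabulate⁺-< id

sorted⇒unique : ∀ {n} {xs : List (Fin n)} → Sorted xs → Unique xs
sorted⇒unique = AllPairs.map (λ { {x} x<x ≡.refl → ℕ.<-irrefl ≡.refl x<x })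

sorted-≡ : ∀ {n} {xs ys : List (Fin n)} → Sorted xs → Sorted ys → (∀ {x} → x ∈ xs → x ∈ ys) → (∀ {x} → x ∈ ys → x ∈ xs) → xs ≡ ys
sorted-≡ {xs = []}     {[]}     _ _ _ _ = ≡.refl
sorted-≡ {xs = []}     {y ∷ ys} _ _ _ g with g (here ≡.refl)
... | ()
sorted-≡ {xs = x ∷ xs} {[]}     _ _ f _ with f (here ≡.refl)
... | ()
sorted-≡ {xs = x ∷ xs} {y ∷ ys} (x< ∷ s) (y< ∷ s′) f g = ≡.cong₂ _∷_ x≡y (sorted-≡ s s′ f′ g′)
  where
  x≡y : x ≡ y
  x≡y with f (here ≡.refl) | g (here ≡.refl)
  ... | here p     | _          = p
  ... | there _    | here p     = ≡.sym p
  ... | there x∈ys | there y∈xs = ⊥-elim (ℕ.<-asym (All.lookup x< y∈xs) (All.lookup y< x∈ys))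
  f′ : ∀ {z} → z ∈ xs → z ∈ ys
  f′ z∈ with f (there z∈)
  ... | there z∈ys = z∈ys
  ... | here ≡.refl  = ⊥-elim (ℕ.<-irrefl (≡.cong Fin.toℕ x≡y) (All.lookup x< z∈))
  g′ : ∀ {z} → z ∈ ys → z ∈ xs
  g′ z∈ with g (there z∈)
  ... | there z∈xs = z∈xs
  ... | here ≡.refl  = ⊥-elim (ℕ.<-irrefl (≡.cong Fin.toℕ (≡.sym x≡y)) (All.lookup y< z∈))

unique-lookup-injective : {A : Set} {xs : List A} → Unique xs → ∀ {i j} → List.lookup xs i ≡ List.lookup xs j → i ≡ j
unique-lookup-injective {xs = x ∷ xs} (x∉ ∷ u) {zero}  {zero}  _  = ≡.refl
unique-lookup-injective {xs = x ∷ xs} (x∉ ∷ u) {zero}  {suc j} eq = ⊥-elim (All.lookup x∉ (∈.∈-lookup j) eq)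
unique-lookup-injective {xs = x ∷ xs} (x∉ ∷ u) {suc i} {zero}  eq = ⊥-elim (All.lookup x∉ (∈.∈-lookup i) (≡.sym eq))
unique-lookup-injective {xs = x ∷ xs} (x∉ ∷ u) {suc i} {suc j} eq = ≡.cong suc (unique-lookup-injective u eq)

unique-full : ∀ {n} (xs : List (Fin n)) → Unique xs → length xs ≡ n → ∀ u → u ∈ xs
unique-full {n} xs unique len u with Any.any? (u Fin.≟_) xs
... | yes u∈ = u∈
... | no  u∉ = ⊥-elim (ℕ.1+n≰n (≡.subst (λ k → suc k ≤ n) len (Fin.injective⇒≤ (unique-lookup-injective (All.tabulate (λ x∈ u≡x → u∉ (≡.subst (_∈ xs) (≡.sym u≡x) x∈)) ∷ unique)))))

ε : ∀ {n} → (Fin n → ℕ) → Fin n → Fin n → ℤ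
ε σ u v = if does (σ u ℕ.<? σ v ⊎-dec (σ v ℕ.≟ σ u ×-dec v Fin.<? u)) then 1ℤ else -1ℤ

-- The sign of a pair depends only on its larger label, apart from the reversal when that label
-- comes first.
SignedBy : ∀ {n} → (Fin n → ℕ) → (Fin n → ℤ) → Set
SignedBy σ s = ∀ {u v} → u Fin.< v → ε σ u v ≡ s v × ε σ v u ≡ ℤ.- s v

module Hooks (n : ℕ) where

  legs : Subset n → List (Fin (suc n))
  legs S = filter (λ u → ¬? (u Sub.∈? (inside Vec.∷ S))) (allFin (suc n))

  arm : Subset n → List (Fin (suc n))
  arm S = elements (inside Vec.∷ S)

  -- The first row of a standard tableau contains the label 0.
  hookOf : Subset n → Tableau (suc n)
  hookOf S = arm S ∷ map [_] (legs S)

  arm-∈⁺ : ∀ {S u} → u Sub.∈ (inside Vec.∷ S) → u ∈ arm S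
  arm-∈⁺ {S} {u} = ∈.∈-filter⁺ (Sub._∈? (inside Vec.∷ S)) (∈.∈-allFin u)

  arm-∈⁻ : ∀ {S u} → u ∈ arm S → u Sub.∈ (inside Vec.∷ S)
  arm-∈⁻ {S} u∈ = proj₂ (∈.∈-filter⁻ (Sub._∈? (inside Vec.∷ S)) {xs = allFin (suc n)} u∈)

  legs-∈⁺ : ∀ {S u} → u Sub.∉ (inside Vec.∷ S) → u ∈ legs S
  legs-∈⁺ {S} {u} = ∈.∈-filter⁺ (λ u → ¬? (u Sub.∈? (inside Vec.∷ S))) (∈.∈-allFin u)

  legs-∈⁻ : ∀ {S u} → u ∈ legs S → u Sub.∉ (inside Vec.∷ S)
  legs-∈⁻ {S} u∈ = proj₂ (∈.∈-filter⁻ (λ u → ¬? (u Sub.∈? (inside Vec.∷ S))) {xs = allFin (suc n)} u∈)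

  arm-sorted : ∀ S → Sorted (arm S)
  arm-sorted S = AllPairs.filter⁺ (Sub._∈? (inside Vec.∷ S)) (allFin-sorted (suc n))

  legs-sorted : ∀ S → Sorted (legs S)
  legs-sorted S = AllPairs.filter⁺ (λ u → ¬? (u Sub.∈? (inside Vec.∷ S))) (allFin-sorted (suc n))

  private
    length-elements : ∀ {k} (p : Subset k) → length (elements p) ≡ ∣ p ∣
    length-elements p = go p _ id (λ _ → ≡.refl)
      where
      go : ∀ {k l} (p : Subset k) (q : Subset l) (f : Fin k → Fin l) → (∀ u → does (f u Sub.∈? q) ≡ does (u Sub.∈? p)) →
        length (filter (Sub._∈? q) (List.tabulate f)) ≡ ∣ p ∣
      go Vec.[] q f eq = ≡.refl
      go (inside Vec.∷ p) q f eq with f zero Sub.∈? q | eq zero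
      ... | yes _ | _  = ≡.cong suc (go p q (f ∘ suc) (λ u → eq (suc u)))
      ... | no  _ | ()
      go (outside Vec.∷ p) q f eq with f zero Sub.∈? q | eq zero
      ... | yes _ | ()
      ... | no  _ | _  = go p q (f ∘ suc) (λ u → eq (suc u))

    length-split : ∀ {A : Set} {P : A → Set} (P? : ∀ x → Dec (P x)) xs → length (filter P? xs) ℕ.+ length (filter (λ x → ¬? (P? x)) xs) ≡ length xs
    length-split P? []       = ≡.refl
    length-split P? (x ∷ xs) with P? x
    ... | yes _ = ≡.cong suc (length-split P? xs)
    ... | no  _ = ≡.trans (ℕ.+-suc _ _) (≡.cong suc (length-split P? xs))

  length-arm : ∀ S → length (arm S) ≡ suc ∣ S ∣
  length-arm S = length-elements (inside Vec.∷ S)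

  length-legs : ∀ S → length (legs S) ≡ n ∸ ∣ S ∣
  length-legs S = ≡.trans (≡.sym (ℕ.m+n∸m≡n (suc ∣ S ∣) _)) (≡.cong (_∸ suc ∣ S ∣) (≡.trans (≡.cong (ℕ._+ length (legs S)) (≡.sym (length-arm S)))
    (≡.trans (length-split (Sub._∈? (inside Vec.∷ S)) (allFin (suc n))) (List.length-tabulate id))))

  private
    single-fillings⁻ : ∀ k {rows} → rows ∈ fillings (suc n) (replicate k 1) → ∃ λ xs → rows ≡ map [_] xs × length xs ≡ k
    single-fillings⁻ zero    (here ≡.refl) = [] , ≡.refl , ≡.refl
    single-fillings⁻ (suc k) rows∈ with ∈.∈-cartesianProductWith⁻ _ (tuples (allFin (suc n)) 1) (fillings (suc n) (replicate k 1)) rows∈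
    ... | (x Vec.∷ Vec.[]) , rows , _ , rows∈′ , ≡.refl with single-fillings⁻ k rows∈′
    ...   | xs , ≡.refl , ≡.refl = x ∷ xs , ≡.refl , ≡.refl

    single-fillings⁺ : ∀ xs → map [_] xs ∈ fillings (suc n) (replicate (length xs) 1)
    single-fillings⁺ []       = here ≡.refl
    single-fillings⁺ (x ∷ xs) = ∈.∈-cartesianProductWith⁺ _ {xs = tuples (allFin (suc n)) 1} (tuples-∈⁺ (x Vec.∷ Vec.[]) (λ i → ∈.∈-allFin _)) (single-fillings⁺ xs)

    toList-∈tuples : ∀ xs k → length xs ≡ k → ∃ λ (r : Vec (Fin (suc n)) k) → Vec.toList r ≡ xs × r ∈ tuples (allFin (suc n)) k
    toList-∈tuples xs _ ≡.refl = Vec.fromList xs , Vec.toList∘fromList xs , tuples-∈⁺ (Vec.fromList xs) (λ i → ∈.∈-allFin _)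

    Column : List (Fin (suc n)) → List (Fin (suc n)) → Set
    Column upper lower = All (uncurry Fin._<_) (zip upper lower)

    columns⁻ : ∀ {xs} → Linked Column (map [_] xs) → Linked Fin._<_ xs
    columns⁻ {[]}         _                = []
    columns⁻ {x ∷ []}     _                = [-]
    columns⁻ {x ∷ y ∷ xs} ((x<y ∷ _) ∷ ls) = x<y ∷ columns⁻ ls

    columns⁺ : ∀ {xs} → Linked Fin._<_ xs → Linked Column (map [_] xs)
    columns⁺ []         = []
    columns⁺ [-]        = [-]
    columns⁺ (x<y ∷ ls) = (x<y ∷ []) ∷ columns⁺ ls

    rows-increasing : ∀ (xs : List (Fin (suc n))) → All (Linked Fin._<_) (map [_] xs)
    rows-increasing []       = []
    rows-increasing (x ∷ xs) = [-] ∷ rows-increasing xs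

    <-trans : ∀ {k} {x y z : Fin k} → x Fin.< y → y Fin.< z → x Fin.< z
    <-trans = ℕ.<-trans

  hookOf∈SYT : ∀ S → hookOf S ∈ SYT (suc n) (hook (suc n) (suc ∣ S ∣))
  hookOf∈SYT S = ∈.∈-filter⁺ isStandard? filling standard
    where
    filling : hookOf S ∈ fillings (suc n) (hook (suc n) (suc ∣ S ∣))
    filling with toList-∈tuples (arm S) (suc ∣ S ∣) (length-arm S)
    ... | r , r≡ , r∈ = ≡.subst (_∈ fillings (suc n) (hook (suc n) (suc ∣ S ∣))) (≡.cong (_∷ map [_] (legs S)) r≡)
      (∈.∈-cartesianProductWith⁺ _ r∈ (≡.subst (λ k → map [_] (legs S) ∈ fillings (suc n) (replicate k 1)) (length-legs S) (single-fillings⁺ (legs S))))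
    legs>0 : ∀ {u : Fin (suc n)} → u ∈ legs S → 0 < Fin.toℕ u
    legs>0 {zero}  u∈ = ⊥-elim (legs-∈⁻ {S} u∈ Vec.here)
    legs>0 {suc u} u∈ = s≤s z≤n
    columns : ∀ {row} xs → 0 < length row → (∀ {u} → u ∈ xs → All (λ h → h Fin.< u) (take 1 row)) → Linked Fin._<_ xs → Linked Column (row ∷ map [_] xs)
    columns []       _ _ _  = [-]
    columns {h ∷ row} (x ∷ xs) _ h< l with h< (here ≡.refl)
    ... | h<x ∷ _ = (h<x ∷ zip-[] row) ∷ columns⁺ l
      where
      zip-[] : ∀ row → All (uncurry Fin._<_) (zip {B = Fin (suc n)} row [])
      zip-[] []      = []
      zip-[] (_ ∷ _) = []
    standard : IsStandard (hookOf S)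
    standard = ≡.subst (λ xs → Unique (arm S ++ xs)) (≡.sym (List.concat-map-[_] (legs S)))
                 (Unique.++⁺ (sorted⇒unique (arm-sorted S)) (sorted⇒unique (legs-sorted S)) (λ (u∈ , u∈′) → legs-∈⁻ {S} u∈′ (arm-∈⁻ {S} u∈)))
             , Linked.AllPairs⇒Linked (arm-sorted S) ∷ rows-increasing (legs S)
             , columns (legs S) (≡.subst (0 <_) (≡.sym (length-arm S)) (s≤s z≤n)) (λ u∈ → legs>0 u∈ ∷ []) (Linked.AllPairs⇒Linked (legs-sorted S))

  -- A standard hook is determined by its first row. The corner is smaller than all entries below
  -- it, so label 0 lies in the first row; both row and column are increasing, hence equal to the
  -- sorted lists `arm S` and `legs S`.
  SYT⇒hookOf : ∀ j → j ≤ n → ∀ {τ} → τ ∈ SYT (suc n) (hook (suc n) (suc j)) → ∃ λ S → ∣ S ∣ ≡ j × τ ≡ hookOf S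
  SYT⇒hookOf j j≤n τ∈ with ∈.∈-filter⁻ isStandard? {xs = fillings (suc n) (hook (suc n) (suc j))} τ∈
  ... | τ∈fillings , standard with ∈.∈-cartesianProductWith⁻ _ (tuples (allFin (suc n)) (suc j)) (fillings (suc n) (replicate (n ∸ j) 1)) τ∈fillings
  ... | r@(h Vec.∷ r′) , rows , _ , rows∈ , ≡.refl with single-fillings⁻ (n ∸ j) rows∈
  ... | xs , ≡.refl , len with standard
  ... | unique , row< ∷ _ , columns = S , ℕ.suc-injective (≡.trans (≡.sym (length-arm S)) (≡.trans (≡.sym (≡.cong length row≡)) (length-row r))) , ≡.cong₂ (λ a b → a ∷ map [_] b) row≡ xs≡
    where
    row = Vec.toList r
    unique′ : Unique (row ++ xs)
    unique′ = ≡.subst (λ xs → Unique (row ++ xs)) (List.concat-map-[_] xs) unique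
    length-row : ∀ {k} (v : Vec (Fin (suc n)) k) → length (Vec.toList v) ≡ k
    length-row Vec.[]      = ≡.refl
    length-row (x Vec.∷ v) = ≡.cong suc (length-row v)
    full : ∀ u → u ∈ row ++ xs
    full = unique-full (row ++ xs) unique′ (≡.trans (List.length-++ row) (≡.trans (≡.cong₂ ℕ._+_ (length-row r) len) (≡.cong suc (ℕ.m+[n∸m]≡n j≤n))))
    xs-sorted : Sorted xs
    xs-sorted = Linked.Linked⇒AllPairs <-trans (columns⁻ (Linked.tail columns))
    xs>h : ∀ {u} → u ∈ xs → h Fin.< u
    xs>h = go xs columns xs-sorted
      where
      go : ∀ xs → Linked Column (row ∷ map [_] xs) → Sorted xs → ∀ {u} → u ∈ xs → h Fin.< u
      go (x ∷ xs) ((h<x ∷ _) ∷ _) (x< ∷ _) (here ≡.refl) = h<x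
      go (x ∷ xs) ((h<x ∷ _) ∷ _) (x< ∷ _) (there u∈)  = <-trans h<x (All.lookup x< u∈)
    zero∈row : zero ∈ row
    zero∈row with ∈.∈-++⁻ row (full zero)
    ... | inj₁ z∈ = z∈
    ... | inj₂ z∈ with xs>h z∈
    ...   | ()
    S : Subset n
    S = Vec.tabulate (λ u → does (Any.any? (suc u Fin.≟_) row))
    inside⇒∈ : ∀ {u} → u Sub.∈ (inside Vec.∷ S) → u ∈ row
    inside⇒∈ {zero}  _ = zero∈row
    inside⇒∈ {suc u} (Vec.there u∈) = does-true (Any.any? (suc u Fin.≟_) row) (≡.trans (≡.sym (Vec.lookup∘tabulate _ u)) (Vec.[]=⇒lookup u∈))
      where
      does-true : {P : Set} (P? : Dec P) → does P? ≡ true → P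
      does-true (yes p) _ = p
    ∈⇒inside : ∀ {u} → u ∈ row → u Sub.∈ (inside Vec.∷ S)
    ∈⇒inside {zero}  _  = Vec.here
    ∈⇒inside {suc u} u∈ = Vec.there (Vec.lookup⇒[]= u S (≡.trans (Vec.lookup∘tabulate _ u) (dec-true (Any.any? (suc u Fin.≟_) row) u∈)))
    row≡ : row ≡ arm S
    row≡ = sorted-≡ (Linked.Linked⇒AllPairs <-trans row<) (arm-sorted S) (arm-∈⁺ {S} ∘ ∈⇒inside) (inside⇒∈ ∘ arm-∈⁻ {S})
    disjoint : ∀ (ys : List (Fin (suc n))) {zs u} → Unique (ys ++ zs) → u ∈ ys → u ∉ zs
    disjoint (y ∷ ys) (y∉ ∷ _) (here ≡.refl) u∈ = All.lookup y∉ (∈.∈-++⁺ʳ ys u∈) ≡.refl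
    disjoint (y ∷ ys) (_ ∷ un) (there u∈)  u∈′ = disjoint ys un u∈ u∈′
    xs≡ : xs ≡ legs S
    xs≡ = sorted-≡ xs-sorted (legs-sorted S) (λ u∈ → legs-∈⁺ {S} (λ u∈S → disjoint row unique′ (inside⇒∈ u∈S) u∈)) back
      where
      back : ∀ {u} → u ∈ legs S → u ∈ xs
      back {u} u∈ with ∈.∈-++⁻ row (full u)
      ... | inj₁ u∈row = ⊥-elim (legs-∈⁻ {S} u∈ (∈⇒inside u∈row))
      ... | inj₂ u∈xs  = u∈xs

  -- Replaces a sum over hook tableaux by one over sets of j labels other than 0, the form in which
  -- the product of brackets expands.
  SYT-hook-↭ : ∀ j → j ≤ n → SYT (suc n) (hook (suc n) (suc j)) ↭ map hookOf (filter (λ S → ∣ S ∣ ℕ.≟ j) (subsets n))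
  SYT-hook-↭ j j≤n = unique-↭ (Unique.filter⁺ isStandard? (fillings-unique (hook (suc n) (suc j))))
    (Unique.map⁺ hookOf-injective (Unique.filter⁺ (λ S → ∣ S ∣ ℕ.≟ j) (subsets-unique n))) to from
    where
    toList-injective : ∀ {k} (v v′ : Vec (Fin (suc n)) k) → Vec.toList v ≡ Vec.toList v′ → v ≡ v′
    toList-injective Vec.[]      Vec.[]        _  = ≡.refl
    toList-injective (x Vec.∷ v) (x′ Vec.∷ v′) eq = ≡.cong₂ Vec._∷_ (List.∷-injectiveˡ eq) (toList-injective v v′ (List.∷-injectiveʳ eq))
    fillings-unique : ∀ shape → Unique (fillings (suc n) shape)
    fillings-unique []          = [] ∷ []
    fillings-unique (l ∷ shape) = Unique.cartesianProductWith⁺ _ (λ eq → toList-injective _ _ (List.∷-injectiveˡ eq) , List.∷-injectiveʳ eq)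
      (tuples-unique l (Unique.allFin⁺ (suc n))) (fillings-unique shape)
    hookOf-injective : ∀ {S S′} → hookOf S ≡ hookOf S′ → S ≡ S′
    hookOf-injective {S} {S′} eq = Vec.∷-injectiveʳ (⊆-antisym {i = inside Vec.∷ S} {inside Vec.∷ S′}
      (λ {u} u∈ → arm-∈⁻ {S′} (≡.subst (u ∈_) (List.∷-injectiveˡ eq) (arm-∈⁺ {S} u∈)))
      (λ {u} u∈ → arm-∈⁻ {S} (≡.subst (u ∈_) (≡.sym (List.∷-injectiveˡ eq)) (arm-∈⁺ {S′} u∈))))
    to : ∀ {τ} → τ ∈ SYT (suc n) (hook (suc n) (suc j)) → τ ∈ map hookOf (filter (λ S → ∣ S ∣ ℕ.≟ j) (subsets n))
    to τ∈ with SYT⇒hookOf j j≤n τ∈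
    ... | S , eq , ≡.refl = ∈.∈-map⁺ hookOf (∈.∈-filter⁺ (λ S → ∣ S ∣ ℕ.≟ j) (∈-subsets S) eq)
    from : ∀ {τ} → τ ∈ map hookOf (filter (λ S → ∣ S ∣ ℕ.≟ j) (subsets n)) → τ ∈ SYT (suc n) (hook (suc n) (suc j))
    from τ∈ with ∈.∈-map⁻ hookOf τ∈
    ... | S , S∈ , ≡.refl with ∈.∈-filter⁻ (λ S → ∣ S ∣ ℕ.≟ j) {xs = subsets n} S∈
    ...   | _ , ≡.refl = hookOf∈SYT S

  private
    ε-plus : ∀ (σ : Fin (suc n) → ℕ) {u v} → σ u < σ v ⊎ (σ v ≡ σ u × v Fin.< u) → ε σ u v ≡ 1ℤ
    ε-plus σ {u} {v} p = ≡.cong (λ b → if b then 1ℤ else -1ℤ) (dec-true (σ u ℕ.<? σ v ⊎-dec (σ v ℕ.≟ σ u ×-dec v Fin.<? u)) p)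

    ε-minus : ∀ (σ : Fin (suc n) → ℕ) {u v} → ¬ (σ u < σ v ⊎ (σ v ≡ σ u × v Fin.< u)) → ε σ u v ≡ -1ℤ
    ε-minus σ {u} {v} p = ≡.cong (λ b → if b then 1ℤ else -1ℤ) (dec-false (σ u ℕ.<? σ v ⊎-dec (σ v ℕ.≟ σ u ×-dec v Fin.<? u)) p)

    rowOf≥1 : ∀ rows (u : Fin (suc n)) → 1 ≤ rowOf rows u
    rowOf≥1 []           u = s≤s z≤n
    rowOf≥1 (row ∷ rows) u with does (Any.any? (u Fin.≟_) row)
    ... | true  = s≤s z≤n
    ... | false = s≤s z≤n

    rowOf-first : ∀ {row} {rows : Tableau (suc n)} {u} → u ∈ row → rowOf (row ∷ rows) u ≡ 1
    rowOf-first {row} {rows} {u} u∈ = ≡.cong (λ b → if b then 1 else suc (rowOf rows u)) (dec-true (Any.any? (u Fin.≟_) row) u∈)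

    rowOf-later : ∀ {row} {rows : Tableau (suc n)} {u} → u ∉ row → rowOf (row ∷ rows) u ≡ suc (rowOf rows u)
    rowOf-later {row} {rows} {u} u∉ = ≡.cong (λ b → if b then 1 else suc (rowOf rows u)) (dec-false (Any.any? (u Fin.≟_) row) u∉)

    rowOf-legs : ∀ {xs u v} → Sorted xs → u ∈ xs → v ∈ xs → u Fin.< v → rowOf (map [_] xs) u < rowOf (map [_] xs) v
    rowOf-legs {x ∷ xs} {u} {v} (x< ∷ s) u∈ v∈ u<v = by-cases u∈ v∈
      where
      rows = map [_] xs
      head-only : ∀ {y z} → y Fin.< z → z ∉ [ y ]
      head-only y<z (here ≡.refl) = ℕ.<-irrefl ≡.refl y<z
      by-cases : u ∈ x ∷ xs → v ∈ x ∷ xs → rowOf ([ x ] ∷ rows) u < rowOf ([ x ] ∷ rows) v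
      by-cases (here ≡.refl) (here ≡.refl) = ⊥-elim (ℕ.<-irrefl ≡.refl u<v)
      by-cases (here ≡.refl) (there v∈)  = subst₂′ (rowOf-first {[ x ]} {rows} (here ≡.refl)) (rowOf-later {[ x ]} {rows} (head-only u<v)) (s≤s (rowOf≥1 rows v))
        where
        subst₂′ : ∀ {a a′ b b′ : ℕ} → a ≡ a′ → b ≡ b′ → a′ < b′ → a < b
        subst₂′ ≡.refl ≡.refl p = p
      by-cases (there u∈) (here ≡.refl)  = ⊥-elim (ℕ.<-asym u<v (All.lookup x< u∈))
      by-cases (there u∈) (there v∈)   = subst₂′ (rowOf-later {[ x ]} {rows} (head-only (All.lookup x< u∈))) (rowOf-later {[ x ]} {rows} (head-only (All.lookup x< v∈))) (s≤s (rowOf-legs s u∈ v∈ u<v))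
        where
        subst₂′ : ∀ {a a′ b b′ : ℕ} → a ≡ a′ → b ≡ b′ → a′ < b′ → a < b
        subst₂′ ≡.refl ≡.refl p = p

  module _ (S : Subset n) where
    private
      σ : Fin (suc n) → ℕ
      σ = rowOf (hookOf S)
      S⁺ = inside Vec.∷ S

      σ-arm : ∀ {v} → v Sub.∈ S⁺ → σ v ≡ 1
      σ-arm v∈ = rowOf-first {arm S} {map [_] (legs S)} (arm-∈⁺ {S} v∈)

      σ-leg : ∀ {v} → v Sub.∉ S⁺ → σ v ≡ suc (rowOf (map [_] (legs S)) v)
      σ-leg v∉ = rowOf-later {arm S} {map [_] (legs S)} (v∉ ∘ arm-∈⁻ {S})

      σ≥1 : ∀ v → 1 ≤ σ v
      σ≥1 = rowOf≥1 (hookOf S)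

      σ-leg-< : ∀ {u v} → u Fin.< v → v Sub.∉ S⁺ → σ u < σ v
      σ-leg-< {u} {v} u<v v∉ with u Sub.∈? S⁺
      ... | yes u∈ = ≡.subst (_< σ v) (≡.sym (σ-arm u∈)) (≡.subst (1 <_) (≡.sym (σ-leg v∉)) (s≤s (rowOf≥1 (map [_] (legs S)) v)))
      ... | no  u∉ = ≡.subst (_< σ v) (≡.sym (σ-leg u∉)) (≡.subst (_ <_) (≡.sym (σ-leg v∉)) (s≤s (rowOf-legs (legs-sorted S) (legs-∈⁺ {S} u∉) (legs-∈⁺ {S} v∉) u<v)))

      value : ∀ v → (v Sub.∈ S⁺ × signs S⁺ v ≡ -1ℤ) ⊎ (v Sub.∉ S⁺ × signs S⁺ v ≡ 1ℤ)
      value v with Vec.lookup S⁺ v in eq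
      ... | true  = inj₁ (Vec.lookup⇒[]= v S⁺ eq , ≡.refl)
      ... | false = inj₂ ((λ v∈ → true≢false (≡.trans (≡.sym (Vec.[]=⇒lookup v∈)) eq)) , ≡.refl)
        where true≢false : true ≢ false
              true≢false ()

    -- A label v in the leg lies strictly below every smaller label, which gives +1. A label v in
    -- the first row lies in a row at least as high, and a tie with a smaller label u counts as -1.
    ε-hook : SignedBy (rowOf (hookOf S)) (signs (inside Vec.∷ S))
    ε-hook {u} {v} u<v with value v
    ... | inj₂ (v∉ , s≡) = ≡.trans (ε-plus σ {u} {v} (inj₁ (σ-leg-< u<v v∉))) (≡.sym s≡) ,
      ≡.trans (ε-minus σ {v} {u} λ { (inj₁ σv<σu) → ℕ.<-asym σv<σu (σ-leg-< u<v v∉) ; (inj₂ (σu≡σv , _)) → ℕ.<-irrefl σu≡σv (σ-leg-< u<v v∉) }) (≡.cong ℤ.-_ (≡.sym s≡))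
    ... | inj₁ (v∈ , s≡) = ≡.trans (ε-minus σ {u} {v} λ { (inj₁ σu<σv) → ℕ.<⇒≱ (≡.subst (σ u <_) (σ-arm v∈) σu<σv) (σ≥1 u) ; (inj₂ (_ , v<u)) → ℕ.<-asym u<v v<u }) (≡.sym s≡) ,
      ≡.trans (ε-plus σ {v} {u} second) (≡.cong ℤ.-_ (≡.sym s≡))
      where
      second : σ v < σ u ⊎ (σ u ≡ σ v × u Fin.< v)
      second with ℕ.m≤n⇒m<n∨m≡n (≡.subst (_≤ σ u) (≡.sym (σ-arm v∈)) (σ≥1 u))
      ... | inj₁ σv<σu = inj₁ σv<σu
      ... | inj₂ σv≡σu = inj₂ (≡.sym σv≡σu , u<v)

-- Labelled loop decompositions as tuples of loops

vec-ext : {A : Set} {n : ℕ} {u v : Vec A n} → (∀ i → lookup u i ≡ lookup v i) → u ≡ v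
vec-ext {u = u} {v} eq = ≡.trans (≡.sym (Vec.tabulate∘lookup u)) (≡.trans (Vec.tabulate-cong eq) (Vec.tabulate∘lookup v))

disjointUnion⇒ : ∀ {n} {p r s : Subset n} → p isDisjointUnionOf r , s → ∀ u → 𝟚 (lookup r u) ℤ.+ 𝟚 (lookup s u) ≡ 𝟚 (lookup p u)
disjointUnion⇒ {p = p} {r} {s} (p≡ , r∩s) u = bits (lookup r u) (lookup s u)
  (≡.trans (≡.cong (λ p → lookup p u) p≡) (Vec.lookup-zipWith _∨_ u r s))
  (≡.trans (≡.sym (Vec.lookup-zipWith _∧_ u r s)) (≡.trans (≡.cong (λ p → lookup p u) r∩s) (Vec.lookup-replicate u outside)))
  where
  bits : ∀ {c} a b → c ≡ a ∨ b → a ∧ b ≡ false → 𝟚 a ℤ.+ 𝟚 b ≡ 𝟚 c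
  bits true  true  _    ()
  bits true  false ≡.refl _ = ≡.refl
  bits false true  ≡.refl _ = ≡.refl
  bits false false ≡.refl _ = ≡.refl

⇒disjointUnion : ∀ {n} {p r s : Subset n} → (∀ u → 𝟚 (lookup r u) ℤ.+ 𝟚 (lookup s u) ≡ 𝟚 (lookup p u)) → p isDisjointUnionOf r , s
⇒disjointUnion {p = p} {r} {s} eq =
  vec-ext (λ u → ≡.trans (proj₁ (bits (lookup r u) (lookup s u) (lookup p u) (eq u))) (≡.sym (Vec.lookup-zipWith _∨_ u r s))) ,
  vec-ext (λ u → ≡.trans (Vec.lookup-zipWith _∧_ u r s) (≡.trans (proj₂ (bits (lookup r u) (lookup s u) (lookup p u) (eq u))) (≡.sym (Vec.lookup-replicate u outside))))
  where
  bits : ∀ a b c → 𝟚 a ℤ.+ 𝟚 b ≡ 𝟚 c → c ≡ a ∨ b × a ∧ b ≡ false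
  bits true  true  true  ()
  bits true  true  false ()
  bits true  false true  _ = ≡.refl , ≡.refl
  bits false true  true  _ = ≡.refl , ≡.refl
  bits false false false _ = ≡.refl , ≡.refl

blocks-row : ∀ {n} o α (u : Fin n) → map (λ s → lookup s u) (blocks n o α) ≡ rowOfLabel o α (toℕ u)
blocks-row o []      u = ≡.refl
blocks-row o (t ∷ α) u = ≡.cong₂ _∷_ (Vec.lookup∘tabulate _ u) (blocks-row (o ℕ.+ t) α u)

private
  length-blocks : ∀ n o α → length (blocks n o α) ≡ length α
  length-blocks n o []      = ≡.refl
  length-blocks n o (t ∷ α) = ≡.cong suc (length-blocks n (o ℕ.+ t) α)

  columns-≡ : ∀ {n} (xs ys : List (Subset n)) → length xs ≡ length ys → (∀ u → map (λ s → lookup s u) xs ≡ map (λ s → lookup s u) ys) → xs ≡ ys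
  columns-≡ []       []       _   _  = ≡.refl
  columns-≡ (x ∷ xs) (y ∷ ys) len eq = ≡.cong₂ _∷_ (vec-ext (List.∷-injectiveˡ ∘ eq)) (columns-≡ xs ys (ℕ.suc-injective len) (List.∷-injectiveʳ ∘ eq))

module FinSums where
  module Zs = Sums ℤ.+-*-commutativeRing

  Σᶠ : ∀ {n} → (Fin n → ℤ) → ℤ
  Σᶠ {n} f = ∑ᶻ (allFin n) f

  Σᶠ-suc : ∀ {n} (f : Fin (suc n) → ℤ) → Σᶠ f ≡ f zero ℤ.+ Σᶠ (f ∘ suc)
  Σᶠ-suc {n} f = ≡.cong (λ z → f zero ℤ.+ z) (≡.trans (≡.cong (λ es → ∑ᶻ es f) (≡.sym (List.map-tabulate (λ u → u) suc))) (Zs.∑-map suc (allFin n)))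

  Σᶠ-cong : ∀ {n} {f g : Fin n → ℤ} → f ≗ g → Σᶠ f ≡ Σᶠ g
  Σᶠ-cong {n} = Zs.∑-cong (allFin n)

  Σᶠ-*ˡ : ∀ {n} a (f : Fin n → ℤ) → Σᶠ (λ u → a ℤ.* f u) ≡ a ℤ.* Σᶠ f
  Σᶠ-*ˡ {n} a f = ≡.sym (Zs.∑-*ˡ a (allFin n))

  ∑-elements : ∀ {n} (p : Subset n) (f : Fin n → ℤ) → ∑ᶻ (elements p) f ≡ Σᶠ (λ u → 𝟚 (lookup p u) ℤ.* f u)
  ∑-elements {n} p f = ≡.trans (Zs.∑-filter (Sub._∈? p) (allFin n)) (Σᶠ-cong λ u → select (u Sub.∈? p) (f u) (lookup p u) ≡.refl)
    where
    select : ∀ {u} (d : Dec (u Sub.∈ p)) x b → lookup p u ≡ b → Zs.when d x ≡ 𝟚 b ℤ.* x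
    select (yes _) x true  _  = ≡.sym (ℤ.*-identityˡ x)
    select (no _)  x false _  = ≡.refl
    select {u} (no u∉) x true eq = ⊥-elim (u∉ (Vec.lookup⇒[]= u p eq))
    select (yes u∈) x false eq with ≡.trans (≡.sym (Vec.[]=⇒lookup u∈)) eq
    ... | ()

  specialExponent : ∀ {m} → (Fin m → ℤ) → ℤ
  specialExponent {m} f = Σᶠ (λ i → (+ m ℤ.- 1ℤ ℤ.- + 2 ℤ.* + toℕ i) ℤ.* f i)

module Decompositions {w : Web} (I : RadialCut w) where
  open Flows I
  open LabelledFlows I

  size-sumLoops : ∀ {n} (M : Vec (Vec Bool edges) n) e → + ∣ lookup (transpose M) e ∣ ≡ sumLoops M e
  size-sumLoops []      e = ≡.cong (λ r → + ∣ r ∣) (Vec.lookup-replicate e [])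
  size-sumLoops (γ ∷ M) e = ≡.trans (≡.cong (λ r → + ∣ r ∣) (Vec.lookup-zipWith Vec._∷_ e γ (transpose M))) (step (lookup γ e))
    where
    step : ∀ b → + ∣ b ∷ lookup (transpose M) e ∣ ≡ 𝟚 b ℤ.+ sumLoops M e
    step true  = ≡.cong (λ z → 1ℤ ℤ.+ z) (size-sumLoops M e)
    step false = ≡.trans (size-sumLoops M e) (≡.sym (ℤ.+-identityˡ _))

  rows⇒ : ∀ {n} k (M : Vec (Vec Bool edges) n) → Rows k M → ∀ u → Flow ⟦ lookup M u ⟧ˢ × AtRow (k ℕ.+ toℕ u) (lookup M u)
  rows⇒ k (γ ∷ M) ((f , r) , rs) zero    = f , ≡.subst (λ k → AtRow k γ) (≡.sym (ℕ.+-identityʳ k)) r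
  rows⇒ k (γ ∷ M) (_ , rs)       (suc u) = ≡.subst (λ k → Flow ⟦ lookup M u ⟧ˢ × AtRow k (lookup M u)) (≡.sym (ℕ.+-suc k (toℕ u))) (rows⇒ (suc k) M rs u)

  ⇒rows : ∀ {n} k (M : Vec (Vec Bool edges) n) → (∀ u → Flow ⟦ lookup M u ⟧ˢ × AtRow (k ℕ.+ toℕ u) (lookup M u)) → Rows k M
  ⇒rows k []      p = tt
  ⇒rows k (γ ∷ M) p = (proj₁ (p zero) , ≡.subst (λ k → AtRow k γ) (ℕ.+-identityʳ k) (proj₂ (p zero))) ,
    ⇒rows (suc k) M (λ u → ≡.subst (λ k → Flow ⟦ lookup M u ⟧ˢ × AtRow k (lookup M u)) (ℕ.+-suc k (toℕ u)) (p (suc u)))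

  thick : Weight
  thick e = + thickness e

  private
    n = degree

    column : ∀ (M : Vec (Vec Bool edges) n) u → map (λ s → lookup s u) (map (lookup (transpose M)) cut) ≡ map (lookup (lookup M u)) cut
    column M u = ≡.trans (≡.sym (List.map-∘ cut)) (List.map-cong (lookup-transpose M u) cut)

    -- A set is the disjoint union of two others exactly when its indicator function is the sum of
    -- theirs; label by label this is conservation.
    conserved⇔ : ∀ (M : Vec (Vec Bool edges) n) v → (Splits I (transpose M) v → ∀ u → Conserved ⟦ lookup M u ⟧ˢ v) × ((∀ u → Conserved ⟦ lookup M u ⟧ˢ v) → Splits I (transpose M) v)
    conserved⇔ M (merge x y o) =
      (λ d u → ≡.trans (≡.cong (λ z → 𝟚 (lookup (lookup M u) x) ℤ.+ z) (ℤ.+-identityʳ _)) (≡.trans (≡.trans (≡.sym (bits u)) (disjointUnion⇒ d u)) (≡.trans (entry u o) (≡.sym (ℤ.+-identityʳ _))))) ,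
      (λ c → ⇒disjointUnion λ u → ≡.trans (bits u) (≡.trans (≡.cong (λ z → 𝟚 (lookup (lookup M u) x) ℤ.+ z) (≡.sym (ℤ.+-identityʳ _))) (≡.trans (c u) (≡.trans (ℤ.+-identityʳ _) (≡.sym (entry u o))))))
      where
      entry : ∀ u e → 𝟚 (lookup (lookup (transpose M) e) u) ≡ 𝟚 (lookup (lookup M u) e)
      entry u e = ≡.cong 𝟚 (lookup-transpose M u e)
      bits : ∀ u → 𝟚 (lookup (lookup (transpose M) x) u) ℤ.+ 𝟚 (lookup (lookup (transpose M) y) u) ≡ 𝟚 (lookup (lookup M u) x) ℤ.+ 𝟚 (lookup (lookup M u) y)
      bits u = ≡.cong₂ ℤ._+_ (entry u x) (entry u y)
    conserved⇔ M (split o x y) =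
      (λ d u → ≡.sym (≡.trans (≡.cong (λ z → 𝟚 (lookup (lookup M u) x) ℤ.+ z) (ℤ.+-identityʳ _)) (≡.trans (≡.trans (≡.sym (bits u)) (disjointUnion⇒ d u)) (≡.trans (entry u o) (≡.sym (ℤ.+-identityʳ _)))))) ,
      (λ c → ⇒disjointUnion λ u → ≡.trans (bits u) (≡.trans (≡.cong (λ z → 𝟚 (lookup (lookup M u) x) ℤ.+ z) (≡.sym (ℤ.+-identityʳ _))) (≡.trans (≡.sym (c u)) (≡.trans (ℤ.+-identityʳ _) (≡.sym (entry u o))))))
      where
      entry : ∀ u e → 𝟚 (lookup (lookup (transpose M) e) u) ≡ 𝟚 (lookup (lookup M u) e)
      entry u e = ≡.cong 𝟚 (lookup-transpose M u e)
      bits : ∀ u → 𝟚 (lookup (lookup (transpose M) x) u) ℤ.+ 𝟚 (lookup (lookup (transpose M) y) u) ≡ 𝟚 (lookup (lookup M u) x) ℤ.+ 𝟚 (lookup (lookup M u) y)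
      bits u = ≡.cong₂ ℤ._+_ (entry u x) (entry u y)

  SLD⇒valid : ∀ M → IsSLD I (transpose M) → Valid thick M
  SLD⇒valid M (atCut , sizes , splits) =
    ⇒rows 0 M (λ u → ↭.All-resp-↭ (↭-sym order-↭) (All.map (λ {v} s → proj₁ (conserved⇔ M v) s u) splits) ,
      ≡.trans (≡.sym (column M u)) (≡.trans (≡.cong (map (λ s → lookup s u)) atCut) (blocks-row 0 initialThickness u))) ,
    λ e → ≡.trans (≡.sym (size-sumLoops M e)) (≡.cong +_ (sizes e))

  valid⇒SLD : ∀ M → Valid thick M → IsSLD I (transpose M)
  valid⇒SLD M (rows , sums) =
    columns-≡ _ _ (≡.trans (List.length-map _ cut) (≡.sym (≡.trans (length-blocks n 0 initialThickness) (List.length-map _ cut))))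
      (λ u → ≡.trans (column M u) (≡.trans (proj₂ (rows⇒ 0 M rows u)) (≡.sym (blocks-row 0 initialThickness u)))) ,
    (λ e → ℤ.+-injective (≡.trans (size-sumLoops M e) (sums e))) ,
    ↭.All-resp-↭ order-↭ (All.tabulate λ {v} v∈ → proj₂ (conserved⇔ M v) (λ u → All.lookup (proj₁ (rows⇒ 0 M rows u)) v∈))

  open FinSums

  private
    module _ {n : ℕ} where
      at : Vec (Vec Bool edges) n → Edge → Fin n → ℤ
      at M e u = 𝟚 (lookup (lookup M u) e)

      cutPairs : Vec (Vec Bool edges) n → Edge → (Fin n → Fin n → ℤ) → ℤ
      cutPairs M e η = Σᶠ (λ u → at M e u ℤ.* Σᶠ (λ v → at M e v ℤ.* Zs.when (u Fin.<? v) (η u v)))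

      mergePairs : Vec (Vec Bool edges) n → Edge → Edge → (Fin n → Fin n → ℤ) → ℤ
      mergePairs M x y η = Σᶠ (λ u → at M x u ℤ.* Σᶠ (λ v → at M y v ℤ.* η u v))

      alternating : Vec (Vec Bool edges) n → Edge → (Fin n → ℤ) → ℤ
      alternating M e s = Σᶠ (λ v → at M e v ℤ.* s v)

    cutDot : ∀ {n} → Edge → ℤ → Vec (Vec Bool edges) n → (Fin n → ℤ) → ℤ
    cutDot e a []      s = 0ℤ
    cutDot e a (γ ∷ M) s = s zero ℤ.* (a ℤ.* ⟦ γ ⟧ˢ e) ℤ.+ cutDot e (a ℤ.+ ⟦ γ ⟧ˢ e) M (s ∘ suc)

    mergeDot : ∀ {n} → Edge → Edge → ℤ → ℤ → Vec (Vec Bool edges) n → (Fin n → ℤ) → ℤ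
    mergeDot x y a b []      s = 0ℤ
    mergeDot x y a b (γ ∷ M) s = s zero ℤ.* (a ℤ.* ⟦ γ ⟧ˢ y ℤ.- b ℤ.* ⟦ γ ⟧ˢ x) ℤ.+ mergeDot x y (a ℤ.+ ⟦ γ ⟧ˢ x) (b ℤ.+ ⟦ γ ⟧ˢ y) M (s ∘ suc)

    Signed : ∀ {n} → (Fin n → Fin n → ℤ) → (Fin n → ℤ) → Set
    Signed η s = ∀ {u v} → u Fin.< v → η u v ≡ s v × η v u ≡ ℤ.- s v

    -- The induction removes the smallest label, and a counts the removed labels on the edge e;
    -- their pairs with the remaining labels form the second summand.
    cutPairs-dot : ∀ {n} e a (M : Vec (Vec Bool edges) n) {η s} → Signed η s →
      cutPairs M e η ℤ.+ a ℤ.* alternating M e s ≡ cutDot e a M s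
    cutPairs-dot e a []      signed = ≡.trans (ℤ.+-identityˡ _) (ℤ.*-zeroʳ a)
    cutPairs-dot {suc n} e a (γ ∷ M) {η} {s} signed = ≡.trans (≡.cong₂ (λ x y → x ℤ.+ a ℤ.* y) expand (Σᶠ-suc (λ v → at (γ ∷ M) e v ℤ.* s v)))
      (≡.trans (lemma g (s zero) A (cutPairs M e η′) a) (≡.cong (λ z → s zero ℤ.* (a ℤ.* g) ℤ.+ z) (cutPairs-dot e (a ℤ.+ g) M {η′} {s ∘ suc} (λ u<v → signed (ℕ.s≤s u<v)))))
      where
      g = ⟦ γ ⟧ˢ e
      A = alternating M e (s ∘ suc)
      η′ : Fin n → Fin n → ℤ
      η′ u v = η (suc u) (suc v)
      pair : Fin (suc n) → Fin (suc n) → ℤ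
      pair u v = at (γ ∷ M) e v ℤ.* Zs.when (u Fin.<? v) (η u v)
      expand : cutPairs (γ ∷ M) e η ≡ g ℤ.* A ℤ.+ cutPairs M e η′
      expand = ≡.trans (Σᶠ-suc (λ u → at (γ ∷ M) e u ℤ.* Σᶠ (pair u))) (≡.cong₂ ℤ._+_
        (≡.cong (λ z → g ℤ.* z) (≡.trans (Σᶠ-suc (pair zero)) (≡.trans (≡.cong₂ ℤ._+_ (ℤ.*-zeroʳ g) ≡.refl) (≡.trans (ℤ.+-identityˡ _)
          (Σᶠ-cong λ v → ≡.cong (λ z → at M e v ℤ.* z) (≡.trans (Zs.when-yes (zero {n} Fin.<? suc v) (ℕ.s≤s ℕ.z≤n)) (proj₁ (signed (ℕ.s≤s ℕ.z≤n)))))))))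
        (Σᶠ-cong λ u → ≡.cong (λ z → at M e u ℤ.* z) (≡.trans (Σᶠ-suc (pair (suc u))) (≡.trans (≡.cong₂ ℤ._+_ (ℤ.*-zeroʳ g) ≡.refl) (≡.trans (ℤ.+-identityˡ _)
          (Σᶠ-cong λ v → ≡.cong (λ z → at M e v ℤ.* z) (Zs.when-cong (suc u Fin.<? suc v) (u Fin.<? v) (λ { (ℕ.s≤s p) → p }) ℕ.s≤s (λ _ → ≡.refl))))))))
      lemma : ∀ g s A T a → (g ℤ.* A ℤ.+ T) ℤ.+ a ℤ.* (g ℤ.* s ℤ.+ A) ≡ s ℤ.* (a ℤ.* g) ℤ.+ (T ℤ.+ (a ℤ.+ g) ℤ.* A)
      lemma = solve-∀

    -- As for `cutPairs-dot`, with one counter for each input of the merge. A loop is never on both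
    -- inputs, so pairs of equal labels, whose sign is not governed by s, do not occur.
    mergePairs-dot : ∀ {n} x y a b (M : Vec (Vec Bool edges) n) {η s} → (∀ u → at M x u ℤ.* at M y u ≡ 0ℤ) → Signed η s →
      mergePairs M x y η ℤ.+ (a ℤ.* alternating M y s ℤ.- b ℤ.* alternating M x s) ≡ mergeDot x y a b M s
    mergePairs-dot x y a b []      _ signed = lemma a b
      where
      lemma : ∀ a b → 0ℤ ℤ.+ (a ℤ.* 0ℤ ℤ.- b ℤ.* 0ℤ) ≡ 0ℤ
      lemma = solve-∀
    mergePairs-dot {suc n} x y a b (γ ∷ M) {η} {s} disjoint signed =
      ≡.trans (≡.cong₂ ℤ._+_ expand (≡.cong₂ (λ p r → a ℤ.* p ℤ.- b ℤ.* r) (Σᶠ-suc (λ v → at (γ ∷ M) y v ℤ.* s v)) (Σᶠ-suc (λ v → at (γ ∷ M) x v ℤ.* s v))))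
        (≡.trans (lemma gx gy (s zero) Ax Ay (mergePairs M x y η′) a b) (≡.cong (λ z → s zero ℤ.* (a ℤ.* gy ℤ.- b ℤ.* gx) ℤ.+ z)
          (mergePairs-dot x y (a ℤ.+ gx) (b ℤ.+ gy) M {η′} {s ∘ suc} (disjoint ∘ suc) (λ u<v → signed (ℕ.s≤s u<v)))))
      where
      gx = ⟦ γ ⟧ˢ x
      gy = ⟦ γ ⟧ˢ y
      Ax = alternating M x (s ∘ suc)
      Ay = alternating M y (s ∘ suc)
      η′ : Fin n → Fin n → ℤ
      η′ u v = η (suc u) (suc v)
      pair : Fin (suc n) → Fin (suc n) → ℤ
      pair u v = at (γ ∷ M) y v ℤ.* η u v
      rearrange : ∀ g a s → a ℤ.* (g ℤ.* ℤ.- s) ≡ ℤ.- g ℤ.* (a ℤ.* s)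
      rearrange = solve-∀
      diagonal : gx ℤ.* (gy ℤ.* η zero zero) ≡ 0ℤ
      diagonal = ≡.trans (≡.sym (ℤ.*-assoc gx gy _)) (≡.trans (≡.cong (ℤ._* η zero zero) (disjoint zero)) ≡.refl)
      first : gx ℤ.* Σᶠ (λ v → at (γ ∷ M) y v ℤ.* η zero v) ≡ gx ℤ.* Ay
      first = ≡.trans (≡.cong (λ z → gx ℤ.* z) (Σᶠ-suc (pair zero))) (≡.trans (ℤ.*-distribˡ-+ gx _ _) (≡.trans (≡.cong₂ ℤ._+_ diagonal (≡.cong (λ z → gx ℤ.* z)
        (Σᶠ-cong λ v → ≡.cong (λ z → at M y v ℤ.* z) (proj₁ (signed (ℕ.s≤s ℕ.z≤n)))))) (ℤ.+-identityˡ _)))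
      rest : Σᶠ (λ u → at M x u ℤ.* Σᶠ (λ v → at (γ ∷ M) y v ℤ.* η (suc u) v)) ≡ ℤ.- gy ℤ.* Ax ℤ.+ mergePairs M x y η′
      rest = ≡.trans (Σᶠ-cong λ u → ≡.trans (≡.cong (λ z → at M x u ℤ.* z) (≡.trans (Σᶠ-suc (pair (suc u))) (≡.cong₂ ℤ._+_ (≡.cong (λ z → gy ℤ.* z) (proj₂ (signed {zero} {suc u} (ℕ.s≤s ℕ.z≤n)))) ≡.refl)))
          (≡.trans (ℤ.*-distribˡ-+ (at M x u) _ _) (≡.cong₂ ℤ._+_ (rearrange gy (at M x u) (s (suc u))) ≡.refl)))
        (≡.trans (Zs.∑-+ (allFin n)) (≡.cong₂ ℤ._+_ (Σᶠ-*ˡ (ℤ.- gy) (λ u → at M x u ℤ.* s (suc u))) ≡.refl))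
      expand : mergePairs (γ ∷ M) x y η ≡ gx ℤ.* Ay ℤ.+ (ℤ.- gy ℤ.* Ax ℤ.+ mergePairs M x y η′)
      expand = ≡.trans (Σᶠ-suc (λ u → at (γ ∷ M) x u ℤ.* Σᶠ (pair u))) (≡.cong₂ ℤ._+_ first rest)
      lemma : ∀ gx gy s Ax Ay T a b → (gx ℤ.* Ay ℤ.+ (ℤ.- gy ℤ.* Ax ℤ.+ T)) ℤ.+ (a ℤ.* (gy ℤ.* s ℤ.+ Ay) ℤ.- b ℤ.* (gx ℤ.* s ℤ.+ Ax)) ≡
        s ℤ.* (a ℤ.* gy ℤ.- b ℤ.* gx) ℤ.+ (T ℤ.+ ((a ℤ.+ gx) ℤ.* Ay ℤ.- (b ℤ.+ gy) ℤ.* Ax))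
      lemma = solve-∀

    vertexDot : ∀ {n} → Weight → Vec (Vec Bool edges) n → (Fin n → ℤ) → Vertex Edge → ℤ
    vertexDot f M s (merge x y _) = mergeDot x y (f x) (f y) M s
    vertexDot f M s (split _ _ _) = 0ℤ

    dots-attackVector : ∀ {n} f (M : Vec (Vec Bool edges) n) s →
      ∑ᶻ cut (λ e → cutDot e (f e) M s) ℤ.+ ∑ᶻ order (vertexDot f M s) ≡ dot s (attackVector f M)
    dots-attackVector f [] s = ≡.cong₂ ℤ._+_ (Zs.∑-0 cut) (≡.trans (Zs.∑-cong order λ { (merge _ _ _) → ≡.refl ; (split _ _ _) → ≡.refl }) (Zs.∑-0 order))
    dots-attackVector f (γ ∷ M) s = ≡.trans (≡.cong₂ ℤ._+_
        (≡.trans (Zs.∑-+ cut) (≡.cong₂ ℤ._+_ (≡.sym (Zs.∑-*ˡ (s zero) cut)) ≡.refl))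
        (≡.trans (Zs.∑-cong order vertex) (≡.trans (Zs.∑-+ order) (≡.cong₂ ℤ._+_ (≡.sym (Zs.∑-*ˡ (s zero) order)) ≡.refl))))
      (≡.trans (lemma (s zero) (C f ⟦ γ ⟧ˢ) (J f ⟦ γ ⟧ˢ) _ _) (≡.cong (λ z → s zero ℤ.* attacks f γ ℤ.+ z) (dots-attackVector (f ⊕ ⟦ γ ⟧ˢ) M (s ∘ suc))))
      where
      vertex : ∀ v → vertexDot f (γ ∷ M) s v ≡ s zero ℤ.* J-at f ⟦ γ ⟧ˢ v ℤ.+ vertexDot (f ⊕ ⟦ γ ⟧ˢ) M (s ∘ suc) v
      vertex (merge x y _) = ≡.refl
      vertex (split _ _ _) = ≡.sym (≡.trans (ℤ.+-identityʳ _) (ℤ.*-zeroʳ (s zero)))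
      lemma : ∀ s c j x y → (s ℤ.* c ℤ.+ x) ℤ.+ (s ℤ.* j ℤ.+ y) ≡ s ℤ.* (j ℤ.+ c) ℤ.+ (x ℤ.+ y)
      lemma = solve-∀

    disjoint-at-merge : ∀ {γ x y o} → Conserved ⟦ γ ⟧ˢ (merge x y o) → ⟦ γ ⟧ˢ x ℤ.* ⟦ γ ⟧ˢ y ≡ 0ℤ
    disjoint-at-merge {γ} {x} {y} {o} = bits (lookup γ x) (lookup γ y) (lookup γ o)
      where
      bits : ∀ a b c → 𝟚 a ℤ.+ (𝟚 b ℤ.+ 0ℤ) ≡ 𝟚 c ℤ.+ 0ℤ → 𝟚 a ℤ.* 𝟚 b ≡ 0ℤ
      bits true  true  true  ()
      bits true  true  false ()
      bits true  false _ _ = ≡.refl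
      bits false b     _ _ = ≡.refl

  -- Grouping the attacking pairs by their larger label v, all signs in the group are s v up to
  -- orientation. The pairs from the blocks add up to C and those from the merges to J, both against
  -- the sum of the loops with smaller labels.
  inv-attackVector : ∀ M → Valid thick M → ∀ σ s → SignedBy σ s → invᴸ I (transpose M) σ ≡ dot s (attackVector 0ʷ M)
  inv-attackVector M valid@(rows , _) σ s signed = ≡.trans (Zs.∑-++ blockPairs {f = sign-of}) (≡.trans (≡.cong₂ ℤ._+_ cut-part vertex-part) (dots-attackVector 0ʷ M s))
    where
    L = transpose M
    η = ε σ
    entry : ∀ e u → 𝟚 (lookup (lookup L e) u) ≡ at M e u
    entry e u = ≡.cong 𝟚 (lookup-transpose M u e)
    before : Fin n × Fin n → Set
    before (u , v) = u Fin.< v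
    before? : ∀ uv → Dec (before uv)
    before? (u , v) = u Fin.<? v
    sign-of : Fin n × Fin n → ℤ
    sign-of (u , v) = η u v
    pairsIn : Subset n → List (Fin n × Fin n)
    pairsIn b = filter before? (cartesianProduct (elements b) (elements b))
    pairs-at : ∀ e → ∑ᶻ (pairsIn (lookup L e)) sign-of ≡ cutPairs M e η
    pairs-at e = ≡.trans (Zs.∑-filter before? (cartesianProduct els els) {sign-of}) (≡.trans (Zs.∑-product _,_ els els {λ uv → Zs.when (before? uv) (sign-of uv)})
      (≡.trans (∑-elements (lookup L e) (λ u → ∑ᶻ els (λ v → Zs.when (u Fin.<? v) (η u v)))) (Σᶠ-cong λ u → ≡.cong₂ ℤ._*_ (entry e u)
        (≡.trans (∑-elements (lookup L e) (λ v → Zs.when (u Fin.<? v) (η u v))) (Σᶠ-cong λ v → ≡.cong (ℤ._* Zs.when (u Fin.<? v) (η u v)) (entry e v))))))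
      where els = elements (lookup L e)
    blockPairs : List (Fin n × Fin n)
    blockPairs = concatMap pairsIn (B I)
    cut-part : ∑ᶻ blockPairs sign-of ≡ ∑ᶻ cut (λ e → cutDot e 0ℤ M s)
    cut-part = ≡.trans (Zs.∑-concatMap pairsIn (B I) {sign-of}) (≡.trans (≡.cong (λ bs → ∑ᶻ bs (λ b → ∑ᶻ (pairsIn b) sign-of)) (≡.sym (proj₁ (valid⇒SLD M valid)))) (≡.trans (Zs.∑-map (lookup L) cut)
      (Zs.∑-cong cut λ e → ≡.trans (pairs-at e) (≡.trans (≡.sym (ℤ.+-identityʳ _)) (cutPairs-dot e 0ℤ M signed)))))
    vertex-part : _ ≡ ∑ᶻ order (vertexDot 0ʷ M s)
    vertex-part = ≡.trans (Zs.∑-concatMap _ vertices {sign-of}) (≡.trans (Zs.∑-↭ (↭-sym order-↭)) (Zs.∑-cong-∈ order (λ {v} v∈ → at-vertex v (λ u → All.lookup (proj₁ (rows⇒ 0 M rows u)) v∈))))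
      where
      at-vertex : ∀ v → (∀ u → Conserved ⟦ lookup M u ⟧ˢ v) → _ ≡ vertexDot 0ʷ M s v
      at-vertex (merge x y o) c = ≡.trans (Zs.∑-product _,_ (elements (lookup L x)) (elements (lookup L y)) {sign-of})
        (≡.trans (∑-elements (lookup L x) (λ u → ∑ᶻ (elements (lookup L y)) (η u))) (≡.trans (Σᶠ-cong λ u → ≡.cong₂ ℤ._*_ (entry x u) (≡.trans (∑-elements (lookup L y) (η u)) (Σᶠ-cong λ v → ≡.cong (ℤ._* η u v) (entry y v))))
          (≡.trans (≡.sym (ℤ.+-identityʳ _)) (mergePairs-dot x y 0ℤ 0ℤ M (λ u → disjoint-at-merge {lookup M u} {x} {y} {o} (c u)) signed))))
      at-vertex (split _ _ _) c = ≡.refl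

-- The hook identity

module HookSums {c ℓ} {R : CommutativeRing c ℓ} (exp : Exponential R) {w : Web} (I : RadialCut w) (m : ℕ) where
  open CommutativeRing R hiding (zero) renaming (_+_ to _⊞_)
  open Exponential exp
  open Sums R
  open Flows I
  open LabelledFlows I
  open PrincipalSpecialization exp I
  open LabelledLoops exp I m
  open LoopTuples exp I m
  open Decompositions I
  open Relation.Binary.Reasoning.Setoid setoid

  inRange : ℕ → ℕ → Bool
  inRange n j = (1 ≤ᵇ j) ∧ (j ≤ᵇ n)

  hookSum : ∀ n → ((Fin n → ℕ) → ℤ) → ℕ → Carrier
  hookSum n Φ j = if inRange n j then ∑ (SYT n (hook n j)) (λ τ → E (Φ (rowOf τ))) else 0#

  private
    hookSum-subsets : ∀ n Φ (νs : Vec ℤ n) → (∀ S → Φ (rowOf (Hooks.hookOf n S)) ≡ dot (signs S) νs) → ∀ j →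
      hookSum (suc n) Φ j ≈ ∑ (subsets n) (λ S → when (suc ∣ S ∣ ℕ.≟ j) (E (dot (signs S) νs)))
    hookSum-subsets n Φ νs Φ≡ zero = sym (∑-zero (subsets n) λ S → reflexive (when-no (suc ∣ S ∣ ℕ.≟ 0) {E (dot (signs S) νs)} λ ()))
    hookSum-subsets n Φ νs Φ≡ (suc j) with j ℕ.≤? n
    ... | yes j≤n = begin
      (if suc j ≤ᵇ suc n then ∑ (SYT (suc n) (hook (suc n) (suc j))) f else 0#)
        ≡⟨ true-if {suc j ≤ᵇ suc n} (ℕ.≤⇒≤ᵇ (s≤s j≤n)) ⟩
      ∑ (SYT (suc n) (hook (suc n) (suc j))) f
        ≈⟨ ∑-↭ (SYT-hook-↭ j j≤n) ⟩
      ∑ (map hookOf (filter (λ S → ∣ S ∣ ℕ.≟ j) (subsets n))) f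
        ≡⟨ ∑-map hookOf (filter (λ S → ∣ S ∣ ℕ.≟ j) (subsets n)) ⟩
      ∑ (filter (λ S → ∣ S ∣ ℕ.≟ j) (subsets n)) (λ S → f (hookOf S))
        ≈⟨ ∑-filter (λ S → ∣ S ∣ ℕ.≟ j) (subsets n) ⟩
      ∑ (subsets n) (λ S → when (∣ S ∣ ℕ.≟ j) (f (hookOf S)))
        ≈⟨ ∑-cong (subsets n) (λ S → when-cong (∣ S ∣ ℕ.≟ j) (suc ∣ S ∣ ℕ.≟ suc j) (≡.cong suc) ℕ.suc-injective (λ _ → reflexive (≡.cong E (Φ≡ S)))) ⟩
      ∑ (subsets n) (λ S → when (suc ∣ S ∣ ℕ.≟ suc j) (E (dot (signs S) νs))) ∎
      where
      open Hooks n
      f : Tableau (suc n) → Carrier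
      f τ = E (Φ (rowOf τ))
      true-if : ∀ {b} {x y : Carrier} → T b → (if b then x else y) ≡ x
      true-if {true} _ = ≡.refl
    ... | no j≰n = trans (reflexive (false-if {suc j ≤ᵇ suc n} (λ t → j≰n (ℕ.≤-pred (ℕ.≤ᵇ⇒≤ (suc j) (suc n) t)))))
      (sym (∑-zero (subsets n) λ S → reflexive (when-no (suc ∣ S ∣ ℕ.≟ suc j) λ eq → j≰n (≡.subst (_≤ n) (ℕ.suc-injective eq) (∣p∣≤n S)))))
      where
      false-if : ∀ {b} {x y : Carrier} → ¬ T b → (if b then x else y) ≡ y
      false-if {true}  ¬b = ⊥-elim (¬b _)
      false-if {false} ¬b = ≡.refl

  bracketProduct-hookSum : ∀ {n} → 1 ≤ n → (Φ : (Fin n → ℕ) → ℤ) (νs : Vec ℤ n) → (∀ u → toℕ u ≡ 0 → lookup νs u ≡ 0ℤ) →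
    (∀ σ s → SignedBy σ s → Φ σ ≡ dot s νs) → bracketProduct νs ≈ ∑ (upTo (suc n)) (λ k → term n k * (hookSum n Φ k ⊞ hookSum n Φ (suc k)))
  bracketProduct-hookSum {suc n} _ Φ (ν ∷ νs) ν₀ Φ≡ with ν₀ zero ≡.refl
  ... | ≡.refl = trans (bracketProduct-hooks νs) (∑-cong (upTo (suc (suc n))) λ k → *-congˡ (sym (+-cong (hookSum-subsets n Φ νs hooks k) (hookSum-subsets n Φ νs hooks (suc k)))))
    where
    hooks : ∀ S → Φ (rowOf (Hooks.hookOf n S)) ≡ dot (signs S) νs
    hooks S = ≡.trans (Φ≡ _ _ (Hooks.ε-hook n S)) (ℤ.+-identityˡ _)

  ∑-SLD : (F : EdgeSets w degree → Carrier) → ∑ (SLD I) F ≈ ∑ (tuples (subsets edges) degree) (λ M → when (valid? thick M) (F (transpose M)))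
  ∑-SLD F = begin
    ∑ (SLD I) F
      ≈⟨ ∑-filter (isSLD? I) (tuples (subsets degree) edges) ⟩
    ∑ (tuples (subsets degree) edges) (λ L → when (isSLD? I L) (F L))
      ≈⟨ ∑-transpose (true ∷ false ∷ []) degree edges ⟩
    ∑ (tuples (subsets edges) degree) (λ M → when (isSLD? I (transpose M)) (F (transpose M)))
      ≈⟨ ∑-cong (tuples (subsets edges) degree) (λ M → when-cong (isSLD? I (transpose M)) (valid? thick M) (SLD⇒valid M) (valid⇒SLD M) (λ _ → refl)) ⟩
    ∑ (tuples (subsets edges) degree) (λ M → when (valid? thick M) (F (transpose M))) ∎

  hooks : ℕ → Carrier
  hooks j = if inRange degree j then ∑ (SLD I) (λ L → ∑ (SYT degree (hook degree j)) (λ τ → E (invᴸ I L (rowOf τ)))) else 0#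

  private
    hooks-∑ : ∀ j → hooks j ≈ ∑ (SLD I) (λ L → hookSum degree (invᴸ I L) j)
    hooks-∑ j with inRange degree j
    ... | true  = refl
    ... | false = sym (∑-0 (SLD I))

  -- For each loop decomposition the sum over hooks is a product of brackets; the sum of these
  -- products over all decompositions is `Q`, which `Q≈X̂` evaluates.
  hook-identity : 1 ≤ degree →
    ∑ (upTo (suc degree)) (λ k → term degree k * (hooks k ⊞ hooks (suc k))) ≈ factorials initialThickness * X̂ m thick
  hook-identity 1≤n = begin
    ∑ ks (λ k → term degree k * (hooks k ⊞ hooks (suc k)))
      ≈⟨ ∑-cong ks (λ k → *-congˡ (trans (+-cong (hooks-∑ k) (hooks-∑ (suc k))) (sym (∑-+ (SLD I))))) ⟩
    ∑ ks (λ k → term degree k * ∑ (SLD I) (λ L → hookSum degree (invᴸ I L) k ⊞ hookSum degree (invᴸ I L) (suc k)))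
      ≈⟨ ∑-cong ks (λ k → ∑-*ˡ _ (SLD I)) ⟩
    ∑ ks (λ k → ∑ (SLD I) (λ L → term degree k * (hookSum degree (invᴸ I L) k ⊞ hookSum degree (invᴸ I L) (suc k))))
      ≈⟨ ∑-swap ks (SLD I) ⟩
    ∑ (SLD I) (λ L → ∑ ks (λ k → term degree k * (hookSum degree (invᴸ I L) k ⊞ hookSum degree (invᴸ I L) (suc k))))
      ≈⟨ ∑-SLD _ ⟩
    ∑ (tuples (subsets edges) degree) (λ M → when (valid? thick M) (∑ ks (λ k → term degree k * (hookSum degree (invᴸ I (transpose M)) k ⊞ hookSum degree (invᴸ I (transpose M)) (suc k)))))
      ≈⟨ ∑-cong (tuples (subsets edges) degree) (λ M → when-cong (valid? thick M) (valid? thick M) (λ z → z) (λ z → z) (λ valid →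
           bracketProduct-hookSum 1≤n (invᴸ I (transpose M)) (attackVector 0ʷ M) (first M) (inv-attackVector M valid))) ⟨
    ∑ (tuples (subsets edges) degree) (λ M → when (valid? thick M) (bracketProduct (attackVector 0ʷ M)))
      ≈⟨ ∑-tuples≈Q degree thick ⟩
    Q degree thick
      ≈⟨ Q≈X̂ degree ℕ.≤-refl thick (≡.trans (List.map-∘ cut) (≡.cong (map (+_)) (≡.sym (levels-full degree 0 initialThickness ℕ.≤-refl)))) ⟩
    factorials (levels degree 0 initialThickness) * X̂ m thick
      ≡⟨ ≡.cong (λ α → factorials α * X̂ m thick) (levels-full degree 0 initialThickness ℕ.≤-refl) ⟩
    factorials initialThickness * X̂ m thick ∎
    where
    ks = upTo (suc degree)
    -- Label 0 has no smaller label, so nothing attacks it; this is the entry 0 required by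
    -- `bracketProduct-hooks`.
    first : ∀ {n} (M : Vec (Vec Bool edges) n) u → toℕ u ≡ 0 → lookup (attackVector 0ʷ M) u ≡ 0ℤ
    first (γ ∷ M) zero _ = ≡.cong₂ ℤ._+_ (≡.trans (∑ᶻ-cong order {g = λ _ → 0ℤ} λ { (merge _ _ _) → ≡.refl ; (split _ _ _) → ≡.refl }) (∑ᶻ-0 order))
      (∑ᶻ-0 cut)

-- Connected components

module Partitions {E : Set} (_≟_ : DecidableEquality E) (nodes : List E) (nodes-unique : Unique nodes) where
  open import Data.Nat.Base using (_+_)
  open Components _≟_
  open import Data.List.Membership.DecPropositional _≟_ using (_∈?_)

  -- `closed` and `constant` pin down the components from both sides: a class contains all nodes
  -- linked to it, and any labelling that respects the links is constant on it.
  record Invariant (links : List (List E)) (classes : List (List E)) : Set where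
    field
      partitions : concat classes ↭ nodes
      inhabited  : ∀ {C} → C ∈ classes → ∃ λ x → x ∈ C
      closed     : ∀ {link C x y} → link ∈ links → C ∈ classes → x ∈ link → y ∈ link → y ∈ nodes → x ∈ C → y ∈ C
      constant   : (lab : E → ℕ) → (∀ {link x y} → link ∈ links → x ∈ link → y ∈ link → x ∈ nodes → y ∈ nodes → lab x ≡ lab y) →
                   ∀ {C x y} → C ∈ classes → x ∈ C → y ∈ C → lab x ≡ lab y
  open Invariant

  private
    singles : Invariant [] (map [_] nodes)
    singles .partitions = ↭-reflexive (List.concat-map-[_] nodes)
    singles .inhabited C∈ with ∈.∈-map⁻ [_] C∈
    ... | x , _ , ≡.refl = x , here ≡.refl
    singles .closed ()
    singles .constant lab _ C∈ x∈ y∈ with ∈.∈-map⁻ [_] C∈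
    singles .constant lab _ C∈ (here ≡.refl) (here ≡.refl) | _ , _ , ≡.refl = ≡.refl

    concat-filter-↭ : ∀ {P : List E → Set} (P? : ∀ C → Dec (P C)) classes →
      concat (filter P? classes) ++ concat (filter (λ C → ¬? (P? C)) classes) ↭ concat classes
    concat-filter-↭ P? []            = ↭-refl
    concat-filter-↭ P? (C ∷ classes) with P? C
    ... | yes _ = ↭-trans (↭-reflexive (List.++-assoc C _ _)) (↭.++⁺ˡ C (concat-filter-↭ P? classes))
    ... | no  _ = ↭-trans (↭.shifts (concat (filter P? classes)) C) (↭.++⁺ˡ C (concat-filter-↭ P? classes))

    module Join (link : List E) {links classes} (given : Invariant links classes) where
      touches? : ∀ (C : List E) → Dec (Any (_∈ link) C)
      touches? = Any.any? (_∈? link)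

      Ts Us : List (List E)
      Ts = filter touches? classes
      Us = filter (λ C → ¬? (touches? C)) classes

      data Joined : List (List E) → Set where
        untouched : Ts ≡ [] → Joined Us
        merged    : ∀ {C₀} → C₀ ∈ Ts → Joined (concat Ts ∷ Us)

      joined : Joined (join link classes)
      joined with partition touches? classes | List.partition-defn touches? classes
      ... | []     , _ | eq = ≡.subst Joined (≡.sym (≡.cong proj₂ eq)) (untouched (≡.sym (≡.cong proj₁ eq)))
      ... | C ∷ Cs , _ | eq = ≡.subst₂ (λ Ts Us → Joined (concat Ts ∷ Us)) (≡.sym (≡.cong proj₁ eq)) (≡.sym (≡.cong proj₂ eq)) (merged (≡.subst (C ∈_) (≡.cong proj₁ eq) (here ≡.refl)))

      class-nodes : ∀ {C x} → C ∈ classes → x ∈ C → x ∈ nodes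
      class-nodes C∈ x∈ = ↭.∈-resp-↭ (given .partitions) (∈.∈-concat⁺′ x∈ C∈)

      T-classes : ∀ {C} → C ∈ Ts → C ∈ classes × Any (_∈ link) C
      T-classes = ∈.∈-filter⁻ touches? {xs = classes}

      U-classes : ∀ {C} → C ∈ Us → C ∈ classes × ¬ Any (_∈ link) C
      U-classes = ∈.∈-filter⁻ (λ C → ¬? (touches? C)) {xs = classes}

      ∈-concat-Ts : ∀ {x} → x ∈ concat Ts → ∃ λ C → C ∈ Ts × x ∈ C
      ∈-concat-Ts x∈ with ∈.∈-concat⁻′ Ts x∈
      ... | C , x∈C , C∈ = C , C∈ , x∈C

      U-untouched : ∀ {C x} → C ∈ Us → x ∈ C → x ∉ link
      U-untouched C∈ x∈C x∈ = proj₂ (U-classes C∈) (Any.map (λ { ≡.refl → x∈ }) x∈C)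

      partitions′ : ∀ {cs} → Joined cs → concat cs ↭ nodes
      partitions′ (untouched T≡[]) = ↭-trans (≡.subst (λ Ts → concat Us ↭ concat Ts ++ concat Us) (≡.sym T≡[]) ↭-refl) (↭-trans (concat-filter-↭ touches? classes) (given .partitions))
      partitions′ (merged _)       = ↭-trans (concat-filter-↭ touches? classes) (given .partitions)

      inhabited′ : ∀ {cs} → Joined cs → ∀ {C} → C ∈ cs → ∃ λ x → x ∈ C
      inhabited′ (untouched _) C∈ = given .inhabited (proj₁ (U-classes C∈))
      inhabited′ (merged C₀∈) (here ≡.refl) with given .inhabited (proj₁ (T-classes C₀∈))
      ... | x , x∈ = x , ∈.∈-concat⁺′ x∈ C₀∈
      inhabited′ (merged C₀∈) (there C∈) = given .inhabited (proj₁ (U-classes C∈))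

      touched : ∀ {y} → y ∈ link → y ∈ nodes → ∃ λ C → C ∈ Ts × y ∈ C
      touched y∈link y∈ with ∈.∈-concat⁻′ classes (↭.∈-resp-↭ (↭-sym (given .partitions)) y∈)
      ... | C , y∈C , C∈ = C , ∈.∈-filter⁺ touches? C∈ (Any.map (λ { ≡.refl → y∈link }) y∈C) , y∈C

      closed′ : ∀ {cs} → Joined cs → ∀ {l C x y} → l ∈ link ∷ links → C ∈ cs → x ∈ l → y ∈ l → y ∈ nodes → x ∈ C → y ∈ C
      closed′ (untouched _) (here ≡.refl) C∈ x∈ _ _ x∈C = ⊥-elim (U-untouched C∈ x∈C x∈)
      closed′ (untouched _) (there l∈)  C∈ x∈ y∈ y∈n x∈C = given .closed l∈ (proj₁ (U-classes C∈)) x∈ y∈ y∈n x∈C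
      closed′ (merged _) (here ≡.refl) (here ≡.refl) x∈ y∈ y∈n x∈C with touched y∈ y∈n
      ... | C , C∈ , y∈C = ∈.∈-concat⁺′ y∈C C∈
      closed′ (merged _) (here ≡.refl) (there C∈)  x∈ _ _ x∈C = ⊥-elim (U-untouched C∈ x∈C x∈)
      closed′ (merged _) (there l∈)  (here ≡.refl) x∈ y∈ y∈n x∈C with ∈-concat-Ts x∈C
      ... | C , C∈ , x∈C′ = ∈.∈-concat⁺′ (given .closed l∈ (proj₁ (T-classes C∈)) x∈ y∈ y∈n x∈C′) C∈
      closed′ (merged _) (there l∈)  (there C∈)  x∈ y∈ y∈n x∈C = given .closed l∈ (proj₁ (U-classes C∈)) x∈ y∈ y∈n x∈C

      constant′ : ∀ {cs} → Joined cs → (lab : E → ℕ) → (∀ {l x y} → l ∈ link ∷ links → x ∈ l → y ∈ l → x ∈ nodes → y ∈ nodes → lab x ≡ lab y) →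
        ∀ {C x y} → C ∈ cs → x ∈ C → y ∈ C → lab x ≡ lab y
      constant′ j lab linked {C} {x} {y} C∈ x∈ y∈ = go j C∈
        where
        old : ∀ {C x y} → C ∈ classes → x ∈ C → y ∈ C → lab x ≡ lab y
        old = given .constant lab (λ l∈ → linked (there l∈))
        go : ∀ {cs} → Joined cs → C ∈ cs → lab x ≡ lab y
        go (untouched _) C∈ = old (proj₁ (U-classes C∈)) x∈ y∈
        go (merged _) (there C∈) = old (proj₁ (U-classes C∈)) x∈ y∈
        go (merged _) (here ≡.refl) with ∈-concat-Ts x∈ | ∈-concat-Ts y∈
        ... | C₁ , C₁∈ , x∈₁ | C₂ , C₂∈ , y∈₂ with T-classes C₁∈ | T-classes C₂∈
        ... | C₁∈c , t₁ | C₂∈c , t₂ with ∈.find t₁ | ∈.find t₂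
        ... | a , a∈₁ , a∈ | b , b∈₂ , b∈ = ≡.trans (old C₁∈c x∈₁ a∈₁) (≡.trans (linked (here ≡.refl) a∈ b∈ (class-nodes C₁∈c a∈₁) (class-nodes C₂∈c b∈₂)) (old C₂∈c b∈₂ y∈₂))

      invariant : Invariant (link ∷ links) (join link classes)
      invariant .partitions = partitions′ joined
      invariant .inhabited  = inhabited′ joined
      invariant .closed     = closed′ joined
      invariant .constant   = constant′ joined

  components-invariant : ∀ links → Invariant links (components nodes links)
  components-invariant []             = singles
  components-invariant (link ∷ links) = Join.invariant link (components-invariant links)

  module _ {P : E → Set} (P? : ∀ x → Dec (P x)) where
    private
      unique-concat : ∀ classes → Unique (concat classes) → ∀ {C} → C ∈ classes → Unique C
      unique-concat (C ∷ cs) u (here ≡.refl) = unique-++ˡ C u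
        where
        unique-++ˡ : ∀ xs {ys : List E} → Unique (xs ++ ys) → Unique xs
        unique-++ˡ []       _        = []
        unique-++ˡ (x ∷ xs) (x∉ ∷ u) = All.tabulate (λ y∈ → All.lookup x∉ (∈.∈-++⁺ˡ y∈)) ∷ unique-++ˡ xs u
      unique-concat (C ∷ cs) u (there C∈)  = unique-concat cs (unique-++ʳ C u) C∈

      length-one : ∀ C → Unique C → (∃ λ x → x ∈ C × P x) → (∀ {x y} → x ∈ C → y ∈ C → P x → P y → x ≡ y) → length (filter P? C) ≡ 1
      length-one C u (x , x∈ , px) same = go (filter P? C) (Unique.filter⁺ P? u) (∈.∈-filter⁺ P? x∈ px)
        (λ y∈ z∈ → let y∈C , py = ∈.∈-filter⁻ P? y∈ ; z∈C , pz = ∈.∈-filter⁻ P? z∈ in same y∈C z∈C py pz)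
        where
        go : ∀ xs → Unique xs → x ∈ xs → (∀ {y z} → y ∈ xs → z ∈ xs → y ≡ z) → length xs ≡ 1
        go (y ∷ [])     _ _ _ = ≡.refl
        go (y ∷ z ∷ xs) ((y≢z ∷ _) ∷ _) _ same = ⊥-elim (y≢z (same (here ≡.refl) (there (here ≡.refl))))

      length-concat : ∀ classes → (∀ {C} → C ∈ classes → length (filter P? C) ≡ 1) → length (filter P? (concat classes)) ≡ length classes
      length-concat []       _   = ≡.refl
      length-concat (C ∷ cs) one = ≡.trans (≡.cong length (List.filter-++ P? C (concat cs))) (≡.trans (List.length-++ (filter P? C))
        (≡.cong₂ _+_ (one (here ≡.refl)) (length-concat cs (one ∘ there))))

    -- With exactly one marked node in each class, counting classes is counting marked nodes. The
    -- edges at the cut will be the marks.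
    #components-marked : ∀ links →
      (∀ {C} → C ∈ components nodes links → ∃ λ x → x ∈ C × P x) →
      (∀ {C x y} → C ∈ components nodes links → x ∈ C → y ∈ C → P x → P y → x ≡ y) →
      #components nodes links ≡ length (filter P? nodes)
    #components-marked links some same = ≡.trans (≡.sym (length-concat classes λ C∈ → length-one _ (unique-concat classes unique C∈) (some C∈) (same C∈)))
      (↭.↭-length (↭.filter-↭ P? (given .partitions)))
      where
      classes = components nodes links
      given = components-invariant links
      unique : Unique (concat classes)
      unique = ↭Setoid.Unique-resp-↭ (≡.setoid E) (↭⇒↭ₛ (↭-sym (given .partitions))) nodes-unique

module Strands {w : Web} (I : RadialCut w) (γ : Vec Bool (Web.edges w)) (flow : Flows.Flow I (Flows.⟦_⟧ˢ I γ)) where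
  open import Data.Nat.Base using (_+_)
  open Flows I

  count : List Edge → ℕ
  count []       = 0
  count (e ∷ es) = bit (lookup γ e) + count es

  -- The number of strands of γ to the left of e, which identifies a strand since strands do not
  -- cross.
  position : List Edge → Edge → ℕ
  position []       e = 0
  position (x ∷ xs) e = if does (x Fin.≟ e) then 0 else bit (lookup γ x) + position xs e

  private
    count-∑ : ∀ es → + count es ≡ ∑ᶻ es ⟦ γ ⟧ˢ
    count-∑ []       = ≡.refl
    count-∑ (e ∷ es) = ≡.cong₂ ℤ._+_ (bit-𝟚 (lookup γ e)) (count-∑ es)
      where
      bit-𝟚 : ∀ b → + bit b ≡ 𝟚 b
      bit-𝟚 true  = ≡.refl
      bit-𝟚 false = ≡.refl

    balanced : ∀ {v} → Conserved ⟦ γ ⟧ˢ v → count (incoming v) ≡ count (outgoing v)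
    balanced {v} eq = ℤ.+-injective (≡.trans (count-∑ (incoming v)) (≡.trans eq (≡.sym (count-∑ (outgoing v)))))

    bit≤1 : ∀ b → bit b ≤ 1
    bit≤1 true  = s≤s z≤n
    bit≤1 false = z≤n

    one-edge : ∀ e → count (e ∷ []) ≤ 1
    one-edge e = ≡.subst (_≤ 1) (≡.sym (ℕ.+-identityʳ _)) (bit≤1 (lookup γ e))

    incoming≤1 : ∀ v → Conserved ⟦ γ ⟧ˢ v → count (incoming v) ≤ 1
    incoming≤1 v@(merge _ _ o) eq = ≡.subst (_≤ 1) (≡.sym (balanced {v} eq)) (one-edge o)
    incoming≤1 (split i _ _)   eq = one-edge i

    outgoing≤1 : ∀ v → Conserved ⟦ γ ⟧ˢ v → count (outgoing v) ≤ 1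
    outgoing≤1 v eq = ≡.subst (_≤ 1) (balanced {v} eq) (incoming≤1 v eq)

    position-∉ : ∀ ls {rs e} → e ∉ ls → position (ls ++ rs) e ≡ count ls + position rs e
    position-∉ []       e∉ = ≡.refl
    position-∉ (x ∷ ls) {rs} {e} e∉ with x Fin.≟ e
    ... | yes ≡.refl = ⊥-elim (e∉ (here ≡.refl))
    ... | no  _    = ≡.trans (≡.cong (λ k → bit (lookup γ x) + k) (position-∉ ls (e∉ ∘ there))) (≡.sym (ℕ.+-assoc (bit (lookup γ x)) _ _))

    position-∈ : ∀ ls {rs e} → e ∈ ls → position (ls ++ rs) e ≡ position ls e
    position-∈ (x ∷ ls) {rs} {e} e∈ with x Fin.≟ e | e∈
    ... | yes _   | _         = ≡.refl
    ... | no  x≢e | here ≡.refl = ⊥-elim (x≢e ≡.refl)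
    ... | no  _   | there e∈  = ≡.cong (λ k → bit (lookup γ x) + k) (position-∈ ls e∈)

    count-positive : ∀ es {e} → e ∈ es → lookup γ e ≡ true → 1 ≤ count es
    count-positive (x ∷ es) (here ≡.refl) eq rewrite eq = s≤s z≤n
    count-positive (x ∷ es) (there e∈)  eq = ℕ.≤-trans (count-positive es e∈ eq) (ℕ.m≤n+m _ (bit (lookup γ x)))

    position-only : ∀ es {rs e} → count es ≤ 1 → e ∈ es → lookup γ e ≡ true → position (es ++ rs) e ≡ 0
    position-only (x ∷ es) {rs} {e} ≤1 e∈ on with x Fin.≟ e | e∈
    ... | yes _   | _         = ≡.refl
    ... | no  x≢e | here ≡.refl = ⊥-elim (x≢e ≡.refl)
    ... | no  _   | there e∈  = ≡.cong₂ _+_ (zero-bit (bit (lookup γ x)) (count-positive es e∈ on) ≤1)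
                                  (position-only es (ℕ.≤-trans (ℕ.m≤n+m _ (bit (lookup γ x))) ≤1) e∈ on)
      where
      zero-bit : ∀ a {c} → 1 ≤ c → a + c ≤ 1 → a ≡ 0
      zero-bit zero    _   _          = ≡.refl
      zero-bit (suc a) 1≤c (s≤s a+c≤0) = ⊥-elim (ℕ.<⇒≱ 1≤c (ℕ.≤-trans (ℕ.m≤n+m _ a) a+c≤0))

    position-at : ∀ ls es {rs} → Unique (ls ++ es ++ rs) → count es ≤ 1 → ∀ {e} → e ∈ es → lookup γ e ≡ true → position (ls ++ es ++ rs) e ≡ count ls
    position-at ls es u ≤1 e∈ on = ≡.trans (position-∉ ls (λ e∈ls → unique-disjoint ls u e∈ls (∈.∈-++⁺ˡ e∈)))
      (≡.trans (≡.cong (λ k → count ls + k) (position-only es ≤1 e∈ on)) (ℕ.+-identityʳ _))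

    position-pass : ∀ ls v rs → Conserved ⟦ γ ⟧ˢ v → Unique (ls ++ incoming v ++ rs) → Unique (ls ++ outgoing v ++ rs) →
      ∀ {e} → e ∈ ls ⊎ e ∈ rs → position (ls ++ incoming v ++ rs) e ≡ position (ls ++ outgoing v ++ rs) e
    position-pass ls v rs eq u u′ (inj₁ e∈) = ≡.trans (position-∈ ls e∈) (≡.sym (position-∈ ls e∈))
    position-pass ls v rs eq u u′ {e} (inj₂ e∈) = ≡.trans (after (incoming v) u) (≡.trans (≡.cong (λ k → count ls + (k + position rs e)) (balanced {v} eq)) (≡.sym (after (outgoing v) u′)))
      where
      after : ∀ es → Unique (ls ++ es ++ rs) → position (ls ++ es ++ rs) e ≡ count ls + (count es + position rs e)
      after es u = ≡.trans (position-∉ ls (λ e∈ls → unique-disjoint ls u e∈ls (∈.∈-++⁺ʳ es e∈)))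
        (≡.cong (λ k → count ls + k) (position-∉ es (λ e∈es → unique-disjoint es (unique-++ʳ ls u) e∈es e∈)))

    heads-unique : Unique (concatMap incoming order)
    heads-unique = ↭Setoid.Unique-resp-↭ (≡.setoid Edge) (↭⇒↭ₛ (↭-sym (concatMap-↭ incoming order-↭))) unique-head

    -- Each vertex has as many strands of γ above as below, so passing it shifts no other edge. An
    -- edge which no later vertex consumes keeps its position to the end.
    persist : ∀ {r vs r′} → Sweep r vs r′ → All (Conserved ⟦ γ ⟧ˢ) vs → ∀ {e} → e ∈ r → e ∉ concatMap incoming vs → position r e ≡ position r′ e
    persist (done _) _ _ _ = ≡.refl
    persist (pass {v = v} ls rs u ≡.refl sw) (eq ∷ f) {e} e∈ e∉ with ∈.∈-++⁻ ls e∈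
    ... | inj₁ e∈ls = ≡.trans (position-pass ls v rs eq u (sweep-unique sw) (inj₁ e∈ls)) (persist sw f (∈.∈-++⁺ˡ e∈ls) (e∉ ∘ ∈.∈-++⁺ʳ (incoming v)))
    ... | inj₂ e∈′ with ∈.∈-++⁻ (incoming v) e∈′
    ...   | inj₁ e∈in = ⊥-elim (e∉ (∈.∈-++⁺ˡ e∈in))
    ...   | inj₂ e∈rs = ≡.trans (position-pass ls v rs eq u (sweep-unique sw) (inj₂ e∈rs)) (persist sw f (∈.∈-++⁺ʳ ls (∈.∈-++⁺ʳ (outgoing v) e∈rs)) (e∉ ∘ ∈.∈-++⁺ʳ (incoming v)))

    open import Data.List.Membership.DecPropositional (Fin._≟_ {edges}) using (_∈?_)

    firstPosition : ∀ {r vs r′} → Sweep r vs r′ → Edge → ℕ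
    firstPosition (done _) e = 0
    firstPosition (pass {v = v} ls rs _ _ sw) e = if does (e ∈? outgoing v) then count ls else firstPosition sw e

    -- The position of a strand as a function of the edge alone: read off at the cut, or else where
    -- the sweep first produces the edge.
    label : Edge → ℕ
    label e = if does (e ∈? cut) then position cut e else firstPosition sweep e

    label-cut : ∀ {e} → e ∈ cut → label e ≡ position cut e
    label-cut {e} e∈ = ≡.cong (λ b → if b then position cut e else firstPosition sweep e) (dec-true (e ∈? cut) e∈)

    label-other : ∀ {e} → e ∉ cut → label e ≡ firstPosition sweep e
    label-other {e} e∉ = ≡.cong (λ b → if b then position cut e else firstPosition sweep e) (dec-false (e ∈? cut) e∉)

    LinkConstant : Vertex Edge → Set
    LinkConstant v = ∃ λ k → ∀ {e} → e ∈ incoming v ++ outgoing v → lookup γ e ≡ true → label e ≡ k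

    -- A vertex carries at most one strand in and one out, both with `count ls` strands to their
    -- left. Thus the labels agree with the positions in every row and are equal on the edges of γ
    -- at a vertex.
    links-constant : ∀ {r vs} → Sweep r vs cut → (sw : Sweep r vs cut) → All (Conserved ⟦ γ ⟧ˢ) vs → Unique (concatMap outgoing vs) → Unique (concatMap incoming vs) →
      (∀ {e} → e ∈ r → lookup γ e ≡ true → label e ≡ position r e) →
      (∀ {e} → e ∈ cut → e ∈ r ⊎ e ∉ concatMap incoming vs) →
      (∀ {e} → e ∉ cut → e ∈ concatMap outgoing vs → label e ≡ firstPosition sw e) →
      ∀ {v} → v ∈ vs → LinkConstant v
    links-constant _ (pass {v = v} {vs} ls rs u ≡.refl sw) (eq ∷ f) ut uh row consumed fresh = λ
      { (here ≡.refl) → count ls , at-v ; (there v∈) → links-constant sw sw f (unique-++ʳ (outgoing v) ut) (unique-++ʳ (incoming v) uh) row′ consumed′ fresh′ v∈ }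
      where
      u′ : Unique (ls ++ outgoing v ++ rs)
      u′ = sweep-unique sw
      out-label : ∀ {e} → e ∈ outgoing v → lookup γ e ≡ true → label e ≡ count ls
      out-label {e} e∈ on = by-cut (e ∈? cut)
        where
        gone : e ∈ ls ++ incoming v ++ rs ⊎ e ∉ concatMap incoming (v ∷ vs) → e ∉ concatMap incoming vs
        gone (inj₂ e∉) = e∉ ∘ ∈.∈-++⁺ʳ (incoming v)
        gone (inj₁ e∈r) with ∈.∈-++⁻ ls e∈r
        ... | inj₁ e∈ls = ⊥-elim (unique-disjoint ls u′ e∈ls (∈.∈-++⁺ˡ e∈))
        ... | inj₂ e∈r′ with ∈.∈-++⁻ (incoming v) e∈r′
        ...   | inj₁ e∈in = unique-disjoint (incoming v) uh e∈in
        ...   | inj₂ e∈rs = ⊥-elim (unique-disjoint (outgoing v) (unique-++ʳ ls u′) e∈ e∈rs)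
        by-cut : Dec (e ∈ cut) → label e ≡ count ls
        by-cut (no e∉cut) = ≡.trans (fresh e∉cut (∈.∈-++⁺ˡ e∈)) (≡.cong (λ b → if b then count ls else firstPosition sw e) (dec-true (e ∈? outgoing v) e∈))
        -- An edge of the cut carries the label read at the start. Produced again, it stays in the
        -- row until the sweep is back at the cut, so its position now is that same number.
        by-cut (yes e∈cut) = ≡.trans (label-cut e∈cut) (≡.trans (≡.sym (persist sw f (∈.∈-++⁺ʳ ls (∈.∈-++⁺ˡ e∈)) (gone (consumed e∈cut)))) (position-at ls (outgoing v) u′ (outgoing≤1 v eq) e∈ on))
      at-v : ∀ {e} → e ∈ incoming v ++ outgoing v → lookup γ e ≡ true → label e ≡ count ls
      at-v e∈ on with ∈.∈-++⁻ (incoming v) e∈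
      ... | inj₂ e∈out = out-label e∈out on
      ... | inj₁ e∈in  = ≡.trans (row (∈.∈-++⁺ʳ ls (∈.∈-++⁺ˡ e∈in)) on) (position-at ls (incoming v) u (incoming≤1 v eq) e∈in on)
      row′ : ∀ {e} → e ∈ ls ++ outgoing v ++ rs → lookup γ e ≡ true → label e ≡ position (ls ++ outgoing v ++ rs) e
      row′ e∈ on with ∈.∈-++⁻ ls e∈
      ... | inj₁ e∈ls = ≡.trans (row (∈.∈-++⁺ˡ e∈ls) on) (position-pass ls v rs eq u u′ (inj₁ e∈ls))
      ... | inj₂ e∈′ with ∈.∈-++⁻ (outgoing v) e∈′
      ...   | inj₁ e∈out = ≡.trans (out-label e∈out on) (≡.sym (position-at ls (outgoing v) u′ (outgoing≤1 v eq) e∈out on))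
      ...   | inj₂ e∈rs  = ≡.trans (row (∈.∈-++⁺ʳ ls (∈.∈-++⁺ʳ (incoming v) e∈rs)) on) (position-pass ls v rs eq u u′ (inj₂ e∈rs))
      consumed′ : ∀ {e} → e ∈ cut → e ∈ ls ++ outgoing v ++ rs ⊎ e ∉ concatMap incoming vs
      consumed′ e∈cut with consumed e∈cut
      ... | inj₂ e∉ = inj₂ (e∉ ∘ ∈.∈-++⁺ʳ (incoming v))
      ... | inj₁ e∈r with ∈.∈-++⁻ ls e∈r
      ...   | inj₁ e∈ls = inj₁ (∈.∈-++⁺ˡ e∈ls)
      ...   | inj₂ e∈r′ with ∈.∈-++⁻ (incoming v) e∈r′
      ...     | inj₁ e∈in = inj₂ (unique-disjoint (incoming v) uh e∈in)
      ...     | inj₂ e∈rs = inj₁ (∈.∈-++⁺ʳ ls (∈.∈-++⁺ʳ (outgoing v) e∈rs))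
      fresh′ : ∀ {e} → e ∉ cut → e ∈ concatMap outgoing vs → label e ≡ firstPosition sw e
      fresh′ {e} e∉ e∈ = ≡.trans (fresh e∉ (∈.∈-++⁺ʳ (outgoing v) e∈))
        (≡.cong (λ b → if b then count ls else firstPosition sw e) (dec-false (e ∈? outgoing v) (λ e∈o → unique-disjoint (outgoing v) ut e∈o e∈)))

    link-constant : ∀ {v} → v ∈ order → LinkConstant v
    link-constant = links-constant sweep sweep flow outs-unique heads-unique (λ e∈ _ → label-cut e∈) inj₁ (λ e∉ _ → label-other e∉)

    position-injective : ∀ es {x y} → x ∈ es → y ∈ es → lookup γ x ≡ true → lookup γ y ≡ true → position es x ≡ position es y → x ≡ y
    position-injective (e ∷ es) {x} {y} x∈ y∈ onx ony eq with e Fin.≟ x | e Fin.≟ y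
    ... | yes ≡.refl | yes ≡.refl = ≡.refl
    ... | yes ≡.refl | no _ rewrite onx with eq
    ...   | ()
    position-injective (e ∷ es) {x} {y} x∈ y∈ onx ony eq | no _ | yes ≡.refl rewrite ony with eq
    ... | ()
    position-injective (e ∷ es) {x} {y} (here ≡.refl) _ onx ony eq | no e≢x | no _ = ⊥-elim (e≢x ≡.refl)
    position-injective (e ∷ es) {x} {y} (there _) (here ≡.refl) onx ony eq | no _ | no e≢y = ⊥-elim (e≢y ≡.refl)
    position-injective (e ∷ es) {x} {y} (there x∈) (there y∈) onx ony eq | no _ | no _ =
      position-injective es x∈ y∈ onx ony (ℕ.+-cancelˡ-≡ (bit (lookup γ e)) _ _ eq)

    find-on : ∀ es → 1 ≤ count es → ∃ λ x → x ∈ es × lookup γ x ≡ true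
    find-on (x ∷ es) 1≤ with lookup γ x in eqx
    ... | true  = x , here ≡.refl , eqx
    ... | false with find-on es 1≤
    ...   | x′ , x′∈ , on′ = x′ , there x′∈ , on′

    -- Following a strand downward leads to the cut.
    module _ {P : Edge → Set} (step : ∀ {v x y} → v ∈ order → x ∈ incoming v → y ∈ outgoing v → lookup γ x ≡ true → P y → P x) where
      reach-cut : ∀ {r vs} → Sweep r vs cut → (∀ {v} → v ∈ vs → v ∈ order) → All (Conserved ⟦ γ ⟧ˢ) vs → {Q : Set} →
        (∀ {e} → e ∈ r → lookup γ e ≡ true → P e → Q) → ∀ {e} → e ∈ concatMap outgoing vs → lookup γ e ≡ true → P e → Q
      reach-cut (pass {v = v} {vs} ls rs _ ≡.refl sw) sub (eq ∷ f) {Q} row e∈ on pe with ∈.∈-++⁻ (outgoing v) e∈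
      ... | inj₁ e∈out = out e∈out on pe
        where
        out : ∀ {e} → e ∈ outgoing v → lookup γ e ≡ true → P e → Q
        out e∈ on pe with find-on (incoming v) (≡.subst (1 ≤_) (≡.sym (balanced {v} eq)) (count-positive (outgoing v) e∈ on))
        ... | x , x∈ , onx = row (∈.∈-++⁺ʳ ls (∈.∈-++⁺ˡ x∈)) onx (step (sub (here ≡.refl)) x∈ e∈ onx pe)
      ... | inj₂ e∈rest = reach-cut sw (sub ∘ there) f row′ e∈rest on pe
        where
        row′ : ∀ {e} → e ∈ ls ++ outgoing v ++ rs → lookup γ e ≡ true → P e → Q
        row′ e∈ on pe with ∈.∈-++⁻ ls e∈
        ... | inj₁ e∈ls = row (∈.∈-++⁺ˡ e∈ls) on pe
        ... | inj₂ e∈′ with ∈.∈-++⁻ (outgoing v) e∈′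
        ...   | inj₂ e∈rs = row (∈.∈-++⁺ʳ ls (∈.∈-++⁺ʳ (incoming v) e∈rs)) on pe
        ...   | inj₁ e∈out with find-on (incoming v) (≡.subst (1 ≤_) (≡.sym (balanced {v} eq)) (count-positive (outgoing v) e∈out on))
        ...     | x , x∈ , onx = row (∈.∈-++⁺ʳ ls (∈.∈-++⁺ˡ x∈)) onx (step (sub (here ≡.refl)) x∈ e∈out onx pe)

  -- Going down along a strand leads every component to the cut. It meets the cut only once, because
  -- the label is constant on components and distinguishes the strands at the cut.
  #strands : ∀ nodes → Unique nodes → (∀ {e} → e ∈ nodes → lookup γ e ≡ true) → (∀ {e} → lookup γ e ≡ true → e ∈ nodes) →
    + Components.#components Fin._≟_ nodes (map (λ v → incoming v ++ outgoing v) vertices) ≡ h ⟦ γ ⟧ˢ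
  #strands nodes unique on⁺ on⁻ = ≡.trans (≡.cong +_ (≡.trans (#components-marked (_∈? cut) links some same) lengths)) (count-∑ cut)
    where
    open Partitions Fin._≟_ nodes unique
    links = map (λ v → incoming v ++ outgoing v) vertices
    open Components Fin._≟_ using (components)
    given = components-invariant links
    in-order : ∀ {v} → v ∈ vertices → v ∈ order
    in-order = ↭.∈-resp-↭ (↭-sym order-↭)
    in-class : ∀ {C x} → C ∈ components nodes links → x ∈ C → x ∈ nodes
    in-class C∈ x∈ = ↭.∈-resp-↭ (Invariant.partitions given) (∈.∈-concat⁺′ x∈ C∈)
    some : ∀ {C} → C ∈ components nodes links → ∃ λ x → x ∈ C × x ∈ cut
    some {C} C∈ with Invariant.inhabited given C∈
    ... | e , e∈ with covered e
    ...   | inj₁ e∈cut = e , e∈ , e∈cut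
    ...   | inj₂ e∈outs = reach-cut {P = _∈ C} step sweep (λ v∈ → v∈) flow (λ {x} x∈cut _ x∈C → x , x∈C , x∈cut) e∈outs (on⁺ (in-class C∈ e∈)) e∈
      where
      step : ∀ {v x y} → v ∈ order → x ∈ incoming v → y ∈ outgoing v → lookup γ x ≡ true → y ∈ C → x ∈ C
      step {v} v∈ x∈ y∈ onx y∈C = Invariant.closed given (∈.∈-map⁺ (λ v → incoming v ++ outgoing v) (↭.∈-resp-↭ order-↭ v∈)) C∈ (∈.∈-++⁺ʳ (incoming v) y∈) (∈.∈-++⁺ˡ x∈) (on⁻ onx) y∈C
    linked : ∀ {link x y} → link ∈ links → x ∈ link → y ∈ link → x ∈ nodes → y ∈ nodes → label x ≡ label y
    linked link∈ x∈ y∈ x∈n y∈n with ∈.∈-map⁻ (λ v → incoming v ++ outgoing v) link∈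
    ... | v , v∈ , ≡.refl with link-constant (in-order v∈)
    ...   | k , const = ≡.trans (const x∈ (on⁺ x∈n)) (≡.sym (const y∈ (on⁺ y∈n)))
    same : ∀ {C x y} → C ∈ components nodes links → x ∈ C → y ∈ C → x ∈ cut → y ∈ cut → x ≡ y
    same C∈ x∈ y∈ x∈cut y∈cut = position-injective cut x∈cut y∈cut (on⁺ (in-class C∈ x∈)) (on⁺ (in-class C∈ y∈))
      (≡.trans (≡.sym (label-cut x∈cut)) (≡.trans (Invariant.constant given label linked C∈ x∈ y∈) (label-cut y∈cut)))
    on? : ∀ e → Dec (lookup γ e ≡ true)
    on? e = lookup γ e Bool.≟ true
    lengths : length (filter (_∈? cut) nodes) ≡ count cut
    lengths = ≡.trans (↭.↭-length (unique-↭ (Unique.filter⁺ (_∈? cut) unique) (Unique.filter⁺ on? (sweep-unique sweep))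
        (λ e∈ → let e∈n , e∈cut = ∈.∈-filter⁻ (_∈? cut) {xs = nodes} e∈ in ∈.∈-filter⁺ on? e∈cut (on⁺ e∈n))
        (λ e∈ → let e∈cut , on = ∈.∈-filter⁻ on? {xs = cut} e∈ in ∈.∈-filter⁺ (_∈? cut) (on⁻ on) e∈cut)))
      (length-count cut)
      where
      length-count : ∀ es → length (filter on? es) ≡ count es
      length-count []       = ≡.refl
      length-count (e ∷ es) with lookup γ e
      ... | true  = ≡.cong suc (length-count es)
      ... | false = length-count es

-- Colourings

∣∪∣+∣∩∣ : ∀ {n} (r s : Subset n) → ∣ r ∪ s ∣ ℕ.+ ∣ r ∩ s ∣ ≡ ∣ r ∣ ℕ.+ ∣ s ∣
∣∪∣+∣∩∣ []           []           = ≡.refl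
∣∪∣+∣∩∣ (true  ∷ r) (true  ∷ s) = ≡.cong suc (≡.trans (ℕ.+-suc _ _) (≡.trans (≡.cong suc (∣∪∣+∣∩∣ r s)) (≡.sym (ℕ.+-suc _ _))))
∣∪∣+∣∩∣ (true  ∷ r) (false ∷ s) = ≡.cong suc (∣∪∣+∣∩∣ r s)
∣∪∣+∣∩∣ (false ∷ r) (true  ∷ s) = ≡.trans (≡.cong suc (∣∪∣+∣∩∣ r s)) (≡.sym (ℕ.+-suc _ _))
∣∪∣+∣∩∣ (false ∷ r) (false ∷ s) = ∣∪∣+∣∩∣ r s

∣p∣≡0⇒p≡⊥ : ∀ {n} (p : Subset n) → ∣ p ∣ ≡ 0 → p ≡ Sub.⊥
∣p∣≡0⇒p≡⊥ []          _  = ≡.refl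
∣p∣≡0⇒p≡⊥ (false ∷ p) eq = ≡.cong (false ∷_) (∣p∣≡0⇒p≡⊥ p eq)

-- By inclusion and exclusion, the sizes leave no room for an intersection.
sized-union : ∀ {n} {p r s : Subset n} → p ≡ r ∪ s → ∣ p ∣ ≡ ∣ r ∣ ℕ.+ ∣ s ∣ → p isDisjointUnionOf r , s
sized-union {r = r} {s} ≡.refl sizes = ≡.refl ,
  ∣p∣≡0⇒p≡⊥ (r ∩ s) (ℕ.+-cancelˡ-≡ ∣ r ∪ s ∣ _ _ (≡.trans (∣∪∣+∣∩∣ r s) (≡.trans (≡.sym sizes) (≡.sym (ℕ.+-identityʳ _)))))

module Colorings {c ℓ} {R : CommutativeRing c ℓ} (exp : Exponential R) {w : Web} (I : RadialCut w) where
  open CommutativeRing R hiding (zero)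
  open Exponential exp
  open Sums R
  open Flows I
  open LabelledFlows I using (sumLoops)
  open PrincipalSpecialization exp I
  open Decompositions I
  open FinSums

  AllFlows : ∀ {m} → Vec (Vec Bool edges) m → Set
  AllFlows []      = ⊤
  AllFlows (γ ∷ M) = Flow ⟦ γ ⟧ˢ × AllFlows M

  allFlows? : ∀ {m} (M : Vec (Vec Bool edges) m) → Dec (AllFlows M)
  allFlows? []      = yes tt
  allFlows? (γ ∷ M) = flow? γ ×-dec allFlows? M

  lookup-flow : ∀ {m} (M : Vec (Vec Bool edges) m) → AllFlows M → ∀ i → Flow ⟦ lookup M i ⟧ˢ
  lookup-flow (γ ∷ M) (f , _)  zero    = f
  lookup-flow (γ ∷ M) (_ , fs) (suc i) = lookup-flow M fs i

  allFlows : ∀ {m} (M : Vec (Vec Bool edges) m) → (∀ i → Flow ⟦ lookup M i ⟧ˢ) → AllFlows M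
  allFlows []      f = tt
  allFlows (γ ∷ M) f = f zero , allFlows M (f ∘ suc)

  Superposes : ∀ {m} → Weight → Vec (Vec Bool edges) m → Set
  Superposes t M = AllFlows M × (∀ e → sumLoops M e ≡ t e)

  superposes? : ∀ {m} t (M : Vec (Vec Bool edges) m) → Dec (Superposes t M)
  superposes? t M = allFlows? M ×-dec Fin.all? (λ e → sumLoops M e ℤ.≟ t e)

  exponent : ∀ {m} → Vec (Vec Bool edges) m → ℤ
  exponent []              = 0ℤ
  exponent {suc m} (γ ∷ M) = weight m ⟦ γ ⟧ˢ (sumLoops (γ ∷ M)) ℤ.+ exponent M

  -- Unfolds the recursion for `X̂` into one sum over tuples of flows, the colour classes.
  X̂≈∑-superposes : ∀ m t → X̂ m t ≈ ∑ (tuples (subsets edges) m) (λ M → when (superposes? t M) (E (exponent M)))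
  X̂≈∑-superposes zero t = trans (when-cong (Fin.all? _) (superposes? t []) (λ p → tt , λ e → ≡.sym (p e)) (λ p e → ≡.sym (proj₂ p e)) (λ _ → sym E-0)) (sym (+-identityʳ _))
  X̂≈∑-superposes (suc m) t = begin
    ∑ flows (λ γ → E (weight m ⟦ γ ⟧ˢ t) * X̂ m (t ⊖ ⟦ γ ⟧ˢ))
      ≈⟨ ∑-filter flow? (subsets edges) ⟩
    ∑ (subsets edges) (λ γ → when (flow? γ) (E (weight m ⟦ γ ⟧ˢ t) * X̂ m (t ⊖ ⟦ γ ⟧ˢ)))
      ≈⟨ ∑-cong (subsets edges) (λ γ → when-cong (flow? γ) (flow? γ) (λ f → f) (λ f → f) (λ _ → trans (*-congˡ (X̂≈∑-superposes m (t ⊖ ⟦ γ ⟧ˢ))) (∑-*ˡ _ Ms))) ⟩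
    ∑ (subsets edges) (λ γ → when (flow? γ) (∑ Ms (λ M → E (weight m ⟦ γ ⟧ˢ t) * when (superposes? (t ⊖ ⟦ γ ⟧ˢ) M) (E (exponent M)))))
      ≈⟨ ∑-cong (subsets edges) (λ γ → trans (when-∑ (flow? γ) Ms) (∑-cong Ms (step γ))) ⟩
    ∑ (subsets edges) (λ γ → ∑ Ms (λ M → when (superposes? t (γ ∷ M)) (E (exponent (γ ∷ M)))))
      ≈⟨ ∑-tuples-suc (subsets edges) m ⟨
    ∑ (tuples (subsets edges) (suc m)) (λ M → when (superposes? t M) (E (exponent M))) ∎
    where
    open import Relation.Binary.Reasoning.Setoid setoid
    Ms = tuples (subsets edges) m
    move : ∀ {a b s} → s ≡ a ℤ.- b → b ℤ.+ s ≡ a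
    move {a} {b} ≡.refl = lemma a b
      where
      lemma : ∀ a b → b ℤ.+ (a ℤ.- b) ≡ a
      lemma = solve-∀
    move′ : ∀ {a b s} → b ℤ.+ s ≡ a → s ≡ a ℤ.- b
    move′ {b = b} {s} ≡.refl = lemma b s
      where
      lemma : ∀ b s → s ≡ (b ℤ.+ s) ℤ.- b
      lemma = solve-∀
    step : ∀ γ M → when (flow? γ) (E (weight m ⟦ γ ⟧ˢ t) * when (superposes? (t ⊖ ⟦ γ ⟧ˢ) M) (E (exponent M))) ≈ when (superposes? t (γ ∷ M)) (E (exponent (γ ∷ M)))
    step γ M = by-cases (flow? γ) (superposes? (t ⊖ ⟦ γ ⟧ˢ) M) (superposes? t (γ ∷ M))
      where
      by-cases : ∀ f? s? s?′ → when {Flow ⟦ γ ⟧ˢ} f? (E (weight m ⟦ γ ⟧ˢ t) * when {Superposes (t ⊖ ⟦ γ ⟧ˢ) M} s? (E (exponent M))) ≈ when {Superposes t (γ ∷ M)} s?′ (E (exponent (γ ∷ M)))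
      by-cases (yes f) (yes s) (yes s′) = trans (sym (E-+ _ _)) (reflexive (≡.cong (λ x → E (x ℤ.+ exponent M)) (weight-cong m {⟦ γ ⟧ˢ} (λ _ → ≡.refl) (≡.sym ∘ proj₂ s′))))
      by-cases (yes f) (yes (fs , s)) (no ¬s′)  = ⊥-elim (¬s′ ((f , fs) , λ e → move (s e)))
      by-cases (yes f) (no ¬s) (yes ((_ , fs) , s)) = ⊥-elim (¬s (fs , λ e → move′ (s e)))
      by-cases (yes f) (no ¬s) (no _) = zeroʳ _
      by-cases (no ¬f) s? (yes ((f , _) , _)) = ⊥-elim (¬f f)
      by-cases (no ¬f) s? (no _) = refl

  private
    entry : ∀ {m} (M : Vec (Vec Bool edges) m) i e → 𝟚 (lookup (lookup (transpose M) e) i) ≡ ⟦ lookup M i ⟧ˢ e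
    entry M i e = ≡.cong 𝟚 (lookup-transpose M i e)

    crossings : ∀ {m} → Edge → Edge → Vec (Vec Bool edges) m → ℤ
    crossings {m} x y M = Σᶠ (λ i → ⟦ lookup M i ⟧ˢ y ℤ.* Σᶠ (λ j → ⟦ lookup M j ⟧ˢ x ℤ.* sgn (+ toℕ i ℤ.- + toℕ j)))

    pairings : ∀ {m} → Vertex Edge → Vec (Vec Bool edges) m → ℤ
    pairings v []      = 0ℤ
    pairings v (γ ∷ M) = J-at ⟦ γ ⟧ˢ (sumLoops M) v ℤ.+ pairings v M

    ∑-column : ∀ {m} (M : Vec (Vec Bool edges) m) e → Σᶠ (λ i → ⟦ lookup M i ⟧ˢ e) ≡ sumLoops M e
    ∑-column []      e = ≡.refl
    ∑-column (γ ∷ M) e = ≡.trans (Σᶠ-suc (λ i → ⟦ lookup (γ ∷ M) i ⟧ˢ e)) (≡.cong (λ s → ⟦ γ ⟧ˢ e ℤ.+ s) (∑-column M e))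

    -- Induction removing the smallest colour: against every other colour its sign is constant, +1
    -- when it is on the left edge x and -1 when it is on the right edge y.
    crossings-pairings : ∀ {m} x y o (M : Vec (Vec Bool edges) m) → crossings x y M ≡ pairings (merge x y o) M
    crossings-pairings x y o []      = ≡.refl
    crossings-pairings {suc m} x y o (γ ∷ M) = ≡.trans (Σᶠ-suc (λ i → ⟦ lookup (γ ∷ M) i ⟧ˢ y ℤ.* Σᶠ (row i)))
      (≡.trans (≡.cong₂ ℤ._+_ first rest) (≡.trans (lemma (⟦ γ ⟧ˢ x) (⟦ γ ⟧ˢ y) (sumLoops M x) (sumLoops M y) (crossings x y M))
        (≡.cong (λ z → J-at ⟦ γ ⟧ˢ (sumLoops M) (merge x y o) ℤ.+ z) (crossings-pairings x y o M))))
      where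
      row : Fin (suc m) → Fin (suc m) → ℤ
      row i j = ⟦ lookup (γ ∷ M) j ⟧ˢ x ℤ.* sgn (+ toℕ i ℤ.- + toℕ j)
      sgn-suc : ∀ a b → sgn (+ suc a ℤ.- + suc b) ≡ sgn (+ a ℤ.- + b)
      sgn-suc a b = ≡.cong sgn (lemma′ (+ a) (+ b))
        where
        lemma′ : ∀ a b → (1ℤ ℤ.+ a) ℤ.- (1ℤ ℤ.+ b) ≡ a ℤ.- b
        lemma′ = solve-∀
      first : ⟦ γ ⟧ˢ y ℤ.* Σᶠ (row zero) ≡ ⟦ γ ⟧ˢ y ℤ.* (-1ℤ ℤ.* sumLoops M x)
      first = ≡.cong (λ z → ⟦ γ ⟧ˢ y ℤ.* z) (≡.trans (Σᶠ-suc (row zero)) (≡.trans (≡.cong₂ ℤ._+_ (ℤ.*-zeroʳ (⟦ γ ⟧ˢ x))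
        (≡.trans (Σᶠ-cong (λ j → ℤ.*-comm (⟦ lookup M j ⟧ˢ x) -1ℤ)) (≡.trans (Σᶠ-*ˡ -1ℤ (λ j → ⟦ lookup M j ⟧ˢ x)) (≡.cong (-1ℤ ℤ.*_) (∑-column M x))))) (ℤ.+-identityˡ _)))
      rest : Σᶠ (λ i → ⟦ lookup M i ⟧ˢ y ℤ.* Σᶠ (row (suc i))) ≡ ⟦ γ ⟧ˢ x ℤ.* sumLoops M y ℤ.+ crossings x y M
      rest = ≡.trans (Σᶠ-cong λ i → ≡.trans (≡.cong (λ z → ⟦ lookup M i ⟧ˢ y ℤ.* z) (≡.trans (Σᶠ-suc (row (suc i))) (≡.cong (λ z → ⟦ γ ⟧ˢ x ℤ.* 1ℤ ℤ.+ z)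
            (Σᶠ-cong λ j → ≡.cong (λ z → ⟦ lookup M j ⟧ˢ x ℤ.* z) (sgn-suc (toℕ i) (toℕ j))))))
          (expand (⟦ lookup M i ⟧ˢ y) (⟦ γ ⟧ˢ x) _))
        (≡.trans (Zs.∑-+ (allFin m)) (≡.cong₂ ℤ._+_ (≡.trans (Σᶠ-*ˡ (⟦ γ ⟧ˢ x) (λ i → ⟦ lookup M i ⟧ˢ y)) (≡.cong (λ z → ⟦ γ ⟧ˢ x ℤ.* z) (∑-column M y))) ≡.refl))
        where
        expand : ∀ a b c → a ℤ.* (b ℤ.* 1ℤ ℤ.+ c) ≡ b ℤ.* a ℤ.+ a ℤ.* c
        expand = solve-∀
      lemma : ∀ gx gy sx sy k → gy ℤ.* (-1ℤ ℤ.* sx) ℤ.+ (gx ℤ.* sy ℤ.+ k) ≡ (gx ℤ.* sy ℤ.- gy ℤ.* sx) ℤ.+ k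
      lemma = solve-∀

    inv-at-pairings : ∀ {m} (M : Vec (Vec Bool edges) m) v → inv-at w (transpose M) v ≡ pairings v M
    inv-at-pairings {m} M (merge x y o) = ≡.trans (Zs.∑-product _,_ (els y) (els x) {λ (a , b) → sgn (+ toℕ a ℤ.- + toℕ b)})
      (≡.trans (∑-elements (lookup (transpose M) y) _) (≡.trans (Σᶠ-cong λ i → ≡.cong₂ ℤ._*_ (entry M i y)
        (≡.trans (∑-elements (lookup (transpose M) x) (λ j → sgn (+ toℕ i ℤ.- + toℕ j))) (Σᶠ-cong λ j → ≡.cong (ℤ._* sgn (+ toℕ i ℤ.- + toℕ j)) (entry M j x))))
      (crossings-pairings x y o M)))
      where
      els : Edge → List (Fin m)
      els e = elements (lookup (transpose M) e)
    inv-at-pairings M (split _ _ _) = zeros M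
      where
      zeros : ∀ {m} (M : Vec (Vec Bool edges) m) → 0ℤ ≡ pairings (split _ _ _) M
      zeros []      = ≡.refl
      zeros (γ ∷ M) = ≡.trans (zeros M) (≡.sym (ℤ.+-identityˡ _))

  -- Separates the power of q due to inv from that due to the variables. The repeated rescaling by
  -- q^-1 in `weight` accumulates to the variable q^(m-1-2i) for colour i.
  exponent-split : ∀ {m} (M : Vec (Vec Bool edges) m) → exponent M ≡ inv w (transpose M) ℤ.+ specialExponent (λ i → h ⟦ lookup M i ⟧ˢ)
  exponent-split M = ≡.trans (recursive M) (≡.cong (ℤ._+ specialExponent (λ i → h ⟦ lookup M i ⟧ˢ)) (≡.trans (Zs.∑-↭ order-↭) (Zs.∑-cong vertices (λ v → ≡.sym (inv-at-pairings M v)))))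
    where
    ∑-h : ∀ {m} (M : Vec (Vec Bool edges) m) → Σᶠ (λ i → h ⟦ lookup M i ⟧ˢ) ≡ h (sumLoops M)
    ∑-h []      = ≡.sym (∑ᶻ-0 cut)
    ∑-h (γ ∷ M) = ≡.trans (Σᶠ-suc (λ i → h ⟦ lookup (γ ∷ M) i ⟧ˢ)) (≡.trans (≡.cong (λ z → h ⟦ γ ⟧ˢ ℤ.+ z) (∑-h M)) (≡.sym (h-⊕ ⟦ γ ⟧ˢ (sumLoops M))))
    special-suc : ∀ {m} γ (M : Vec (Vec Bool edges) m) → specialExponent (λ i → h ⟦ lookup (γ ∷ M) i ⟧ˢ) ≡ + m ℤ.* h ⟦ γ ⟧ˢ ℤ.+ (specialExponent (λ i → h ⟦ lookup M i ⟧ˢ) ℤ.- h (sumLoops M))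
    special-suc {m} γ M = ≡.trans (Σᶠ-suc {m} (λ i → (+ suc m ℤ.- 1ℤ ℤ.- + 2 ℤ.* + toℕ i) ℤ.* h ⟦ lookup (γ ∷ M) i ⟧ˢ)) (≡.cong₂ ℤ._+_ (head (+ m) (h ⟦ γ ⟧ˢ))
      (≡.trans (Σᶠ-cong λ i → shift (+ m) (+ toℕ i) (h ⟦ lookup M i ⟧ˢ)) (≡.trans (Zs.∑-+ (allFin m))
        (≡.cong (λ z → specialExponent (λ i → h ⟦ lookup M i ⟧ˢ) ℤ.+ z) (≡.trans (≡.sym (Zs.∑-neg (allFin m))) (≡.cong ℤ.-_ (∑-h M)))))))
      where
      head : ∀ m h → (1ℤ ℤ.+ m ℤ.- 1ℤ ℤ.- + 2 ℤ.* 0ℤ) ℤ.* h ≡ m ℤ.* h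
      head = solve-∀
      shift : ∀ m i h → (1ℤ ℤ.+ m ℤ.- 1ℤ ℤ.- + 2 ℤ.* (1ℤ ℤ.+ i)) ℤ.* h ≡ (m ℤ.- 1ℤ ℤ.- + 2 ℤ.* i) ℤ.* h ℤ.+ ℤ.- h
      shift = solve-∀
    recursive : ∀ {m} (M : Vec (Vec Bool edges) m) → exponent M ≡ ∑ᶻ order (λ v → pairings v M) ℤ.+ specialExponent (λ i → h ⟦ lookup M i ⟧ˢ)
    recursive [] = ≡.sym (≡.trans (ℤ.+-identityʳ _) (∑ᶻ-0 order))
    recursive {suc m} (γ ∷ M) = ≡.trans (≡.cong₂ ℤ._+_ head (recursive M)) (≡.trans (lemma (J ⟦ γ ⟧ˢ (sumLoops M)) (+ m ℤ.* h ⟦ γ ⟧ˢ) (h (sumLoops M)) (∑ᶻ order (λ v → pairings v M)) (specialExponent (λ i → h ⟦ lookup M i ⟧ˢ)))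
      (≡.cong₂ ℤ._+_ (≡.sym (Zs.∑-+ order)) (≡.sym (special-suc γ M))))
      where
      head : weight m ⟦ γ ⟧ˢ (sumLoops (γ ∷ M)) ≡ J ⟦ γ ⟧ˢ (sumLoops M) ℤ.+ + m ℤ.* h ⟦ γ ⟧ˢ ℤ.- h (sumLoops M)
      head = ≡.cong₂ ℤ._-_ (≡.cong (λ z → z ℤ.+ + m ℤ.* h ⟦ γ ⟧ˢ) (≡.trans (J-⊕ʳ ⟦ γ ⟧ˢ ⟦ γ ⟧ˢ (sumLoops M)) (≡.trans (≡.cong (λ z → z ℤ.+ J ⟦ γ ⟧ˢ (sumLoops M)) (J-self ⟦ γ ⟧ˢ)) (ℤ.+-identityˡ (J ⟦ γ ⟧ˢ (sumLoops M))))))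
        (h-cong λ e → cancel (⟦ γ ⟧ˢ e) (sumLoops M e))
        where
        cancel : ∀ a b → a ℤ.+ b ℤ.- a ≡ b
        cancel = solve-∀
      lemma : ∀ j a s p x → (j ℤ.+ a ℤ.- s) ℤ.+ (p ℤ.+ x) ≡ (j ℤ.+ p) ℤ.+ (a ℤ.+ (x ℤ.- s))
      lemma = solve-∀

  private
    Preserved : ∀ {m} → EdgeSets w m → Vertex Edge → Set
    Preserved L v = ⋃ (map (lookup L) (incoming v)) ≡ ⋃ (map (lookup L) (outgoing v))

    ⋃-pair : ∀ {n} (r s : Subset n) → ⋃ (r ∷ s ∷ []) ≡ r ∪ s
    ⋃-pair r s = ≡.cong (r ∪_) (∪-identityʳ s)

    -- A coloring only asks for equal unions; conservation of thickness makes them disjoint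
    -- (`sized-union`), so each single colour is conserved.
    preserved⇒conserved : ∀ {m} (M : Vec (Vec Bool edges) m) → (∀ e → ∣ lookup (transpose M) e ∣ ≡ thickness e) →
      ∀ v → sum (map thickness (incoming v)) ≡ sum (map thickness (outgoing v)) → Preserved (transpose M) v → ∀ i → Conserved ⟦ lookup M i ⟧ˢ v
    preserved⇒conserved M sizes (merge x y o) thick≡ p i = ≡.trans (≡.cong₂ ℤ._+_ (≡.sym (entry M i x)) (≡.trans (ℤ.+-identityʳ _) (≡.sym (entry M i y))))
      (≡.trans (disjointUnion⇒ (sized-union union size) i) (≡.trans (entry M i o) (≡.sym (ℤ.+-identityʳ _))))
      where
      union = ≡.trans (≡.sym (∪-identityʳ (lookup (transpose M) o))) (≡.trans (≡.sym p) (⋃-pair (lookup (transpose M) x) (lookup (transpose M) y)))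
      size = ≡.trans (sizes o) (≡.trans (≡.sym (≡.trans thick≡ (ℕ.+-identityʳ _))) (≡.cong₂ ℕ._+_ (≡.sym (sizes x)) (≡.trans (ℕ.+-identityʳ _) (≡.sym (sizes y)))))
    preserved⇒conserved M sizes (split o x y) thick≡ p i = ≡.sym (≡.trans (≡.cong₂ ℤ._+_ (≡.sym (entry M i x)) (≡.trans (ℤ.+-identityʳ _) (≡.sym (entry M i y))))
      (≡.trans (disjointUnion⇒ (sized-union union size) i) (≡.trans (entry M i o) (≡.sym (ℤ.+-identityʳ _)))))
      where
      union = ≡.trans (≡.sym (∪-identityʳ (lookup (transpose M) o))) (≡.trans p (⋃-pair (lookup (transpose M) x) (lookup (transpose M) y)))
      size = ≡.trans (sizes o) (≡.trans (≡.sym (≡.trans (≡.sym thick≡) (ℕ.+-identityʳ _))) (≡.cong₂ ℕ._+_ (≡.sym (sizes x)) (≡.trans (ℕ.+-identityʳ _) (≡.sym (sizes y)))))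

    conserved⇒preserved : ∀ {m} (M : Vec (Vec Bool edges) m) v → (∀ i → Conserved ⟦ lookup M i ⟧ˢ v) → Preserved (transpose M) v
    conserved⇒preserved M (merge x y o) p = ≡.trans (⋃-pair (lookup (transpose M) x) (lookup (transpose M) y))
      (≡.trans (≡.sym (proj₁ (⇒disjointUnion λ i → ≡.trans (≡.cong₂ ℤ._+_ (entry M i x) (≡.trans (entry M i y) (≡.sym (ℤ.+-identityʳ _))))
        (≡.trans (p i) (≡.trans (ℤ.+-identityʳ _) (≡.sym (entry M i o))))))) (≡.sym (∪-identityʳ (lookup (transpose M) o))))
    conserved⇒preserved M (split o x y) p = ≡.sym (≡.trans (⋃-pair (lookup (transpose M) x) (lookup (transpose M) y))
      (≡.trans (≡.sym (proj₁ (⇒disjointUnion λ i → ≡.trans (≡.cong₂ ℤ._+_ (entry M i x) (≡.trans (entry M i y) (≡.sym (ℤ.+-identityʳ _))))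
        (≡.trans (≡.sym (p i)) (≡.trans (ℤ.+-identityʳ _) (≡.sym (entry M i o))))))) (≡.sym (∪-identityʳ (lookup (transpose M) o)))))

  coloring⇒superposes : ∀ {m} (M : Vec (Vec Bool edges) m) → IsColoring w (transpose M) → Superposes thick M
  coloring⇒superposes M (sizes , preserved) = allFlows M (λ i → All.tabulate λ {v} v∈ → let v∈′ = ↭.∈-resp-↭ order-↭ v∈ in
      preserved⇒conserved M sizes v (All.lookup conservation v∈′) (All.lookup preserved v∈′) i) ,
    λ e → ≡.trans (≡.sym (size-sumLoops M e)) (≡.cong (+_) (sizes e))

  superposes⇒coloring : ∀ {m} (M : Vec (Vec Bool edges) m) → Superposes thick M → IsColoring w (transpose M)
  superposes⇒coloring M (fs , sums) = (λ e → ℤ.+-injective (≡.trans (size-sumLoops M e) (sums e))) ,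
    All.tabulate λ {v} v∈ → conserved⇒preserved M v (λ i → All.lookup (lookup-flow M fs i) (↭.∈-resp-↭ (↭-sym order-↭) v∈))

  #circles : ∀ {m} (M : Vec (Vec Bool edges) m) → AllFlows M → ∀ i → + ∣Γ_∣ w (transpose M) i ≡ h ⟦ lookup M i ⟧ˢ
  #circles M fs i = Strands.#strands I (lookup M i) (lookup-flow M fs i) (Γ w (transpose M) i) (Unique.filter⁺ on? (Unique.allFin⁺ edges))
    (λ {e} e∈ → ≡.trans (≡.sym (lookup-transpose M i e)) (Vec.[]=⇒lookup (proj₂ (∈.∈-filter⁻ on? {xs = allFin edges} e∈))))
    (λ {e} on → ∈.∈-filter⁺ on? (∈.∈-allFin e) (Vec.lookup⇒[]= i _ (≡.trans (lookup-transpose M i e) on)))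
    where
    on? : ∀ e → Dec (i Sub.∈ lookup (transpose M) e)
    on? e = i Sub.∈? lookup (transpose M) e

  -- The left side is X_w at the variables q^(m-1), ..., q^(1-m), with circles counted as
  -- components. Transposing a coloring gives its tuple of colour classes, and `#circles` replaces
  -- components by edges at the cut.
  ∑-colorings≈X̂ : ∀ m → ∑ (colorings w m) (λ c → E (inv w c) * E (specialExponent (λ i → + ∣Γ_∣ w c i))) ≈ X̂ m thick
  ∑-colorings≈X̂ m = begin
    ∑ (colorings w m) F
      ≈⟨ ∑-filter (isColoring? w) (tuples (subsets m) edges) ⟩
    ∑ (tuples (subsets m) edges) (λ c → when (isColoring? w c) (F c))
      ≈⟨ ∑-transpose (true ∷ false ∷ []) m edges ⟩
    ∑ (tuples (subsets edges) m) (λ M → when (isColoring? w (transpose M)) (F (transpose M)))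
      ≈⟨ ∑-cong (tuples (subsets edges) m) (λ M → when-cong (isColoring? w (transpose M)) (superposes? thick M) (coloring⇒superposes M) (superposes⇒coloring M) (λ col →
           trans (sym (E-+ _ _)) (reflexive (≡.cong E (≡.trans (≡.cong (λ s → inv w (transpose M) ℤ.+ s)
             (Σᶠ-cong λ i → ≡.cong (λ x → (+ m ℤ.- 1ℤ ℤ.- + 2 ℤ.* + toℕ i) ℤ.* x) (#circles M (proj₁ (coloring⇒superposes M col)) i))) (≡.sym (exponent-split M))))))) ⟩
    ∑ (tuples (subsets edges) m) (λ M → when (superposes? thick M) (E (exponent M)))
      ≈⟨ X̂≈∑-superposes m thick ⟨
    X̂ m thick ∎
    where
    open import Relation.Binary.Reasoning.Setoid setoid
    F : EdgeSets w m → Carrier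
    F c = E (inv w c) * E (specialExponent (λ i → + ∣Γ_∣ w c i))

-- Evaluation at a = q^N

module FormalSums {ℓ} (R : CommutativeRing 0ℓ ℓ) {M : Set} (_≟_ : DecidableEquality M) where
  open CommutativeRing R hiding (zero)
  open Sums R
  open Relation.Binary.Reasoning.Setoid setoid

  Terms : Set
  Terms = List (Carrier × M)

  coeff : M → Terms → Carrier
  coeff m F = ∑ (filter (λ t → proj₂ t ≟ m) F) proj₁

  evaluate : (M → Carrier) → Terms → Carrier
  evaluate χ F = ∑ F (λ t → proj₁ t * χ (proj₂ t))

  rescale : Carrier → Terms → Terms
  rescale a = map (λ t → a * proj₁ t , proj₂ t)

  coeff≈∑ : ∀ m F → coeff m F ≈ ∑ F (λ t → when (proj₂ t ≟ m) (proj₁ t))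
  coeff≈∑ m F = ∑-filter (λ t → proj₂ t ≟ m) F

  evaluate-support : ∀ χ F S → Unique S → (∀ {t} → t ∈ F → proj₂ t ∈ S) → evaluate χ F ≈ ∑ S (λ m → coeff m F * χ m)
  evaluate-support χ F S unique support = begin
    ∑ F (λ t → proj₁ t * χ (proj₂ t))
      ≈⟨ ∑-cong-∈ F (λ {t} t∈ → ∑-δ _≟_ {f = λ m → proj₁ t * χ m} unique (support t∈)) ⟨
    ∑ F (λ t → ∑ S (λ m → when (proj₂ t ≟ m) (proj₁ t * χ m)))
      ≈⟨ ∑-swap F S ⟩
    ∑ S (λ m → ∑ F (λ t → when (proj₂ t ≟ m) (proj₁ t * χ m)))
      ≈⟨ ∑-cong S (λ m → trans (*-congʳ (coeff≈∑ m F)) (trans (∑-*ʳ (χ m) F) (∑-cong F λ t → when-*ʳ (proj₂ t ≟ m) (χ m)))) ⟨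
    ∑ S (λ m → coeff m F * χ m) ∎

  -- Formal sums with equal coefficients may list their terms differently; both are collected over a
  -- common duplicate-free support.
  evaluate-cong : ∀ χ {F G} → (∀ m → coeff m F ≈ coeff m G) → evaluate χ F ≈ evaluate χ G
  evaluate-cong χ {F} {G} F≈G = begin
    evaluate χ F                    ≈⟨ evaluate-support χ F S unique (λ t∈ → ∈.∈-deduplicate⁺ _≟_ (∈.∈-map⁺ proj₂ (∈.∈-++⁺ˡ t∈))) ⟩
    ∑ S (λ m → coeff m F * χ m)     ≈⟨ ∑-cong S (λ m → *-congʳ (F≈G m)) ⟩
    ∑ S (λ m → coeff m G * χ m)     ≈⟨ evaluate-support χ G S unique (λ t∈ → ∈.∈-deduplicate⁺ _≟_ (∈.∈-map⁺ proj₂ (∈.∈-++⁺ʳ F t∈))) ⟨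
    evaluate χ G                    ∎
    where
    S = deduplicate _≟_ (map proj₂ (F ++ G))
    unique : Unique S
    unique = DecUnique.deduplicate-! _≟_ (map proj₂ (F ++ G))

  evaluate-rescale : ∀ χ a F → evaluate χ (rescale a F) ≈ a * evaluate χ F
  evaluate-rescale χ a F = trans (reflexive (∑-map _ F)) (trans (∑-cong F λ t → *-assoc a _ _) (sym (∑-*ˡ a F)))

  coeff-rescale : ∀ a m F → coeff m (rescale a F) ≈ a * coeff m F
  coeff-rescale a m F = trans (coeff≈∑ m (rescale a F)) (trans (reflexive (∑-map _ F)) (trans (∑-cong F λ t → sym (when-*ˡ (proj₂ t ≟ m) a))
    (trans (sym (∑-*ˡ a F)) (*-congˡ (sym (coeff≈∑ m F))))))

  module Character (_∙_ : Op₂ M) (ε : M) (χ : M → Carrier) (χ-ε : χ ε ≈ 1#) (χ-∙ : ∀ l m → χ (l ∙ m) ≈ χ l * χ m) where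

    infixr 7 _⊗_
    _⊗_ : Terms → Terms → Terms
    _⊗_ = cartesianProductWith λ s t → proj₁ s * proj₁ t , proj₂ s ∙ proj₂ t

    -- Built exactly like the substitution in the statement, so that over ℚ(q) `plethysm` and
    -- `inVariables` are instances of it.
    substitute : (ℕ → Terms) → List (Carrier × List ℕ) → Terms
    substitute p = concatMap λ t → rescale (proj₁ t) (foldr _⊗_ ((1# , ε) ∷ []) (map (p ∘ suc) (proj₂ t)))

    evaluate-⊗ : ∀ F G → evaluate χ (F ⊗ G) ≈ evaluate χ F * evaluate χ G
    evaluate-⊗ F G = begin
      evaluate χ (F ⊗ G)
        ≈⟨ ∑-product _ F G ⟩
      ∑ F (λ s → ∑ G (λ t → (proj₁ s * proj₁ t) * χ (proj₂ s ∙ proj₂ t)))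
        ≈⟨ ∑-cong F (λ s → trans (∑-cong G λ t → trans (*-congˡ (χ-∙ _ _)) (interchange _ _ _ _)) (sym (∑-*ˡ _ G))) ⟩
      ∑ F (λ s → (proj₁ s * χ (proj₂ s)) * evaluate χ G)
        ≈⟨ ∑-*ʳ _ F ⟨
      evaluate χ F * evaluate χ G ∎
      where
      open IntegerCoefficients R
      interchange : ∀ a b c d → (a * b) * (c * d) ≈ (a * c) * (b * d)
      interchange = solve 4 (λ a b c d → (a :* b) :* (c :* d) := (a :* c) :* (b :* d)) refl

    evaluate-substitute : ∀ p v → (∀ m → evaluate χ (p (suc m)) ≈ v m) → ∀ f →
      evaluate χ (substitute p f) ≈ ∑ f (λ t → proj₁ t * foldr _*_ 1# (map v (proj₂ t)))
    evaluate-substitute p v p≈v f = trans (∑-concatMap _ f) (∑-cong f λ t → trans (evaluate-rescale χ (proj₁ t) (product (proj₂ t))) (*-congˡ (monomial (proj₂ t))))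
      where
      product : List ℕ → Terms
      product ks = foldr _⊗_ ((1# , ε) ∷ []) (map (p ∘ suc) ks)
      monomial : ∀ ks → evaluate χ (product ks) ≈ foldr _*_ 1# (map v ks)
      monomial []       = trans (+-identityʳ _) (trans (*-identityˡ _) χ-ε)
      monomial (k ∷ ks) = trans (evaluate-⊗ (p (suc k)) (product ks)) (*-cong (p≈v k) (monomial ks))

-- Laurent polynomials determined by their values at powers of q

module LaurentPolynomials {ℓ} {R : CommutativeRing 0ℓ ℓ} (exp : Exponential R) (isField : IsField R) (E-E≉0 : Exponential.Separates exp) where
  open CommutativeRing R hiding (zero)
  open IsField isField
  open Exponential exp
  open Sums R
  open FormalSums R ℤ._≟_
  open FieldProperties isField using (*-cancelˡ; ≈-/)
  open Algebra.Properties.Ring ring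
  open IntegerCoefficients R using (solve; _:=_; _:+_; _:*_; :-_; _:-_; con)
  open Relation.Binary.Reasoning.Setoid setoid

  E≉0 : ∀ i → ¬ E i ≈ 0#
  E≉0 i p = 1≉0 (begin
    1#                  ≈⟨ E-0 ⟨
    E 0ℤ                ≡⟨ ≡.cong E (ℤ.+-inverseʳ i) ⟨
    E (i ℤ.- i)         ≈⟨ E-+ i (ℤ.- i) ⟩
    E i * E (ℤ.- i)     ≈⟨ *-congʳ p ⟩
    0# * E (ℤ.- i)      ≈⟨ zeroˡ _ ⟩
    0#                  ∎)

  -- The value at a = q^N.
  _at^_ : Terms → ℕ → Carrier
  F at^ N = evaluate (λ j → E (+ N ℤ.* j)) F

  private
    coeff-∷ : ∀ c i F j → coeff j ((c , i) ∷ F) ≈ when (i ℤ.≟ j) c + coeff j F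
    coeff-∷ c i F j = trans (coeff≈∑ j ((c , i) ∷ F)) (+-congˡ (sym (coeff≈∑ j F)))

    x*y≈0⇒y≈0 : ∀ {x y} → ¬ x ≈ 0# → x * y ≈ 0# → y ≈ 0#
    x*y≈0⇒y≈0 {x} x≉0 p = *-cancelˡ x x≉0 (trans p (sym (zeroʳ x)))

    -- Passing from F = c aⁱ + G to F(q a) - qⁱ F(a) removes the term in aⁱ.
    descend : ℤ → Terms → Terms
    descend i = map (λ t → proj₁ t * (E (proj₂ t) - E i) , proj₂ t)

    descend-at^ : ∀ i G N → descend i G at^ N ≈ (G at^ suc N) - E i * (G at^ N)
    descend-at^ i G N = begin
      descend i G at^ N
        ≡⟨ ∑-map _ G ⟩
      ∑ G (λ t → (proj₁ t * (E (proj₂ t) - E i)) * E (+ N ℤ.* proj₂ t))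
        ≈⟨ ∑-cong G (λ t → trans (expand (proj₁ t) (E (proj₂ t)) (E i) _) (+-congʳ (*-congˡ (trans (sym (E-+ _ _)) (reflexive (≡.cong E (≡.sym (ℤ.suc-* (+ N) (proj₂ t))))))))) ⟩
      ∑ G (λ t → proj₁ t * E (+ suc N ℤ.* proj₂ t) - E i * (proj₁ t * E (+ N ℤ.* proj₂ t)))
        ≈⟨ ∑-+ G ⟩
      (G at^ suc N) + ∑ G (λ t → - (E i * (proj₁ t * E (+ N ℤ.* proj₂ t))))
        ≈⟨ +-congˡ (trans (sym (∑-neg G)) (-‿cong (sym (∑-*ˡ (E i) G)))) ⟩
      (G at^ suc N) - E i * (G at^ N) ∎
      where
      expand : ∀ c x y e → (c * (x - y)) * e ≈ c * (x * e) - y * (c * e)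
      expand = solve 4 (λ c x y e → (c :* (x :- y)) :* e := c :* (x :* e) :- y :* (c :* e)) refl

    coeff-descend : ∀ i j G → coeff j (descend i G) ≈ (E j - E i) * coeff j G
    coeff-descend i j G = begin
      coeff j (descend i G)
        ≈⟨ coeff≈∑ j (descend i G) ⟩
      ∑ (descend i G) (λ t → when (proj₂ t ℤ.≟ j) (proj₁ t))
        ≡⟨ ∑-map _ G ⟩
      ∑ G (λ t → when (proj₂ t ℤ.≟ j) (proj₁ t * (E (proj₂ t) - E i)))
        ≈⟨ ∑-cong G (λ t → trans (when-cong (proj₂ t ℤ.≟ j) (proj₂ t ℤ.≟ j) (λ p → p) (λ p → p) (λ { ≡.refl → *-comm _ _ })) (sym (when-*ˡ (proj₂ t ℤ.≟ j) _))) ⟩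
      ∑ G (λ t → (E j - E i) * when (proj₂ t ℤ.≟ j) (proj₁ t))
        ≈⟨ ∑-*ˡ _ G ⟨
      (E j - E i) * ∑ G (λ t → when (proj₂ t ℤ.≟ j) (proj₁ t))
        ≈⟨ *-congˡ (coeff≈∑ j G) ⟨
      (E j - E i) * coeff j G ∎

  -- Induction on the number of terms. `descend` removes the leading term a^i and multiplies the
  -- coefficient of each other a^j by q^j - q^i, which is nonzero; so all coefficients with j
  -- different from i vanish, and then the value at a = q forces the coefficient of a^i to vanish
  -- too.
  vanishing : ∀ F → (∀ N → 1 ≤ N → F at^ N ≈ 0#) → ∀ j → coeff j F ≈ 0#
  vanishing = λ F → by-length (length F) F ≡.refl
    where
    by-length : ∀ n F → length F ≡ n → (∀ N → 1 ≤ N → F at^ N ≈ 0#) → ∀ j → coeff j F ≈ 0#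
    by-length _       []            _   _  j = refl
    by-length (suc n) F@((c , i) ∷ G) len F₀ j = by-cases (i ℤ.≟ j)
      where
      S = deduplicate ℤ._≟_ (map proj₂ F)
      unique : Unique S
      unique = DecUnique.deduplicate-! ℤ._≟_ (map proj₂ F)
      support : ∀ {t} → t ∈ F → proj₂ t ∈ S
      support t∈ = ∈.∈-deduplicate⁺ ℤ._≟_ (∈.∈-map⁺ proj₂ t∈)
      descended₀ : ∀ N → 1 ≤ N → descend i G at^ N ≈ 0#
      descended₀ N 1≤N = begin
        descend i G at^ N
          ≈⟨ descend-at^ i G N ⟩
        (G at^ suc N) - E i * (G at^ N)
          ≈⟨ trans (sym (+-identityˡ _)) (trans (+-congʳ (sym leading)) (rearrange (c * E (+ suc N ℤ.* i)) (G at^ suc N) (E i) (c * E (+ N ℤ.* i)) (G at^ N))) ⟩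
        (c * E (+ suc N ℤ.* i) + (G at^ suc N)) - E i * (c * E (+ N ℤ.* i) + (G at^ N))
          ≈⟨ +-cong (F₀ (suc N) (s≤s z≤n)) (-‿cong (trans (*-congˡ (F₀ N 1≤N)) (zeroʳ _))) ⟩
        0# - 0#
          ≈⟨ -‿inverseʳ 0# ⟩
        0# ∎
        where
        leading : c * E (+ suc N ℤ.* i) - E i * (c * E (+ N ℤ.* i)) ≈ 0#
        leading = trans (+-congʳ (*-congˡ (trans (reflexive (≡.cong E (ℤ.suc-* (+ N) i))) (E-+ _ _)))) (cancel c (E i) (E (+ N ℤ.* i)))
          where
          cancel : ∀ c x e → c * (x * e) - x * (c * e) ≈ 0#
          cancel = solve 3 (λ c x e → c :* (x :* e) :- x :* (c :* e) := con 0ℤ) refl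
        rearrange : ∀ a g x b g′ → (a - x * b) + (g - x * g′) ≈ (a + g) - x * (b + g′)
        rearrange = solve 5 (λ a g x b g′ → (a :- x :* b) :+ (g :- x :* g′) := (a :+ g) :- x :* (b :+ g′)) refl
      other : ∀ {j} → i ≢ j → coeff j F ≈ 0#
      other {j} i≢j = trans (coeff-∷ c i G j) (trans (+-congʳ (reflexive (when-no (i ℤ.≟ j) i≢j))) (trans (+-identityˡ _)
        (x*y≈0⇒y≈0 (E-E≉0 (i≢j ∘ ≡.sym)) (trans (sym (coeff-descend i j G)) (by-length n (descend i G) (≡.trans (List.length-map _ G) (ℕ.suc-injective len)) descended₀ j)))))
      by-cases : Dec (i ≡ j) → coeff j F ≈ 0#
      by-cases (no i≢j)     = other i≢j
      by-cases (yes ≡.refl) = x*y≈0⇒y≈0 (E≉0 (+ 1 ℤ.* i)) (trans (*-comm _ _) (begin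
        coeff i F * E (+ 1 ℤ.* i)
          ≈⟨ ∑-δ ℤ._≟_ {f = λ m → coeff m F * E (+ 1 ℤ.* m)} unique (support (here ≡.refl)) ⟨
        ∑ S (λ m → when (i ℤ.≟ m) (coeff m F * E (+ 1 ℤ.* m)))
          ≈⟨ ∑-cong S (λ m → only m (i ℤ.≟ m)) ⟩
        ∑ S (λ m → coeff m F * E (+ 1 ℤ.* m))
          ≈⟨ evaluate-support _ F S unique support ⟨
        F at^ 1
          ≈⟨ F₀ 1 (s≤s z≤n) ⟩
        0# ∎))
        where
        only : ∀ m (i? : Dec (i ≡ m)) → when i? (coeff m F * E (+ 1 ℤ.* m)) ≈ coeff m F * E (+ 1 ℤ.* m)
        only m (yes _)  = refl
        only m (no i≢m) = sym (trans (*-congʳ (other i≢m)) (zeroˡ _))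

  determined : ∀ a F G → (∀ N → 1 ≤ N → a * (F at^ N) ≈ G at^ N) → ∀ j → a * coeff j F ≈ coeff j G
  determined a F G aF≈G j = begin
    a * coeff j F                      ≈⟨ coeff-rescale a j F ⟨
    coeff j (rescale a F)                ≈⟨ FractionIdentities.sub≈0⇒≈ R difference ⟩
    coeff j G                          ∎
    where
    D = rescale a F ++ rescale (- 1#) G
    -1* : ∀ x → - 1# * x ≈ - x
    -1* x = -1*x≈-x x
    difference : coeff j (rescale a F) - coeff j G ≈ 0#
    difference = begin
      coeff j (rescale a F) - coeff j G
        ≈⟨ +-cong (coeff≈∑ j (rescale a F)) (trans (sym (-1* _)) (trans (sym (coeff-rescale (- 1#) j G)) (coeff≈∑ j (rescale (- 1#) G)))) ⟩
      ∑ (rescale a F) (λ t → when (proj₂ t ℤ.≟ j) (proj₁ t)) + ∑ (rescale (- 1#) G) (λ t → when (proj₂ t ℤ.≟ j) (proj₁ t))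
        ≈⟨ ∑-++ (rescale a F) ⟨
      ∑ D (λ t → when (proj₂ t ℤ.≟ j) (proj₁ t))
        ≈⟨ coeff≈∑ j D ⟨
      coeff j D
        ≈⟨ vanishing D (λ N 1≤N → trans (∑-++ (rescale a F)) (trans (+-cong (trans (evaluate-rescale _ a F) (aF≈G N 1≤N)) (trans (evaluate-rescale _ (- 1#) G) (-1* _))) (-‿inverseʳ _))) j ⟩
      0# ∎

  open FinSums

  -- The value of a monomial at x_i = q^(N-1-2i).
  specialization : ∀ {N} → Vec ℕ N → Carrier
  specialization v = E (specialExponent (λ i → + lookup v i))

  private
    specialize-monomial : ∀ {N} (f : Fin N → ℤ) i m → Σᶠ (λ j → f j ℤ.* + lookup (Vec.replicate N 0 Vec.[ i ]≔ m) j) ≡ f i ℤ.* + m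
    specialize-monomial {suc N} f zero m = ≡.trans (Σᶠ-suc (λ j → f j ℤ.* + lookup (Vec.replicate (suc N) 0 Vec.[ zero {N} ]≔ m) j)) (≡.trans (≡.cong (λ z → f zero ℤ.* + m ℤ.+ z)
      (≡.trans (Σᶠ-cong λ j → ≡.trans (≡.cong (λ k → f (suc j) ℤ.* + k) (Vec.lookup-replicate j 0)) (ℤ.*-zeroʳ (f (suc j)))) (Zs.∑-0 (allFin N)))) (ℤ.+-identityʳ _))
    specialize-monomial {suc N} f (suc i) m = ≡.trans (Σᶠ-suc (λ j → f j ℤ.* + lookup (Vec.replicate (suc N) 0 Vec.[ suc i ]≔ m) j))
      (≡.trans (≡.cong₂ ℤ._+_ (ℤ.*-zeroʳ (f zero)) (specialize-monomial (f ∘ suc) i m)) (ℤ.+-identityˡ _))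

  specialization-+ : ∀ {N} (u v : Vec ℕ N) → specialization (Vec.zipWith ℕ._+_ u v) ≈ specialization u * specialization v
  specialization-+ {N} u v = trans (reflexive (≡.cong E (≡.trans (Σᶠ-cong λ i → ≡.trans (≡.cong (λ k → (+ N ℤ.- 1ℤ ℤ.- + 2 ℤ.* + toℕ i) ℤ.* + k) (Vec.lookup-zipWith ℕ._+_ i u v))
    (ℤ.*-distribˡ-+ (+ N ℤ.- 1ℤ ℤ.- + 2 ℤ.* + toℕ i) _ _)) (Zs.∑-+ (allFin N))))) (E-+ _ _)

  specialization-0 : ∀ N → specialization (Vec.replicate N 0) ≈ 1#
  specialization-0 N = trans (reflexive (≡.cong E (≡.trans (Σᶠ-cong λ i → ≡.trans (≡.cong (λ k → (+ N ℤ.- 1ℤ ℤ.- + 2 ℤ.* + toℕ i) ℤ.* + k) (Vec.lookup-replicate {n = N} i 0))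
    (ℤ.*-zeroʳ (+ N ℤ.- 1ℤ ℤ.- + 2 ℤ.* + toℕ i))) (Zs.∑-0 (allFin N))))) E-0

  private
    progression : ℕ → ℤ → Carrier
    progression N m = ∑ (allFin N) (λ i → E ((+ N ℤ.- 1ℤ ℤ.- + 2 ℤ.* + toℕ i) ℤ.* m))

    -- The terms after the first form q^-m times the progression for N - 1, so the product
    -- telescopes.
    geometric : ∀ N m → (E m - E (ℤ.- m)) * progression N m ≈ E (+ N ℤ.* m) - E (+ N ℤ.* ℤ.- m)
    geometric zero    m = trans (zeroʳ _) (sym (-‿inverseʳ _))
    geometric (suc N) m = begin
      (E m - E (ℤ.- m)) * progression (suc N) m
        ≈⟨ *-congˡ (trans (+-cong (reflexive (≡.cong E (first (+ N) m))) (trans (reflexive (≡.trans (≡.cong (λ is → ∑ is f) (≡.sym (List.map-tabulate {n = N} (λ i → i) suc))) (∑-map suc (allFin N)))) 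
             (∑-cong (allFin N) λ i → trans (reflexive (≡.cong E (next (+ N) (+ toℕ i) m))) (E-+ _ _)))) (+-congˡ (sym (∑-*ˡ (E (ℤ.- m)) (allFin N))))) ⟩
      (E m - E (ℤ.- m)) * (E (+ N ℤ.* m) + E (ℤ.- m) * progression N m)
        ≈⟨ expand (E m) (E (ℤ.- m)) (E (+ N ℤ.* m)) (progression N m) ⟩
      E m * E (+ N ℤ.* m) + E (ℤ.- m) * ((E m - E (ℤ.- m)) * progression N m - E (+ N ℤ.* m))
        ≈⟨ +-congˡ (*-congˡ (+-congʳ (geometric N m))) ⟩
      E m * E (+ N ℤ.* m) + E (ℤ.- m) * ((E (+ N ℤ.* m) - E (+ N ℤ.* ℤ.- m)) - E (+ N ℤ.* m))
        ≈⟨ collapse (E m) (E (ℤ.- m)) (E (+ N ℤ.* m)) (E (+ N ℤ.* ℤ.- m)) ⟩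
      E m * E (+ N ℤ.* m) - E (ℤ.- m) * E (+ N ℤ.* ℤ.- m)
        ≈⟨ +-cong (next-power m) (-‿cong (next-power (ℤ.- m))) ⟩
      E (+ suc N ℤ.* m) - E (+ suc N ℤ.* ℤ.- m) ∎
      where
      f : Fin (suc N) → Carrier
      f i = E ((+ suc N ℤ.- 1ℤ ℤ.- + 2 ℤ.* + toℕ i) ℤ.* m)
      first : ∀ n m → (1ℤ ℤ.+ n ℤ.- 1ℤ ℤ.- + 2 ℤ.* 0ℤ) ℤ.* m ≡ n ℤ.* m
      first = solve-∀
      next : ∀ n i m → (1ℤ ℤ.+ n ℤ.- 1ℤ ℤ.- + 2 ℤ.* (1ℤ ℤ.+ i)) ℤ.* m ≡ ℤ.- m ℤ.+ (n ℤ.- 1ℤ ℤ.- + 2 ℤ.* i) ℤ.* m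
      next = solve-∀
      next-power : ∀ m → E m * E (+ N ℤ.* m) ≈ E (+ suc N ℤ.* m)
      next-power m = trans (sym (E-+ _ _)) (reflexive (≡.cong E (≡.sym (ℤ.suc-* (+ N) m))))
      expand : ∀ x y e g → (x - y) * (e + y * g) ≈ x * e + y * ((x - y) * g - e)
      expand = solve 4 (λ x y e g → (x :- y) :* (e :+ y :* g) := x :* e :+ y :* ((x :- y) :* g :- e)) refl
      collapse : ∀ x y e e′ → x * e + y * ((e - e′) - e) ≈ x * e - y * e′
      collapse = solve 4 (λ x y e e′ → x :* e :+ y :* ((e :- e′) :- e) := x :* e :- y :* e′) refl

  powerSumTerms : (N m : ℕ) → List (Carrier × Vec ℕ N)
  powerSumTerms N m = map (λ i → 1# , Vec.replicate N 0 Vec.[ i ]≔ m) (allFin N)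

  plethysmFactor : ℕ → Terms
  plethysmFactor m = ((E (+ m) - E (ℤ.- + m)) ⁻¹ , + m) ∷ (- (E (+ m) - E (ℤ.- + m)) ⁻¹ , ℤ.- + m) ∷ []

  ∑-powerSumTerms : ∀ N m → FormalSums.evaluate R (Vec.≡-dec ℕ._≟_) specialization (powerSumTerms N m) ≈ progression N (+ m)
  ∑-powerSumTerms N m = trans (reflexive (∑-map _ (allFin N))) (∑-cong (allFin N) λ i → trans (*-identityˡ _) (reflexive (≡.cong E (specialize-monomial (λ i → + N ℤ.- 1ℤ ℤ.- + 2 ℤ.* + toℕ i) i m))))

  -- At a = q^N the plethystic value of a power sum is the closed form of a geometric progression,
  -- that is, the power sum of the specialized variables.
  plethysmFactor-at^ : ∀ N m → plethysmFactor (suc m) at^ N ≈ progression N (+ suc m)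
  plethysmFactor-at^ N m = sym (begin
    progression N (+ suc m)      ≈⟨ ≈-/ (E-E≉0 λ ()) (geometric N (+ suc m)) ⟩
    (x - y) * d                  ≈⟨ distribute x y d ⟩
    plethysmFactor (suc m) at^ N ∎)
    where
    x = E (+ N ℤ.* + suc m)
    y = E (+ N ℤ.* ℤ.- + suc m)
    d = (E (+ suc m) - E (ℤ.- + suc m)) ⁻¹
    distribute : ∀ x y d → (x - y) * d ≈ d * x + (- d * y + 0#)
    distribute = solve 3 (λ x y d → (x :- y) :* d := d :* x :+ (:- d :* y :+ con 0ℤ)) refl

  module _ (N : ℕ) where
    module Polynomials = FormalSums R {Vec ℕ N} (Vec.≡-dec ℕ._≟_)
    module PolynomialCharacter = Polynomials.Character (Vec.zipWith ℕ._+_) (Vec.replicate N 0) specialization (specialization-0 N) specialization-+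
    module LaurentCharacter = Character ℤ._+_ 0ℤ (λ j → E (+ N ℤ.* j)) (trans (reflexive (≡.cong E (ℤ.*-zeroʳ (+ N)))) E-0)
      (λ l m → trans (reflexive (≡.cong E (ℤ.*-distribˡ-+ (+ N) l m))) (E-+ _ _))

    -- Plethystic substitution at a = q^N is the principal specialization in N variables.
    plethysm-at^ : ∀ f → LaurentCharacter.substitute plethysmFactor f at^ N ≈ Polynomials.evaluate specialization (PolynomialCharacter.substitute (powerSumTerms N) f)
    plethysm-at^ f = trans (LaurentCharacter.evaluate-substitute plethysmFactor (λ m → progression N (+ suc m)) (plethysmFactor-at^ N) f)
      (sym (PolynomialCharacter.evaluate-substitute (powerSumTerms N) (λ m → progression N (+ suc m)) (λ m → ∑-powerSumTerms N (suc m)) f))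

-- The coefficient formula

module CoefficientFormula {ℓ} {R : CommutativeRing 0ℓ ℓ} (exp : Exponential R) (isField : IsField R) (E-E≉0 : Exponential.Separates exp) {w : Web} (I : RadialCut w) where
  open CommutativeRing R hiding (zero)
  open IsField isField
  open Exponential exp
  open Sums R
  open Flows I
  open PrincipalSpecialization exp I
  open Decompositions I
  open FieldProperties isField using (*-≉0; ≈-/)
  open IntegerCoefficients R using (solve; _:=_; _:+_; _:*_; :-_; _:-_; con)
  open Relation.Binary.Reasoning.Setoid setoid

  module Laurent = LaurentPolynomials exp isField E-E≉0
  open Laurent using (_at^_; determined)
  open FormalSums R ℤ._≟_ using (Terms; coeff; coeff≈∑)

  ζ : Carrier
  ζ = E 1ℤ - E -1ℤ

  qint : ℕ → Carrier
  qint k = (E (+ k) - E (ℤ.- + k)) * ζ ⁻¹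

  qint! : ℕ → Carrier
  qint! zero    = 1#
  qint! (suc k) = qint! k * qint (suc k)

  denominator : Carrier
  denominator = foldr _*_ 1# (map qint! initialThickness) * power ζ degree

  -- The hook sums are the same for every number of colours, which is why a single Laurent
  -- polynomial in a takes the right value at all q^N.
  hooks : ℕ → Carrier
  hooks = HookSums.hooks exp I 0

  private
    ζ≉0 : ¬ ζ ≈ 0#
    ζ≉0 = E-E≉0 λ ()

    interchange : ∀ a b c d → (a * b) * (c * d) ≈ (a * c) * (b * d)
    interchange = solve 4 (λ a b c d → (a :* b) :* (c :* d) := (a :* c) :* (b :* d)) refl

    power-+ : ∀ x m n → power x (m ℕ.+ n) ≈ power x m * power x n
    power-+ x zero    n = sym (*-identityˡ _)
    power-+ x (suc m) n = trans (*-congˡ (power-+ x m n)) (sym (*-assoc _ _ _))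

    qint!-power : ∀ k → qint! k * power ζ k ≈ quantum-factorial k
    qint!-power zero    = *-identityˡ _
    qint!-power (suc k) = begin
      (qint! k * qint (suc k)) * (ζ * power ζ k)       ≈⟨ *-congˡ (*-comm _ _) ⟩
      (qint! k * qint (suc k)) * (power ζ k * ζ)       ≈⟨ interchange _ _ _ _ ⟩
      (qint! k * power ζ k) * (qint (suc k) * ζ)       ≈⟨ *-cong (qint!-power k) (trans (*-assoc _ _ _) (trans (*-congˡ (trans (*-comm _ _) (*-inverseʳ ζ ζ≉0))) (*-identityʳ _))) ⟩
      quantum-factorial k * bracket (+ suc k)          ∎

    qint!s-power : ∀ α → foldr _*_ 1# (map qint! α) * power ζ (sum α) ≈ factorials α
    qint!s-power []      = *-identityˡ _
    qint!s-power (k ∷ α) = trans (*-congˡ (power-+ ζ k (sum α))) (trans (interchange _ _ _ _) (*-cong (qint!-power k) (qint!s-power α)))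

    quantum-factorial≉0 : ∀ k → ¬ quantum-factorial k ≈ 0#
    quantum-factorial≉0 zero    = 1≉0
    quantum-factorial≉0 (suc k) = *-≉0 (quantum-factorial≉0 k) (E-E≉0 λ ())

    factorials≉0 : ∀ α → ¬ factorials α ≈ 0#
    factorials≉0 []      = 1≉0
    factorials≉0 (k ∷ α) = *-≉0 (quantum-factorial≉0 k) (factorials≉0 α)

    denominator≉0 : ¬ denominator ≈ 0#
    denominator≉0 p = factorials≉0 initialThickness (trans (sym (qint!s-power initialThickness)) p)

    slot : ℕ → ℤ
    slot k = + (2 ℕ.* k) ℤ.- + degree

    slot-injective : ∀ {k l} → slot k ≡ slot l → k ≡ l
    slot-injective {k} {l} eq = ℕ.*-cancelˡ-≡ k l 2 (ℤ.+-injective (≡.trans (≡.sym (restore (+ (2 ℕ.* k)) (+ degree))) (≡.trans (≡.cong (λ i → i ℤ.+ + degree) eq) (restore (+ (2 ℕ.* l)) (+ degree)))))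
      where
      restore : ∀ i n → (i ℤ.- n) ℤ.+ n ≡ i
      restore = solve-∀

  numerator : ℕ → Carrier
  numerator k = power (- 1#) (degree ∸ k) * (hooks k + hooks (suc k))

  private
    ks = upTo (suc degree)

    formula : Terms
    formula = map (λ k → numerator k , slot k) ks

    coeff-formula : ∀ j → coeff j formula ≈ ∑ ks (λ k → when (slot k ℤ.≟ j) (numerator k))
    coeff-formula j = trans (coeff≈∑ j formula) (reflexive (∑-map _ ks))

    coeff-slot : ∀ k → k ≤ degree → coeff (slot k) formula ≈ numerator k
    coeff-slot k k≤n = trans (coeff-formula (slot k)) (trans (∑-cong ks λ l → when-cong (slot l ℤ.≟ slot k) (k ℕ.≟ l) (≡.sym ∘ slot-injective) (≡.cong slot ∘ ≡.sym) (λ _ → refl))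
      (∑-δ ℕ._≟_ {f = numerator} (Unique.upTo⁺ (suc degree)) (∈.∈-upTo⁺ (s≤s k≤n))))

    coeff-other : ∀ j → (∀ k → k ≤ degree → j ≢ slot k) → coeff j formula ≈ 0#
    coeff-other j j≢ = trans (coeff-formula j) (∑-zero-∈ ks λ {k} k∈ → reflexive (when-no (slot k ℤ.≟ j) (λ eq → j≢ k (ℕ.≤-pred (∈.∈-upTo⁻ k∈)) (≡.sym eq))))

    module _ (1≤n : 1 ≤ degree) (P : Terms) (P-at^ : ∀ N → 1 ≤ N → P at^ N ≈ X̂ N thick) where

      -- By `hook-identity` the two Laurent polynomials agree at every a = q^N with N ≥ 1, hence
      -- coefficient by coefficient.
      denominator-P : ∀ j → denominator * coeff j P ≈ coeff j formula
      denominator-P = determined denominator P formula λ N 1≤N → begin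
        denominator * (P at^ N)
          ≈⟨ *-cong (qint!s-power initialThickness) (P-at^ N 1≤N) ⟩
        factorials initialThickness * X̂ N thick
          ≈⟨ HookSums.hook-identity exp I N 1≤n ⟨
        ∑ ks (λ k → LoopTuples.term exp I N degree k * (hooks k + hooks (suc k)))
          ≈⟨ ∑-cong ks (λ k → rearrange (power (- 1#) (degree ∸ k)) (E (+ N ℤ.* slot k)) (hooks k + hooks (suc k))) ⟩
        ∑ ks (λ k → numerator k * E (+ N ℤ.* slot k))
          ≡⟨ ∑-map _ ks ⟨
        formula at^ N ∎
        where
        rearrange : ∀ a b c → (a * b) * c ≈ (a * c) * b
        rearrange = solve 3 (λ a b c → (a :* b) :* c := (a :* c) :* b) refl

  module _ (1≤n : 1 ≤ degree) (P : Terms) (P-at^ : ∀ N → 1 ≤ N → P at^ N ≈ X̂ N thick) where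

    coefficient-formula : ∀ k → k ≤ degree → coeff (+ (2 ℕ.* k) ℤ.- + degree) P ≈ numerator k * denominator ⁻¹
    coefficient-formula k k≤n = ≈-/ denominator≉0 (trans (denominator-P 1≤n P P-at^ (slot k)) (coeff-slot k k≤n))

    coefficient-vanishes : ∀ j → (∀ k → k ≤ degree → j ≢ + (2 ℕ.* k) ℤ.- + degree) → coeff j P ≈ 0#
    coefficient-vanishes j j≢ = trans (≈-/ denominator≉0 (trans (denominator-P 1≤n P P-at^ j) (coeff-other j j≢))) (zeroˡ _)

-- The theorem over ℚ(q)

open ℚ⟨q⟩-field using (_≅_; toᴷ; fromᴷ)
private
  module K = CommutativeRing ℚ⟨q⟩-field.commutativeRing

qExponential : Exponential ℚ⟨q⟩-field.commutativeRing
qExponential = record { E = q^_ ; E-0 = K.refl ; E-+ = ℚ⟨q⟩-field.E-+ }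

open Exponential qExponential using (power)

private module qLaurent = LaurentPolynomials qExponential ℚ⟨q⟩-field.isField ℚ⟨q⟩-field.E-E≉0

power≡^ : ∀ x n → power x n ≡ x ^ n
power≡^ x zero    = ≡.refl
power≡^ x (suc n) = ≡.cong (x *ᴷ_) (power≡^ x n)

module _ {w : Web} (I : RadialCut w) where
  open Flows I
  open Sums ℚ⟨q⟩-field.commutativeRing
  open PrincipalSpecialization qExponential I
  open Decompositions I
  open FinSums
  open CoefficientFormula qExponential ℚ⟨q⟩-field.isField ℚ⟨q⟩-field.E-E≉0 I
  private module C = Colorings qExponential I

  qint!≡ : ∀ k → qint! k ≡ ⟦ k ⟧!
  qint!≡ zero    = ≡.refl
  qint!≡ (suc k) = ≡.cong (_*ᴷ ⟦ suc k ⟧) (qint!≡ k)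

  qint!s≡ : ∀ α → foldr _*ᴷ_ 1ᴷ (map qint! α) ≡ ⟦ α ⟧!!
  qint!s≡ []      = ≡.refl
  qint!s≡ (k ∷ α) = ≡.cong₂ _*ᴷ_ (qint!≡ k) (qint!s≡ α)

  denominator≡ : denominator ≡ ⟦ initialThickness ⟧!! *ᴷ (z ^ degree)
  denominator≡ = ≡.cong₂ _*ᴷ_ (qint!s≡ initialThickness) (power≡^ z degree)

  numerator≡ : ∀ k → numerator k ≡ ((-ᴷ 1ᴷ) ^ (degree ∸ k)) *ᴷ (b I k +ᴷ b I (suc k))
  numerator≡ k = ≡.cong (_*ᴷ (b I k +ᴷ b I (suc k))) (power≡^ (-ᴷ 1ᴷ) (degree ∸ k))

  X-specialization : ∀ N → qLaurent.Polynomials.evaluate N qLaurent.specialization (Defs.X w N) ≅ X̂ N thick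
  X-specialization N = K.trans (K.reflexive (∑-map _ (colorings w N))) (K.trans (∑-cong (colorings w N) λ c →
    K.*-congˡ {q^ inv w c} (K.reflexive (≡.cong q^_ (Σᶠ-cong λ i → ≡.cong (λ k → (+ N ℤ.- 1ℤ ℤ.- + 2 ℤ.* + toℕ i) ℤ.* + k) (Vec.lookup∘tabulate (∣Γ_∣ w c) i)))))
    (C.∑-colorings≈X̂ N))

  -- Plethysm at a = q^N is the specialization in N variables, so f and with it the plethysm can be
  -- replaced by X_w in N variables, whose value is known.
  HOMFLYPT-at^ : ∀ P → IsHOMFLYPT w P → ∀ N → P qLaurent.at^ N ≅ X̂ N thick
  HOMFLYPT-at^ P homfly N = K.trans (FormalSums.evaluate-cong ℚ⟨q⟩-field.commutativeRing ℤ._≟_ (λ j → q^ (+ N ℤ.* j)) {P} {plethysm f} (λ j → fromᴷ (P≈f j)))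
    (K.trans (qLaurent.plethysm-at^ N f) (K.trans (K.sym (qLaurent.Polynomials.evaluate-cong N qLaurent.specialization {Defs.X w N} {inVariables N f} (λ m → fromᴷ (X≈f N m)))) (X-specialization N)))
    where open IsHOMFLYPT homfly

open import Data.Nat.Base using (_*_)
open import Data.Integer.Base using (_-_)

theorem3 :
  (w : Web) (I : RadialCut w) →
  let n = RadialCut.degree I
      α = RadialCut.initialThickness I
  in
  1 ≤ n →
  (P : LaurentA.Carrier) → IsHOMFLYPT w P →
  (∀ k → k ≤ n →
    LaurentA.coeff (+ (2 * k) - + n) P
      ≈ᴷ (((-ᴷ 1ᴷ) ^ (n ∸ k)) *ᴷ (b I k +ᴷ b I (suc k))) /ᴷ (⟦ α ⟧!! *ᴷ (z ^ n)))
  × (∀ (j : ℤ) → (∀ k → k ≤ n → j ≢ + (2 * k) - + n) → LaurentA.coeff j P ≈ᴷ 0ᴷ)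
theorem3 w I 1≤n P homfly =
  (λ k k≤n → toᴷ (K.trans (coefficient-formula 1≤n P P-at^ k k≤n) (K.reflexive (≡.cong₂ _/ᴷ_ (numerator≡ I k) (denominator≡ I))))) ,
  λ j j≢ → toᴷ (coefficient-vanishes 1≤n P P-at^ j j≢)
  where
  open CoefficientFormula qExponential ℚ⟨q⟩-field.isField ℚ⟨q⟩-field.E-E≉0 I
  P-at^ : ∀ N → 1 ≤ N → P qLaurent.at^ N ≅ _
  P-at^ N _ = HOMFLYPT-at^ I P homfly N
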